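{- There exist an absolute constant $\gamma>0$ and $d_0$ such that for every integer $d\ge d_0$ there is $n_0(d)$ with the following property. Let $n\ge n_0(d)$ and let $G$ be a connected graph with $n$ vertices and minimum degree at least $d$, and let $\mathcal{T}$ be a spanning tree of $G$ chosen uniformly at random among all spanning trees of $G$. Then for every tree $T$, \[ \mathbb{P}(\mathcal{T}\cong T)\le n^{ -\gamma d}. \]
   Context: $\mathcal{T}\cong T$ means that $\mathcal{T}$ is isomorphic to $T$ as a graph. The paper phrases the statement as: "Let $d$ be sufficiently large, and let $n$ be sufficiently large relative to $d$ ... then $\mathbb{P}(\mathcal{T}\cong T)\le n^{ -\Omega(d)}$", where the implied constant in $\Omega(d)$ is absolute. -}

module Defs where

open import Data.Nat using (ℕ; zero; suc; _≤_; _<ᵇ_)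
open import Data.Bool using (Bool; true; false; _∧_)
open import Data.Fin using (Fin; toℕ)
open import Data.Fin.Subset using (Subset)
open import Data.Vec as V using ()
open import Data.List using (List; []; _∷_; length; map; concatMap; allFin; filterᵇ; lookup)
open import Data.List.Relation.Unary.Unique.Propositional using (Unique)
open import Data.List.Membership.Propositional using (_∈_)
open import Data.Product using (Σ; _×_; _,_)
open import Data.Sum using (_⊎_)
open import Data.Unit using (⊤)
open import Relation.Nullary using (¬_)
open import Relation.Binary.PropositionalEquality using (_≡_)
open import Relation.Binary.Construct.Closure.ReflexiveTransitive using (Star)
open import Function.Bundles using (_↔_; _⇔_; Inverse)

record Graph (n : ℕ) : Set where
  field
    adj     : Fin n → Fin n → Bool
    symm    : ∀ i j → adj i j ≡ adj j i
    irrefl  : ∀ i → adj i i ≡ false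
open Graph public

Adj : ∀ {n} → Graph n → Fin n → Fin n → Set
Adj G i j = adj G i j ≡ true

degree : ∀ {n} → Graph n → Fin n → ℕ
degree {n} G i = length (filterᵇ (adj G i) (allFin n))

MinDegreeAtLeast : ∀ {n} → Graph n → ℕ → Set
MinDegreeAtLeast G d = ∀ i → d ≤ degree G i

Connected : ∀ {n} → (Fin n → Fin n → Set) → Set
Connected R = ∀ i j → Star R i j

Chain : ∀ {n} → (Fin n → Fin n → Set) → Fin n → List (Fin n) → Set
Chain R x []       = ⊤
Chain R x (y ∷ ys) = R x y × Chain R y ys

lastOf : ∀ {n} → Fin n → List (Fin n) → Fin n
lastOf x []       = x
lastOf x (y ∷ ys) = lastOf y ys

IsCycle : ∀ {n} → (Fin n → Fin n → Set) → Fin n → List (Fin n) → Set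
IsCycle R v vs = 2 ≤ length vs × Unique (v ∷ vs) × Chain R v vs × R (lastOf v vs) v

Acyclic : ∀ {n} → (Fin n → Fin n → Set) → Set
Acyclic R = ∀ v vs → ¬ IsCycle R v vs

IsTree : ∀ {n} → (Fin n → Fin n → Set) → Set
IsTree R = Connected R × Acyclic R

Isomorphic : ∀ {n m} → (Fin n → Fin n → Set) → (Fin m → Fin m → Set) → Set
Isomorphic {n} {m} R S =
  Σ (Fin n ↔ Fin m) λ f → ∀ i j → R i j ⇔ S (Inverse.to f i) (Inverse.to f j)

allPairs : ∀ n → List (Fin n × Fin n)
allPairs n = concatMap (λ i → map (λ j → (i , j)) (allFin n)) (allFin n)

edgeList : ∀ {n} → Graph n → List (Fin n × Fin n)
edgeList {n} G = filterᵇ (λ { (i , j) → (toℕ i <ᵇ toℕ j) ∧ adj G i j }) (allPairs n)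

numEdges : ∀ {n} → Graph n → ℕ
numEdges G = length (edgeList G)

EdgeSubset : ∀ {n} → Graph n → Set
EdgeSubset G = Subset (numEdges G)

SubAdj : ∀ {n} (G : Graph n) → EdgeSubset G → Fin n → Fin n → Set
SubAdj G s i j = Σ (Fin (numEdges G)) λ k →
  V.lookup s k ≡ true × (lookup (edgeList G) k ≡ (i , j) ⊎ lookup (edgeList G) k ≡ (j , i))

IsSpanningTree : ∀ {n} (G : Graph n) → EdgeSubset G → Set
IsSpanningTree G s = IsTree (SubAdj G s)

HasCount : ∀ {n} (G : Graph n) → (EdgeSubset G → Set) → ℕ → Set
HasCount G P N = Σ (List (EdgeSubset G)) λ xs →
  Unique xs × length xs ≡ N × (∀ s → P s ⇔ s ∈ xs)

{-# OPTIONS --safe #-}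

-- A move of a tree at x adds an edge xz and removes the first edge xv of the
-- old path from x to z.  Weighting moves by 1 / deg x, most moves of a tree with
-- few leaves turn a vertex of degree 2 into a leaf, while few moves lead back;
-- hence the number of trees with j leaves at least doubles with j as long as
-- j ≤ n / 448, and all but an exponentially small fraction of the spanning
-- trees have linearly many leaves.
--
-- Averaging over bipartitions (A , B) of the vertices, a constant fraction of
-- the remaining trees have linearly many leaves in A attached to B.  Each such
-- leaf w may be re-attached to any of its neighbours in B, independently of the
-- others, and the neighbours are grouped so that w has between D and 2D choices
-- with D linear in d.  It remains to bound the probability that the degree
-- sequence of the resampled tree is a rearrangement of a given one.
--
-- Either (hubs) there are K = Ω(d) disjoint pairs a , b with n^Ω(1) leaves each
-- that choose between a and b: given all other choices, the degrees of the 2K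
-- hubs are known up to order, and each is a binomial variable.  Or (spiders)
-- there are n^Ω(1) disjoint vertices a with 2K + 1 leaves that choose between a
-- and private vertices.  Then the K invariants counting the pairs (u , v) with
-- v < deg u and v ≡ τ modulo 2K fluctuate independently: the degree of a can be
-- steered into any residue class τ before a last leaf decides whether it
-- attaches to a.  Both cases give a factor n^-Ω(1) for each of K coordinates.
module Submission where

open import Defs
open import Data.Bool as 𝔹 using (Bool; true; false; _∧_; _∨_; _xor_; not; if_then_else_)
open import Data.Bool.Properties using (T-≡; not-involutive; ∧-comm; ∨-comm; ∧-zeroʳ; ∨-identityʳ)
open import Data.Empty using (⊥-elim)
open import Data.Fin as F using (Fin; toℕ)
open import Data.Fin.Properties as FP using (any?)
open import Data.List using (List; []; _∷_; _++_; length; map; concat; concatMap; allFin; filterᵇ; lookup; take; upTo; cartesianProduct; deduplicate; [_])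
open import Data.List.Properties using (length-map; length-++; length-tabulate; length-take; length-upTo; ++-identityʳ; map-++; map-∘; concat-map; map-id)
import Data.List.Properties as LP
open import Data.List.Membership.Propositional using (_∈_; _∉_; find; lose)
open import Data.List.Membership.Propositional.Properties using (∈-allFin; ∈-∃++; ∈-filter⁺; ∈-filter⁻; ∈-++⁺ˡ; ∈-++⁺ʳ; ∈-++⁻; ∈-map⁺; ∈-map⁻; ∈-cartesianProduct⁺; ∈-cartesianProduct⁻; ∈-concat⁺′; ∈-lookup; ∈-concatMap⁺; ∈-concatMap⁻; ∈-upTo⁻; ∈-deduplicate⁺)
open import Data.List.Relation.Binary.Permutation.Propositional using (_↭_; ↭-sym)
open import Data.List.Relation.Binary.Permutation.Propositional.Properties using (shift; ∈-resp-↭)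
open import Data.List.Relation.Binary.Pointwise as PW using (Pointwise; []; _∷_)
open import Data.List.Relation.Unary.All as All using (All; []; _∷_)
import Data.List.Relation.Unary.All.Properties as AllP
open import Data.List.Relation.Unary.AllPairs using ([]; _∷_)
open import Data.List.Relation.Unary.Any as Any using (Any; here; there)
import Data.List.Relation.Unary.Any.Properties as AnyP
open import Data.List.Relation.Unary.Unique.Propositional using (Unique)
import Data.List.Relation.Unary.Unique.Propositional.Properties as Uniq
open import Data.List.Relation.Unary.Unique.DecPropositional.Properties using (deduplicate-!)
open import Data.Nat using (ℕ; zero; suc; _+_; _*_; _∸_; _^_; _/_; _%_; _≤_; _<_; _≡ᵇ_; _<ᵇ_; _≤ᵇ_; z≤n; s≤s; _!; NonZero; >-nonZero)
open import Data.Nat.Properties hiding (≡-irrelevant)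
open import Data.Nat.DivMod using (m/n*n≤m; m≡m%n+[m/n]*n; m%n<n; m<n⇒m%n≡m; [m+kn]%n≡m%n)
open import Data.Nat.Divisibility using (_∣_; divides; quotient; ∣-trans; m≤n⇒m!∣n!)
open import Data.Nat.Tactic.RingSolver using (solve-∀)
open import Data.Product using (Σ; _×_; _,_; proj₁; proj₂)
open import Data.Product.Properties using (≡-dec)
open import Data.Sum using (_⊎_; inj₁; inj₂; [_,_]′)
open import Data.Unit using (tt)
open import Data.Vec as V using (Vec; []; _∷_)
import Data.Vec.Properties as VP
open import Function using (_∘_; id)
open import Function.Bundles using (_↔_; Inverse; Equivalence)
open import Relation.Binary.Construct.Closure.ReflexiveTransitive using (Star; ε; _◅_)
open import Relation.Binary.Definitions using (tri<; tri≈; tri>)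
open import Relation.Binary.PropositionalEquality using (_≡_; _≢_; refl; sym; trans; cong; cong₂; subst; subst₂; module ≡-Reasoning)
open import Relation.Nullary using (¬_; Dec; yes; no; does; contradiction)
open import Relation.Nullary.Decidable using (_×-dec_; _⊎-dec_; ¬?; dec-true; dec-false)

-- Finite sums

-- A leaf of A moves only among vertices of B, so it never changes the degree or the neighbour of
-- another leaf of A; without the bipartition one leaf could be attached to another and the choices
-- would interact. The number of choices per leaf has to be bounded in terms of d alone, although
-- degrees in `G` may be of order n: a prescribed pair of options is met with probability about one
-- over that number. It also has to grow with d, since K disjoint pairs are to be found among the
-- options. A multiset of degrees is probed by sums of functions of the degrees. Indicators suffice
-- for hubs, where listing the possible degrees costs a factor O(K) each; spiders occupy too many
-- vertices for a list, which is why K periodic statistics replace it and why each segment of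
-- spiders is arranged to move exactly one of them. All probabilities are cross-multiplied
-- inequalities in the natural numbers. The scale is R, the integer part of n^(1/21): the largest
-- quantity to stay below the number of leaves is u²t₂, with u ≤ R⁷ and t₂ ≤ R⁴, and the spare
-- powers of R absorb whatever depends on d.

private
  variable
    A B C : Set
    n : ℕ

⟦_⟧ : Bool → ℕ
⟦ true ⟧ = 1
⟦ false ⟧ = 0

⟦⟧≤1 : ∀ b → ⟦ b ⟧ ≤ 1
⟦⟧≤1 true = ≤-refl
⟦⟧≤1 false = z≤n

⟦⟧-∧ : ∀ b c → ⟦ b ∧ c ⟧ ≡ ⟦ b ⟧ * ⟦ c ⟧
⟦⟧-∧ true true = refl
⟦⟧-∧ true false = refl
⟦⟧-∧ false _ = refl

⟦⟧-pos : ∀ {b} → 0 < ⟦ b ⟧ → b ≡ true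
⟦⟧-pos {true} _ = refl

⟦⟧-≤ : ∀ {b m} → (b ≡ true → 1 ≤ m) → ⟦ b ⟧ ≤ m
⟦⟧-≤ {true} h = h refl
⟦⟧-≤ {false} h = z≤n

⟦⟧-true : ∀ {b} → b ≡ true → ⟦ b ⟧ ≡ 1
⟦⟧-true refl = refl

⟦⟧-not : ∀ b → ⟦ b ⟧ + ⟦ not b ⟧ ≡ 1
⟦⟧-not true = refl
⟦⟧-not false = refl

≡true-or-false : ∀ b → b ≡ true ⊎ b ≡ false
≡true-or-false true = inj₁ refl
≡true-or-false false = inj₂ refl

true≢false : true ≢ false
true≢false ()

∧-true : ∀ {b c} → b ∧ c ≡ true → b ≡ true × c ≡ true
∧-true {true} e = refl , e

∧-intro : ∀ {b c} → b ≡ true → c ≡ true → b ∧ c ≡ true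
∧-intro refl refl = refl

does-true : {P : Set} {d : Dec P} → does d ≡ true → P
does-true {d = yes p} _ = p

_==_ : Fin n → Fin n → Bool
i == j = does (i F.≟ j)

==-refl : (i : Fin n) → (i == i) ≡ true
==-refl i = dec-true (i F.≟ i) refl

==-eq : {i j : Fin n} → (i == j) ≡ true → i ≡ j
==-eq {i = i} {j} = does-true {d = i F.≟ j}

==-neq : {i j : Fin n} → i ≢ j → (i == j) ≡ false
==-neq {i = i} {j} = dec-false (i F.≟ j)

==-sym : (i j : Fin n) → (i == j) ≡ (j == i)
==-sym i j with i F.≟ j
... | yes refl = sym (==-refl i)
... | no p = sym (==-neq (p ∘ sym))

∑ : List A → (A → ℕ) → ℕ
∑ [] f = 0
∑ (x ∷ xs) f = f x + ∑ xs f

∏ : List A → (A → ℕ) → ℕ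
∏ [] f = 1
∏ (x ∷ xs) f = f x * ∏ xs f

∑-cong∈ : ∀ xs {f g : A → ℕ} → (∀ x → x ∈ xs → f x ≡ g x) → ∑ xs f ≡ ∑ xs g
∑-cong∈ [] h = refl
∑-cong∈ (x ∷ xs) h = cong₂ _+_ (h x (here refl)) (∑-cong∈ xs (λ y y∈ → h y (there y∈)))

∑-cong : ∀ xs {f g : A → ℕ} → (∀ x → f x ≡ g x) → ∑ xs f ≡ ∑ xs g
∑-cong xs h = ∑-cong∈ xs (λ x _ → h x)

∑-mono∈ : ∀ xs {f g : A → ℕ} → (∀ x → x ∈ xs → f x ≤ g x) → ∑ xs f ≤ ∑ xs g
∑-mono∈ [] h = z≤n
∑-mono∈ (x ∷ xs) h = +-mono-≤ (h x (here refl)) (∑-mono∈ xs (λ y y∈ → h y (there y∈)))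

∑-mono : ∀ xs {f g : A → ℕ} → (∀ x → f x ≤ g x) → ∑ xs f ≤ ∑ xs g
∑-mono xs h = ∑-mono∈ xs (λ x _ → h x)

+-interchange : ∀ a b c d → (a + b) + (c + d) ≡ (a + c) + (b + d)
+-interchange = solve-∀

∑-+ : ∀ xs (f g : A → ℕ) → ∑ xs (λ x → f x + g x) ≡ ∑ xs f + ∑ xs g
∑-+ [] f g = refl
∑-+ (x ∷ xs) f g rewrite ∑-+ xs f g = +-interchange (f x) (g x) _ _

∑-*ˡ : ∀ xs c (f : A → ℕ) → ∑ xs (λ x → c * f x) ≡ c * ∑ xs f
∑-*ˡ [] c f = sym (*-zeroʳ c)
∑-*ˡ (x ∷ xs) c f rewrite ∑-*ˡ xs c f = sym (*-distribˡ-+ c (f x) _)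

∑-*ʳ : ∀ xs c (f : A → ℕ) → ∑ xs (λ x → f x * c) ≡ ∑ xs f * c
∑-*ʳ [] c f = refl
∑-*ʳ (x ∷ xs) c f rewrite ∑-*ʳ xs c f = sym (*-distribʳ-+ c (f x) _)

∑-0 : (xs : List A) → ∑ xs (λ _ → 0) ≡ 0
∑-0 [] = refl
∑-0 (x ∷ xs) = ∑-0 xs

∑-zero : ∀ xs {f : A → ℕ} → (∀ x → x ∈ xs → f x ≡ 0) → ∑ xs f ≡ 0
∑-zero xs h = trans (∑-cong∈ xs h) (∑-0 xs)

∑-const : ∀ (xs : List A) c → ∑ xs (λ _ → c) ≡ length xs * c
∑-const [] c = refl
∑-const (x ∷ xs) c = cong (c +_) (∑-const xs c)

∑-one : (xs : List A) → ∑ xs (λ _ → 1) ≡ length xs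
∑-one xs = trans (∑-const xs 1) (*-identityʳ _)

∑-swap : ∀ (xs : List A) (ys : List B) (f : A → B → ℕ) →
  ∑ xs (λ x → ∑ ys (f x)) ≡ ∑ ys (λ y → ∑ xs (λ x → f x y))
∑-swap [] ys f = sym (∑-0 ys)
∑-swap (x ∷ xs) ys f rewrite ∑-swap xs ys f = sym (∑-+ ys (f x) _)

∑-++ : ∀ (xs ys : List A) f → ∑ (xs ++ ys) f ≡ ∑ xs f + ∑ ys f
∑-++ [] ys f = refl
∑-++ (x ∷ xs) ys f rewrite ∑-++ xs ys f = sym (+-assoc (f x) _ _)

∑-map : ∀ (h : A → B) xs f → ∑ (map h xs) f ≡ ∑ xs (f ∘ h)
∑-map h [] f = refl
∑-map h (x ∷ xs) f = cong (f (h x) +_) (∑-map h xs f)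

∑-concatMap : ∀ (h : A → List B) xs f → ∑ (concatMap h xs) f ≡ ∑ xs (λ x → ∑ (h x) f)
∑-concatMap h [] f = refl
∑-concatMap h (x ∷ xs) f = trans (∑-++ (h x) _ f) (cong (∑ (h x) f +_) (∑-concatMap h xs f))

∑-cartesianProduct : ∀ (xs : List A) (ys : List B) f →
  ∑ (cartesianProduct xs ys) f ≡ ∑ xs (λ x → ∑ ys (λ y → f (x , y)))
∑-cartesianProduct [] ys f = refl
∑-cartesianProduct (x ∷ xs) ys f =
  trans (∑-++ (map (x ,_) ys) _ f) (cong₂ _+_ (∑-map (x ,_) ys f) (∑-cartesianProduct xs ys f))

∑-↭ : ∀ {xs ys : List A} f → xs ↭ ys → ∑ xs f ≡ ∑ ys f
∑-↭ f _↭_.refl = refl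
∑-↭ f (_↭_.prep x p) = cong (f x +_) (∑-↭ f p)
∑-↭ f (_↭_.swap x y p) rewrite ∑-↭ f p = lemma (f x) (f y) _
  where
  lemma : ∀ a b c → a + (b + c) ≡ b + (a + c)
  lemma = solve-∀
∑-↭ f (_↭_.trans p q) = trans (∑-↭ f p) (∑-↭ f q)

∑-term : ∀ {xs} {x : A} (f : A → ℕ) → x ∈ xs → f x ≤ ∑ xs f
∑-term f (here refl) = m≤m+n _ _
∑-term f (there x∈) = ≤-trans (∑-term f x∈) (m≤n+m _ _)

∑-pos : ∀ xs (f : A → ℕ) → 0 < ∑ xs f → Σ A λ x → x ∈ xs × 0 < f x
∑-pos (x ∷ xs) f p with f x in eq
... | suc k = x , here refl , subst (0 <_) (sym eq) (s≤s z≤n)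
... | zero with ∑-pos xs f p
...   | y , y∈ , q = y , there y∈ , q

∑-pigeonhole : ∀ xs (f : A → ℕ) b → length xs * b < ∑ xs f → Σ A λ x → x ∈ xs × b < f x
∑-pigeonhole (x ∷ xs) f b p with b <? f x
... | yes q = x , here refl , q
... | no q with ∑-pigeonhole xs f b
                  (+-cancelˡ-< b _ _ (<-≤-trans p (+-monoˡ-≤ (∑ xs f) (≮⇒≥ q))))
...   | y , y∈ , r = y , there y∈ , r

∈⇒↭ : ∀ {xs} {x : A} → x ∈ xs → Σ (List A) λ ys → xs ↭ x ∷ ys
∈⇒↭ {x = x} x∈ with ∈-∃++ x∈
... | ys , zs , refl = ys ++ zs , shift x ys zs

-- The form in which all double counting is done. Membership and injectivity are asked only where
-- `f` is positive, so indicators take the place of sublists and a partial map, such as a tree move,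
-- may be given by a total function. Each image is removed from `ys` up to permutation before the
-- induction goes on.
∑-inj : ∀ {xs : List A} {ys : List B} (φ : A → B) {f : A → ℕ} {g : B → ℕ} → Unique xs →
  (∀ x → x ∈ xs → 0 < f x → φ x ∈ ys × f x ≤ g (φ x)) →
  (∀ x x′ → x ∈ xs → x′ ∈ xs → 0 < f x → 0 < f x′ → φ x ≡ φ x′ → x ≡ x′) →
  ∑ xs f ≤ ∑ ys g
∑-inj {xs = []} φ u h inj = z≤n
∑-inj {xs = x ∷ xs} {ys} φ {f} {g} (x∉ ∷ u) h inj with f x in eq
... | zero = ∑-inj φ u (λ y y∈ → h y (there y∈)) (λ y y′ a b → inj y y′ (there a) (there b))
... | suc k = goal
  where
  fx>0 : 0 < f x
  fx>0 = subst (0 <_) (sym eq) (s≤s z≤n)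
  hx = h x (here refl) fx>0
  zs = proj₁ (∈⇒↭ (proj₁ hx))
  p = proj₂ (∈⇒↭ (proj₁ hx))
  x≢ : ∀ y → y ∈ xs → x ≢ y
  x≢ y y∈ = All.lookup x∉ y∈
  move : ∀ y → y ∈ xs → 0 < f y → φ y ∈ zs
  move y y∈ q with ∈-resp-↭ p (proj₁ (h y (there y∈) q))
  ... | there r = r
  ... | here e = contradiction (sym (inj y x (there y∈) (here refl) q fx>0 e)) (x≢ y y∈)
  goal : suc k + ∑ xs f ≤ ∑ ys g
  goal = begin
    suc k + ∑ xs f    ≡⟨ cong (_+ ∑ xs f) (sym eq) ⟩
    f x + ∑ xs f      ≤⟨ +-mono-≤ (proj₂ hx)
                           (∑-inj φ u (λ y y∈ q → move y y∈ q , proj₂ (h y (there y∈) q))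
                                      (λ y y′ a b → inj y y′ (there a) (there b))) ⟩
    g (φ x) + ∑ zs g  ≡⟨ ∑-↭ g (↭-sym p) ⟩
    ∑ ys g            ∎
    where open ≤-Reasoning

∑-single : ∀ {xs : List A} {x} (f : A → ℕ) → Unique xs → x ∈ xs →
  (∀ y → y ∈ xs → y ≢ x → f y ≡ 0) → ∑ xs f ≡ f x
∑-single {xs = x ∷ xs} f (x∉ ∷ u) (here refl) h =
  trans (cong (f x +_) (∑-zero xs (λ y y∈ → h y (there y∈) (λ e → All.lookup x∉ y∈ (sym e))))) (+-identityʳ _)
∑-single {xs = y ∷ xs} f (y∉ ∷ u) (there x∈) h =
  trans (cong (_+ ∑ xs f) (h y (here refl) (λ e → All.lookup y∉ x∈ e)))
        (∑-single f u x∈ (λ z z∈ → h z (there z∈)))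

∑-filter : ∀ (p : A → Bool) xs f → ∑ (filterᵇ p xs) f ≡ ∑ xs (λ x → ⟦ p x ⟧ * f x)
∑-filter p [] f = refl
∑-filter p (x ∷ xs) f with p x
... | true = cong₂ _+_ (sym (*-identityˡ (f x))) (∑-filter p xs f)
... | false = ∑-filter p xs f

length-filter-∑ : ∀ (p : A → Bool) xs → length (filterᵇ p xs) ≡ ∑ xs (λ x → ⟦ p x ⟧)
length-filter-∑ p [] = refl
length-filter-∑ p (x ∷ xs) with p x
... | true = cong suc (length-filter-∑ p xs)
... | false = length-filter-∑ p xs

∈-filterᵇ⁺ : ∀ {p : A → Bool} {xs x} → x ∈ xs → p x ≡ true → x ∈ filterᵇ p xs
∈-filterᵇ⁺ x∈ e = ∈-filter⁺ _ x∈ (Equivalence.from T-≡ e)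

∈-filterᵇ⁻ : ∀ {p : A → Bool} {xs x} → x ∈ filterᵇ p xs → x ∈ xs × p x ≡ true
∈-filterᵇ⁻ {p = p} x∈ with ∈-filter⁻ _ x∈
... | a , b = a , Equivalence.to T-≡ b

unique-filterᵇ : ∀ (p : A → Bool) {xs} → Unique xs → Unique (filterᵇ p xs)
unique-filterᵇ p u = Uniq.filter⁺ _ u

∏-pos : ∀ xs (f : A → ℕ) → (∀ x → x ∈ xs → 1 ≤ f x) → 1 ≤ ∏ xs f
∏-pos [] f h = ≤-refl
∏-pos (x ∷ xs) f h = *-mono-≤ (h x (here refl)) (∏-pos xs f (λ y y∈ → h y (there y∈)))

∏-mono : ∀ xs {f g : A → ℕ} → (∀ x → f x ≤ g x) → ∏ xs f ≤ ∏ xs g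
∏-mono [] h = ≤-refl
∏-mono (x ∷ xs) h = *-mono-≤ (h x) (∏-mono xs h)

∑V : ∀ {n} → (Fin n → ℕ) → ℕ
∑V {n} f = ∑ (allFin n) f

∑V-single : ∀ (i : Fin n) (f : Fin n → ℕ) → ∑V (λ j → ⟦ i == j ⟧ * f j) ≡ f i
∑V-single {n} i f =
  trans (∑-single _ (Uniq.allFin⁺ n) (∈-allFin i)
          (λ j _ j≢i → cong (λ b → ⟦ b ⟧ * f j) (==-neq (λ e → j≢i (sym e)))))
        (trans (cong (λ b → ⟦ b ⟧ * f i) (==-refl i)) (*-identityˡ _))

∑V-single₁ : ∀ (i : Fin n) → ∑V (λ j → ⟦ i == j ⟧) ≡ 1
∑V-single₁ {n} i = trans (∑-cong (allFin n) (λ j → sym (*-identityʳ _))) (∑V-single i (λ _ → 1))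

∑V-const : ∀ n c → ∑V {n} (λ _ → c) ≡ n * c
∑V-const n c = trans (∑-const (allFin n) c) (cong (_* c) (length-tabulate {n = n} id))

∑V-pigeonhole : ∀ (f : Fin n → ℕ) b → n * b < ∑V f → Σ (Fin n) λ i → b < f i
∑V-pigeonhole {n} f b p with ∑-pigeonhole (allFin n) f b (subst (λ k → k * b < ∑V f) (sym (length-tabulate {n = n} id)) p)
... | i , _ , q = i , q

∑V-one-bound : ∀ (f : Fin n → ℕ) b → (∀ i → f i ≤ b) → ∑V f ≤ n * b
∑V-one-bound {n} f b h = ≤-trans (∑-mono (allFin n) h) (≤-reflexive (∑V-const n b))

∑V-≤1 : ∀ (p : Fin n → Bool) → (∀ i j → p i ≡ true → p j ≡ true → i ≡ j) → ∑V (λ i → ⟦ p i ⟧) ≤ 1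
∑V-≤1 {n} p h = ≤-trans
  (∑-inj {ys = tt ∷ []} (λ _ → tt) {g = λ _ → 1} (Uniq.allFin⁺ n)
     (λ i _ _ → here refl , ⟦⟧≤1 (p i))
     (λ i j _ _ a b _ → h i j (⟦⟧-pos a) (⟦⟧-pos b)))
  ≤-refl

∑V-≥1 : ∀ (p : Fin n → Bool) i → p i ≡ true → 1 ≤ ∑V (λ i → ⟦ p i ⟧)
∑V-≥1 p i e = ≤-trans (≤-reflexive (sym (⟦⟧-true e))) (∑-term (λ i → ⟦ p i ⟧) (∈-allFin i))

∑V-pos : ∀ (p : Fin n → Bool) → 0 < ∑V (λ i → ⟦ p i ⟧) → Σ (Fin n) λ i → p i ≡ true
∑V-pos {n} p q with ∑-pos (allFin n) _ q
... | i , _ , e = i , ⟦⟧-pos e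

-- Trees as Boolean matrices

Mat : ℕ → Set
Mat n = Fin n → Fin n → Bool

SameEdge : (a b i j : Fin n) → Set
SameEdge a b i j = (i ≡ a × j ≡ b) ⊎ (i ≡ b × j ≡ a)

-- In a tree this is the fundamental cut of the edge `a b`, oriented so that `side` marks the
-- component of `a` after deleting the edge. Being a Boolean function, it can be combined with other
-- cuts by `xor`.
record Cut {n : ℕ} (R : Mat n) (a b : Fin n) : Set where
  field
    side : Fin n → Bool
    far  : side a ≡ true
    near : side b ≡ false
    mono : ∀ i j → R i j ≡ true → side i ≡ side j ⊎ SameEdge a b i j
open Cut public

-- Trees in terms of the cut space over 𝔽₂: connected means that only the
-- constants have empty coboundary, acyclic means that every edge is the whole
-- coboundary of some side function.
record Tree {n : ℕ} (R : Mat n) : Set where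
  field
    R-sym : ∀ i j → R i j ≡ R j i
    R-irr : ∀ i → R i i ≡ false
    conn  : ∀ (χ : Fin n → Bool) → (∀ i j → R i j ≡ true → χ i ≡ χ j) → ∀ i j → χ i ≡ χ j
    cut   : ∀ a b → R a b ≡ true → Cut R a b
open Tree public

deg : Mat n → Fin n → ℕ
deg R u = ∑V (λ j → ⟦ R u j ⟧)

∨-introʳ : ∀ b {c} → c ≡ true → b ∨ c ≡ true
∨-introʳ true _ = refl
∨-introʳ false e = e

∨-falseˡ : ∀ {b c} → b ≡ false → b ∨ c ≡ c
∨-falseˡ refl = refl

⇔-≡ : ∀ {b c} → (b ≡ true → c ≡ true) → (c ≡ true → b ≡ true) → b ≡ c
⇔-≡ {true} f g = sym (f refl)
⇔-≡ {false} {true} f g = g refl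
⇔-≡ {false} {false} f g = refl

xor-self : ∀ b → b xor b ≡ false
xor-self true = refl
xor-self false = refl

xor-≢ : ∀ {a b} → a ≢ b → a xor b ≡ true
xor-≢ {true} {true} h = contradiction refl h
xor-≢ {true} {false} h = refl
xor-≢ {false} {true} h = refl
xor-≢ {false} {false} h = contradiction refl h

xor-cross : ∀ {a b c d} → a ≢ b → c ≢ d → a xor c ≡ b xor d
xor-cross {true} {true} h k = contradiction refl h
xor-cross {true} {false} {true} {true} h k = contradiction refl k
xor-cross {true} {false} {true} {false} h k = refl
xor-cross {true} {false} {false} {true} h k = refl
xor-cross {true} {false} {false} {false} h k = contradiction refl k
xor-cross {false} {false} h k = contradiction refl h
xor-cross {false} {true} {true} {true} h k = contradiction refl k
xor-cross {false} {true} {true} {false} h k = refl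
xor-cross {false} {true} {false} {true} h k = refl
xor-cross {false} {true} {false} {false} h k = contradiction refl k

module _ {n : ℕ} {R : Mat n} where

  -- Sums and complements of cuts keep edges monochromatic but may reverse the orientation; adding
  -- the constant `χ b` restores it.
  normaliseCut : ∀ {a b} (χ : Fin n → Bool) → χ a ≢ χ b →
    (∀ i j → R i j ≡ true → χ i ≡ χ j ⊎ SameEdge a b i j) → Cut R a b
  normaliseCut {a} {b} χ χa≢χb m = record
    { side = λ u → χ u xor χ b
    ; far = xor-≢ χa≢χb
    ; near = xor-self (χ b)
    ; mono = λ i j r → [ (λ e → inj₁ (cong (_xor χ b) e)) , inj₂ ]′ (m i j r) }

  cut-differs : ∀ {a b i j} (c : Cut R a b) → SameEdge a b i j → side c i ≢ side c j
  cut-differs c (inj₁ (refl , refl)) e = true≢false (trans (sym (far c)) (trans e (near c)))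
  cut-differs c (inj₂ (refl , refl)) e = true≢false (trans (sym (far c)) (trans (sym e) (near c)))

  Cut-flip : ∀ {a b} → Cut R a b → Cut R b a
  Cut-flip c = normaliseCut (side c) (λ e → cut-differs c (inj₁ (refl , refl)) (sym e))
    (λ i j r → [ inj₁ , [ inj₂ ∘ inj₂ , inj₂ ∘ inj₁ ]′ ]′ (mono c i j r))

  module _ (t : Tree R) where

    -- The sum of two cuts of one edge is constant along every edge, since that edge flips both. By
    -- connectedness it is constant, and it vanishes at `a`.
    cut-unique : ∀ {a b} (c c′ : Cut R a b) u → side c u ≡ side c′ u
    cut-unique {a} {b} c c′ u = lemma (trans (conn t χ closed u a) χa)
      where
      χ : Fin n → Bool
      χ u = side c u xor side c′ u
      χa : χ a ≡ false
      χa rewrite far c | far c′ = refl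
      closed : ∀ i j → R i j ≡ true → χ i ≡ χ j
      closed i j r with mono c i j r | mono c′ i j r
      ... | inj₁ e | inj₁ e′ = cong₂ _xor_ e e′
      ... | inj₂ s | _ = xor-cross (cut-differs c s) (cut-differs c′ s)
      ... | inj₁ _ | inj₂ s = xor-cross (cut-differs c s) (cut-differs c′ s)
      lemma : ∀ {x y} → x xor y ≡ false → x ≡ y
      lemma {true} {true} _ = refl
      lemma {false} {false} _ = refl

    -- via x v z : the path from x to z leaves x through its neighbour v.
    via : (x v z : Fin n) → Bool
    via x v z with R v x 𝔹.≟ true
    ... | yes p = side (cut t v x p) z
    ... | no _ = false

    via⁻ : ∀ x v z → via x v z ≡ true → Σ (R v x ≡ true) λ p → side (cut t v x p) z ≡ true
    via⁻ x v z e with R v x 𝔹.≟ true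
    ... | yes p = p , e

    via-cut : ∀ {x v} (c : Cut R v x) → R v x ≡ true → ∀ z → via x v z ≡ side c z
    via-cut {x} {v} c r z with R v x 𝔹.≟ true
    ... | yes p = cut-unique (cut t v x p) c z
    ... | no q = contradiction r q

    edge-≢ : ∀ {i j} → R i j ≡ true → i ≢ j
    edge-≢ r refl = true≢false (trans (sym r) (R-irr t _))

    -- Distinct branches at `x` are disjoint. Their intersection `ψ` is constant along every edge,
    -- because `z` and `z′` each lie outside the branch of the other and `x` lies outside both; so
    -- `ψ` cannot separate `v` from `x`.
    via-unique : ∀ x z z′ v → via x z v ≡ true → via x z′ v ≡ true → z ≡ z′
    via-unique x z z′ v e e′ with z F.≟ z′
    ... | yes q = q
    ... | no z≢z′ = contradiction (trans (conn t ψ closed v x) ψx) (λ q → true≢false (trans (sym ψv) q))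
      where
      r = proj₁ (via⁻ x z v e)
      r′ = proj₁ (via⁻ x z′ v e′)
      c = cut t z x r
      c′ = cut t z′ x r′
      ψ : Fin n → Bool
      ψ u = side c u ∧ side c′ u
      ψx : ψ x ≡ false
      ψx rewrite near c = refl
      ψv : ψ v ≡ true
      ψv = ∧-intro (proj₂ (via⁻ x z v e)) (proj₂ (via⁻ x z′ v e′))
      c′z : side c′ z ≡ false
      c′z with mono c′ z x r
      ... | inj₁ q = trans q (near c′)
      ... | inj₂ (inj₁ (q , _)) = contradiction q z≢z′
      ... | inj₂ (inj₂ (q , _)) = contradiction q (edge-≢ r)
      cz′ : side c z′ ≡ false
      cz′ with mono c z′ x r′
      ... | inj₁ q = trans q (near c)
      ... | inj₂ (inj₁ (q , _)) = contradiction (sym q) z≢z′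
      ... | inj₂ (inj₂ (q , _)) = contradiction q (edge-≢ r′)
      ψz : ψ z ≡ false
      ψz rewrite c′z = ∧-zeroʳ _
      ψz′ : ψ z′ ≡ false
      ψz′ rewrite cz′ = refl
      closed : ∀ i j → R i j ≡ true → ψ i ≡ ψ j
      closed i j q with mono c i j q | mono c′ i j q
      ... | inj₁ a | inj₁ b = cong₂ _∧_ a b
      ... | inj₂ (inj₁ (refl , refl)) | _ = trans ψz (sym ψx)
      ... | inj₂ (inj₂ (refl , refl)) | _ = trans ψx (sym ψz)
      ... | inj₁ _ | inj₂ (inj₁ (refl , refl)) = trans ψz′ (sym ψx)
      ... | inj₁ _ | inj₂ (inj₂ (refl , refl)) = trans ψx (sym ψz′)

    -- Otherwise `x` together with all its branches would be a set closed under edges that contains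
    -- `x` but not `z`.
    via-exists : ∀ x z → z ≢ x → Σ (Fin n) λ v → via x v z ≡ true
    via-exists x z z≢x with any? (λ v → via x v z 𝔹.≟ true)
    ... | yes p = p
    ... | no none = contradiction (trans (sym ψx) (trans (conn t ψ closed x z) ψz)) true≢false
      where
      some : Fin n → Bool
      some u = does (any? (λ v → via x v u 𝔹.≟ true))
      ψ : Fin n → Bool
      ψ u = (u == x) ∨ some u
      ψx : ψ x ≡ true
      ψx rewrite ==-refl x = refl
      ψz : ψ z ≡ false
      ψz rewrite ==-neq z≢x = dec-false (any? (λ v → via x v z 𝔹.≟ true)) none
      some-mono : ∀ i j → i ≢ x → j ≢ x → R i j ≡ true → some i ≡ true → some j ≡ true
      some-mono i j i≢x j≢x r s with does-true {d = any? (λ v → via x v i 𝔹.≟ true)} s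
      ... | v , e with via⁻ x v i e
      ...   | p , q with mono (cut t v x p) i j r
      ...     | inj₁ m = dec-true (any? _) (v , trans (via-cut (cut t v x p) p j) (trans (sym m) q))
      ...     | inj₂ (inj₁ (_ , m)) = contradiction m j≢x
      ...     | inj₂ (inj₂ (m , _)) = contradiction m i≢x
      nbr : ∀ j → R x j ≡ true → ψ j ≡ true
      nbr j r = ∨-introʳ (j == x) (dec-true (any? (λ v → via x v j 𝔹.≟ true))
                  (j , trans (via-cut (cut t j x r′) r′ j) (far (cut t j x r′))))
        where r′ = trans (R-sym t j x) r
      step : ∀ i j → R i j ≡ true → ψ i ≡ true → ψ j ≡ true
      step i j r e with j F.≟ x
      ... | yes refl = refl
      ... | no j≢x with i F.≟ x
      ...   | yes refl = trans (sym (∨-falseˡ (==-neq j≢x))) (nbr j r)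
      ...   | no i≢x = some-mono i j i≢x j≢x r e
      closed : ∀ i j → R i j ≡ true → ψ i ≡ ψ j
      closed i j r = ⇔-≡ (step i j r) (step j i (trans (R-sym t j i) r))

    degree-positive : ∀ {x z} → z ≢ x → 1 ≤ deg R x
    degree-positive {x} {z} z≢x with via-exists x z z≢x
    ... | v , e = ∑V-≥1 (R x) v (trans (R-sym t x v) (proj₁ (via⁻ x v z e)))

    via-either : ∀ ρ i j → R i j ≡ true → via i j ρ ≡ true ⊎ via j i ρ ≡ true
    via-either ρ i j r with side (cut t i j r) ρ in eq
    ... | true = inj₂ (trans (via-cut (cut t i j r) r ρ) eq)
    ... | false = inj₁ (trans (via-cut (Cut-flip (cut t i j r)) (trans (R-sym t j i) r) ρ)
                          (trans (cong₂ _xor_ eq (far (cut t i j r))) refl))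

    -- Orienting every edge towards a root ρ gives each vertex at most one out-edge.
    ∑degree≤2n : Fin n → ∑V (deg R) ≤ 2 * n
    ∑degree≤2n ρ = begin
      ∑V (deg R)
        ≤⟨ ∑-mono V (λ i → ∑-mono V (λ j → bound i j)) ⟩
      ∑ V (λ i → ∑ V (λ j → ⟦ via i j ρ ⟧ + ⟦ via j i ρ ⟧))
        ≡⟨ ∑-cong V (λ i → ∑-+ V (λ j → ⟦ via i j ρ ⟧) (λ j → ⟦ via j i ρ ⟧)) ⟩
      ∑ V (λ i → ∑ V (λ j → ⟦ via i j ρ ⟧) + ∑ V (λ j → ⟦ via j i ρ ⟧))
        ≡⟨ ∑-+ V (λ i → ∑ V (λ j → ⟦ via i j ρ ⟧)) (λ i → ∑ V (λ j → ⟦ via j i ρ ⟧)) ⟩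
      out + ∑ V (λ i → ∑ V (λ j → ⟦ via j i ρ ⟧))
        ≡⟨ cong (out +_) (∑-swap V V (λ i j → ⟦ via j i ρ ⟧)) ⟩
      out + out
        ≤⟨ +-mono-≤ out≤n out≤n ⟩
      n + n
        ≡⟨ cong (n +_) (sym (+-identityʳ n)) ⟩
      2 * n ∎
      where
      open ≤-Reasoning
      V = allFin n
      out = ∑ V (λ i → ∑ V (λ j → ⟦ via i j ρ ⟧))
      out≤n : out ≤ n
      out≤n = ≤-trans (∑V-one-bound _ 1 (λ i → ∑V-≤1 (λ j → via i j ρ) (λ j j′ → via-unique i j j′ ρ)))
                      (≤-reflexive (*-identityʳ n))
      bound : ∀ i j → ⟦ R i j ⟧ ≤ ⟦ via i j ρ ⟧ + ⟦ via j i ρ ⟧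
      bound i j = ⟦⟧-≤ (λ e → [ (λ q → ≤-trans (≤-reflexive (sym (⟦⟧-true q))) (m≤m+n _ _))
                              , (λ q → ≤-trans (≤-reflexive (sym (⟦⟧-true q))) (m≤n+m _ _)) ]′ (via-either ρ i j e))

-- Exchanging one edge of a tree for another

edge : (a b i j : Fin n) → Bool
edge a b i j = ((i == a) ∧ (j == b)) ∨ ((i == b) ∧ (j == a))

edge⁻ : ∀ {a b i j : Fin n} → edge a b i j ≡ true → SameEdge a b i j
edge⁻ {a = a} {b} {i} {j} e with (i == a) ∧ (j == b) in eq
... | true = inj₁ (==-eq (proj₁ (∧-true eq)) , ==-eq (proj₂ (∧-true eq)))
... | false = inj₂ (==-eq (proj₁ (∧-true e)) , ==-eq (proj₂ (∧-true e)))

edge⁺ : ∀ {a b i j : Fin n} → SameEdge a b i j → edge a b i j ≡ true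
edge⁺ {a = a} {b} (inj₁ (refl , refl)) rewrite ==-refl a | ==-refl b = refl
edge⁺ {a = a} {b} (inj₂ (refl , refl)) = ∨-introʳ ((b == a) ∧ (a == b)) (∧-intro (==-refl b) (==-refl a))

edge-sym : ∀ (a b i j : Fin n) → edge a b i j ≡ edge a b j i
edge-sym a b i j = trans (∨-comm ((i == a) ∧ (j == b)) _)
  (cong₂ _∨_ (∧-comm (i == b) (j == a)) (∧-comm (i == a) (j == b)))

∑-edge : ∀ {a b : Fin n} → a ≢ b → ∀ u → ∑V (λ j → ⟦ edge a b u j ⟧) ≡ ⟦ u == a ⟧ + ⟦ u == b ⟧
∑-edge {n} {a} {b} a≢b u = begin
  ∑ V (λ j → ⟦ edge a b u j ⟧)
    ≡⟨ ∑-cong V split ⟩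
  ∑ V (λ j → ⟦ u == a ⟧ * ⟦ b == j ⟧ + ⟦ u == b ⟧ * ⟦ a == j ⟧)
    ≡⟨ ∑-+ V (λ j → ⟦ u == a ⟧ * ⟦ b == j ⟧) (λ j → ⟦ u == b ⟧ * ⟦ a == j ⟧) ⟩
  ∑ V (λ j → ⟦ u == a ⟧ * ⟦ b == j ⟧) + ∑ V (λ j → ⟦ u == b ⟧ * ⟦ a == j ⟧)
    ≡⟨ cong₂ _+_ (one a b) (one b a) ⟩
  ⟦ u == a ⟧ + ⟦ u == b ⟧ ∎
  where
  open ≡-Reasoning
  V = allFin n
  one : ∀ p q → ∑ V (λ j → ⟦ u == p ⟧ * ⟦ q == j ⟧) ≡ ⟦ u == p ⟧
  one p q = trans (∑-*ˡ V ⟦ u == p ⟧ (λ j → ⟦ q == j ⟧))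
              (trans (cong (⟦ u == p ⟧ *_) (∑V-single₁ q)) (*-identityʳ _))
  split : ∀ j → ⟦ edge a b u j ⟧ ≡ ⟦ u == a ⟧ * ⟦ b == j ⟧ + ⟦ u == b ⟧ * ⟦ a == j ⟧
  split j rewrite ==-sym b j | ==-sym a j with u F.≟ a | u F.≟ b
  ... | yes refl | yes q = contradiction q a≢b
  ... | yes _ | no _ = trans (cong ⟦_⟧ (∨-identityʳ (j == b))) (sym (trans (+-identityʳ _) (+-identityʳ _)))
  ... | no _ | yes _ = sym (+-identityʳ _)
  ... | no _ | no _ = refl

-- Truth table for one matrix entry under an exchange: `ρ` belongs to the tree, `e` to the removed
-- edge, `f` to the added one. The alternative `e ≡ f` is the degenerate exchange that puts the
-- removed edge back; there `f` is not absent from the tree.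
swap-count : ∀ ρ e f → (e ≡ true → ρ ≡ true) → (f ≡ true → ρ ≡ false) ⊎ e ≡ f →
  ⟦ (ρ ∧ not e) ∨ f ⟧ + ⟦ e ⟧ ≡ ⟦ ρ ⟧ + ⟦ f ⟧
swap-count true true true h k = refl
swap-count true true false h k = refl
swap-count true false true h (inj₁ k) = contradiction (k refl) true≢false
swap-count true false false h k = refl
swap-count false true f h k = contradiction (sym (h refl)) true≢false
swap-count false false true h k = refl
swap-count false false false h k = refl

swap-back : ∀ ρ e f → (e ≡ true → ρ ≡ true) → (f ≡ true → ρ ≡ false) ⊎ e ≡ f →
  (((ρ ∧ not e) ∨ f) ∧ not f) ∨ e ≡ ρ
swap-back true true true h k = refl
swap-back true true false h k = refl
swap-back true false true h (inj₁ k) = contradiction (k refl) true≢false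
swap-back true false false h k = refl
swap-back false true f h k = contradiction (sym (h refl)) true≢false
swap-back false false true h k = refl
swap-back false false false h k = refl

-- The case `z = v` is allowed and, when `x v` is an edge, gives back `R`: a resampled leaf may keep
-- its neighbour.
exch : Mat n → (x v z : Fin n) → Mat n
exch R x v z i j = (R i j ∧ not (edge x v i j)) ∨ edge x z i j

module Exchange {n : ℕ} {R : Mat n} (t : Tree R) {x v z : Fin n}
                (r : R v x ≡ true) (c : Cut R v x) (far-z : side c z ≡ true) where

  R′ : Mat n
  R′ = exch R x v z

  swapEdge : ∀ {a b i j : Fin n} → SameEdge a b i j → SameEdge b a i j
  swapEdge (inj₁ p) = inj₂ p
  swapEdge (inj₂ p) = inj₁ p

  R′⁻ : ∀ {i j} → R′ i j ≡ true → (R i j ≡ true × ¬ SameEdge x v i j) ⊎ SameEdge x z i j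
  R′⁻ {i} {j} e with edge x z i j in eq
  ... | true = inj₂ (edge⁻ eq)
  ... | false with R i j | edge x v i j in eq′
  ...   | true | false = inj₁ (refl , λ s → true≢false (trans (sym (edge⁺ s)) eq′))
  ...   | true | true = ⊥-elim (true≢false (sym e))
  ...   | false | _ = ⊥-elim (true≢false (sym e))

  R′⁺ : ∀ {i j} → R i j ≡ true → ¬ SameEdge x v i j → R′ i j ≡ true
  R′⁺ {i} {j} e s with edge x v i j in eq
  ... | true = contradiction (edge⁻ eq) s
  ... | false rewrite e = refl

  R′-new : ∀ {i j} → SameEdge x z i j → R′ i j ≡ true
  R′-new {i} {j} s = ∨-introʳ (R i j ∧ not (edge x v i j)) (edge⁺ s)

  x≢z : x ≢ z
  x≢z refl = true≢false (trans (sym far-z) (near c))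

  x≢v : x ≢ v
  x≢v e = edge-≢ t r (sym e)

  c-mono : ∀ {i j} → R i j ≡ true → ¬ SameEdge x v i j → side c i ≡ side c j
  c-mono {i} {j} q s with mono c i j q
  ... | inj₁ e = e
  ... | inj₂ e = contradiction (swapEdge e) s

  sameEdge? : ∀ (i j : Fin n) → SameEdge x v i j ⊎ ¬ SameEdge x v i j
  sameEdge? i j with edge x v i j in eq
  ... | true = inj₁ (edge⁻ eq)
  ... | false = inj₂ (λ s → true≢false (trans (sym (edge⁺ s)) eq))

  new-cut : Cut R′ z x
  new-cut = record
    { side = side c ; far = far-z ; near = near c
    ; mono = λ i j q → [ (λ (e , s) → inj₁ (c-mono e s)) , inj₂ ∘ swapEdge ]′ (R′⁻ q) }

  -- The old cut of `a b` survives unless the new edge crosses it. In that case adding `c` helps: in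
  -- the new tree `c` is crossed by the new edge alone, so the sum is crossed by `a b` alone.
  old-cut : ∀ {a b} → R a b ≡ true → ¬ SameEdge x v a b → Cut R′ a b
  old-cut {a} {b} q s with side (cut t a b q) x 𝔹.≟ side (cut t a b q) z
  ... | yes e = record
    { side = side (cut t a b q) ; far = far (cut t a b q) ; near = near (cut t a b q)
    ; mono = λ i j p → [ (λ (e′ , _) → mono (cut t a b q) i j e′) , (λ s′ → inj₁ (equal s′)) ]′ (R′⁻ p) }
    where
    equal : ∀ {i j} → SameEdge x z i j → side (cut t a b q) i ≡ side (cut t a b q) j
    equal (inj₁ (refl , refl)) = e
    equal (inj₂ (refl , refl)) = sym e
  ... | no ne = normaliseCut χ χa≢χb χ-mono
    where
    c′ = cut t a b q
    χ : Fin n → Bool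
    χ u = side c′ u xor side c u
    χa≢χb : χ a ≢ χ b
    χa≢χb rewrite far c′ | near c′ | c-mono q s with side c b
    ... | true = λ ()
    ... | false = λ ()
    c≢ : side c x ≢ side c z
    c≢ e = true≢false (trans (sym far-z) (trans (sym e) (near c)))
    χ-mono : ∀ i j → R′ i j ≡ true → χ i ≡ χ j ⊎ SameEdge a b i j
    χ-mono i j p with R′⁻ p
    ... | inj₂ (inj₁ (refl , refl)) = inj₁ (xor-cross ne c≢)
    ... | inj₂ (inj₂ (refl , refl)) = inj₁ (xor-cross (ne ∘ sym) (c≢ ∘ sym))
    ... | inj₁ (e , s′) with mono c′ i j e
    ...   | inj₁ m = inj₁ (cong₂ _xor_ m (c-mono e s′))
    ...   | inj₂ m = inj₂ m

  exch-tree : Tree R′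
  exch-tree .R-sym i j = cong₂ _∨_
    (cong₂ _∧_ (R-sym t i j) (cong not (edge-sym x v i j))) (edge-sym x z i j)
  exch-tree .R-irr i with R′ i i in eq
  ... | false = refl
  ... | true with R′⁻ eq
  ...   | inj₁ (e , _) = contradiction (trans (sym e) (R-irr t i)) true≢false
  ...   | inj₂ (inj₁ (refl , e)) = contradiction e x≢z
  ...   | inj₂ (inj₂ (e , refl)) = contradiction e x≢z
  -- A function constant along the new tree could vary in the old one only across `x v`. If it does,
  -- adding `side c` makes it constant along the old tree; but then it would have to differ at `x`
  -- and `z`, which the new edge joins.
  exch-tree .conn χ closed with χ x 𝔹.≟ χ v
  ... | yes e = conn t χ closed′
    where
    closed′ : ∀ i j → R i j ≡ true → χ i ≡ χ j
    closed′ i j q with sameEdge? i j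
    ... | inj₁ (inj₁ (refl , refl)) = e
    ... | inj₁ (inj₂ (refl , refl)) = sym e
    ... | inj₂ s = closed i j (R′⁺ q s)
  ... | no ne = ⊥-elim (xor-lemma (conn t ψ closed′ x z) (closed x z (R′-new (inj₁ (refl , refl)))))
    where
    ψ : Fin n → Bool
    ψ u = χ u xor side c u
    c≢ : side c x ≢ side c v
    c≢ e = true≢false (trans (sym (far c)) (trans (sym e) (near c)))
    closed′ : ∀ i j → R i j ≡ true → ψ i ≡ ψ j
    closed′ i j q with sameEdge? i j
    ... | inj₁ (inj₁ (refl , refl)) = xor-cross ne c≢
    ... | inj₁ (inj₂ (refl , refl)) = xor-cross (ne ∘ sym) (c≢ ∘ sym)
    ... | inj₂ s = cong₂ _xor_ (closed i j (R′⁺ q s)) (c-mono q s)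
    xor-lemma : ψ x ≡ ψ z → χ x ≢ χ z
    xor-lemma e e′ rewrite near c | far-z | e′ with χ z
    ... | true = true≢false e
    ... | false = true≢false (sym e)
  exch-tree .cut a b q with R′⁻ q
  ... | inj₁ (e , s) = old-cut e s
  ... | inj₂ (inj₁ (refl , refl)) = Cut-flip new-cut
  ... | inj₂ (inj₂ (refl , refl)) = new-cut

  no-edge : z ≢ v → R x z ≡ false
  no-edge z≢v with R x z in eq
  ... | false = refl
  ... | true with mono c x z eq
  ...   | inj₁ e = contradiction (trans (sym far-z) (trans (sym e) (near c))) true≢false
  ...   | inj₂ (inj₁ (e , _)) = contradiction e x≢v
  ...   | inj₂ (inj₂ (_ , e)) = contradiction e z≢v

  -- The vertex `x` loses one edge and gains one, so only `v` and `z` are affected. Terms are added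
  -- on both sides in place of a subtraction, which also covers `z = v`.
  exch-degree : ∀ u → deg R′ u + ⟦ u == v ⟧ ≡ deg R u + ⟦ u == z ⟧
  exch-degree u = +-cancelˡ-≡ ⟦ u == x ⟧ _ _ (begin
    ⟦ u == x ⟧ + (deg R′ u + ⟦ u == v ⟧)
      ≡⟨ rot ⟦ u == x ⟧ (deg R′ u) ⟦ u == v ⟧ ⟩
    deg R′ u + (⟦ u == x ⟧ + ⟦ u == v ⟧)
      ≡⟨ cong (deg R′ u +_) (sym (∑-edge x≢v u)) ⟩
    deg R′ u + ∑V (λ j → ⟦ edge x v u j ⟧)
      ≡⟨ sym (∑-+ (allFin n) (λ j → ⟦ R′ u j ⟧) (λ j → ⟦ edge x v u j ⟧)) ⟩
    ∑V (λ j → ⟦ R′ u j ⟧ + ⟦ edge x v u j ⟧)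
      ≡⟨ ∑-cong (allFin n) (λ j → pointwise j) ⟩
    ∑V (λ j → ⟦ R u j ⟧ + ⟦ edge x z u j ⟧)
      ≡⟨ ∑-+ (allFin n) (λ j → ⟦ R u j ⟧) (λ j → ⟦ edge x z u j ⟧) ⟩
    deg R u + ∑V (λ j → ⟦ edge x z u j ⟧)
      ≡⟨ cong (deg R u +_) (∑-edge x≢z u) ⟩
    deg R u + (⟦ u == x ⟧ + ⟦ u == z ⟧)
      ≡⟨ sym (rot ⟦ u == x ⟧ (deg R u) ⟦ u == z ⟧) ⟩
    ⟦ u == x ⟧ + (deg R u + ⟦ u == z ⟧) ∎)
    where
    open ≡-Reasoning
    rot : ∀ a b c → a + (b + c) ≡ b + (a + c)
    rot = solve-∀
    R-xv : ∀ {i j} → SameEdge x v i j → R i j ≡ true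
    R-xv (inj₁ (refl , refl)) = trans (R-sym t x v) r
    R-xv (inj₂ (refl , refl)) = r
    R-xz : z ≢ v → ∀ {i j} → SameEdge x z i j → R i j ≡ false
    R-xz h (inj₁ (refl , refl)) = no-edge h
    R-xz h (inj₂ (refl , refl)) = trans (R-sym t z x) (no-edge h)
    pointwise : ∀ j → ⟦ R′ u j ⟧ + ⟦ edge x v u j ⟧ ≡ ⟦ R u j ⟧ + ⟦ edge x z u j ⟧
    pointwise j = swap-count (R u j) (edge x v u j) (edge x z u j)
      (λ e → R-xv (edge⁻ {i = u} {j} e)) (excluded (z F.≟ v))
      where
      excluded : Dec (z ≡ v) → (edge x z u j ≡ true → R u j ≡ false) ⊎ edge x v u j ≡ edge x z u j
      excluded (yes refl) = inj₂ refl
      excluded (no z≢v) = inj₁ (λ e → R-xz z≢v (edge⁻ {i = u} {j} e))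

exch-involutive : ∀ (R : Mat n) {x v z : Fin n} → (∀ i j → SameEdge x v i j → R i j ≡ true) →
  (z ≢ v → ∀ i j → SameEdge x z i j → R i j ≡ false) →
  ∀ i j → exch (exch R x v z) x z v i j ≡ R i j
exch-involutive R {x} {v} {z} h k i j =
  swap-back (R i j) (edge x v i j) (edge x z i j) (λ e → h i j (edge⁻ {i = i} {j} e)) (excluded (z F.≟ v))
  where
  excluded : Dec (z ≡ v) → (edge x z i j ≡ true → R i j ≡ false) ⊎ edge x v i j ≡ edge x z i j
  excluded (yes refl) = inj₂ refl
  excluded (no z≢v) = inj₁ (λ e → k z≢v i j (edge⁻ {i = i} {j} e))

two-distinct : ∀ (p : Fin n → Bool) {i j} → i ≢ j → p i ≡ true → p j ≡ true → 2 ≤ ∑V (λ k → ⟦ p k ⟧)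
two-distinct {n} p {i} {j} i≢j pi pj =
  ∑-inj {xs = i ∷ j ∷ []} {ys = allFin n} id {f = λ _ → 1} {g = λ k → ⟦ p k ⟧} ((i≢j ∷ []) ∷ [] ∷ [])
    (λ { _ (here refl) _ → ∈-allFin i , ≤-reflexive (sym (⟦⟧-true pi))
       ; _ (there (here refl)) _ → ∈-allFin j , ≤-reflexive (sym (⟦⟧-true pj)) })
    (λ _ _ _ _ _ _ e → e)

leaf-unique : ∀ (R : Mat n) {w y j} → deg R w ≡ 1 → R w y ≡ true → R w j ≡ true → j ≡ y
leaf-unique R {w} {y} {j} d1 ry rj with j F.≟ y
... | yes e = e
... | no ne = contradiction (two-distinct (R w) ne rj ry) (λ q → 1+n≰n (≤-trans q (≤-reflexive d1)))

-- Deleting its only edge isolates a leaf. All other vertices lie on the far side of this cut, so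
-- `Exchange` may re-attach the leaf to any of them.
leaf-cut : ∀ {R : Mat n} → Tree R → ∀ {w y} → deg R w ≡ 1 → R w y ≡ true → Cut R y w
leaf-cut {n} {R} t {w} {y} d1 r = record
  { side = λ u → not (u == w)
  ; far = cong not (==-neq (λ e → edge-≢ t r (sym e)))
  ; near = cong not (==-refl w)
  ; mono = m }
  where
  m : ∀ i j → R i j ≡ true → not (i == w) ≡ not (j == w) ⊎ SameEdge y w i j
  m i j q with i F.≟ w | j F.≟ w
  ... | yes refl | yes refl = inj₁ refl
  ... | yes refl | no _ = inj₂ (inj₂ (refl , leaf-unique R d1 r q))
  ... | no _ | yes refl = inj₂ (inj₁ (leaf-unique R d1 r (trans (R-sym t j i) q) , refl))
  ... | no _ | no _ = inj₁ refl

-- Connected acyclic relations and the cut-space description of trees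

length-unique≤n : ∀ {xs : List (Fin n)} → Unique xs → length xs ≤ n
length-unique≤n {n} {xs} u = begin
  length xs           ≡⟨ sym (∑-one xs) ⟩
  ∑ xs (λ _ → 1)      ≤⟨ ∑-inj id u (λ x _ _ → ∈-allFin x , ≤-refl) (λ _ _ _ _ _ _ e → e) ⟩
  ∑V {n} (λ _ → 1)    ≡⟨ ∑V-const n 1 ⟩
  n * 1               ≡⟨ *-identityʳ n ⟩
  n                   ∎
  where open ≤-Reasoning

module _ {n : ℕ} where

  open import Data.List.Membership.DecPropositional (F._≟_ {n}) using (_∈?_)

  module _ (R : Mat n) (a : Fin n) where

    Joined : Fin n → Fin n → Set
    Joined i j = R i j ≡ true

    -- The path is kept inside the explored set `S`, so extending it by a vertex outside `S` leaves
    -- it simple.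
    SimplePath : List (Fin n) → Fin n → Set
    SimplePath S u = Σ (List (Fin n)) λ vs →
      Chain Joined a vs × lastOf a vs ≡ u × Unique (a ∷ vs) × All (_∈ S) (a ∷ vs)

    Chain-snoc : ∀ x vs {y} → Chain Joined x vs → Joined (lastOf x vs) y → Chain Joined x (vs ++ [ y ])
    Chain-snoc x [] c e = e , tt
    Chain-snoc x (v ∷ vs) (r , c) e = r , Chain-snoc v vs c e

    lastOf-snoc : ∀ (x : Fin n) vs y → lastOf x (vs ++ [ y ]) ≡ y
    lastOf-snoc x [] y = refl
    lastOf-snoc x (v ∷ vs) y = lastOf-snoc v vs y

    Reachable : (Fin n → Bool) → Set
    Reachable χ = χ a ≡ true × (∀ i j → R i j ≡ true → χ i ≡ true → χ j ≡ true) ×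
      (∀ u → χ u ≡ true → Σ (List (Fin n)) λ vs → Chain Joined a vs × lastOf a vs ≡ u × Unique (a ∷ vs))

    -- Here `fuel` covers the vertices not yet explored. Once it is used up, a further new vertex
    -- would give more than `n` distinct elements of `Fin n`.
    explore : ∀ fuel S → Unique S → a ∈ S → n ≤ length S + fuel → (∀ u → u ∈ S → SimplePath S u) →
      Σ (Fin n → Bool) Reachable
    explore fuel S uS a∈S bound path
      with any? (λ i → any? (λ j → (R i j 𝔹.≟ true) ×-dec ((i ∈? S) ×-dec ¬? (j ∈? S))))
    ... | no closed = (λ u → does (u ∈? S)) , dec-true (a ∈? S) a∈S , step , paths
      where
      step : ∀ i j → R i j ≡ true → does (i ∈? S) ≡ true → does (j ∈? S) ≡ true
      step i j r e with j ∈? S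
      ... | yes _ = refl
      ... | no j∉ = contradiction (i , j , r , does-true {d = i ∈? S} e , j∉) closed
      paths : ∀ u → does (u ∈? S) ≡ true → Σ (List (Fin n)) λ vs → Chain Joined a vs × lastOf a vs ≡ u × Unique (a ∷ vs)
      paths u e with path u (does-true {d = u ∈? S} e)
      ... | vs , c , l , q , _ = vs , c , l , q
    explore zero S uS a∈S bound path | yes (i , j , r , i∈ , j∉) =
      ⊥-elim (1+n≰n (≤-trans (s≤s bound) (≤-trans (s≤s (≤-reflexive (+-identityʳ _))) (length-unique≤n (AllP.¬Any⇒All¬ S j∉ ∷ uS)))))
    explore (suc fuel) S uS a∈S bound path | yes (i , j , r , i∈ , j∉) =
      explore fuel (j ∷ S) (AllP.¬Any⇒All¬ S j∉ ∷ uS) (there a∈S)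
        (≤-trans bound (≤-reflexive (+-suc _ fuel))) path′
      where
      path′ : ∀ u → u ∈ j ∷ S → SimplePath (j ∷ S) u
      path′ u (there u∈) with path u u∈
      ... | vs , c , l , q , al = vs , c , l , q , All.map there al
      path′ u (here refl) with path i i∈
      ... | vs , c , refl , q , al =
        vs ++ [ j ] , Chain-snoc a vs c r , lastOf-snoc a vs j
        , Uniq.++⁺ q ([] ∷ []) (λ { (p , here refl) → j∉ (All.lookup al p) })
        , AllP.++⁺ (All.map there al) (here refl ∷ [])

    reach : Σ (Fin n → Bool) Reachable
    reach = explore n [ a ] ([] ∷ []) (here refl) (m≤n+m n 1)
      (λ { u (here refl) → [] , tt , refl , ([] ∷ []) , (here refl ∷ []) })

  Chain-map : ∀ {P Q : Fin n → Fin n → Set} → (∀ {i j} → P i j → Q i j) → ∀ x vs → Chain P x vs → Chain Q x vs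
  Chain-map f x [] c = tt
  Chain-map f x (v ∷ vs) (p , c) = f p , Chain-map f v vs c

  Chain⇒Star : ∀ {P : Fin n → Fin n → Set} x vs → Chain P x vs → Star P x (lastOf x vs)
  Chain⇒Star x [] c = ε
  Chain⇒Star x (v ∷ vs) (p , c) = p ◅ Chain⇒Star v vs c

  lastOf-∈ : ∀ (x : Fin n) v vs → lastOf x (v ∷ vs) ∈ v ∷ vs
  lastOf-∈ x v [] = here refl
  lastOf-∈ x v (u ∷ vs) = there (lastOf-∈ v u vs)

  module _ {P : Fin n → Fin n → Set} {R : Mat n}
           (to : ∀ {i j} → P i j → R i j ≡ true) (from : ∀ {i j} → R i j ≡ true → P i j) where

    -- The cut of an edge `a b` is the set reached from `a` after deleting that edge. If it
    -- contained `b`, a simple path and the edge would close a cycle; paths with fewer than two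
    -- steps are excluded because `R` is irreflexive and the edge is gone.
    IsTree⇒Tree : (∀ i j → R i j ≡ R j i) → (∀ i → R i i ≡ false) → IsTree P → Tree R
    IsTree⇒Tree s irr (connected , acyclic) = record { R-sym = s ; R-irr = irr ; conn = con ; cut = cuts }
      where
      con : ∀ (χ : Fin n → Bool) → (∀ i j → R i j ≡ true → χ i ≡ χ j) → ∀ i j → χ i ≡ χ j
      con χ closed i j = go (connected i j)
        where
        go : ∀ {i} → Star P i j → χ i ≡ χ j
        go ε = refl
        go (p ◅ ps) = trans (closed _ _ (to p)) (go ps)
      cuts : ∀ a b → R a b ≡ true → Cut R a b
      cuts a b r with reach (λ i j → R i j ∧ not (edge a b i j)) a
      ... | χ , χa , step , paths with χ b in χb
      ...   | false = record { side = χ ; far = χa ; near = χb ; mono = m }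
        where
        R₀⁺ : ∀ i j → R i j ≡ true → edge a b i j ≡ false → R i j ∧ not (edge a b i j) ≡ true
        R₀⁺ i j q e rewrite e = ∧-intro q refl
        m : ∀ i j → R i j ≡ true → χ i ≡ χ j ⊎ SameEdge a b i j
        m i j q with edge a b i j in eq
        ... | true = inj₂ (edge⁻ {i = i} {j} eq)
        ... | false = inj₁ (⇔-≡ (step i j (R₀⁺ i j q eq))
                                (step j i (R₀⁺ j i (trans (s j i) q) (trans (edge-sym a b j i) eq))))
      ...   | true with paths b χb
      ...     | [] , c , refl , u = contradiction (trans (sym r) (irr a)) true≢false
      ...     | y ∷ [] , (c , _) , refl , u =
        contradiction (trans (sym (proj₂ (∧-true {R a y} c))) (cong not (edge⁺ {i = a} {y} (inj₁ (refl , refl))))) true≢false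
      ...     | y ∷ z ∷ vs , c , l , u = ⊥-elim (acyclic a (y ∷ z ∷ vs)
        (s≤s (s≤s z≤n) , u , Chain-map (λ {i} {j} q → from (proj₁ (∧-true {R i j} q))) a (y ∷ z ∷ vs) c
        , subst (λ q → P q a) (sym l) (from (trans (s b a) r))))

    -- The cut of the closing edge of a cycle is crossed by no other edge of the cycle, yet the rest
    -- of the cycle joins the two ends of that edge.
    Tree⇒IsTree : Tree R → IsTree P
    Tree⇒IsTree t = connected , acyclic
      where
      connected : ∀ i j → Star P i j
      connected i j with reach R i
      ... | χ , χi , step , paths
        with paths j (trans (sym (conn t χ (λ p q r → ⇔-≡ (step p q r) (step q p (trans (R-sym t q p) r))) i j)) χi)
      ...   | vs , c , refl , _ = Chain⇒Star i vs (Chain-map from i vs c)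
      acyclic : ∀ v vs → ¬ IsCycle P v vs
      acyclic v (y ∷ []) (s≤s () , _)
      acyclic v (y ∷ z ∷ zs) (_ , (v∉ ∷ y∉ ∷ _) , (p , ps) , q) =
        true≢false (trans (sym (far c)) (trans (sym (along y (z ∷ zs) (λ u u∈ → u≢v u (there u∈)) (u≢v y (here refl)) ps)) (trans (sym first) (near c))))
        where
        l = lastOf z zs
        c = cut t l v (to q)
        u≢v : ∀ u → u ∈ y ∷ z ∷ zs → u ≢ v
        u≢v u u∈ e = All.lookup v∉ u∈ (sym e)
        first : side c v ≡ side c y
        first with mono c v y (to p)
        ... | inj₁ e = e
        ... | inj₂ (inj₁ (_ , e)) = contradiction e (u≢v y (here refl))
        ... | inj₂ (inj₂ (_ , e)) = contradiction e (All.lookup y∉ (lastOf-∈ y z zs))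
        along : ∀ x vs → (∀ u → u ∈ vs → u ≢ v) → x ≢ v → Chain P x vs → side c x ≡ side c (lastOf x vs)
        along x [] h x≢v _ = refl
        along x (u ∷ us) h x≢v (e , es) with mono c x u (to e)
        ... | inj₁ m = trans m (along u us (λ w w∈ → h w (there w∈)) (h u (here refl)) es)
        ... | inj₂ (inj₁ (_ , m)) = contradiction m (h u (here refl))
        ... | inj₂ (inj₂ (m , _)) = contradiction m x≢v

-- Edge subsets of a graph as Boolean matrices

lookup-injective : ∀ {xs : List A} → Unique xs → ∀ i j → lookup xs i ≡ lookup xs j → i ≡ j
lookup-injective (x∉ ∷ u) F.zero F.zero e = refl
lookup-injective {xs = x ∷ xs} (x∉ ∷ u) F.zero (F.suc j) e = contradiction e (All.lookup x∉ (∈-lookup j))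
lookup-injective {xs = x ∷ xs} (x∉ ∷ u) (F.suc i) F.zero e = contradiction (sym e) (All.lookup x∉ (∈-lookup i))
lookup-injective (x∉ ∷ u) (F.suc i) (F.suc j) e = cong F.suc (lookup-injective u i j e)

allPairs≡cartesianProduct : ∀ (xs : List A) (ys : List B) →
  concatMap (λ i → map (λ j → (i , j)) ys) xs ≡ cartesianProduct xs ys
allPairs≡cartesianProduct [] ys = refl
allPairs≡cartesianProduct (x ∷ xs) ys = cong (map (x ,_) ys ++_) (allPairs≡cartesianProduct xs ys)

module Matrices {n : ℕ} (G : Graph n) where

  X : Set
  X = EdgeSubset G

  end : Fin (numEdges G) → Fin n × Fin n
  end = lookup (edgeList G)

  edgeList-unique : Unique (edgeList G)
  edgeList-unique = unique-filterᵇ _ (subst Unique (sym (allPairs≡cartesianProduct (allFin n) (allFin n)))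
    (Uniq.cartesianProduct⁺ (Uniq.allFin⁺ n) (Uniq.allFin⁺ n)))

  end-ordered : ∀ k → toℕ (proj₁ (end k)) < toℕ (proj₂ (end k)) × Adj G (proj₁ (end k)) (proj₂ (end k))
  end-ordered k with ∧-true (proj₂ (∈-filterᵇ⁻ {xs = allPairs n} (∈-lookup {xs = edgeList G} k)))
  ... | p , q = <ᵇ⇒< _ _ (Equivalence.from T-≡ p) , q

  end-surjective : ∀ i j → toℕ i < toℕ j → Adj G i j → Σ (Fin (numEdges G)) λ k → end k ≡ (i , j)
  end-surjective i j i<j a = Any.index e∈ , sym (AnyP.lookup-index e∈)
    where
    e∈ : (i , j) ∈ edgeList G
    e∈ = ∈-filterᵇ⁺ (subst ((i , j) ∈_) (sym (allPairs≡cartesianProduct (allFin n) (allFin n)))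
           (∈-cartesianProduct⁺ (∈-allFin i) (∈-allFin j)))
         (∧-intro (Equivalence.to T-≡ (<⇒<ᵇ i<j)) a)

  SubAdj? : ∀ s i j → Dec (SubAdj G s i j)
  SubAdj? s i j = any? (λ k → (V.lookup s k 𝔹.≟ true) ×-dec
    (≡-dec F._≟_ F._≟_ (end k) (i , j) ⊎-dec ≡-dec F._≟_ F._≟_ (end k) (j , i)))

  abstract
    mat : X → Mat n
    mat s i j = does (SubAdj? s i j)

    mat⁺ : ∀ {s i j} → SubAdj G s i j → mat s i j ≡ true
    mat⁺ {s} {i} {j} = dec-true (SubAdj? s i j)

    mat⁻ : ∀ {s i j} → mat s i j ≡ true → SubAdj G s i j
    mat⁻ {s} {i} {j} = does-true {d = SubAdj? s i j}

    enc : Mat n → X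
    enc R = V.tabulate (λ k → R (proj₁ (end k)) (proj₂ (end k)))

    lookup-enc : ∀ R k → V.lookup (enc R) k ≡ R (proj₁ (end k)) (proj₂ (end k))
    lookup-enc R k = VP.lookup∘tabulate _ k

  mat⊆adj : ∀ s i j → mat s i j ≡ true → Adj G i j
  mat⊆adj s i j e with mat⁻ {s} e
  ... | k , _ , inj₁ q = subst (λ p → Adj G (proj₁ p) (proj₂ p)) q (proj₂ (end-ordered k))
  ... | k , _ , inj₂ q = trans (symm G i j) (subst (λ p → Adj G (proj₁ p) (proj₂ p)) q (proj₂ (end-ordered k)))

  SubAdj-sym : ∀ {s i j} → SubAdj G s i j → SubAdj G s j i
  SubAdj-sym (k , e , inj₁ q) = k , e , inj₂ q
  SubAdj-sym (k , e , inj₂ q) = k , e , inj₁ q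

  mat-sym : ∀ s i j → mat s i j ≡ mat s j i
  mat-sym s i j = ⇔-≡ (λ e → mat⁺ {s} (SubAdj-sym {s} (mat⁻ {s} e))) (λ e → mat⁺ {s} (SubAdj-sym {s} (mat⁻ {s} e)))

  mat-irr : ∀ s i → mat s i i ≡ false
  mat-irr s i with mat s i i in eq
  ... | false = refl
  ... | true = trans (sym (mat⊆adj s i i eq)) (irrefl G i)

  spanning⇒Tree : ∀ {s} → IsSpanningTree G s → Tree (mat s)
  spanning⇒Tree {s} = IsTree⇒Tree (mat⁺ {s}) (mat⁻ {s}) (mat-sym s) (mat-irr s)

  Tree⇒spanning : ∀ {s} → Tree (mat s) → IsSpanningTree G s
  Tree⇒spanning {s} = Tree⇒IsTree (mat⁺ {s}) (mat⁻ {s})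

  -- The listed pairs are increasing and distinct, so neither another index nor a reversed pair
  -- produces this matrix entry.
  mat-at-end : ∀ s k → mat s (proj₁ (end k)) (proj₂ (end k)) ≡ V.lookup s k
  mat-at-end s k = ⇔-≡ one (λ e → mat⁺ {s} (k , e , inj₁ refl))
    where
    one : mat s (proj₁ (end k)) (proj₂ (end k)) ≡ true → V.lookup s k ≡ true
    one e with mat⁻ {s} e
    ... | k′ , q , inj₁ p = subst (λ i → V.lookup s i ≡ true) (lookup-injective edgeList-unique k′ k p) q
    ... | k′ , q , inj₂ p = ⊥-elim (<-asym (proj₁ (end-ordered k))
            (subst (λ p → toℕ (proj₁ p) < toℕ (proj₂ p)) p (proj₁ (end-ordered k′))))

  mat-injective : ∀ s s′ → (∀ i j → mat s i j ≡ mat s′ i j) → s ≡ s′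
  mat-injective s s′ h = trans (sym (VP.tabulate∘lookup s))
    (trans (VP.tabulate-cong (λ k → trans (sym (mat-at-end s k)) (trans (h _ _) (mat-at-end s′ k))))
           (VP.tabulate∘lookup s′))

  mat-enc : ∀ R → (∀ i j → R i j ≡ R j i) → (∀ i j → R i j ≡ true → Adj G i j) → ∀ i j → mat (enc R) i j ≡ R i j
  mat-enc R s sub i j = ⇔-≡ one two
    where
    at : ∀ k → V.lookup (enc R) k ≡ R (proj₁ (end k)) (proj₂ (end k))
    at k = lookup-enc R k
    one : mat (enc R) i j ≡ true → R i j ≡ true
    one e with mat⁻ {enc R} e
    ... | k , q , inj₁ p = trans (sym (trans (at k) (cong (λ (a , b) → R a b) p))) q
    ... | k , q , inj₂ p = trans (s i j) (trans (sym (trans (at k) (cong (λ (a , b) → R a b) p))) q)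
    two : R i j ≡ true → mat (enc R) i j ≡ true
    two r with <-cmp (toℕ i) (toℕ j)
    ... | tri< l _ _ with end-surjective i j l (sub i j r)
    ...   | k , p = mat⁺ {enc R} (k , trans (at k) (trans (cong (λ (a , b) → R a b) p) r) , inj₁ p)
    two r | tri≈ _ e _ with FP.toℕ-injective e
    ...   | refl = contradiction (trans (sym (sub i i r)) (irrefl G i)) true≢false
    two r | tri> _ _ l with end-surjective j i l (sub j i (trans (s j i) r))
    ...   | k , p = mat⁺ {enc R} (k , trans (at k) (trans (cong (λ (a , b) → R a b) p) (trans (s j i) r)) , inj₂ p)

deg-cong : ∀ {R R′ : Mat n} → (∀ i j → R i j ≡ R′ i j) → ∀ u → deg R u ≡ deg R′ u
deg-cong {n} h u = ∑-cong (allFin n) (λ j → cong ⟦_⟧ (h u j))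

Cut-cong : ∀ {R R′ : Mat n} → (∀ i j → R i j ≡ R′ i j) → ∀ {a b} → Cut R a b → Cut R′ a b
Cut-cong h c = record
  { side = side c ; far = far c ; near = near c ; mono = λ i j r → mono c i j (trans (h i j) r) }

Tree-cong : ∀ {R R′ : Mat n} → (∀ i j → R i j ≡ R′ i j) → Tree R → Tree R′
Tree-cong h t = record
  { R-sym = λ i j → trans (sym (h i j)) (trans (R-sym t i j) (h j i))
  ; R-irr = λ i → trans (sym (h i i)) (R-irr t i)
  ; conn = λ χ closed → conn t χ (λ i j r → closed i j (trans (sym (h i j)) r))
  ; cut = λ a b r → Cut-cong h (cut t a b (trans (h a b) r)) }

≤ᵇ-true : ∀ {m k} → (m ≤ᵇ k) ≡ true → m ≤ k
≤ᵇ-true {m} {k} e = ≤ᵇ⇒≤ m k (Equivalence.from T-≡ e)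

≤ᵇ-intro : ∀ {m k} → m ≤ k → (m ≤ᵇ k) ≡ true
≤ᵇ-intro p = Equivalence.to T-≡ (≤⇒≤ᵇ p)

≤ᵇ-false : ∀ {m k} → (m ≤ᵇ k) ≡ false → k < m
≤ᵇ-false {m} {k} e = ≰⇒> (λ p → true≢false (trans (sym (≤ᵇ-intro p)) e))

≡ᵇ-true : ∀ {m k} → (m ≡ᵇ k) ≡ true → m ≡ k
≡ᵇ-true {m} {k} e = ≡ᵇ⇒≡ m k (Equivalence.from T-≡ e)

≡ᵇ-intro : ∀ {m k} → m ≡ k → (m ≡ᵇ k) ≡ true
≡ᵇ-intro {m} refl = Equivalence.to T-≡ (≡⇒≡ᵇ m m refl)

≡ᵇ-false : ∀ {m k} → m ≢ k → (m ≡ᵇ k) ≡ false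
≡ᵇ-false {m} {k} h with m ≡ᵇ k in eq
... | false = refl
... | true = contradiction (≡ᵇ-true eq) h

-- Moves between spanning trees, weighted by degrees

module SpanningTrees {n : ℕ} (G : Graph n) (xs : List (EdgeSubset G)) (uxs : Unique xs)
  (tree : ∀ {s} → s ∈ xs → Tree (Matrices.mat G s))
  (complete : ∀ s → Tree (Matrices.mat G s) → s ∈ xs) where

  open Matrices G public

  gdeg : Fin n → ℕ
  gdeg x = ∑V (λ z → ⟦ adj G x z ⟧)

  module Move {s} (s∈ : s ∈ xs) {x v z : Fin n} (r : mat s v x ≡ true)
              (c : Cut (mat s) v x) (far-z : side c z ≡ true) (xz : Adj G x z) where
    open Exchange (tree s∈) r c far-z public

    s′ : X
    s′ = enc (exch (mat s) x v z)

    mat-s′ : ∀ i j → mat s′ i j ≡ R′ i j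
    mat-s′ = mat-enc R′ (R-sym exch-tree) sub
      where
      sub : ∀ i j → R′ i j ≡ true → Adj G i j
      sub i j q with R′⁻ q
      ... | inj₁ (e , _) = mat⊆adj s i j e
      ... | inj₂ (inj₁ (refl , refl)) = xz
      ... | inj₂ (inj₂ (refl , refl)) = trans (symm G z x) xz

    tree′ : Tree (mat s′)
    tree′ = Tree-cong (λ i j → sym (mat-s′ i j)) exch-tree

    s′∈ : s′ ∈ xs
    s′∈ = complete s′ tree′

    degree′ : ∀ u → deg (mat s′) u + ⟦ u == v ⟧ ≡ deg (mat s) u + ⟦ u == z ⟧
    degree′ u = trans (cong (_+ ⟦ u == v ⟧) (deg-cong mat-s′ u)) (exch-degree u)

    new-edge : mat s′ x z ≡ true
    new-edge = trans (mat-s′ x z) (R′-new (inj₁ (refl , refl)))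

    -- The reverse move exchanges the roles of `v` and `z`. Thus the new tree and the triple `x`,
    -- `z`, `v` determine the old tree, which is what makes the move maps injective.
    back : enc (exch (mat s′) x z v) ≡ s
    back = mat-injective _ s (λ i j → trans (mat-enc _ sy sub i j) (≗ i j))
      where
      xv : ∀ i j → SameEdge x v i j → mat s i j ≡ true
      xv i j (inj₁ (refl , refl)) = trans (mat-sym s x v) r
      xv i j (inj₂ (refl , refl)) = r
      not-xz : z ≢ v → ∀ i j → SameEdge x z i j → mat s i j ≡ false
      not-xz h i j (inj₁ (refl , refl)) = no-edge h
      not-xz h i j (inj₂ (refl , refl)) = trans (mat-sym s z x) (no-edge h)
      ≗ : ∀ i j → exch (mat s′) x z v i j ≡ mat s i j
      ≗ i j = trans (cong (λ b → (b ∧ not (edge x z i j)) ∨ edge x v i j) (mat-s′ i j))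
                    (exch-involutive (mat s) xv not-xz i j)
      sy : ∀ i j → exch (mat s′) x z v i j ≡ exch (mat s′) x z v j i
      sy i j = trans (≗ i j) (trans (mat-sym s i j) (sym (≗ j i)))
      sub : ∀ i j → exch (mat s′) x z v i j ≡ true → Adj G i j
      sub i j q = mat⊆adj s i j (trans (sym (≗ i j)) q)

  open import Data.List.Membership.DecPropositional (VP.≡-dec {A = Bool} {n = numEdges G} 𝔹._≟_) using (_∈?_) public

  abstract
    -- The value `false` outside `xs` extends `via` to all edge subsets, so that moves can be
    -- selected by Boolean tests that carry no proof of being a tree.
    via′ : X → (x v z : Fin n) → Bool
    via′ s x v z with s ∈? xs
    ... | yes s∈ = via (tree s∈) x v z
    ... | no _ = false

    via′-cut : ∀ {s} → s ∈ xs → ∀ {x v} (c : Cut (mat s) v x) → mat s v x ≡ true → ∀ z → via′ s x v z ≡ side c z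
    via′-cut {s} s∈ c r z with s ∈? xs
    ... | yes p = via-cut (tree p) c r z
    ... | no q = contradiction s∈ q

    via′⁻ : ∀ {s} → s ∈ xs → ∀ x v z → via′ s x v z ≡ true →
      Σ (mat s v x ≡ true) λ r → Σ (Cut (mat s) v x) λ c → side c z ≡ true
    via′⁻ {s} s∈ x v z e with s ∈? xs
    ... | yes p = let (r , q) = via⁻ (tree p) x v z e in r , cut (tree p) v x r , q

    via′-unique : ∀ {s} → ∀ x z z′ v → via′ s x z v ≡ true → via′ s x z′ v ≡ true → z ≡ z′
    via′-unique {s} x z z′ v e e′ with s ∈? xs
    ... | yes p = via-unique (tree p) x z z′ v e e′

    via′-exists : ∀ {s} → s ∈ xs → ∀ x z → z ≢ x → Σ (Fin n) λ v → via′ s x v z ≡ true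
    via′-exists {s} s∈ x z h with s ∈? xs
    ... | yes p = via-exists (tree p) x z h
    ... | no q = contradiction s∈ q

  -- c x = W / deg x makes the choice of a random neighbour of a random vertex
  -- an integer-weighted count.
  module Weights (W : ℕ) (W>0 : 1 ≤ W) (c : Fin n → ℕ) (c-deg : ∀ x → c x * gdeg x ≡ W) where

    -- If every vertex picks a uniformly random neighbour, `h v / W` is the expected number of
    -- vertices that pick `v`. It is the weight of the backward moves available at a leaf `v`.
    h : Fin n → ℕ
    h v = ∑V (λ x → c x * ⟦ adj G x v ⟧)

    ∑c-adj : ∀ x → ∑V (λ z → c x * ⟦ adj G x z ⟧) ≡ W
    ∑c-adj x = trans (∑-*ˡ (allFin n) (c x) (λ z → ⟦ adj G x z ⟧)) (c-deg x)

    ∑h : ∑V h ≡ n * W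
    ∑h = trans (∑-swap (allFin n) (allFin n) (λ v x → c x * ⟦ adj G x v ⟧))
               (trans (∑-cong (allFin n) ∑c-adj) (∑V-const n W))

    -- The mean of `h` is `W`, but single values can be huge, and such vertices would spoil the
    -- bound on backward moves. With the threshold 24 Markov's inequality leaves at most n/24
    -- exceptions, just what `fwd-bound` can afford.
    good : Fin n → Bool
    good v = h v ≤ᵇ 24 * W

    bads : ℕ
    bads = ∑V (λ v → ⟦ not (good v) ⟧)

    24bads≤n : 24 * bads ≤ n
    24bads≤n = *-cancelʳ-≤ _ _ W {{>-nonZero W>0}} (begin
      24 * bads * W                              ≡⟨ rot 24 bads W ⟩
      bads * (24 * W)                            ≡⟨ sym (∑-*ʳ (allFin n) (24 * W) (λ v → ⟦ not (good v) ⟧)) ⟩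
      ∑V (λ v → ⟦ not (good v) ⟧ * (24 * W))     ≤⟨ ∑-mono (allFin n) bound ⟩
      ∑V h                                       ≡⟨ ∑h ⟩
      n * W                                      ∎)
      where
      open ≤-Reasoning
      rot : ∀ a b c → a * b * c ≡ b * (a * c)
      rot = solve-∀
      bound : ∀ v → ⟦ not (good v) ⟧ * (24 * W) ≤ h v
      bound v with good v in eq
      ... | true = z≤n
      ... | false = ≤-trans (≤-reflexive (*-identityˡ _)) (<⇒≤ (≤ᵇ-false eq))

    leaf : X → Fin n → Bool
    leaf s v = deg (mat s) v ≡ᵇ 1

    gl : X → Fin n → Bool
    gl s v = good v ∧ leaf s v

    goodLeaves : X → ℕ
    goodLeaves s = ∑V (λ v → ⟦ gl s v ⟧)

    gl-weight : ∀ s → ∑V (λ v → ⟦ gl s v ⟧ * h v) ≤ goodLeaves s * (24 * W)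
    gl-weight s = ≤-trans (∑-mono (allFin n) bound) (≤-reflexive (∑-*ʳ (allFin n) (24 * W) (λ v → ⟦ gl s v ⟧)))
      where
      bound : ∀ v → ⟦ gl s v ⟧ * h v ≤ ⟦ gl s v ⟧ * (24 * W)
      bound v with good v in eq
      ... | true = *-monoʳ-≤ ⟦ leaf s v ⟧ (≤ᵇ-true eq)
      ... | false = z≤n

    -- The conditions on `v` make it a new good leaf, and excluding good leaves as `z` ensures that
    -- none is lost, so a move raises `goodLeaves` by exactly one.
    valid : X → (x z v : Fin n) → Bool
    valid s x z v = adj G x z ∧ (via′ s x v z ∧ (not (z == v) ∧ (good v ∧ ((deg (mat s) v ≡ᵇ 2) ∧ not (gl s z)))))

    valid′ : X → (x z v : Fin n) → Bool
    valid′ s x z v = adj G x v ∧ (gl s v ∧ via′ s x z v)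

    fwd bwd : X → ℕ
    fwd s = ∑V (λ x → ∑V (λ z → ∑V (λ v → c x * ⟦ valid s x z v ⟧)))
    bwd s = ∑V (λ x → ∑V (λ z → ∑V (λ v → c x * ⟦ valid′ s x z v ⟧)))

    -- Given `x` and the leaf `v`, the vertex `z` is the first step from `x` towards `v`, hence
    -- unique; what remains at `v` is the weight `h v`.
    bwd-bound : ∀ s → bwd s ≤ goodLeaves s * (24 * W)
    bwd-bound s = begin
      bwd s
        ≡⟨ ∑-cong V (λ x → ∑-swap V V (λ z v → c x * ⟦ valid′ s x z v ⟧)) ⟩
      ∑ V (λ x → ∑ V (λ v → ∑ V (λ z → c x * ⟦ valid′ s x z v ⟧)))
        ≤⟨ ∑-mono V (λ x → ∑-mono V (λ v → inner x v)) ⟩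
      ∑ V (λ x → ∑ V (λ v → ⟦ gl s v ⟧ * (c x * ⟦ adj G x v ⟧)))
        ≡⟨ ∑-swap V V (λ x v → ⟦ gl s v ⟧ * (c x * ⟦ adj G x v ⟧)) ⟩
      ∑ V (λ v → ∑ V (λ x → ⟦ gl s v ⟧ * (c x * ⟦ adj G x v ⟧)))
        ≡⟨ ∑-cong V (λ v → ∑-*ˡ V ⟦ gl s v ⟧ (λ x → c x * ⟦ adj G x v ⟧)) ⟩
      ∑ V (λ v → ⟦ gl s v ⟧ * h v)
        ≤⟨ gl-weight s ⟩
      goodLeaves s * (24 * W) ∎
      where
      open ≤-Reasoning
      V = allFin n
      rearrange : ∀ a b c d → a * (b * (c * d)) ≡ (c * (a * b)) * d
      rearrange = solve-∀
      inner : ∀ x v → ∑ V (λ z → c x * ⟦ valid′ s x z v ⟧) ≤ ⟦ gl s v ⟧ * (c x * ⟦ adj G x v ⟧)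
      inner x v = begin
        ∑ V (λ z → c x * ⟦ valid′ s x z v ⟧)
          ≡⟨ ∑-cong V (λ z → trans (cong (c x *_) (trans (⟦⟧-∧ (adj G x v) _) (cong (⟦ adj G x v ⟧ *_) (⟦⟧-∧ (gl s v) _))))
                                   (rearrange (c x) ⟦ adj G x v ⟧ ⟦ gl s v ⟧ ⟦ via′ s x z v ⟧)) ⟩
        ∑ V (λ z → (⟦ gl s v ⟧ * (c x * ⟦ adj G x v ⟧)) * ⟦ via′ s x z v ⟧)
          ≡⟨ ∑-*ˡ V (⟦ gl s v ⟧ * (c x * ⟦ adj G x v ⟧)) (λ z → ⟦ via′ s x z v ⟧) ⟩
        (⟦ gl s v ⟧ * (c x * ⟦ adj G x v ⟧)) * ∑ V (λ z → ⟦ via′ s x z v ⟧)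
          ≤⟨ *-monoʳ-≤ (⟦ gl s v ⟧ * (c x * ⟦ adj G x v ⟧)) (∑V-≤1 (λ z → via′ s x z v) (λ z z′ → via′-unique {s} x z z′ v)) ⟩
        (⟦ gl s v ⟧ * (c x * ⟦ adj G x v ⟧)) * 1
          ≡⟨ *-identityʳ _ ⟩
        ⟦ gl s v ⟧ * (c x * ⟦ adj G x v ⟧) ∎

    -- The move with the fixed triple `x`, `z`, `v` is an injection from one level of `goodLeaves`
    -- to the next, by `back`.
    move-count : ∀ j x z v →
      ∑ xs (λ s → ⟦ goodLeaves s ≡ᵇ j ⟧ * ⟦ valid s x z v ⟧) ≤
      ∑ xs (λ s → ⟦ goodLeaves s ≡ᵇ suc j ⟧ * ⟦ valid′ s x z v ⟧)
    move-count j x z v = ∑-inj φ uxs into injective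
      where
      φ : X → X
      φ s = enc (exch (mat s) x v z)
      split : ∀ {s} → 0 < ⟦ goodLeaves s ≡ᵇ j ⟧ * ⟦ valid s x z v ⟧ → goodLeaves s ≡ j × valid s x z v ≡ true
      split {s} p with goodLeaves s ≡ᵇ j in eq
      ... | true = ≡ᵇ-true eq , ⟦⟧-pos (subst (0 <_) (*-identityˡ _) p)
      module Valid {s} (s∈ : s ∈ xs) (e : valid s x z v ≡ true) where
        xz = proj₁ (∧-true {adj G x z} e)
        e₂ = proj₂ (∧-true {adj G x z} e)
        vd = via′⁻ s∈ x v z (proj₁ (∧-true {via′ s x v z} e₂))
        e₃ = proj₂ (∧-true {via′ s x v z} e₂)
        e₄ = proj₂ (∧-true {not (z == v)} e₃)
        e₅ = proj₂ (∧-true {good v} e₄)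
        good-v = proj₁ (∧-true {good v} e₄)
        deg-v : deg (mat s) v ≡ 2
        deg-v = ≡ᵇ-true (proj₁ (∧-true {deg (mat s) v ≡ᵇ 2} e₅))
        open Move s∈ (proj₁ vd) (proj₁ (proj₂ vd)) (proj₂ (proj₂ vd)) xz public
        z≢v : z ≢ v
        z≢v refl = true≢false (trans (sym (proj₁ (∧-true {not (z == v)} e₃))) (cong not (==-refl z)))
        gl-z : gl s z ≡ false
        gl-z with gl s z | proj₂ (∧-true {deg (mat s) v ≡ᵇ 2} e₅)
        ... | false | _ = refl
        deg′-v : deg (mat s′) v ≡ 1
        deg′-v = +-cancelʳ-≡ 1 _ _ (trans (subst (λ b → deg (mat s′) v + ⟦ b ⟧ ≡ deg (mat s) v + ⟦ v == z ⟧) (==-refl v) (degree′ v))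
                   (trans (cong (λ b → deg (mat s) v + ⟦ b ⟧) (==-neq (z≢v ∘ sym))) (trans (+-identityʳ _) deg-v)))
        gl′-v : gl s′ v ≡ true
        gl′-v = ∧-intro good-v (≡ᵇ-intro deg′-v)
        gl-v : gl s v ≡ false
        gl-v rewrite deg-v = ∧-zeroʳ (good v)
        deg-same : ∀ u → u ≢ v → u ≢ z → deg (mat s′) u ≡ deg (mat s) u
        deg-same u u≢v u≢z with degree′ u
        ... | q rewrite ==-neq u≢v | ==-neq u≢z = +-cancelʳ-≡ 0 _ _ q
        deg′-z : deg (mat s′) z ≡ deg (mat s) z + 1
        deg′-z with degree′ z
        ... | q rewrite ==-neq z≢v | ==-refl z = trans (sym (+-identityʳ _)) q
        gl′-z : gl s′ z ≡ false
        gl′-z rewrite ≡ᵇ-false {deg (mat s′) z} {1} (λ q → 1+n≰n (≤-trans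
                  (+-monoˡ-≤ 1 (degree-positive (tree s∈) x≢z)) (≤-reflexive (trans (sym deg′-z) q)))) = ∧-zeroʳ (good z)
        gl-step : ∀ u → ⟦ gl s′ u ⟧ ≡ ⟦ gl s u ⟧ + ⟦ v == u ⟧
        gl-step u with u F.≟ v
        ... | yes refl rewrite gl′-v | gl-v | ==-refl u = refl
        ... | no u≢v rewrite ==-neq (u≢v ∘ sym) with u F.≟ z
        ...   | yes refl rewrite gl′-z | gl-z = refl
        ...   | no u≢z rewrite deg-same u u≢v u≢z = sym (+-identityʳ _)
        goodLeaves′ : goodLeaves s′ ≡ suc (goodLeaves s)
        goodLeaves′ = trans (∑-cong (allFin n) gl-step) (trans (∑-+ (allFin n) (λ u → ⟦ gl s u ⟧) (λ u → ⟦ v == u ⟧))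
          (trans (cong (goodLeaves s +_) (∑V-single₁ v)) (+-comm _ 1)))
        valid-s′ : valid′ s′ x z v ≡ true
        valid-s′ = ∧-intro (mat⊆adj s x v (trans (mat-sym s x v) (proj₁ vd)))
          (∧-intro gl′-v (trans (via′-cut s′∈ (Cut-cong (λ i j → sym (mat-s′ i j)) new-cut) (trans (mat-sym s′ z x) new-edge) v)
                                (far (proj₁ (proj₂ vd)))))
      into : ∀ s → s ∈ xs → 0 < ⟦ goodLeaves s ≡ᵇ j ⟧ * ⟦ valid s x z v ⟧ →
        φ s ∈ xs × ⟦ goodLeaves s ≡ᵇ j ⟧ * ⟦ valid s x z v ⟧ ≤ ⟦ goodLeaves (φ s) ≡ᵇ suc j ⟧ * ⟦ valid′ (φ s) x z v ⟧
      into s s∈ p with split {s} p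
      ... | q , e = s′∈ , ≤-trans (*-mono-≤ (⟦⟧≤1 (goodLeaves s ≡ᵇ j)) (⟦⟧≤1 (valid s x z v)))
              (≤-reflexive (sym (cong₂ _*_ (⟦⟧-true {goodLeaves s′ ≡ᵇ suc j} (≡ᵇ-intro (trans goodLeaves′ (cong suc q)))) (⟦⟧-true valid-s′))))
        where open Valid s∈ e
      injective : ∀ s t → s ∈ xs → t ∈ xs → 0 < ⟦ goodLeaves s ≡ᵇ j ⟧ * ⟦ valid s x z v ⟧ →
        0 < ⟦ goodLeaves t ≡ᵇ j ⟧ * ⟦ valid t x z v ⟧ → φ s ≡ φ t → s ≡ t
      injective s t s∈ t∈ p q e = trans (sym (Valid.back s∈ (proj₂ (split {s} p))))
        (trans (cong (λ u → enc (exch (mat u) x z v)) e) (Valid.back t∈ (proj₂ (split {t} q))))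

-- Trees with few leaves

∑³-exchange : ∀ (ys : List A) (b : A → ℕ) (c : Fin n → ℕ) (e : A → (x z v : Fin n) → ℕ) →
  ∑ ys (λ s → b s * ∑V (λ x → ∑V (λ z → ∑V (λ v → c x * e s x z v)))) ≡
  ∑V (λ x → ∑V (λ z → ∑V (λ v → c x * ∑ ys (λ s → b s * e s x z v))))
∑³-exchange {n = n} ys b c e = begin
  ∑ ys (λ s → b s * ∑ V (λ x → ∑ V (λ z → ∑ V (λ v → c x * e s x z v))))
    ≡⟨ ∑-cong ys (λ s → trans (sym (∑-*ˡ V (b s) _)) (∑-cong V (λ x →
         trans (sym (∑-*ˡ V (b s) _)) (∑-cong V (λ z →
         trans (sym (∑-*ˡ V (b s) _)) (∑-cong V (λ v → rot (b s) (c x) (e s x z v)))))))) ⟩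
  ∑ ys (λ s → ∑ V (λ x → ∑ V (λ z → ∑ V (λ v → c x * (b s * e s x z v)))))
    ≡⟨ ∑-swap ys V (λ s x → ∑ V (λ z → ∑ V (λ v → c x * (b s * e s x z v)))) ⟩
  ∑ V (λ x → ∑ ys (λ s → ∑ V (λ z → ∑ V (λ v → c x * (b s * e s x z v)))))
    ≡⟨ ∑-cong V (λ x → trans (∑-swap ys V (λ s z → ∑ V (λ v → c x * (b s * e s x z v)))) (∑-cong V (λ z →
         trans (∑-swap ys V (λ s v → c x * (b s * e s x z v))) (∑-cong V (λ v →
         ∑-*ˡ ys (c x) (λ s → b s * e s x z v)))))) ⟩
  ∑ V (λ x → ∑ V (λ z → ∑ V (λ v → c x * ∑ ys (λ s → b s * e s x z v)))) ∎
  where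
  open ≡-Reasoning
  V = allFin n
  rot : ∀ a b c → a * (b * c) ≡ b * (a * c)
  rot = solve-∀

module FewLeaves {n : ℕ} (G : Graph n) (xs : List (EdgeSubset G)) (uxs : Unique xs)
  (tree : ∀ {s} → s ∈ xs → Tree (Matrices.mat G s))
  (complete : ∀ s → Tree (Matrices.mat G s) → s ∈ xs)
  (W : ℕ) (W>0 : 1 ≤ W) (c : Fin n → ℕ)
  (c-deg : ∀ x → c x * SpanningTrees.gdeg G xs uxs tree complete x ≡ W)
  (d : ℕ) (16≤d : 16 ≤ d) (min : ∀ x → d ≤ SpanningTrees.gdeg G xs uxs tree complete x)
  (u₀ u₁ : Fin n) (u₀≢u₁ : u₀ ≢ u₁) where

  open SpanningTrees G xs uxs tree complete
  open Weights W W>0 c c-deg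

  module _ {s} (s∈ : s ∈ xs) where

    deg-pos : ∀ v → 1 ≤ deg (mat s) v
    deg-pos v with u₀ F.≟ v
    ... | no q = degree-positive (tree s∈) q
    ... | yes refl = degree-positive (tree s∈) (u₀≢u₁ ∘ sym)

    -- Marks the vertices that do not become good leaves when one of their edges is removed.
    odd : Fin n → Bool
    odd v = not (good v ∧ (deg (mat s) v ≡ᵇ 2))

    oddNbrs : Fin n → ℕ
    oddNbrs x = ∑V (λ v → ⟦ mat s x v ⟧ * ⟦ odd v ⟧)

    oddDegree : ℕ
    oddDegree = ∑V (λ v → ⟦ odd v ⟧ * deg (mat s) v)

    -- Since degrees sum to at most 2n, the sum of 3(deg - 2) is at most 0. This quantity pays for
    -- good vertices of degree at least 3; a good leaf needs 4 in addition, and 6 is enough for a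
    -- bad vertex.
    oddDegree-bound : oddDegree ≤ 4 * goodLeaves s + 6 * bads
    oddDegree-bound = +-cancelʳ-≤ (6 * n) _ _ (begin
      oddDegree + 6 * n
        ≡⟨ cong (oddDegree +_) (trans (*-comm 6 n) (sym (∑V-const n 6))) ⟩
      oddDegree + ∑ V (λ _ → 6)
        ≡⟨ sym (∑-+ V (λ v → ⟦ odd v ⟧ * D v) (λ _ → 6)) ⟩
      ∑ V (λ v → ⟦ odd v ⟧ * D v + 6)
        ≤⟨ ∑-mono V local ⟩
      ∑ V (λ v → 3 * D v + (4 * ⟦ gl s v ⟧ + 6 * ⟦ not (good v) ⟧))
        ≡⟨ trans (∑-+ V (λ v → 3 * D v) (λ v → 4 * ⟦ gl s v ⟧ + 6 * ⟦ not (good v) ⟧))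
             (cong₂ _+_ (∑-*ˡ V 3 D) (trans (∑-+ V (λ v → 4 * ⟦ gl s v ⟧) (λ v → 6 * ⟦ not (good v) ⟧))
               (cong₂ _+_ (∑-*ˡ V 4 (λ v → ⟦ gl s v ⟧)) (∑-*ˡ V 6 (λ v → ⟦ not (good v) ⟧))))) ⟩
      3 * ∑ V D + (4 * goodLeaves s + 6 * bads)
        ≤⟨ +-monoˡ-≤ _ (*-monoʳ-≤ 3 (∑degree≤2n (tree s∈) u₀)) ⟩
      3 * (2 * n) + (4 * goodLeaves s + 6 * bads)
        ≡⟨ fin n (4 * goodLeaves s + 6 * bads) ⟩
      4 * goodLeaves s + 6 * bads + 6 * n ∎)
      where
      open ≤-Reasoning
      V = allFin n
      D = deg (mat s)
      fin : ∀ n k → 3 * (2 * n) + k ≡ k + 6 * n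
      fin = solve-∀
      table : ∀ g k → 1 ≤ k →
        ⟦ not (g ∧ (k ≡ᵇ 2)) ⟧ * k + 6 ≤ 3 * k + (4 * ⟦ g ∧ (k ≡ᵇ 1) ⟧ + 6 * ⟦ not g ⟧)
      table true 1 _ = ≤-refl
      table true 2 _ = ≤-refl
      table true (suc (suc (suc k))) _ = subst₂ _≤_ (sym (e₁ k)) (sym (e₂ k)) (m≤m+n (k + 9) (k + k))
        where
        e₁ : ∀ k → 1 * (3 + k) + 6 ≡ k + 9
        e₁ = solve-∀
        e₂ : ∀ k → 3 * (3 + k) + 0 ≡ k + 9 + (k + k)
        e₂ = solve-∀
      table false k _ = subst₂ _≤_ (sym (e₁ k)) (sym (e₂ k)) (m≤m+n (k + 6) (k + k))
        where
        e₁ : ∀ k → 1 * k + 6 ≡ k + 6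
        e₁ = solve-∀
        e₂ : ∀ k → 3 * k + 6 ≡ k + 6 + (k + k)
        e₂ = solve-∀
      local : ∀ v → ⟦ odd v ⟧ * D v + 6 ≤ 3 * D v + (4 * ⟦ gl s v ⟧ + 6 * ⟦ not (good v) ⟧)
      local v = table (good v) (D v) (deg-pos v)

    cdeg : ℕ
    cdeg = ∑V (λ x → c x * deg (mat s) x)

    -- A random neighbour of `x` is a tree neighbour with probability at most the tree degree over
    -- `d`. Tree degrees average at most 2, so `16 ≤ d` leaves one eighth.
    cdeg-bound : 8 * cdeg ≤ n * W
    cdeg-bound = *-cancelˡ-≤ 2 (begin
      2 * (8 * cdeg)            ≡⟨ sym (*-assoc 2 8 cdeg) ⟩
      16 * cdeg                 ≤⟨ *-monoˡ-≤ cdeg 16≤d ⟩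
      d * cdeg                  ≡⟨ sym (∑-*ˡ V d _) ⟩
      ∑ V (λ x → d * (c x * deg (mat s) x))
                             ≤⟨ ∑-mono V (λ x → ≤-trans (≤-reflexive (rot d (c x) _))
                                  (*-monoˡ-≤ (deg (mat s) x) (≤-trans (*-monoʳ-≤ (c x) (min x)) (≤-reflexive (c-deg x))))) ⟩
      ∑ V (λ x → W * deg (mat s) x) ≡⟨ ∑-*ˡ V W _ ⟩
      W * ∑ V (deg (mat s))  ≤⟨ *-monoʳ-≤ W (∑degree≤2n (tree s∈) u₀) ⟩
      W * (2 * n)            ≡⟨ fin W n ⟩
      2 * (n * W)            ∎)
      where
      open ≤-Reasoning
      V = allFin n
      rot : ∀ a b c → a * (b * c) ≡ b * a * c
      rot = solve-∀
      fin : ∀ w n → w * (2 * n) ≡ 2 * (n * w)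
      fin = solve-∀

    -- The last three alternatives are the ways a random pair `x`, `z` can fail to give a move. The
    -- requirement on the path vertex `v` is weakened to some unsuitable tree neighbour of `x`,
    -- which no longer depends on `z` and can therefore be summed.
    Covered : Fin n → Fin n → Set
    Covered x z = (Σ (Fin n) λ v → valid s x z v ≡ true) ⊎ (mat s x z ≡ true) ⊎ (gl s z ≡ true) ⊎ (1 ≤ oddNbrs x)

    cover : ∀ x z → Adj G x z → Covered x z
    cover x z xz = cases (z F.≟ v) (≡true-or-false (gl s z)) (≡true-or-false (good v ∧ (deg (mat s) v ≡ᵇ 2)))
      where
      step₁ = via′-exists s∈ x z (λ z≡x → true≢false (trans (sym xz) (trans (cong (adj G x) z≡x) (irrefl G x))))
      v = proj₁ step₁
      r : mat s x v ≡ true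
      r = trans (mat-sym s x v) (proj₁ (via′⁻ s∈ x v z (proj₂ step₁)))
      cases : Dec (z ≡ v) → gl s z ≡ true ⊎ gl s z ≡ false →
        good v ∧ (deg (mat s) v ≡ᵇ 2) ≡ true ⊎ good v ∧ (deg (mat s) v ≡ᵇ 2) ≡ false → Covered x z
      cases (yes z≡v) _ _ = inj₂ (inj₁ (trans (cong (mat s x) z≡v) r))
      cases (no _) (inj₁ g) _ = inj₂ (inj₂ (inj₁ g))
      cases (no _) (inj₂ _) (inj₂ o) = inj₂ (inj₂ (inj₂ (≤-trans
        (≤-reflexive (sym (cong₂ _*_ (⟦⟧-true r) (⟦⟧-true (cong not o)))))
        (∑-term (λ v → ⟦ mat s x v ⟧ * ⟦ odd v ⟧) (∈-allFin v)))))
      cases (no z≢v) (inj₂ g) (inj₁ o) = inj₁ (v , ∧-intro xz (∧-intro (proj₂ step₁) (∧-intro (cong not (==-neq z≢v))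
        (∧-intro (proj₁ (∧-true {good v} o)) (∧-intro (proj₂ (∧-true {good v} o)) (cong not g))))))

    local-forward : ∀ x z → c x * ⟦ adj G x z ⟧ ≤
      (∑V (λ v → c x * ⟦ valid s x z v ⟧) + c x * ⟦ mat s x z ⟧) +
      (⟦ gl s z ⟧ * (c x * ⟦ adj G x z ⟧) + c x * ⟦ adj G x z ⟧ * oddNbrs x)
    local-forward x z = [ (λ e → adjacent e (cover x z e))
                        , (λ e → ≤-trans (≤-reflexive (trans (cong (λ b → c x * ⟦ b ⟧) e) (*-zeroʳ (c x)))) z≤n) ]′
                        (≡true-or-false (adj G x z))
      where
      adjacent : adj G x z ≡ true → Covered x z → c x * ⟦ adj G x z ⟧ ≤
        (∑V (λ v → c x * ⟦ valid s x z v ⟧) + c x * ⟦ mat s x z ⟧) +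
        (⟦ gl s z ⟧ * (c x * ⟦ adj G x z ⟧) + c x * ⟦ adj G x z ⟧ * oddNbrs x)
      adjacent e (inj₁ (v , val)) = ≤-trans (*-monoʳ-≤ (c x) (≤-trans (⟦⟧≤1 (adj G x z)) (≤-reflexive (sym (⟦⟧-true val)))))
        (≤-trans (∑-term (λ v → c x * ⟦ valid s x z v ⟧) (∈-allFin v)) (≤-trans (m≤m+n _ _) (m≤m+n _ _)))
      adjacent e (inj₂ (inj₁ r)) = ≤-trans (*-monoʳ-≤ (c x) (≤-trans (⟦⟧≤1 (adj G x z)) (≤-reflexive (sym (⟦⟧-true r)))))
        (≤-trans (m≤n+m _ (∑V (λ v → c x * ⟦ valid s x z v ⟧))) (m≤m+n _ _))
      adjacent e (inj₂ (inj₂ (inj₁ g))) = ≤-trans (≤-reflexive (trans (sym (*-identityˡ _)) (cong (_* (c x * ⟦ adj G x z ⟧)) (sym (⟦⟧-true g)))))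
        (≤-trans (m≤m+n _ (c x * ⟦ adj G x z ⟧ * oddNbrs x)) (m≤n+m _ (∑V (λ v → c x * ⟦ valid s x z v ⟧) + c x * ⟦ mat s x z ⟧)))
      adjacent e (inj₂ (inj₂ (inj₂ o))) = ≤-trans (≤-trans (≤-reflexive (sym (*-identityʳ _))) (*-monoʳ-≤ (c x * ⟦ adj G x z ⟧) o))
        (≤-trans (m≤n+m _ (⟦ gl s z ⟧ * (c x * ⟦ adj G x z ⟧))) (m≤n+m _ (∑V (λ v → c x * ⟦ valid s x z v ⟧) + c x * ⟦ mat s x z ⟧)))

    forward-sum : n * W ≤ (fwd s + cdeg) + (goodLeaves s * (24 * W) + W * oddDegree)
    forward-sum = begin
      n * W
        ≡⟨ sym (trans (∑-cong V ∑c-adj) (∑V-const n W)) ⟩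
      ∑ V (λ x → ∑ V (λ z → c x * ⟦ adj G x z ⟧))
        ≤⟨ ∑-mono V (λ x → ∑-mono V (λ z → local-forward x z)) ⟩
      ∑ V (λ x → ∑ V (λ z → (T₁ x z + T₂ x z) + (T₃ x z + T₄ x z)))
        ≡⟨ ∑-cong V (λ x → trans (∑-+ V (λ z → T₁ x z + T₂ x z) (λ z → T₃ x z + T₄ x z))
             (cong₂ _+_ (∑-+ V (T₁ x) (T₂ x)) (∑-+ V (T₃ x) (T₄ x)))) ⟩
      ∑ V (λ x → (∑ V (T₁ x) + ∑ V (T₂ x)) + (∑ V (T₃ x) + ∑ V (T₄ x)))
        ≡⟨ trans (∑-+ V (λ x → ∑ V (T₁ x) + ∑ V (T₂ x)) (λ x → ∑ V (T₃ x) + ∑ V (T₄ x)))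
             (cong₂ _+_ (∑-+ V (λ x → ∑ V (T₁ x)) (λ x → ∑ V (T₂ x))) (∑-+ V (λ x → ∑ V (T₃ x)) (λ x → ∑ V (T₄ x)))) ⟩
      (fwd s + ∑ V (λ x → ∑ V (T₂ x))) + (∑ V (λ x → ∑ V (T₃ x)) + ∑ V (λ x → ∑ V (T₄ x)))
        ≡⟨ cong₂ (λ a b → (fwd s + a) + (∑ V (λ x → ∑ V (T₃ x)) + b))
             (∑-cong V (λ x → ∑-*ˡ V (c x) (λ z → ⟦ mat s x z ⟧))) sum₄ ⟩
      (fwd s + cdeg) + (∑ V (λ x → ∑ V (T₃ x)) + W * oddDegree)
        ≤⟨ +-monoʳ-≤ (fwd s + cdeg) (+-monoˡ-≤ (W * oddDegree) sum₃) ⟩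
      (fwd s + cdeg) + (goodLeaves s * (24 * W) + W * oddDegree) ∎
      where
      open ≤-Reasoning
      V = allFin n
      T₁ T₂ T₃ T₄ : Fin n → Fin n → ℕ
      T₁ x z = ∑ V (λ v → c x * ⟦ valid s x z v ⟧)
      T₂ x z = c x * ⟦ mat s x z ⟧
      T₃ x z = ⟦ gl s z ⟧ * (c x * ⟦ adj G x z ⟧)
      T₄ x z = c x * ⟦ adj G x z ⟧ * oddNbrs x
      sum₃ : ∑ V (λ x → ∑ V (T₃ x)) ≤ goodLeaves s * (24 * W)
      sum₃ = ≤-trans (≤-reflexive (trans (∑-swap V V T₃) (∑-cong V (λ z → ∑-*ˡ V ⟦ gl s z ⟧ (λ x → c x * ⟦ adj G x z ⟧)))))
                     (gl-weight s)
      sum₄ : ∑ V (λ x → ∑ V (T₄ x)) ≡ W * oddDegree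
      sum₄ = trans (∑-cong V (λ x → trans (∑-*ʳ V (oddNbrs x) (λ z → c x * ⟦ adj G x z ⟧)) (cong (_* oddNbrs x) (∑c-adj x))))
             (trans (∑-*ˡ V W oddNbrs)
             (cong (W *_) (trans (∑-swap V V (λ x v → ⟦ mat s x v ⟧ * ⟦ odd v ⟧))
               (∑-cong V (λ v → trans (∑-cong V (λ x → trans (*-comm ⟦ mat s x v ⟧ _) (cong (λ b → ⟦ odd v ⟧ * ⟦ b ⟧) (mat-sym s x v))))
                                      (∑-*ˡ V ⟦ odd v ⟧ (λ x → ⟦ mat s v x ⟧)))))))

    -- Failures use up at most half of the weight `n * W`: an eighth for tree edges, an eighth for
    -- good leaves and a quarter for bad vertices. After multiplication by 8, good leaves enter with
    -- 8 · 24 from `gl-weight` and 8 · 4 from `oddDegree-bound`, whence 224.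
    fwd-bound : ∀ j → goodLeaves s ≡ j → 224 * suc j ≤ n → n * W ≤ 2 * fwd s
    fwd-bound j refl p = *-cancelˡ-≤ 4 (+-cancelʳ-≤ (4 * (n * W)) _ _ (begin
      4 * (n * W) + 4 * (n * W)
        ≡⟨ sym (*-distribʳ-+ (n * W) 4 4) ⟩
      8 * (n * W)
        ≤⟨ *-monoʳ-≤ 8 forward-sum ⟩
      8 * ((fwd s + cdeg) + (j * (24 * W) + W * oddDegree))
        ≡⟨ e₁ (fwd s) cdeg j W oddDegree ⟩
      8 * fwd s + (8 * cdeg + (192 * j * W + 8 * oddDegree * W))
        ≤⟨ +-monoʳ-≤ (8 * fwd s) (+-mono-≤ cdeg-bound (+-monoʳ-≤ (192 * j * W) (*-monoˡ-≤ W (*-monoʳ-≤ 8 oddDegree-bound)))) ⟩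
      8 * fwd s + (n * W + (192 * j * W + 8 * (4 * j + 6 * bads) * W))
        ≡⟨ e₂ (fwd s) n W j bads ⟩
      8 * fwd s + (n * W + (224 * j * W + 2 * (24 * bads) * W))
        ≤⟨ +-monoʳ-≤ (8 * fwd s) (+-monoʳ-≤ (n * W) (+-mono-≤
             (*-monoˡ-≤ W (≤-trans (*-monoʳ-≤ 224 (n≤1+n j)) p)) (*-monoˡ-≤ W (*-monoʳ-≤ 2 24bads≤n)))) ⟩
      8 * fwd s + (n * W + (n * W + 2 * n * W))
        ≡⟨ e₃ (fwd s) n W ⟩
      4 * (2 * fwd s) + 4 * (n * W) ∎))
      where
      open ≤-Reasoning
      e₁ : ∀ f e j w o → 8 * ((f + e) + (j * (24 * w) + w * o)) ≡ 8 * f + (8 * e + (192 * j * w + 8 * o * w))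
      e₁ = solve-∀
      e₂ : ∀ f n w j b → 8 * f + (n * w + (192 * j * w + 8 * (4 * j + 6 * b) * w)) ≡
                         8 * f + (n * w + (224 * j * w + 2 * (24 * b) * w))
      e₂ = solve-∀
      e₃ : ∀ f n w → 8 * f + (n * w + (n * w + 2 * n * w)) ≡ 4 * (2 * f) + 4 * (n * w)
      e₃ = solve-∀

  F# : ℕ → ℕ
  F# j = ∑ xs (λ s → ⟦ goodLeaves s ≡ᵇ j ⟧)

  on-level : ∀ {f g : X → ℕ} j → (∀ {s} → s ∈ xs → goodLeaves s ≡ j → f s ≤ g s) →
    ∑ xs (λ s → ⟦ goodLeaves s ≡ᵇ j ⟧ * f s) ≤ ∑ xs (λ s → ⟦ goodLeaves s ≡ᵇ j ⟧ * g s)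
  on-level {f} {g} j le = ∑-mono∈ xs local
    where
    local : ∀ s → s ∈ xs → ⟦ goodLeaves s ≡ᵇ j ⟧ * f s ≤ ⟦ goodLeaves s ≡ᵇ j ⟧ * g s
    local s s∈ with goodLeaves s ≡ᵇ j in eq
    ... | true = *-monoʳ-≤ 1 (le s∈ (≡ᵇ-true eq))
    ... | false = z≤n

  -- Each tree on level `j` sends out weight at least `n * W / 2`, each tree on the next level
  -- receives at most `24 * suc j * W`. Doubling needs only 96 in place of 224.
  step : ∀ j → 224 * suc j ≤ n → 2 * F# j ≤ F# (suc j)
  step j p = *-cancelˡ-≤ (48 * suc j) (*-cancelʳ-≤ _ _ W {{>-nonZero W>0}} (begin
    48 * suc j * (2 * F# j) * W
      ≡⟨ e₁ (suc j) (F# j) W ⟩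
    96 * suc j * (F# j * W)
      ≤⟨ *-monoˡ-≤ (F# j * W) (≤-trans (*-monoˡ-≤ (suc j) (≤ᵇ⇒≤ 96 224 tt)) p) ⟩
    n * (F# j * W)
      ≡⟨ e₂ n (F# j) W ⟩
    F# j * (n * W)
      ≡⟨ sym (∑-*ʳ xs (n * W) (λ s → ⟦ goodLeaves s ≡ᵇ j ⟧)) ⟩
    ∑ xs (λ s → ⟦ goodLeaves s ≡ᵇ j ⟧ * (n * W))
      ≤⟨ on-level j (λ s∈ q → fwd-bound s∈ j q p) ⟩
    ∑ xs (λ s → ⟦ goodLeaves s ≡ᵇ j ⟧ * (2 * fwd s))
      ≡⟨ trans (∑-cong xs (λ s → rot ⟦ goodLeaves s ≡ᵇ j ⟧ 2 (fwd s))) (∑-*ˡ xs 2 _) ⟩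
    2 * ∑ xs (λ s → ⟦ goodLeaves s ≡ᵇ j ⟧ * fwd s)
      ≤⟨ *-monoʳ-≤ 2 flow ⟩
    2 * ∑ xs (λ s → ⟦ goodLeaves s ≡ᵇ suc j ⟧ * bwd s)
      ≤⟨ *-monoʳ-≤ 2 (on-level (suc j) (λ {s} s∈ q → ≤-trans (bwd-bound s) (≤-reflexive (cong (_* (24 * W)) q)))) ⟩
    2 * ∑ xs (λ s → ⟦ goodLeaves s ≡ᵇ suc j ⟧ * (suc j * (24 * W)))
      ≡⟨ cong (2 *_) (∑-*ʳ xs (suc j * (24 * W)) (λ s → ⟦ goodLeaves s ≡ᵇ suc j ⟧)) ⟩
    2 * (F# (suc j) * (suc j * (24 * W)))
      ≡⟨ e₃ (F# (suc j)) (suc j) W ⟩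
    48 * suc j * F# (suc j) * W ∎))
    where
    open ≤-Reasoning
    V = allFin n
    e₁ : ∀ j f w → 48 * j * (2 * f) * w ≡ 96 * j * (f * w)
    e₁ = solve-∀
    e₂ : ∀ n f w → n * (f * w) ≡ f * (n * w)
    e₂ = solve-∀
    e₃ : ∀ f j w → 2 * (f * (j * (24 * w))) ≡ 48 * j * f * w
    e₃ = solve-∀
    rot : ∀ a b c → a * (b * c) ≡ b * (a * c)
    rot = solve-∀
    flow : ∑ xs (λ s → ⟦ goodLeaves s ≡ᵇ j ⟧ * fwd s) ≤ ∑ xs (λ s → ⟦ goodLeaves s ≡ᵇ suc j ⟧ * bwd s)
    flow = begin
      ∑ xs (λ s → ⟦ goodLeaves s ≡ᵇ j ⟧ * fwd s)
        ≡⟨ ∑³-exchange xs (λ s → ⟦ goodLeaves s ≡ᵇ j ⟧) c (λ s x z v → ⟦ valid s x z v ⟧) ⟩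
      ∑ V (λ x → ∑ V (λ z → ∑ V (λ v → c x * ∑ xs (λ s → ⟦ goodLeaves s ≡ᵇ j ⟧ * ⟦ valid s x z v ⟧))))
        ≤⟨ ∑-mono V (λ x → ∑-mono V (λ z → ∑-mono V (λ v → *-monoʳ-≤ (c x) (move-count j x z v)))) ⟩
      ∑ V (λ x → ∑ V (λ z → ∑ V (λ v → c x * ∑ xs (λ s → ⟦ goodLeaves s ≡ᵇ suc j ⟧ * ⟦ valid′ s x z v ⟧))))
        ≡⟨ sym (∑³-exchange xs (λ s → ⟦ goodLeaves s ≡ᵇ suc j ⟧) c (λ s x z v → ⟦ valid′ s x z v ⟧)) ⟩
      ∑ xs (λ s → ⟦ goodLeaves s ≡ᵇ suc j ⟧ * bwd s) ∎

  climb : ∀ i j → 224 * (i + j) ≤ n → 2 ^ i * F# j ≤ length xs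
  climb zero j _ = ≤-trans (≤-reflexive (*-identityˡ (F# j)))
    (≤-trans (∑-mono xs (λ s → ⟦⟧≤1 (goodLeaves s ≡ᵇ j))) (≤-reflexive (∑-one xs)))
  climb (suc i) j p = begin
    2 ^ suc i * F# j       ≡⟨ e (2 ^ i) (F# j) ⟩
    2 ^ i * (2 * F# j)     ≤⟨ *-monoʳ-≤ (2 ^ i) (step j (≤-trans (*-monoʳ-≤ 224 (s≤s (m≤n+m j i))) p)) ⟩
    2 ^ i * F# (suc j)     ≤⟨ climb i (suc j) (≤-trans (*-monoʳ-≤ 224 (≤-reflexive (+-suc i j))) p) ⟩
    length xs              ∎
    where
    open ≤-Reasoning
    e : ∀ a f → 2 * a * f ≡ a * (2 * f)
    e = solve-∀

  -- From every level below `J` there is room for `J` doublings before 224 times the level exceeds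
  -- `n`; this doubles 224 to 448.
  few-leaves : ∀ J → 448 * J ≤ n → 2 ^ J * ∑ xs (λ s → ⟦ goodLeaves s <ᵇ J ⟧) ≤ J * length xs
  few-leaves J p = go J ≤-refl
    where
    split : ∀ a k → ⟦ a <ᵇ suc k ⟧ ≤ ⟦ a <ᵇ k ⟧ + ⟦ a ≡ᵇ k ⟧
    split zero zero = ≤-refl
    split zero (suc k) = ≤-refl
    split (suc a) zero = z≤n
    split (suc a) (suc k) = split a k
    go : ∀ k → k ≤ J → 2 ^ J * ∑ xs (λ s → ⟦ goodLeaves s <ᵇ k ⟧) ≤ k * length xs
    go zero _ = ≤-trans (*-monoʳ-≤ (2 ^ J) (≤-reflexive (∑-0 xs))) (≤-reflexive (*-zeroʳ (2 ^ J)))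
    go (suc k) k<J = begin
      2 ^ J * ∑ xs (λ s → ⟦ goodLeaves s <ᵇ suc k ⟧)
        ≤⟨ *-monoʳ-≤ (2 ^ J) (∑-mono xs (λ s → split (goodLeaves s) k)) ⟩
      2 ^ J * ∑ xs (λ s → ⟦ goodLeaves s <ᵇ k ⟧ + ⟦ goodLeaves s ≡ᵇ k ⟧)
        ≡⟨ trans (cong (2 ^ J *_) (∑-+ xs (λ s → ⟦ goodLeaves s <ᵇ k ⟧) (λ s → ⟦ goodLeaves s ≡ᵇ k ⟧)))
                 (*-distribˡ-+ (2 ^ J) (∑ xs (λ s → ⟦ goodLeaves s <ᵇ k ⟧)) (F# k)) ⟩
      2 ^ J * ∑ xs (λ s → ⟦ goodLeaves s <ᵇ k ⟧) + 2 ^ J * F# k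
        ≤⟨ +-mono-≤ (go k (<⇒≤ k<J)) (climb J k (≤-trans (≤-trans (*-monoʳ-≤ 224 (+-monoʳ-≤ J (<⇒≤ k<J))) (≤-reflexive (e J))) p)) ⟩
      k * length xs + length xs
        ≡⟨ +-comm (k * length xs) _ ⟩
      suc k * length xs ∎
      where
      open ≤-Reasoning
      e : ∀ J → 224 * (J + J) ≡ 448 * J
      e = solve-∀

-- A random bipartition of the vertices

allBits : ∀ n → List (Vec Bool n)
allBits zero = [ [] ]
allBits (suc n) = map (true ∷_) (allBits n) ++ map (false ∷_) (allBits n)

allBits-complete : ∀ (P : Vec Bool n) → P ∈ allBits n
allBits-complete [] = here refl
allBits-complete (true ∷ P) = ∈-++⁺ˡ (∈-map⁺ (true ∷_) (allBits-complete P))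
allBits-complete {suc n} (false ∷ P) = ∈-++⁺ʳ (map (true ∷_) (allBits n)) (∈-map⁺ (false ∷_) (allBits-complete P))

allBits-unique : ∀ n → Unique (allBits n)
allBits-unique zero = [] ∷ []
allBits-unique (suc n) = Uniq.++⁺ (Uniq.map⁺ VP.∷-injectiveʳ (allBits-unique n)) (Uniq.map⁺ VP.∷-injectiveʳ (allBits-unique n)) disjoint
  where
  disjoint : ∀ {P} → ¬ (P ∈ map (true ∷_) (allBits n) × P ∈ map (false ∷_) (allBits n))
  disjoint (p , q) with ∈-map⁻ (true ∷_) p | ∈-map⁻ (false ∷_) q
  ... | _ , _ , refl | _ , _ , ()

flip : Fin n → Vec Bool n → Vec Bool n
flip i P = V.updateAt P i not

flip-at : ∀ (i : Fin n) P → V.lookup (flip i P) i ≡ not (V.lookup P i)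
flip-at i P = VP.lookup∘updateAt i P

flip-other : ∀ {i j : Fin n} P → j ≢ i → V.lookup (flip i P) j ≡ V.lookup P j
flip-other {i = i} {j} P h = VP.lookup∘updateAt′ j i h P

flip-flip : ∀ (i : Fin n) P → flip i (flip i P) ≡ P
flip-flip i P = trans (VP.updateAt-updateAt i P) (trans (VP.updateAt-cong i not-involutive P) (VP.updateAt-id i P))

lit : Bool → Bool → ℕ
lit true v = ⟦ v ⟧
lit false v = ⟦ not v ⟧

lit-not : ∀ b v → lit b (not v) + lit b v ≡ 1
lit-not true true = refl
lit-not true false = refl
lit-not false true = refl
lit-not false false = refl

-- Flipping coordinate `i` matches the two halves of the cube and preserves `g`.
half : ∀ b (i : Fin n) (g : Vec Bool n → ℕ) → (∀ P → g (flip i P) ≡ g P) →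
  ∑ (allBits n) g ≤ 2 * ∑ (allBits n) (λ P → lit b (V.lookup P i) * g P)
half {n} b i g inv = begin
  ∑ Ps g
    ≡⟨ ∑-cong Ps (λ P → trans (sym (*-identityˡ (g P))) (trans (cong (_* g P) (sym (lit-not b (V.lookup P i)))) (*-distribʳ-+ (g P) (lit b (not (V.lookup P i))) (lit b (V.lookup P i))))) ⟩
  ∑ Ps (λ P → lit b (not (V.lookup P i)) * g P + lit b (V.lookup P i) * g P)
    ≡⟨ ∑-+ Ps (λ P → lit b (not (V.lookup P i)) * g P) (λ P → lit b (V.lookup P i) * g P) ⟩
  ∑ Ps (λ P → lit b (not (V.lookup P i)) * g P) + S
    ≤⟨ +-monoˡ-≤ S (∑-inj (flip i) (allBits-unique n) (λ P _ _ → allBits-complete (flip i P) , ≤-reflexive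
         (cong₂ _*_ (cong (lit b) (sym (flip-at i P))) (sym (inv P))))
         (λ P Q _ _ _ _ e → trans (sym (flip-flip i P)) (trans (cong (flip i) e) (flip-flip i Q)))) ⟩
  S + S
    ≡⟨ cong (S +_) (sym (+-identityʳ S)) ⟩
  2 * S ∎
  where
  open ≤-Reasoning
  Ps = allBits n
  S = ∑ Ps (λ P → lit b (V.lookup P i) * g P)

cutBit : Vec Bool n → (w y b : Fin n) → ℕ
cutBit P w y b = lit false (V.lookup P w) * (lit true (V.lookup P y) * lit true (V.lookup P b))

-- Three independent bits give 1/8. If `y` and `b` coincide there are only two of them and the bound
-- holds with room to spare.
average-cutBit : ∀ {w y b : Fin n} → w ≢ y → w ≢ b → length (allBits n) ≤ 8 * ∑ (allBits n) (λ P → cutBit P w y b)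
average-cutBit {n} {w} {y} {b} w≢y w≢b = begin
  length Ps                                    ≡⟨ sym (∑-one Ps) ⟩
  ∑ Ps (λ _ → 1)                               ≤⟨ half true b (λ _ → 1) (λ _ → refl) ⟩
  2 * ∑ Ps (λ P → lit true (V.lookup P b) * 1) ≡⟨ cong (2 *_) (∑-cong Ps (λ P → *-identityʳ _)) ⟩
  2 * ∑ Ps (λ P → lit true (V.lookup P b))     ≤⟨ *-monoʳ-≤ 2 (second (y F.≟ b)) ⟩
  2 * (2 * ∑ Ps g)                             ≤⟨ *-monoʳ-≤ 2 (*-monoʳ-≤ 2 (half false w g (λ P →
                                                    cong₂ (λ p q → ⟦ p ⟧ * ⟦ q ⟧) (flip-other P (w≢y ∘ sym)) (flip-other P (w≢b ∘ sym))))) ⟩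
  2 * (2 * (2 * ∑ Ps (λ P → cutBit P w y b)))  ≡⟨ e (∑ Ps (λ P → cutBit P w y b)) ⟩
  8 * ∑ Ps (λ P → cutBit P w y b)              ∎
  where
  open ≤-Reasoning
  Ps = allBits n
  e : ∀ a → 2 * (2 * (2 * a)) ≡ 8 * a
  e = solve-∀
  g : Vec Bool n → ℕ
  g P = lit true (V.lookup P y) * lit true (V.lookup P b)
  idem : ∀ v → ⟦ v ⟧ ≡ ⟦ v ⟧ * ⟦ v ⟧
  idem true = refl
  idem false = refl
  second : Dec (y ≡ b) → ∑ Ps (λ P → lit true (V.lookup P b)) ≤ 2 * ∑ Ps g
  second (yes refl) = ≤-trans (≤-reflexive (∑-cong Ps (λ P → idem (V.lookup P y)))) (m≤m+n _ _)
  second (no y≢b) = half true y (λ P → lit true (V.lookup P b)) (λ P → cong ⟦_⟧ (flip-other P (y≢b ∘ sym)))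

∑-average : ∀ (xs : List A) (f : A → ℕ) b → 1 ≤ length xs → length xs * b ≤ ∑ xs f → Σ A λ x → x ∈ xs × b ≤ f x
∑-average xs f zero h p with xs | h
... | x ∷ _ | _ = x , here refl , z≤n
∑-average xs f (suc b) h p with ∑-pigeonhole xs f b (<-≤-trans (*-monoʳ-< (length xs) {{>-nonZero h}} ≤-refl) p)
... | x , x∈ , q = x , x∈ , q

-- First moment method: the average over all partitions keeps an eighth of the total weight, so some
-- partition does.
good-partition : ∀ {I : Set} (is : List I) (ω : I → ℕ) (w y b : I → Fin n) →
  (∀ i → i ∈ is → 0 < ω i → w i ≢ y i × w i ≢ b i) →
  Σ (Vec Bool n) λ P → ∑ is ω ≤ 8 * ∑ is (λ i → ω i * cutBit P (w i) (y i) (b i))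
good-partition {n} is ω w y b distinct with ∑-average Ps Ψ (∑ is ω) nonempty total
  where
  Ps = allBits n
  Ψ : Vec Bool n → ℕ
  Ψ P = 8 * ∑ is (λ i → ω i * cutBit P (w i) (y i) (b i))
  nonempty : 1 ≤ length Ps
  nonempty = ≤-trans (∑-term (λ _ → 1) (allBits-complete (V.replicate n true))) (≤-reflexive (∑-one Ps))
  total : length Ps * ∑ is ω ≤ ∑ Ps Ψ
  total = begin
    length Ps * ∑ is ω
      ≡⟨ sym (∑-*ˡ is (length Ps) ω) ⟩
    ∑ is (λ i → length Ps * ω i)
      ≤⟨ ∑-mono∈ is local ⟩
    ∑ is (λ i → ∑ Ps (λ P → 8 * (ω i * cutBit P (w i) (y i) (b i))))
      ≡⟨ ∑-swap is Ps (λ i P → 8 * (ω i * cutBit P (w i) (y i) (b i))) ⟩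
    ∑ Ps (λ P → ∑ is (λ i → 8 * (ω i * cutBit P (w i) (y i) (b i))))
      ≡⟨ ∑-cong Ps (λ P → ∑-*ˡ is 8 _) ⟩
    ∑ Ps Ψ ∎
    where
    open ≤-Reasoning
    rot : ∀ a b c → a * (b * c) ≡ b * (a * c)
    rot = solve-∀
    local : ∀ i → i ∈ is → length Ps * ω i ≤ ∑ Ps (λ P → 8 * (ω i * cutBit P (w i) (y i) (b i)))
    local i i∈ with ω i in eq
    ... | zero = ≤-trans (≤-reflexive (*-zeroʳ (length Ps))) z≤n
    ... | suc k = ≤-trans (*-monoˡ-≤ (suc k) (average-cutBit (proj₁ ds) (proj₂ ds)))
                    (≤-reflexive (trans (*-comm _ (suc k)) (trans (cong (suc k *_) (sym (∑-*ˡ Ps 8 (λ P → cutBit P (w i) (y i) (b i)))))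
                      (trans (sym (∑-*ˡ Ps (suc k) (λ P → 8 * cutBit P (w i) (y i) (b i)))) (∑-cong Ps (λ P → rot (suc k) 8 (cutBit P (w i) (y i) (b i))))))))
      where ds = distinct i i∈ (subst (0 <_) (sym eq) (s≤s z≤n))
... | P , _ , q = P , q

module Partition {n : ℕ} (G : Graph n) (xs : List (EdgeSubset G)) (uxs : Unique xs)
  (tree : ∀ {s} → s ∈ xs → Tree (Matrices.mat G s))
  (complete : ∀ s → Tree (Matrices.mat G s) → s ∈ xs)
  (W : ℕ) (W>0 : 1 ≤ W) (c : Fin n → ℕ)
  (c-deg : ∀ x → c x * SpanningTrees.gdeg G xs uxs tree complete x ≡ W)
  (κ ℓ : ℕ) (ℓ>0 : 1 ≤ ℓ) (16ℓ≤κ : 16 * ℓ ≤ κ) where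

  open SpanningTrees G xs uxs tree complete
  open Weights W W>0 c c-deg

  module _ (P : Vec Bool n) where

    inB : Fin n → Bool
    inB y = V.lookup P y

    nB : Fin n → ℕ
    nB w = ∑V (λ b → ⟦ adj G w b ⟧ * ⟦ inB b ⟧)

    -- The second condition guarantees that a proportion 1/κ of the neighbours of `w` is available
    -- for re-attachment.
    inA : Fin n → Bool
    inA w = not (inB w) ∧ (gdeg w ≤ᵇ κ * nB w)

    attached : X → Fin n → ℕ
    attached s w = ∑V (λ y → ⟦ mat s w y ⟧ * ⟦ inB y ⟧)

    inL : X → Fin n → Bool
    inL s w = inA w ∧ (leaf s w ∧ (1 ≤ᵇ attached s w))

    sizeL : X → ℕ
    sizeL s = ∑V (λ w → ⟦ inL s w ⟧)

    -- For a leaf outside B attached to B this is `W` times the probability that a random neighbour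
    -- lies in B. It is a sum of the monomials `cutBit`, so unlike `inL` it can be averaged over
    -- partitions directly.
    Ψ : X → Fin n → ℕ
    Ψ s w = (⟦ leaf s w ⟧ * (⟦ not (inB w) ⟧ * attached s w)) * (c w * nB w)

    -- A leaf with too small a share of neighbours in B contributes at most `W / κ`, any other leaf
    -- at most `W`.
    Ψ-bound : ∀ s w → κ * Ψ s w ≤ κ * (W * ⟦ inL s w ⟧) + W
    Ψ-bound s w = cases (≡true-or-false (inB w)) (≡true-or-false (leaf s w)) (≡true-or-false (gdeg w ≤ᵇ κ * nB w)) (≡true-or-false (1 ≤ᵇ attached s w))
      where
      open ≤-Reasoning
      zero-case : ⟦ leaf s w ⟧ * (⟦ not (inB w) ⟧ * attached s w) ≡ 0 → κ * Ψ s w ≤ κ * (W * ⟦ inL s w ⟧) + W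
      zero-case e = ≤-trans (≤-reflexive (trans (cong (λ k → κ * (k * (c w * nB w))) e) (*-zeroʳ κ))) z≤n
      att≤1 : leaf s w ≡ true → attached s w ≤ 1
      att≤1 l = ≤-trans (∑-mono (allFin n) (λ y → ≤-trans (*-monoʳ-≤ ⟦ mat s w y ⟧ (⟦⟧≤1 (inB y))) (≤-reflexive (*-identityʳ _))))
                        (≤-reflexive (≡ᵇ-true l))
      coef : leaf s w ≡ true → ⟦ leaf s w ⟧ * (⟦ not (inB w) ⟧ * attached s w) ≤ 1
      coef l = *-mono-≤ (⟦⟧≤1 (leaf s w)) (*-mono-≤ (⟦⟧≤1 (not (inB w))) (att≤1 l))
      Ψ≤ : leaf s w ≡ true → Ψ s w ≤ c w * nB w
      Ψ≤ l = ≤-trans (*-monoˡ-≤ (c w * nB w) (coef l)) (≤-reflexive (*-identityˡ _))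
      nB≤ : nB w ≤ gdeg w
      nB≤ = ∑-mono (allFin n) (λ b → ≤-trans (*-monoʳ-≤ ⟦ adj G w b ⟧ (⟦⟧≤1 (inB b))) (≤-reflexive (*-identityʳ _)))
      rot : ∀ a b c → a * (b * c) ≡ b * (a * c)
      rot = solve-∀
      cases : inB w ≡ true ⊎ inB w ≡ false → leaf s w ≡ true ⊎ leaf s w ≡ false →
        (gdeg w ≤ᵇ κ * nB w) ≡ true ⊎ (gdeg w ≤ᵇ κ * nB w) ≡ false →
        (1 ≤ᵇ attached s w) ≡ true ⊎ (1 ≤ᵇ attached s w) ≡ false → κ * Ψ s w ≤ κ * (W * ⟦ inL s w ⟧) + W
      cases (inj₁ e) _ _ _ = zero-case (trans (cong (λ b → ⟦ leaf s w ⟧ * (⟦ not b ⟧ * attached s w)) e) (*-zeroʳ ⟦ leaf s w ⟧))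
      cases (inj₂ _) (inj₂ e) _ _ = zero-case (cong (λ b → ⟦ b ⟧ * (⟦ not (inB w) ⟧ * attached s w)) e)
      cases (inj₂ e) (inj₁ l) (inj₂ g) _ = ≤-trans (*-monoʳ-≤ κ (Ψ≤ l)) (≤-trans (≤-trans (≤-reflexive (rot κ (c w) (nB w)))
        (≤-trans (*-monoʳ-≤ (c w) (<⇒≤ (≤ᵇ-false g))) (≤-reflexive (c-deg w)))) (m≤n+m W _))
      cases (inj₂ e) (inj₁ l) (inj₁ g) (inj₂ a) = zero-case (trans (cong (λ k → ⟦ leaf s w ⟧ * (⟦ not (inB w) ⟧ * k)) (n<1⇒n≡0 (≤ᵇ-false {1} a)))
        (trans (cong (⟦ leaf s w ⟧ *_) (*-zeroʳ ⟦ not (inB w) ⟧)) (*-zeroʳ ⟦ leaf s w ⟧)))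
      cases (inj₂ e) (inj₁ l) (inj₁ g) (inj₁ a) = ≤-trans (*-monoʳ-≤ κ (begin
        Ψ s w             ≤⟨ Ψ≤ l ⟩
        c w * nB w        ≤⟨ *-monoʳ-≤ (c w) nB≤ ⟩
        c w * gdeg w      ≡⟨ c-deg w ⟩
        W                 ≡⟨ sym (*-identityʳ W) ⟩
        W * 1             ≡⟨ cong (W *_) (sym (⟦⟧-true (∧-intro (∧-intro (cong not e) g) (∧-intro l a)))) ⟩
        W * ⟦ inL s w ⟧   ∎)) (m≤m+n _ W)

  leaves : X → ℕ
  leaves s = ∑V (λ w → ⟦ leaf s w ⟧)

  partition : 1 ≤ n → (p : X → ℕ) → (∀ s → s ∈ xs → 0 < p s → n ≤ ℓ * leaves s) →
    Σ (Vec Bool n) λ P → ∑ xs p ≤ 2 * κ * ∑ xs (λ s → p s * ⟦ n ≤ᵇ 2 * κ * sizeL P s ⟧)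
  partition n>0 p many = P , conclusion
    where
    open ≤-Reasoning
    V = allFin n
    Item = X × Fin n × Fin n × Fin n
    items : List Item
    items = cartesianProduct xs (cartesianProduct V (cartesianProduct V V))
    -- Here `y` is the tree neighbour of the leaf `w`, and `b` is a random neighbour that samples
    -- how much of the neighbourhood of `w` falls into B.
    ω : Item → ℕ
    ω (s , w , y , b) = p s * (⟦ leaf s w ⟧ * (⟦ mat s w y ⟧ * (c w * ⟦ adj G w b ⟧)))
    ∑items : ∀ f → ∑ items f ≡ ∑ xs (λ s → ∑ V (λ w → ∑ V (λ y → ∑ V (λ b → f (s , w , y , b)))))
    ∑items f = trans (∑-cartesianProduct xs (cartesianProduct V (cartesianProduct V V)) f) (∑-cong xs (λ s →
      trans (∑-cartesianProduct V (cartesianProduct V V) (λ i → f (s , i))) (∑-cong V (λ w →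
      ∑-cartesianProduct V V (λ i → f (s , w , i))))))
    pos-factor : ∀ {a b} → 0 < a * b → 0 < a × 0 < b
    pos-factor {suc a} {suc b} _ = s≤s z≤n , s≤s z≤n
    pos-factor {suc a} {zero} q = ⊥-elim (n≮0 (subst (0 <_) (*-zeroʳ (suc a)) q))
    distinct : ∀ i → i ∈ items → 0 < ω i → proj₁ (proj₂ i) ≢ proj₁ (proj₂ (proj₂ i)) × proj₁ (proj₂ i) ≢ proj₂ (proj₂ (proj₂ i))
    distinct (s , w , y , b) _ q =
      (λ { refl → true≢false (trans (sym (⟦⟧-pos (proj₁ q₂))) (mat-irr s w)) }) ,
      (λ { refl → true≢false (trans (sym (⟦⟧-pos (proj₂ (pos-factor {c w} (proj₂ q₂))))) (irrefl G w)) })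
      where q₂ = pos-factor {⟦ mat s w y ⟧} (proj₂ (pos-factor {⟦ leaf s w ⟧} (proj₂ (pos-factor {p s} q))))
    found = good-partition items ω (λ i → proj₁ (proj₂ i)) (λ i → proj₁ (proj₂ (proj₂ i))) (λ i → proj₂ (proj₂ (proj₂ i))) distinct
    P = proj₁ found
    Σp = ∑ xs p
    ΣΨ = ∑ xs (λ s → p s * ∑ V (Ψ P s))
    SL = ∑ xs (λ s → p s * sizeL P s)
    lhs : ∑ items ω ≡ ∑ xs (λ s → p s * (W * leaves s))
    lhs = trans (∑items ω) (∑-cong xs (λ s → trans
      (∑-cong V (λ w → trans
        (∑-cong V (λ y → trans (∑-*ˡ V (p s) _) (cong (p s *_) (trans (∑-*ˡ V ⟦ leaf s w ⟧ _) (cong (⟦ leaf s w ⟧ *_)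
           (trans (∑-*ˡ V ⟦ mat s w y ⟧ _) (cong (⟦ mat s w y ⟧ *_) (∑c-adj w))))))))
        (trans (∑-*ˡ V (p s) _) (cong (p s *_) (trans (∑-*ˡ V ⟦ leaf s w ⟧ _)
          (trans (cong (⟦ leaf s w ⟧ *_) (∑-*ʳ V W (λ y → ⟦ mat s w y ⟧))) (leaf-deg s w)))))))
      (trans (∑-*ˡ V (p s) _) (cong (p s *_) (∑-*ˡ V W _)))))
      where
      leaf-deg : ∀ s w → ⟦ leaf s w ⟧ * (deg (mat s) w * W) ≡ W * ⟦ leaf s w ⟧
      leaf-deg s w with deg (mat s) w
      ... | 0 = sym (*-zeroʳ W)
      ... | 1 = trans (*-identityˡ (1 * W)) (*-comm 1 W)
      ... | suc (suc k) = sym (*-zeroʳ W)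
    ωP : Item → ℕ
    ωP i = ω i * cutBit P (proj₁ (proj₂ i)) (proj₁ (proj₂ (proj₂ i))) (proj₂ (proj₂ (proj₂ i)))
    rhs : ∑ items ωP ≡ ΣΨ
    rhs = trans (∑items _) (∑-cong xs (λ s → trans
      (∑-cong V (λ w → trans
        (∑-cong V (λ y → trans (∑-cong V (λ b → e₁ (p s) ⟦ leaf s w ⟧ ⟦ mat s w y ⟧ (c w) ⟦ adj G w b ⟧ _ _ _)) (∑-*ˡ V (K s w * (⟦ mat s w y ⟧ * ⟦ inB P y ⟧)) _)))
        (trans (∑-*ʳ V (nB P w) (λ y → K s w * (⟦ mat s w y ⟧ * ⟦ inB P y ⟧))) (trans (cong (_* nB P w) (∑-*ˡ V (K s w) _))
          (e₂ (p s) ⟦ leaf s w ⟧ (c w) ⟦ not (inB P w) ⟧ (attached P s w) (nB P w))))))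
      (∑-*ˡ V (p s) _)))
      where
      K : X → Fin n → ℕ
      K s w = p s * (⟦ leaf s w ⟧ * (c w * ⟦ not (inB P w) ⟧))
      e₁ : ∀ p l m c a nw y b → p * (l * (m * (c * a))) * (nw * (y * b)) ≡ p * (l * (c * nw)) * (m * y) * (a * b)
      e₁ = solve-∀
      e₂ : ∀ p l c nw at nb → p * (l * (c * nw)) * at * nb ≡ p * (l * (nw * at) * (c * nb))
      e₂ = solve-∀
    i₁ : n * W * Σp ≤ 8 * ℓ * ΣΨ
    i₁ = begin
      n * W * Σp                                    ≡⟨ sym (∑-*ˡ xs (n * W) p) ⟩
      ∑ xs (λ s → n * W * p s)                      ≤⟨ ∑-mono∈ xs local ⟩
      ∑ xs (λ s → ℓ * (p s * (W * leaves s)))     ≡⟨ ∑-*ˡ xs ℓ _ ⟩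
      ℓ * ∑ xs (λ s → p s * (W * leaves s))       ≡⟨ cong (ℓ *_) (sym lhs) ⟩
      ℓ * ∑ items ω                               ≤⟨ *-monoʳ-≤ ℓ (proj₂ found) ⟩
      ℓ * (8 * ∑ items ωP)                        ≡⟨ cong (λ k → ℓ * (8 * k)) rhs ⟩
      ℓ * (8 * ΣΨ)                                ≡⟨ e₀ ℓ ΣΨ ⟩
      8 * ℓ * ΣΨ ∎
      where
      e₀ : ∀ l a → l * (8 * a) ≡ 8 * l * a
      e₀ = solve-∀
      e : ∀ k l w p → k * l * w * p ≡ k * (p * (w * l))
      e = solve-∀
      local : ∀ s → s ∈ xs → n * W * p s ≤ ℓ * (p s * (W * leaves s))
      local s s∈ with p s in eq
      ... | zero = ≤-trans (≤-reflexive (*-zeroʳ (n * W))) z≤n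
      ... | suc k = ≤-trans (*-monoˡ-≤ (suc k) (*-monoˡ-≤ W (many s s∈ (subst (0 <_) (sym eq) (s≤s z≤n)))))
                            (≤-reflexive (e ℓ (leaves s) W (suc k)))
    i₂ : κ * ΣΨ ≤ κ * (W * SL) + n * W * Σp
    i₂ = begin
      κ * ΣΨ                                             ≡⟨ sym (∑-*ˡ xs κ _) ⟩
      ∑ xs (λ s → κ * (p s * ∑ V (Ψ P s)))               ≤⟨ ∑-mono xs local ⟩
      ∑ xs (λ s → κ * (W * (p s * sizeL P s)) + n * W * p s) ≡⟨ ∑-+ xs (λ s → κ * (W * (p s * sizeL P s))) (λ s → n * W * p s) ⟩
      ∑ xs (λ s → κ * (W * (p s * sizeL P s))) + ∑ xs (λ s → n * W * p s)
        ≡⟨ cong₂ _+_ (trans (∑-*ˡ xs κ _) (cong (κ *_) (∑-*ˡ xs W _))) (∑-*ˡ xs (n * W) p) ⟩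
      κ * (W * SL) + n * W * Σp ∎
      where
      rot : ∀ a b c → a * (b * c) ≡ b * (a * c)
      rot = solve-∀
      e : ∀ κ p w l n → p * (κ * (w * l) + n * w) ≡ κ * (w * (p * l)) + n * w * p
      e = solve-∀
      local : ∀ s → κ * (p s * ∑ V (Ψ P s)) ≤ κ * (W * (p s * sizeL P s)) + n * W * p s
      local s = begin
        κ * (p s * ∑ V (Ψ P s))     ≡⟨ rot κ (p s) (∑ V (Ψ P s)) ⟩
        p s * (κ * ∑ V (Ψ P s))     ≡⟨ cong (p s *_) (sym (∑-*ˡ V κ (Ψ P s))) ⟩
        p s * ∑ V (λ w → κ * Ψ P s w) ≤⟨ *-monoʳ-≤ (p s) (∑-mono V (Ψ-bound P s)) ⟩
        p s * ∑ V (λ w → κ * (W * ⟦ inL P s w ⟧) + W)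
          ≡⟨ cong (p s *_) (trans (∑-+ V (λ w → κ * (W * ⟦ inL P s w ⟧)) (λ _ → W))
               (cong₂ _+_ (trans (∑-*ˡ V κ _) (cong (κ *_) (∑-*ˡ V W _))) (∑V-const n W))) ⟩
        p s * (κ * (W * sizeL P s) + n * W) ≡⟨ e κ (p s) W (sizeL P s) n ⟩
        κ * (W * (p s * sizeL P s)) + n * W * p s ∎
    -- By `16ℓ≤κ` the loss term of `i₂` is at most half of what `i₁` supplies, and subtracting it
    -- leaves the other half.
    i₃ : n * Σp ≤ κ * SL
    i₃ = *-cancelˡ-≤ (8 * ℓ) {{>-nonZero (*-mono-≤ {1} {8} (s≤s z≤n) ℓ>0)}} (*-cancelʳ-≤ _ _ W {{>-nonZero W>0}} (+-cancelʳ-≤ (8 * ℓ * (n * W * Σp)) _ _ (begin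
      8 * ℓ * (n * Σp) * W + 8 * ℓ * (n * W * Σp)   ≡⟨ e₁ ℓ n Σp W ⟩
      16 * ℓ * (n * W * Σp)                         ≤⟨ *-monoˡ-≤ (n * W * Σp) 16ℓ≤κ ⟩
      κ * (n * W * Σp)                              ≤⟨ *-monoʳ-≤ κ i₁ ⟩
      κ * (8 * ℓ * ΣΨ)                              ≡⟨ e₂ κ (8 * ℓ) ΣΨ ⟩
      8 * ℓ * (κ * ΣΨ)                              ≤⟨ *-monoʳ-≤ (8 * ℓ) i₂ ⟩
      8 * ℓ * (κ * (W * SL) + n * W * Σp)           ≡⟨ e₃ κ (8 * ℓ) W SL (n * W * Σp) ⟩
      8 * ℓ * (κ * SL) * W + 8 * ℓ * (n * W * Σp)   ∎)))
      where
      e₁ : ∀ l n p w → 8 * l * (n * p) * w + 8 * l * (n * w * p) ≡ 16 * l * (n * w * p)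
      e₁ = solve-∀
      e₂ : ∀ κ m a → κ * (m * a) ≡ m * (κ * a)
      e₂ = solve-∀
      e₃ : ∀ κ m w s k → m * (κ * (w * s) + k) ≡ m * (κ * s) * w + m * k
      e₃ = solve-∀
    big : X → Bool
    big s = n ≤ᵇ 2 * κ * sizeL P s
    -- Reverse Markov inequality: `sizeL` never exceeds `n` and has mean at least n/κ, so trees with
    -- `sizeL` at least n/(2κ) carry a proportion of at least 1/(2κ) of `p`.
    conclusion : Σp ≤ 2 * κ * ∑ xs (λ s → p s * ⟦ big s ⟧)
    conclusion = *-cancelˡ-≤ n {{>-nonZero n>0}} (+-cancelʳ-≤ (n * Σp) _ _ (begin
      n * Σp + n * Σp                           ≡⟨ e₁ (n * Σp) ⟩
      2 * (n * Σp)                              ≤⟨ *-monoʳ-≤ 2 i₃ ⟩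
      2 * (κ * SL)                          ≡⟨ sym (*-assoc 2 κ SL) ⟩
      2 * κ * SL                                ≡⟨ sym (∑-*ˡ xs (2 * κ) _) ⟩
      ∑ xs (λ s → 2 * κ * (p s * sizeL P s))    ≤⟨ ∑-mono xs local ⟩
      ∑ xs (λ s → n * (2 * κ * (p s * ⟦ big s ⟧)) + n * p s)
        ≡⟨ trans (∑-+ xs (λ s → n * (2 * κ * (p s * ⟦ big s ⟧))) (λ s → n * p s))
             (cong₂ _+_ (trans (∑-*ˡ xs n _) (cong (n *_) (∑-*ˡ xs (2 * κ) _))) (∑-*ˡ xs n p)) ⟩
      n * (2 * κ * ∑ xs (λ s → p s * ⟦ big s ⟧)) + n * Σp ∎))
      where
      e₁ : ∀ a → a + a ≡ 2 * a
      e₁ = solve-∀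
      rot : ∀ a b c → a * (b * c) ≡ b * (a * c)
      rot = solve-∀
      e₂ : ∀ κ p n k → p * (2 * κ * (n * k) + n) ≡ n * (2 * κ * (p * k)) + n * p
      e₂ = solve-∀
      sizeL≤n : ∀ s → sizeL P s ≤ n
      sizeL≤n s = ≤-trans (∑V-one-bound _ 1 (λ w → ⟦⟧≤1 (inL P s w))) (≤-reflexive (*-identityʳ n))
      weigh : ∀ s → big s ≡ true ⊎ big s ≡ false → 2 * κ * sizeL P s ≤ 2 * κ * (n * ⟦ big s ⟧) + n
      weigh s (inj₁ q) = ≤-trans (*-monoʳ-≤ (2 * κ) (≤-trans (sizeL≤n s) (≤-reflexive (trans (sym (*-identityʳ n)) (cong (n *_) (sym (⟦⟧-true q))))))) (m≤m+n _ n)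
      weigh s (inj₂ q) = ≤-trans (<⇒≤ (≤ᵇ-false q)) (m≤n+m n _)
      local : ∀ s → 2 * κ * (p s * sizeL P s) ≤ n * (2 * κ * (p s * ⟦ big s ⟧)) + n * p s
      local s = ≤-trans (≤-reflexive (rot (2 * κ) (p s) (sizeL P s)))
        (≤-trans (*-monoʳ-≤ (p s) (weigh s (≡true-or-false (big s)))) (≤-reflexive (e₂ κ (p s) n ⟦ big s ⟧)))

-- Independent choices from finite lists

choices : List (List A) → List (List A)
choices [] = [ [] ]
choices (O ∷ Os) = concatMap (λ y → map (y ∷_) (choices Os)) O

∑-choices : ∀ (O : List A) Os F → ∑ (choices (O ∷ Os)) F ≡ ∑ O (λ y → ∑ (choices Os) (λ f → F (y ∷ f)))
∑-choices O Os F = trans (∑-concatMap (λ y → map (y ∷_) (choices Os)) O F) (∑-cong O (λ y → ∑-map (y ∷_) (choices Os) F))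

∈-choices⁻ : ∀ (Os : List (List A)) {f} → f ∈ choices Os → Pointwise _∈_ f Os
∈-choices⁻ [] (here refl) = []
∈-choices⁻ (O ∷ Os) f∈ with find (∈-concatMap⁻ (λ y → map (y ∷_) (choices Os)) {xs = O} f∈)
... | y , y∈ , q with ∈-map⁻ (y ∷_) q
...   | g , g∈ , refl = y∈ ∷ ∈-choices⁻ Os g∈

∈-choices⁺ : ∀ {Os : List (List A)} {f} → Pointwise _∈_ f Os → f ∈ choices Os
∈-choices⁺ [] = here refl
∈-choices⁺ {Os = O ∷ Os} (_∷_ {x = y} y∈ p) =
  ∈-concatMap⁺ (λ y → map (y ∷_) (choices Os)) (lose y∈ (∈-map⁺ (y ∷_) (∈-choices⁺ p)))

∑-choices-∏ : ∀ (Os : List (List A)) h → ∑ (choices Os) (λ f → ∏ f h) ≡ ∏ Os (λ O → ∑ O h)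
∑-choices-∏ [] h = refl
∑-choices-∏ (O ∷ Os) h = begin
  ∑ (choices (O ∷ Os)) (λ f → ∏ f h)                       ≡⟨ ∑-choices O Os (λ f → ∏ f h) ⟩
  ∑ O (λ y → ∑ (choices Os) (λ f → h y * ∏ f h))           ≡⟨ ∑-cong O (λ y → ∑-*ˡ (choices Os) (h y) (λ f → ∏ f h)) ⟩
  ∑ O (λ y → h y * ∑ (choices Os) (λ f → ∏ f h))           ≡⟨ ∑-*ʳ O _ h ⟩
  ∑ O h * ∑ (choices Os) (λ f → ∏ f h)                     ≡⟨ cong (∑ O h *_) (∑-choices-∏ Os h) ⟩
  ∑ O h * ∏ Os (λ O → ∑ O h)                               ∎
  where open ≡-Reasoning

∏-one : (xs : List A) → ∏ xs (λ _ → 1) ≡ 1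
∏-one [] = refl
∏-one (x ∷ xs) = trans (+-identityʳ _) (∏-one xs)

∏-cong : ∀ (xs : List A) {f g : A → ℕ} → (∀ x → f x ≡ g x) → ∏ xs f ≡ ∏ xs g
∏-cong [] h = refl
∏-cong (x ∷ xs) h = cong₂ _*_ (h x) (∏-cong xs h)

∏-map : ∀ (h : A → B) xs f → ∏ (map h xs) f ≡ ∏ xs (f ∘ h)
∏-map h [] f = refl
∏-map h (x ∷ xs) f = cong (f (h x) *_) (∏-map h xs f)

∏-* : ∀ (xs : List A) f g → ∏ xs (λ x → f x * g x) ≡ ∏ xs f * ∏ xs g
∏-* [] f g = refl
∏-* (x ∷ xs) f g rewrite ∏-* xs f g = e (f x) (g x) (∏ xs f) (∏ xs g)
  where
  e : ∀ a b c d → a * b * (c * d) ≡ a * c * (b * d)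
  e = solve-∀

∏-const : ∀ (xs : List A) c → ∏ xs (λ _ → c) ≡ c ^ length xs
∏-const [] c = refl
∏-const (x ∷ xs) c = cong (c *_) (∏-const xs c)

∏-++ : ∀ (xs ys : List A) f → ∏ (xs ++ ys) f ≡ ∏ xs f * ∏ ys f
∏-++ [] ys f = sym (+-identityʳ _)
∏-++ (x ∷ xs) ys f rewrite ∏-++ xs ys f = sym (*-assoc (f x) _ _)

length-choices : ∀ (Os : List (List A)) → length (choices Os) ≡ ∏ Os length
length-choices Os = trans (sym (∑-one (choices Os)))
  (trans (∑-cong (choices Os) (λ f → sym (∏-one f))) (trans (∑-choices-∏ Os (λ _ → 1)) (∏-cong Os ∑-one)))

-- Equality of multisets, expressed by sums of arbitrary weights, so that options can be regrouped
-- without exhibiting permutations.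
_≈_ : List A → List A → Set
O ≈ O′ = ∀ G → ∑ O G ≡ ∑ O′ G

choices-cong : ∀ {Os Os′ : List (List A)} → Pointwise _≈_ Os Os′ → choices Os ≈ choices Os′
choices-cong [] F = refl
choices-cong {Os = O ∷ Os} {O′ ∷ Os′} (e ∷ es) F = trans (∑-choices O Os F)
  (trans (∑-cong O (λ y → choices-cong es (λ f → F (y ∷ f)))) (trans (e _) (sym (∑-choices O′ Os′ F))))

≈-length : ∀ (O O′ : List A) → O ≈ O′ → length O ≡ length O′
≈-length O O′ e = trans (sym (∑-one O)) (trans (e (λ _ → 1)) (∑-one O′))

-- Conditioning: revealing first the cell of every choice and then the choice within its cell.
refine : ∀ (opts : C → List B) (css : List (List C)) F →
  ∑ (choices (map (concatMap opts) css)) F ≡ ∑ (choices css) (λ ρ → ∑ (choices (map opts ρ)) F)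
refine opts [] F = sym (+-identityʳ _)
refine opts (cs ∷ css) F = begin
  ∑ (choices (concatMap opts cs ∷ map (concatMap opts) css)) F
    ≡⟨ ∑-choices (concatMap opts cs) (map (concatMap opts) css) F ⟩
  ∑ (concatMap opts cs) (λ y → ∑ (choices (map (concatMap opts) css)) (λ f → F (y ∷ f)))
    ≡⟨ ∑-concatMap opts cs _ ⟩
  ∑ cs (λ c → ∑ (opts c) (λ y → ∑ (choices (map (concatMap opts) css)) (λ f → F (y ∷ f))))
    ≡⟨ ∑-cong cs (λ c → ∑-cong (opts c) (λ y → refine opts css (λ f → F (y ∷ f)))) ⟩
  ∑ cs (λ c → ∑ (opts c) (λ y → ∑ (choices css) (λ ρ → ∑ (choices (map opts ρ)) (λ f → F (y ∷ f)))))
    ≡⟨ ∑-cong cs (λ c → ∑-swap (opts c) (choices css) (λ y ρ → ∑ (choices (map opts ρ)) (λ f → F (y ∷ f)))) ⟩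
  ∑ cs (λ c → ∑ (choices css) (λ ρ → ∑ (opts c) (λ y → ∑ (choices (map opts ρ)) (λ f → F (y ∷ f)))))
    ≡⟨ ∑-cong cs (λ c → ∑-cong (choices css) (λ ρ → sym (∑-choices (opts c) (map opts ρ) F))) ⟩
  ∑ cs (λ c → ∑ (choices css) (λ ρ → ∑ (choices (map opts (c ∷ ρ))) F))
    ≡⟨ sym (∑-choices cs css _) ⟩
  ∑ (choices (cs ∷ css)) (λ ρ → ∑ (choices (map opts ρ)) F) ∎
  where open ≡-Reasoning

∑-choices-++ : ∀ (Os Os′ : List (List A)) F →
  ∑ (choices (Os ++ Os′)) F ≡ ∑ (choices Os) (λ f → ∑ (choices Os′) (λ g → F (f ++ g)))
∑-choices-++ [] Os′ F = sym (+-identityʳ _)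
∑-choices-++ (O ∷ Os) Os′ F = trans (∑-choices O (Os ++ Os′) F)
  (trans (∑-cong O (λ y → ∑-choices-++ Os Os′ (λ f → F (y ∷ f)))) (sym (∑-choices O Os _)))

choices-concat : ∀ (Oss : List (List (List A))) F →
  ∑ (choices (concat Oss)) F ≡ ∑ (choices (map choices Oss)) (λ fs → F (concat fs))
choices-concat [] F = refl
choices-concat (Os ∷ Oss) F = trans (∑-choices-++ Os (concat Oss) F)
  (trans (∑-cong (choices Os) (λ f → choices-concat Oss (λ g → F (f ++ g)))) (sym (∑-choices (choices Os) (map choices Oss) _)))

-- Exponential tail bounds for independent choices

bernoulli : ∀ N k → N ^ k * (N + k) ≤ (1 + N) ^ k * N
bernoulli N zero = ≤-reflexive (e N)
  where
  e : ∀ N → 1 * (N + 0) ≡ 1 * N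
  e = solve-∀
bernoulli N (suc k) = begin
  N * N ^ k * (N + suc k)                      ≤⟨ m≤m+n _ (N ^ k * k) ⟩
  N * N ^ k * (N + suc k) + N ^ k * k          ≡⟨ e₁ N (N ^ k) k ⟩
  (1 + N) * (N ^ k * (N + k))                  ≤⟨ *-monoʳ-≤ (1 + N) (bernoulli N k) ⟩
  (1 + N) * ((1 + N) ^ k * N)                  ≡⟨ sym (*-assoc (1 + N) ((1 + N) ^ k) N) ⟩
  (1 + N) * (1 + N) ^ k * N                    ∎
  where
  open ≤-Reasoning
  e₁ : ∀ N a k → N * a * (N + (1 + k)) + a * k ≡ (1 + N) * (a * (N + k))
  e₁ = solve-∀

two-powers : ∀ N → 2 * N ^ suc N ≤ (1 + N) ^ suc N
two-powers zero = z≤n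
two-powers (suc M) = *-cancelʳ-≤ _ _ (suc M) (begin
  2 * N ^ suc N * N        ≡⟨ e N (N ^ N) ⟩
  N * (N ^ N * (N + N))    ≤⟨ *-mono-≤ (n≤1+n N) (bernoulli N N) ⟩
  (1 + N) * ((1 + N) ^ N * N) ≡⟨ sym (*-assoc (1 + N) ((1 + N) ^ N) N) ⟩
  (1 + N) ^ suc N * N      ∎)
  where
  open ≤-Reasoning
  N = suc M
  e : ∀ N a → 2 * (N * a) * N ≡ N * (a * (N + N))
  e = solve-∀

*-^ : ∀ a b k → (a * b) ^ k ≡ a ^ k * b ^ k
*-^ a b zero = refl
*-^ a b (suc k) rewrite *-^ a b k = e a b (a ^ k) (b ^ k)
  where
  e : ∀ a b c d → a * b * (c * d) ≡ a * c * (b * d)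
  e = solve-∀

-- If a trial succeeds with probability 1/(1 + N), then 1 + N trials all fail with probability at
-- most 1/2. Hence any factor 2^k is gained from linearly many sites, with a rate depending only on
-- `N`.
power-gap : ∀ N k → 2 ^ k * N ^ (suc N * k) ≤ (1 + N) ^ (suc N * k)
power-gap N k = begin
  2 ^ k * N ^ (suc N * k)      ≡⟨ cong (2 ^ k *_) (sym (^-*-assoc N (suc N) k)) ⟩
  2 ^ k * (N ^ suc N) ^ k      ≡⟨ sym (*-^ 2 (N ^ suc N) k) ⟩
  (2 * N ^ suc N) ^ k          ≤⟨ ^-monoˡ-≤ k (two-powers N) ⟩
  ((1 + N) ^ suc N) ^ k        ≡⟨ ^-*-assoc (1 + N) (suc N) k ⟩
  (1 + N) ^ (suc N * k)        ∎
  where open ≤-Reasoning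

power-gap-mono : ∀ Z N {m m′} → m ≤ m′ → Z * N ^ m ≤ (1 + N) ^ m → Z * N ^ m′ ≤ (1 + N) ^ m′
power-gap-mono Z N {m} {m′} m≤m′ h = subst (λ k → Z * N ^ k ≤ (1 + N) ^ k) (m+[n∸m]≡n m≤m′) (begin
  Z * N ^ (m + k)              ≡⟨ cong (Z *_) (^-distribˡ-+-* N m k) ⟩
  Z * (N ^ m * N ^ k)          ≡⟨ sym (*-assoc Z _ _) ⟩
  Z * N ^ m * N ^ k            ≤⟨ *-mono-≤ h (^-monoˡ-≤ k (n≤1+n N)) ⟩
  (1 + N) ^ m * (1 + N) ^ k    ≡⟨ sym (^-distribˡ-+-* (1 + N) m k) ⟩
  (1 + N) ^ (m + k)            ∎)
  where
  open ≤-Reasoning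
  k = m′ ∸ m

-- Cells flagged by isOn are the ones left random; a live site has at most
-- (1 + N) / 2 choices, at least one of them in an on-cell.
module Tail {S C B : Set} (cells : S → List C) (opts : C → List B) (isOn : C → Bool) (live : S → Bool) (N : ℕ) where

  len : C → ℕ
  len c = length (opts c)

  Ω : S → ℕ
  Ω σ = ∑ (cells σ) len

  onCount : List C → ℕ
  onCount ρ = ∑ ρ (λ c → ⟦ isOn c ⟧)

  -- Up to the factor 2 per site that keeps it integral, a product of these weights is the size of
  -- the pattern times 2^(- onCount), the integrand of an exponential moment.
  wt : C → ℕ
  wt c = (if isOn c then 1 else 2) * len c

  Bounded : S → Set
  Bounded σ = live σ ≡ true → 1 ≤ ∑ (cells σ) (λ c → ⟦ isOn c ⟧ * len c) × 2 * Ω σ ≤ 1 + N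

  ∑wt : ∀ σ → ∑ (cells σ) wt + ∑ (cells σ) (λ c → ⟦ isOn c ⟧ * len c) ≡ 2 * Ω σ
  ∑wt σ = trans (sym (∑-+ (cells σ) wt _)) (trans (∑-cong (cells σ) local) (∑-*ˡ (cells σ) 2 len))
    where
    local : ∀ c → wt c + ⟦ isOn c ⟧ * len c ≡ 2 * len c
    local c with isOn c
    ... | true = e (len c)
      where e : ∀ a → 1 * a + 1 * a ≡ 2 * a
            e = solve-∀
    ... | false = +-identityʳ _

  liveCount : List S → ℕ
  liveCount σs = ∑ σs (λ σ → ⟦ live σ ⟧)

  -- By `∑wt` a live site loses at least one unit out of `2 * Ω σ`, which is at most 1 + N; so it
  -- contributes a factor N/(1 + N).
  weight-product : ∀ σs → (∀ σ → σ ∈ σs → Bounded σ) →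
    (1 + N) ^ liveCount σs * ∏ σs (λ σ → ∑ (cells σ) wt) ≤ N ^ liveCount σs * ∏ σs (λ σ → 2 * Ω σ)
  weight-product [] h = ≤-refl
  weight-product (σ ∷ σs) h = begin
    (1 + N) ^ (⟦ live σ ⟧ + liveCount σs) * (∑ (cells σ) wt * ∏ σs _)
      ≡⟨ trans (cong (_* (∑ (cells σ) wt * ∏ σs _)) (^-distribˡ-+-* (1 + N) ⟦ live σ ⟧ _)) (e ((1 + N) ^ ⟦ live σ ⟧) _ _ _) ⟩
    ((1 + N) ^ ⟦ live σ ⟧ * ∑ (cells σ) wt) * ((1 + N) ^ liveCount σs * ∏ σs (λ σ → ∑ (cells σ) wt))
      ≤⟨ *-mono-≤ (local (≡true-or-false (live σ))) (weight-product σs (λ τ τ∈ → h τ (there τ∈))) ⟩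
    (N ^ ⟦ live σ ⟧ * (2 * Ω σ)) * (N ^ liveCount σs * ∏ σs (λ σ → 2 * Ω σ))
      ≡⟨ sym (trans (cong (_* ((2 * Ω σ) * ∏ σs (λ σ → 2 * Ω σ))) (^-distribˡ-+-* N ⟦ live σ ⟧ _)) (e (N ^ ⟦ live σ ⟧) _ _ _)) ⟩
    N ^ (⟦ live σ ⟧ + liveCount σs) * ((2 * Ω σ) * ∏ σs (λ σ → 2 * Ω σ)) ∎
    where
    open ≤-Reasoning
    e : ∀ a b c d → a * b * (c * d) ≡ a * c * (b * d)
    e = solve-∀
    w≤ : ∑ (cells σ) wt ≤ 2 * Ω σ
    w≤ = ≤-trans (m≤m+n _ _) (≤-reflexive (∑wt σ))
    live-case : live σ ≡ true → (1 + N) * ∑ (cells σ) wt ≤ N * (2 * Ω σ)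
    live-case q = +-cancelʳ-≤ (1 + N) _ _ (begin
      (1 + N) * ∑ (cells σ) wt + (1 + N)                     ≡⟨ e₂ (1 + N) (∑ (cells σ) wt) ⟩
      (1 + N) * (∑ (cells σ) wt + 1)                         ≤⟨ *-monoʳ-≤ (1 + N) (+-monoʳ-≤ (∑ (cells σ) wt) (proj₁ (h σ (here refl) q))) ⟩
      (1 + N) * (∑ (cells σ) wt + ∑ (cells σ) (λ c → ⟦ isOn c ⟧ * len c)) ≡⟨ cong ((1 + N) *_) (∑wt σ) ⟩
      (1 + N) * (2 * Ω σ)                                    ≡⟨ +-comm (2 * Ω σ) _ ⟩
      N * (2 * Ω σ) + 2 * Ω σ                                ≤⟨ +-monoʳ-≤ (N * (2 * Ω σ)) (proj₂ (h σ (here refl) q)) ⟩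
      N * (2 * Ω σ) + (1 + N)                                ∎)
      where
      e₂ : ∀ a b → a * b + a ≡ a * (b + 1)
      e₂ = solve-∀
    local : live σ ≡ true ⊎ live σ ≡ false → (1 + N) ^ ⟦ live σ ⟧ * ∑ (cells σ) wt ≤ N ^ ⟦ live σ ⟧ * (2 * Ω σ)
    local (inj₁ q) rewrite q = subst₂ (λ a b → a * ∑ (cells σ) wt ≤ b * (2 * Ω σ)) (sym (*-identityʳ (1 + N))) (sym (*-identityʳ N)) (live-case q)
    local (inj₂ q) rewrite q = *-monoʳ-≤ 1 w≤

  -- Markov's inequality for 2^(- onCount).
  few-on : ∀ t ρ → ⟦ onCount ρ <ᵇ t ⟧ * ∏ ρ (λ c → 2 * len c) ≤ 2 ^ t * ∏ ρ wt
  few-on t ρ with onCount ρ <ᵇ t in eq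
  ... | false = z≤n
  ... | true = begin
    1 * ∏ ρ (λ c → 2 * len c)        ≡⟨ trans (*-identityˡ _) (sym (weights ρ)) ⟩
    2 ^ onCount ρ * ∏ ρ wt           ≤⟨ *-monoˡ-≤ (∏ ρ wt) (^-monoʳ-≤ 2 (<⇒≤ (<ᵇ⇒< (onCount ρ) t (Equivalence.from T-≡ eq)))) ⟩
    2 ^ t * ∏ ρ wt                   ∎
    where
    open ≤-Reasoning
    weights : ∀ ρ → 2 ^ onCount ρ * ∏ ρ wt ≡ ∏ ρ (λ c → 2 * len c)
    weights [] = refl
    weights (c ∷ ρ) = trans (cong (_* (wt c * ∏ ρ wt)) (^-distribˡ-+-* 2 ⟦ isOn c ⟧ (onCount ρ)))
      (trans (e (2 ^ ⟦ isOn c ⟧) _ (wt c) _) (cong₂ _*_ local (weights ρ)))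
      where
      e : ∀ a b c d → a * b * (c * d) ≡ a * c * (b * d)
      e = solve-∀
      local : 2 ^ ⟦ isOn c ⟧ * wt c ≡ 2 * len c
      local with isOn c
      ... | true = cong (2 *_) (*-identityˡ (len c))
      ... | false = *-identityˡ _

  length-∈choices : ∀ (Os : List (List A)) {f} → f ∈ choices Os → length f ≡ length Os
  length-∈choices Os f∈ = PW.Pointwise-length (∈-choices⁻ Os f∈)

  tail-bound : ∀ σs Y t → (∀ σ → σ ∈ σs → Bounded σ) → Y * 2 ^ t * N ^ liveCount σs ≤ (1 + N) ^ liveCount σs →
    Y * ∑ (choices (map cells σs)) (λ ρ → ⟦ onCount ρ <ᵇ t ⟧ * ∏ ρ len) ≤ ∏ σs Ω
  tail-bound σs Y t h small = *-cancelˡ-≤ (2 ^ length σs) {{m^n≢0 2 (length σs)}} (*-cancelˡ-≤ ((1 + N) ^ m) {{m^n≢0 (1 + N) m}} (begin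
    (1 + N) ^ m * (2 ^ length σs * (Y * ∑ ρs f))
      ≡⟨ e₁ ((1 + N) ^ m) (2 ^ length σs) Y (∑ ρs f) ⟩
    (1 + N) ^ m * (Y * (2 ^ length σs * ∑ ρs f))
      ≡⟨ cong (λ k → (1 + N) ^ m * (Y * k)) (trans (sym (∑-*ˡ ρs (2 ^ length σs) f)) (∑-cong∈ ρs doubled)) ⟩
    (1 + N) ^ m * (Y * ∑ ρs (λ ρ → ⟦ onCount ρ <ᵇ t ⟧ * ∏ ρ (λ c → 2 * len c)))
      ≤⟨ *-monoʳ-≤ ((1 + N) ^ m) (*-monoʳ-≤ Y (∑-mono ρs (few-on t))) ⟩
    (1 + N) ^ m * (Y * ∑ ρs (λ ρ → 2 ^ t * ∏ ρ wt))
      ≡⟨ cong (λ k → (1 + N) ^ m * (Y * k)) (trans (∑-*ˡ ρs (2 ^ t) (λ ρ → ∏ ρ wt))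
           (cong (2 ^ t *_) (trans (∑-choices-∏ (map cells σs) wt) (∏-map cells σs (λ cs → ∑ cs wt))))) ⟩
    (1 + N) ^ m * (Y * (2 ^ t * ∏ σs (λ σ → ∑ (cells σ) wt)))
      ≡⟨ e₂ ((1 + N) ^ m) Y (2 ^ t) _ ⟩
    Y * 2 ^ t * ((1 + N) ^ m * ∏ σs (λ σ → ∑ (cells σ) wt))
      ≤⟨ *-monoʳ-≤ (Y * 2 ^ t) (weight-product σs h) ⟩
    Y * 2 ^ t * (N ^ m * ∏ σs (λ σ → 2 * Ω σ))
      ≡⟨ sym (*-assoc (Y * 2 ^ t) (N ^ m) _) ⟩
    Y * 2 ^ t * N ^ m * ∏ σs (λ σ → 2 * Ω σ)
      ≤⟨ *-monoˡ-≤ _ small ⟩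
    (1 + N) ^ m * ∏ σs (λ σ → 2 * Ω σ)
      ≡⟨ cong ((1 + N) ^ m *_) (trans (∏-* σs (λ _ → 2) Ω) (cong (_* ∏ σs Ω) (∏-const σs 2))) ⟩
    (1 + N) ^ m * (2 ^ length σs * ∏ σs Ω) ∎))
    where
    open ≤-Reasoning
    m = liveCount σs
    ρs = choices (map cells σs)
    f : List C → ℕ
    f ρ = ⟦ onCount ρ <ᵇ t ⟧ * ∏ ρ len
    e₁ : ∀ a b c d → a * (b * (c * d)) ≡ a * (c * (b * d))
    e₁ = solve-∀
    e₂ : ∀ a b c d → a * (b * (c * d)) ≡ b * c * (a * d)
    e₂ = solve-∀
    rot : ∀ a b c → a * (b * c) ≡ b * (a * c)
    rot = solve-∀
    doubled : ∀ ρ → ρ ∈ ρs → 2 ^ length σs * f ρ ≡ ⟦ onCount ρ <ᵇ t ⟧ * ∏ ρ (λ c → 2 * len c)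
    doubled ρ ρ∈ = trans (rot (2 ^ length σs) ⟦ onCount ρ <ᵇ t ⟧ (∏ ρ len)) (cong (⟦ onCount ρ <ᵇ t ⟧ *_)
      (sym (trans (∏-* ρ (λ _ → 2) len) (cong (_* ∏ ρ len) (trans (∏-const ρ 2) (cong (2 ^_) (trans (length-∈choices (map cells σs) ρ∈) (length-map cells σs))))))))

  ∑-len : ∀ σs → ∑ (choices (map cells σs)) (λ ρ → ∏ ρ len) ≡ ∏ σs Ω
  ∑-len σs = trans (∑-choices-∏ (map cells σs) len) (∏-map cells σs (λ cs → ∑ cs len))

  -- Patterns with fewer than `t` on-cells have total weight at most the fraction 1/a, so the
  -- trivial bound on `I` is enough for them; they account for the 1 in `1 + b`.
  conditional-bound : ∀ σs a b t → (∀ σ → σ ∈ σs → Bounded σ) → a * 2 ^ t * N ^ liveCount σs ≤ (1 + N) ^ liveCount σs →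
    ∀ (I : List C → ℕ) → (∀ ρ → ρ ∈ choices (map cells σs) → I ρ ≤ ∏ ρ len) →
    (∀ ρ → ρ ∈ choices (map cells σs) → t ≤ onCount ρ → a * I ρ ≤ b * ∏ ρ len) →
    a * ∑ (choices (map cells σs)) I ≤ (1 + b) * ∏ σs Ω
  conditional-bound σs a b t bounded small I I≤ aI≤ = begin
    a * ∑ ρs I
      ≡⟨ sym (∑-*ˡ ρs a I) ⟩
    ∑ ρs (λ ρ → a * I ρ)
      ≤⟨ ∑-mono∈ ρs local ⟩
    ∑ ρs (λ ρ → b * ∏ ρ len + a * (⟦ onCount ρ <ᵇ t ⟧ * ∏ ρ len))
      ≡⟨ trans (∑-+ ρs (λ ρ → b * ∏ ρ len) (λ ρ → a * (⟦ onCount ρ <ᵇ t ⟧ * ∏ ρ len)))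
               (cong₂ _+_ (trans (∑-*ˡ ρs b (λ ρ → ∏ ρ len)) (cong (b *_) (∑-len σs))) (∑-*ˡ ρs a _)) ⟩
    b * ∏ σs Ω + a * ∑ ρs (λ ρ → ⟦ onCount ρ <ᵇ t ⟧ * ∏ ρ len)
      ≤⟨ +-monoʳ-≤ (b * ∏ σs Ω) (tail-bound σs a t bounded small) ⟩
    b * ∏ σs Ω + ∏ σs Ω
      ≡⟨ +-comm (b * ∏ σs Ω) _ ⟩
    (1 + b) * ∏ σs Ω ∎
    where
    open ≤-Reasoning
    ρs = choices (map cells σs)
    local : ∀ ρ → ρ ∈ ρs → a * I ρ ≤ b * ∏ ρ len + a * (⟦ onCount ρ <ᵇ t ⟧ * ∏ ρ len)
    local ρ ρ∈ with onCount ρ <ᵇ t in eq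
    ... | true = ≤-trans (*-monoʳ-≤ a (≤-trans (I≤ ρ ρ∈) (≤-reflexive (sym (*-identityˡ _))))) (m≤n+m _ _)
    ... | false = ≤-trans (aI≤ ρ ρ∈ (≮⇒≥ (λ q → true≢false (trans (sym (Equivalence.to T-≡ (<⇒<ᵇ q))) eq)))) (m≤m+n _ _)

-- Anticoncentration of binomial coefficients and of switches

-- bico a b is the binomial coefficient (a + b choose a).
bico : ℕ → ℕ → ℕ
bico zero b = 1
bico (suc a) zero = 1
bico (suc a) (suc b) = bico a (suc b) + bico (suc a) b

bico-zeroʳ : ∀ a → bico a 0 ≡ 1
bico-zeroʳ zero = refl
bico-zeroʳ (suc a) = refl

bico-sym : ∀ a b → bico a b ≡ bico b a
bico-sym zero b = sym (bico-zeroʳ b)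
bico-sym (suc a) zero = refl
bico-sym (suc a) (suc b) = trans (cong₂ _+_ (bico-sym a (suc b)) (bico-sym (suc a) b)) (+-comm (bico (suc b) a) _)

bico-absorb : ∀ a b → suc a * bico (suc a) b ≡ (suc a + b) * bico a b
bico-absorb a zero = trans (*-identityʳ (suc a)) (sym (trans (cong₂ _*_ (+-identityʳ (suc a)) (bico-zeroʳ a)) (*-identityʳ (suc a))))
bico-absorb zero (suc b) = trans (*-identityˡ _) (trans (cong suc (bico-one b)) (sym (*-identityʳ _)))
  where
  bico-one : ∀ b → bico 1 b ≡ suc b
  bico-one zero = refl
  bico-one (suc b) = cong suc (bico-one b)
bico-absorb (suc a) (suc b) = begin
  suc (suc a) * (bico (suc a) (suc b) + bico (suc (suc a)) b)
    ≡⟨ e₁ a (bico (suc a) (suc b)) (bico (suc (suc a)) b) ⟩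
  bico (suc a) (suc b) + suc a * bico (suc a) (suc b) + suc (suc a) * bico (suc (suc a)) b
    ≡⟨ cong₂ (λ p q → bico (suc a) (suc b) + p + q) (bico-absorb a (suc b)) (bico-absorb (suc a) b) ⟩
  bico (suc a) (suc b) + (suc a + suc b) * bico a (suc b) + (suc (suc a) + b) * bico (suc a) b
    ≡⟨ e₂ a b (bico (suc a) (suc b)) (bico a (suc b)) (bico (suc a) b) ⟩
  bico (suc a) (suc b) + (suc (suc a) + b) * (bico a (suc b) + bico (suc a) b)
    ≡⟨ e₃ a b (bico (suc a) (suc b)) ⟩
  (suc (suc a) + suc b) * bico (suc a) (suc b) ∎
  where
  open ≡-Reasoning
  e₁ : ∀ a p q → (2 + a) * (p + q) ≡ p + (1 + a) * p + (2 + a) * q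
  e₁ = solve-∀
  e₂ : ∀ a b u p q → u + (1 + a + (1 + b)) * p + (2 + a + b) * q ≡ u + (2 + a + b) * (p + q)
  e₂ = solve-∀
  e₃ : ∀ a b u → u + (2 + a + b) * u ≡ (2 + a + (1 + b)) * u
  e₃ = solve-∀

-- The bound C(2a, a) ≤ 4^a / √(2a + 1) and its analogue in odd rows, squared. They support each
-- other because neighbouring central coefficients have an explicit ratio; the only loss is (2a +
-- 1)(2a + 3) < 4(a + 1)².
bico-central : ∀ a → (2 * a + 1) * (bico a a * bico a a) ≤ 16 ^ a
bico-near : ∀ a → (2 * a + 3) * (bico a (suc a) * bico a (suc a)) ≤ 4 * 16 ^ a

bico-central zero = ≤-refl
bico-central (suc a) = begin
  (2 * suc a + 1) * (bico (suc a) (suc a) * bico (suc a) (suc a))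
    ≡⟨ cong (λ k → (2 * suc a + 1) * (k * k)) (trans (cong (w +_) (bico-sym (suc a) a)) (cong (w +_) (sym (+-identityʳ w)))) ⟩
  (2 * suc a + 1) * ((2 * w) * (2 * w))   ≡⟨ e a w ⟩
  4 * ((2 * a + 3) * (w * w))             ≤⟨ *-monoʳ-≤ 4 (bico-near a) ⟩
  4 * (4 * 16 ^ a)                        ≡⟨ sym (*-assoc 4 4 (16 ^ a)) ⟩
  16 ^ suc a                              ∎
  where
  open ≤-Reasoning
  w = bico a (suc a)
  e : ∀ a w → (2 * (1 + a) + 1) * ((2 * w) * (2 * w)) ≡ 4 * ((2 * a + 3) * (w * w))
  e = solve-∀

bico-near a = *-cancelˡ-≤ (suc a * suc a) (begin
  suc a * suc a * ((2 * a + 3) * (w * w))          ≡⟨ e₁ (suc a) (2 * a + 3) w ⟩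
  (2 * a + 3) * ((suc a * w) * (suc a * w))        ≡⟨ cong (λ k → (2 * a + 3) * (k * k)) rel ⟩
  (2 * a + 3) * (((2 * a + 1) * u) * ((2 * a + 1) * u)) ≡⟨ e₂ a u ⟩
  ((2 * a + 3) * (2 * a + 1)) * ((2 * a + 1) * (u * u)) ≤⟨ *-mono-≤ (≤-trans (m≤m+n _ 1) (≤-reflexive (e₃ a))) (bico-central a) ⟩
  (4 * (suc a * suc a)) * 16 ^ a                   ≡⟨ e₄ (suc a * suc a) (16 ^ a) ⟩
  suc a * suc a * (4 * 16 ^ a)                     ∎)
  where
  open ≤-Reasoning
  w = bico a (suc a)
  u = bico a a
  rel : suc a * w ≡ (2 * a + 1) * u
  rel = trans (cong (suc a *_) (bico-sym a (suc a))) (trans (bico-absorb a a) (cong (_* u) (e₀ a)))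
    where
    e₀ : ∀ a → 1 + a + a ≡ 2 * a + 1
    e₀ = solve-∀
  e₁ : ∀ s k w → s * s * (k * (w * w)) ≡ k * ((s * w) * (s * w))
  e₁ = solve-∀
  e₂ : ∀ a u → (2 * a + 3) * (((2 * a + 1) * u) * ((2 * a + 1) * u)) ≡ ((2 * a + 3) * (2 * a + 1)) * ((2 * a + 1) * (u * u))
  e₂ = solve-∀
  e₃ : ∀ a → (2 * a + 3) * (2 * a + 1) + 1 ≡ 4 * ((1 + a) * (1 + a))
  e₃ = solve-∀
  e₄ : ∀ s p → (4 * s) * p ≡ s * (4 * p)
  e₄ = solve-∀

16^a : ∀ a → 16 ^ a ≡ 4 ^ (a + a)
16^a a = trans (*-^ 4 4 a) (sym (^-distribˡ-+-* 4 a a))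

-- Moving towards the diagonal increases bico.
bico-bound′ : ∀ k a → (a + (a + k)) * (bico a (a + k) * bico a (a + k)) ≤ 4 ^ (a + (a + k))
bico-bound′ zero a rewrite +-identityʳ a = begin
  (a + a) * (bico a a * bico a a)     ≤⟨ *-monoˡ-≤ (bico a a * bico a a) (≤-trans (m≤m+n (a + a) 1) (≤-reflexive (e a))) ⟩
  (2 * a + 1) * (bico a a * bico a a) ≤⟨ bico-central a ⟩
  16 ^ a                              ≡⟨ 16^a a ⟩
  4 ^ (a + a)                         ∎
  where
  open ≤-Reasoning
  e : ∀ a → a + a + 1 ≡ 2 * a + 1
  e = solve-∀
bico-bound′ (suc zero) a rewrite +-comm a 1 = begin
  (a + suc a) * (w * w)   ≤⟨ *-monoˡ-≤ (w * w) (≤-trans (m≤m+n (a + suc a) 2) (≤-reflexive (e a))) ⟩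
  (2 * a + 3) * (w * w)   ≤⟨ bico-near a ⟩
  4 * 16 ^ a              ≡⟨ cong (4 *_) (16^a a) ⟩
  4 ^ suc (a + a)         ≡⟨ cong (4 ^_) (sym (+-suc a a)) ⟩
  4 ^ (a + suc a)         ∎
  where
  open ≤-Reasoning
  w = bico a (suc a)
  e : ∀ a → a + (1 + a) + 2 ≡ 2 * a + 3
  e = solve-∀
bico-bound′ (suc (suc k)) a = begin
  (a + (a + suc (suc k))) * (bico a (a + suc (suc k)) * bico a (a + suc (suc k)))
    ≡⟨ cong (λ j → (a + j) * (bico a j * bico a j)) e₀ ⟩
  (a + suc b) * (bico a (suc b) * bico a (suc b))
    ≤⟨ *-mono-≤ (≤-reflexive (+-suc a b)) (*-mono-≤ closer closer) ⟩
  (suc a + b) * (bico (suc a) b * bico (suc a) b)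
    ≤⟨ bico-bound′ k (suc a) ⟩
  4 ^ (suc a + b)
    ≡⟨ cong (4 ^_) (sym (trans (cong (a +_) e₀) (+-suc a b))) ⟩
  4 ^ (a + (a + suc (suc k))) ∎
  where
  open ≤-Reasoning
  b = suc a + k
  e₀ : a + suc (suc k) ≡ suc b
  e₀ = trans (+-suc a (suc k)) (cong suc (+-suc a k))
  closer : bico a (suc b) ≤ bico (suc a) b
  closer = *-cancelˡ-≤ (suc b) (begin
    suc b * bico a (suc b)       ≡⟨ cong (suc b *_) (bico-sym a (suc b)) ⟩
    suc b * bico (suc b) a       ≡⟨ bico-absorb b a ⟩
    (suc b + a) * bico b a       ≡⟨ cong₂ _*_ (trans (+-comm (suc b) a) (+-suc a b)) (bico-sym b a) ⟩
    (suc a + b) * bico a b       ≡⟨ sym (bico-absorb a b) ⟩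
    suc a * bico (suc a) b       ≤⟨ *-monoˡ-≤ (bico (suc a) b) (≤-trans (m≤m+n (suc a) k) (n≤1+n b)) ⟩
    suc b * bico (suc a) b       ∎)

bico-bound : ∀ a b → (a + b) * (bico a b * bico a b) ≤ 4 ^ (a + b)
bico-bound a b with ≤-total a b
... | inj₁ a≤b = subst (λ k → (a + k) * (bico a k * bico a k) ≤ 4 ^ (a + k)) (m+[n∸m]≡n a≤b) (bico-bound′ (b ∸ a) a)
... | inj₂ b≤a rewrite +-comm a b | bico-sym a b =
  subst (λ k → (b + k) * (bico b k * bico b k) ≤ 4 ^ (b + k)) (m+[n∸m]≡n b≤a) (bico-bound′ (a ∸ b) b)

-- The coefficient `M` choose `x`, zero for `x > M`. This indexing follows the number of heads among
-- `M` coins, while `bico` is symmetric and suits the induction towards the diagonal.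
bin : ℕ → ℕ → ℕ
bin zero zero = 1
bin zero (suc x) = 0
bin (suc M) zero = bin M zero
bin (suc M) (suc x) = bin M x + bin M (suc x)

bin-zero : ∀ M → bin M 0 ≡ 1
bin-zero zero = refl
bin-zero (suc M) = bin-zero M

bin-large : ∀ M x → M < x → bin M x ≡ 0
bin-large zero (suc x) _ = refl
bin-large (suc M) (suc x) (s≤s p) = cong₂ _+_ (bin-large M x p) (bin-large M (suc x) (m≤n⇒m≤1+n p))

bin-bico : ∀ a b → bin (a + b) a ≡ bico a b
bin-bico zero b = bin-zero b
bin-bico (suc a) zero rewrite +-identityʳ a = cong₂ _+_
  (trans (cong (λ k → bin k a) (sym (+-identityʳ a))) (trans (bin-bico a 0) (bico-zeroʳ a))) (bin-large a (suc a) ≤-refl)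
bin-bico (suc a) (suc b) = cong₂ _+_ (bin-bico a (suc b))
  (trans (cong (λ k → bin k (suc a)) (+-suc a b)) (bin-bico (suc a) b))

square-cancel-≤ : ∀ {a b} → a * a ≤ b * b → a ≤ b
square-cancel-≤ {a} {b} h = ≮⇒≥ (λ p → <⇒≱ (*-mono-< p p) h)

-- No value of a fair binomial variable with `M` trials has probability above 1/√M; squares are
-- compared to avoid the root.
bin-anticoncentration : ∀ R M x → R * R ≤ M → R * bin M x ≤ 2 ^ M
bin-anticoncentration R M x h with x ≤? M
... | no q = ≤-trans (≤-reflexive (trans (cong (R *_) (bin-large M x (≰⇒> q))) (*-zeroʳ R))) z≤n
... | yes x≤M = square-cancel-≤ (begin
  (R * bin M x) * (R * bin M x)         ≡⟨ e R (bin M x) ⟩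
  R * R * (bin M x * bin M x)           ≤⟨ *-monoˡ-≤ (bin M x * bin M x) h ⟩
  M * (bin M x * bin M x)               ≡⟨ cong (λ k → k * (bin k x * bin k x)) (sym (m+[n∸m]≡n x≤M)) ⟩
  (x + y) * (bin (x + y) x * bin (x + y) x) ≡⟨ cong (λ k → (x + y) * (k * k)) (bin-bico x y) ⟩
  (x + y) * (bico x y * bico x y)       ≤⟨ bico-bound x y ⟩
  4 ^ (x + y)                           ≡⟨ cong (4 ^_) (m+[n∸m]≡n x≤M) ⟩
  4 ^ M                                 ≡⟨ *-^ 2 2 M ⟩
  2 ^ M * 2 ^ M                         ∎)
  where
  open ≤-Reasoning
  y = M ∸ x
  e : ∀ r b → (r * b) * (r * b) ≡ r * r * (b * b)
  e = solve-∀

bin≤2^ : ∀ M x → bin M x ≤ 2 ^ M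
bin≤2^ zero zero = ≤-refl
bin≤2^ zero (suc x) = z≤n
bin≤2^ (suc M) zero = ≤-trans (bin≤2^ M zero) (m≤m+n _ _)
bin≤2^ (suc M) (suc x) = ≤-trans (+-mono-≤ (bin≤2^ M x) (bin≤2^ M (suc x))) (≤-reflexive (cong (2 ^ M +_) (sym (+-identityʳ _))))

-- sw p q : a fair coin decides between p and q; fx o : the choice o is fixed.
data Cell (A : Set) : Set where
  sw : A → A → Cell A
  fx : A → Cell A

opts : Cell A → List (Bool × A)
opts (sw p q) = (true , p) ∷ (false , q) ∷ []
opts (fx o) = (false , o) ∷ []

isSw : Cell A → Bool
isSw (sw _ _) = true
isSw (fx _) = false

outcomes : List (Cell A) → List (List (Bool × A))
outcomes ρ = choices (map opts ρ)

#p : List (Bool × A) → ℕ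
#p ω = ∑ ω (λ x → ⟦ proj₁ x ⟧)

#sw : List (Cell A) → ℕ
#sw ρ = ∑ ρ (λ c → ⟦ isSw c ⟧)

∑-outcomes-#p : ∀ (ρ : List (Cell A)) x → ∑ (outcomes ρ) (λ ω → ⟦ #p ω ≡ᵇ x ⟧) ≡ bin (#sw ρ) x
∑-outcomes-#p [] zero = refl
∑-outcomes-#p [] (suc x) = refl
∑-outcomes-#p (fx o ∷ ρ) x = trans (∑-choices (opts (fx o)) (map opts ρ) (λ ω → ⟦ #p ω ≡ᵇ x ⟧))
  (trans (+-identityʳ _) (∑-outcomes-#p ρ x))
∑-outcomes-#p (sw p q ∷ ρ) zero = trans (∑-choices (opts (sw p q)) (map opts ρ) (λ ω → ⟦ #p ω ≡ᵇ zero ⟧))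
  (trans (cong₂ _+_ (∑-0 (outcomes ρ)) (+-identityʳ _)) (∑-outcomes-#p ρ zero))
∑-outcomes-#p (sw p q ∷ ρ) (suc x) = trans (∑-choices (opts (sw p q)) (map opts ρ) (λ ω → ⟦ #p ω ≡ᵇ suc x ⟧))
  (cong₂ _+_ (∑-outcomes-#p ρ x) (trans (+-identityʳ _) (∑-outcomes-#p ρ (suc x))))

size : Cell A → ℕ
size c = length (opts c)

∏-size : ∀ (ρ : List (Cell A)) → ∏ ρ size ≡ 2 ^ #sw ρ
∏-size [] = refl
∏-size (sw p q ∷ ρ) = cong (2 *_) (∏-size ρ)
∏-size (fx o ∷ ρ) = trans (*-identityˡ _) (∏-size ρ)

-- A site is the list of its cells, a segment is a list of sites.
hasSw : List (Cell A) → Bool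
hasSw cs = 1 ≤ᵇ #sw cs

sites : List (List (Cell A)) → List (List (Bool × A))
sites seg = choices (map (concatMap opts) seg)

siteSize : List (Cell A) → ℕ
siteSize cs = ∑ cs size

swSites : List (List (Cell A)) → ℕ
swSites seg = ∑ seg (λ cs → ⟦ hasSw cs ⟧)

module Switch {A : Set} (κ R N t : ℕ) (R²≤t : R * R ≤ t) where

  open Tail {S = List (Cell A)} id opts isSw hasSw N using (tail-bound; ∑-len; Bounded)

  -- Estimates `R` times the number of outcomes whose count is one of κ values: the first term
  -- suffices if there are at least `t` switches, the second is the trivial bound for the remaining
  -- patterns.
  bound : List (Cell A) → ℕ
  bound ρ = κ * (∏ ρ size + R * (⟦ #sw ρ <ᵇ t ⟧ * ∏ ρ size))

  weight : List (Bool × A) → List ℕ → ℕ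
  weight o v = ∑ v (λ x → ⟦ #p o ≡ᵇ x ⟧)

  segment-count : ∀ ρ v → length v ≤ κ → R * ∑ (outcomes ρ) (λ o → weight o v) ≤ bound ρ
  segment-count ρ v v≤κ = begin
    R * ∑ (outcomes ρ) (λ o → ∑ v (λ x → ⟦ #p o ≡ᵇ x ⟧))
      ≡⟨ cong (R *_) (trans (∑-swap (outcomes ρ) v (λ o x → ⟦ #p o ≡ᵇ x ⟧)) (∑-cong v (∑-outcomes-#p ρ))) ⟩
    R * ∑ v (bin (#sw ρ))
      ≡⟨ sym (∑-*ˡ v R (bin (#sw ρ))) ⟩
    ∑ v (λ x → R * bin (#sw ρ) x)
      ≤⟨ ∑-mono v each ⟩
    ∑ v (λ _ → ∏ ρ size + R * (⟦ #sw ρ <ᵇ t ⟧ * ∏ ρ size))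
      ≡⟨ ∑-const v _ ⟩
    length v * (∏ ρ size + R * (⟦ #sw ρ <ᵇ t ⟧ * ∏ ρ size))
      ≤⟨ *-monoˡ-≤ _ v≤κ ⟩
    bound ρ ∎
    where
    open ≤-Reasoning
    each : ∀ x → R * bin (#sw ρ) x ≤ ∏ ρ size + R * (⟦ #sw ρ <ᵇ t ⟧ * ∏ ρ size)
    each x rewrite ∏-size ρ with #sw ρ <ᵇ t in eq
    ... | true = ≤-trans (*-monoʳ-≤ R (≤-trans (bin≤2^ (#sw ρ) x) (≤-reflexive (sym (*-identityˡ _))))) (m≤n+m _ _)
    ... | false = ≤-trans (bin-anticoncentration R (#sw ρ) x (≤-trans R²≤t
                    (≮⇒≥ (λ q → true≢false (trans (sym (Equivalence.to T-≡ (<⇒<ᵇ q))) eq))))) (m≤m+n _ _)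

  Constrained : List (List (Cell A)) → (List (List (Bool × A)) → ℕ) → List (List ℕ) → Set
  Constrained ρs F Vs = ∀ ω → ω ∈ choices (map outcomes ρs) → 0 < F ω → Pointwise (λ o v → #p o ∈ v) ω Vs

  -- One segment is split off at a time: at most κ values of its count survive, and for each of its
  -- outcomes `o` the other segments face the same problem with the function of the remaining
  -- outcomes. The segment bounds multiply because `Vs` is fixed before the outcomes are drawn.
  pattern-bound : ∀ ρs Vs F → (∀ ω → F ω ≤ 1) → All (λ v → length v ≤ κ) Vs → Constrained ρs F Vs →
    R ^ length ρs * ∑ (choices (map outcomes ρs)) F ≤ ∏ ρs bound
  pattern-bound [] Vs F F≤1 short con = ≤-trans (≤-reflexive (trans (*-identityˡ _) (+-identityʳ _))) (F≤1 [])
  pattern-bound (ρ ∷ ρs) [] F F≤1 short con = ≤-trans (≤-reflexive (trans (cong (R ^ suc (length ρs) *_)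
    (∑-zero (choices (map outcomes (ρ ∷ ρs))) none)) (*-zeroʳ (R ^ suc (length ρs))))) z≤n
    where
    none : ∀ ω → ω ∈ choices (map outcomes (ρ ∷ ρs)) → F ω ≡ 0
    none ω ω∈ with F ω in eq
    ... | zero = refl
    ... | suc k with con ω ω∈ (subst (0 <_) (sym eq) (s≤s z≤n)) | ∈-choices⁻ (map outcomes (ρ ∷ ρs)) ω∈
    ...   | [] | ()
  pattern-bound (ρ ∷ ρs) (v ∷ Vs) F F≤1 (short ∷ shorts) con = begin
    R * R ^ length ρs * ∑ (choices (map outcomes (ρ ∷ ρs))) F
      ≡⟨ trans (cong (R * R ^ length ρs *_) (∑-choices (outcomes ρ) (map outcomes ρs) F)) (*-assoc R _ _) ⟩
    R * (R ^ length ρs * ∑ (outcomes ρ) G)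
      ≡⟨ cong (R *_) (sym (∑-*ˡ (outcomes ρ) (R ^ length ρs) G)) ⟩
    R * ∑ (outcomes ρ) (λ o → R ^ length ρs * G o)
      ≤⟨ *-monoʳ-≤ R (∑-mono∈ (outcomes ρ) each) ⟩
    R * ∑ (outcomes ρ) (λ o → weight o v * ∏ ρs bound)
      ≡⟨ trans (cong (R *_) (∑-*ʳ (outcomes ρ) (∏ ρs bound) (λ o → weight o v))) (sym (*-assoc R _ _)) ⟩
    R * ∑ (outcomes ρ) (λ o → weight o v) * ∏ ρs bound
      ≤⟨ *-monoˡ-≤ (∏ ρs bound) (segment-count ρ v short) ⟩
    bound ρ * ∏ ρs bound ∎
    where
    open ≤-Reasoning
    G : List (Bool × A) → ℕ
    G o = ∑ (choices (map outcomes ρs)) (λ ω → F (o ∷ ω))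
    ∈cons : ∀ {o ω} → o ∈ outcomes ρ → ω ∈ choices (map outcomes ρs) → o ∷ ω ∈ choices (map outcomes (ρ ∷ ρs))
    ∈cons o∈ ω∈ = ∈-choices⁺ (o∈ ∷ ∈-choices⁻ (map outcomes ρs) ω∈)
    member-weight : ∀ {o v} → #p o ∈ v → 1 ≤ weight o v
    member-weight {o} {v} q = ≤-trans (≤-reflexive (sym (⟦⟧-true (≡ᵇ-intro {#p o} refl)))) (∑-term (λ x → ⟦ #p o ≡ᵇ x ⟧) q)
    each : ∀ o → o ∈ outcomes ρ → R ^ length ρs * G o ≤ weight o v * ∏ ρs bound
    each o o∈ with G o in eq
    ... | zero = ≤-trans (≤-reflexive (*-zeroʳ (R ^ length ρs))) z≤n
    ... | suc k with ∑-pos (choices (map outcomes ρs)) (λ ω → F (o ∷ ω)) (subst (0 <_) (sym eq) (s≤s z≤n))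
    ...   | ω , ω∈ , pos with con (o ∷ ω) (∈cons o∈ ω∈) pos
    ...     | q ∷ _ = begin
      R ^ length ρs * suc k         ≡⟨ cong (R ^ length ρs *_) (sym eq) ⟩
      R ^ length ρs * G o           ≤⟨ pattern-bound ρs Vs (λ ω → F (o ∷ ω)) (λ ω → F≤1 (o ∷ ω)) shorts
                                         (λ ω′ ω′∈ p → tail (con (o ∷ ω′) (∈cons o∈ ω′∈) p)) ⟩
      ∏ ρs bound                    ≡⟨ sym (*-identityˡ _) ⟩
      1 * ∏ ρs bound                ≤⟨ *-monoˡ-≤ (∏ ρs bound) (member-weight {o} q) ⟩
      weight o v * ∏ ρs bound       ∎
      where
      tail : ∀ {o ω v Vs} → Pointwise (λ o v → #p o ∈ v) (o ∷ ω) (v ∷ Vs) → Pointwise (λ o v → #p o ∈ v) ω Vs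
      tail (_ ∷ p) = p

  -- The candidate lists may depend on the revealed cells and on one outcome `ω₀` detected by `F`; a
  -- pattern without such an outcome contributes nothing. Per segment the main term and the tail
  -- each give κ times the total, hence `2 * κ`.
  switch-bound : ∀ (segs : List (List (List (Cell A)))) (F : List (List (Bool × A)) → ℕ) → (∀ ω → F ω ≤ 1) →
    (∀ seg → seg ∈ segs → ∀ cs → cs ∈ seg → 2 * siteSize cs ≤ 1 + N) →
    (∀ seg → seg ∈ segs → R * 2 ^ t * N ^ swSites seg ≤ (1 + N) ^ swSites seg) →
    (∀ ρs → ρs ∈ choices (map choices segs) → ∀ ω₀ → ω₀ ∈ choices (map outcomes ρs) → 0 < F ω₀ →
       Σ (List (List ℕ)) λ Vs → All (λ v → length v ≤ κ) Vs × Constrained ρs F Vs) →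
    R ^ length segs * ∑ (choices (map sites segs)) F ≤ (2 * κ) ^ length segs * ∏ segs (λ seg → ∏ seg siteSize)
  switch-bound segs F F≤1 sizes small constrain = begin
    R ^ length segs * ∑ (choices (map sites segs)) F
      ≡⟨ cong (R ^ length segs *_) (trans (choices-cong (pw segs) F) (trans (cong (λ l → ∑ (choices l) F) (map-∘ segs)) (refine outcomes (map choices segs) F))) ⟩
    R ^ length segs * ∑ ρss (λ ρs → ∑ (choices (map outcomes ρs)) F)
      ≡⟨ sym (∑-*ˡ ρss (R ^ length segs) _) ⟩
    ∑ ρss (λ ρs → R ^ length segs * ∑ (choices (map outcomes ρs)) F)
      ≤⟨ ∑-mono∈ ρss each ⟩
    ∑ ρss (λ ρs → ∏ ρs bound)
      ≡⟨ trans (∑-choices-∏ (map choices segs) bound) (∏-map choices segs (λ l → ∑ l bound)) ⟩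
    ∏ segs (λ seg → ∑ (choices seg) bound)
      ≤⟨ ∏-mono∈ segs per-segment ⟩
    ∏ segs (λ seg → 2 * κ * ∏ seg siteSize)
      ≡⟨ trans (∏-* segs (λ _ → 2 * κ) (λ seg → ∏ seg siteSize)) (cong (_* ∏ segs (λ seg → ∏ seg siteSize)) (∏-const segs (2 * κ))) ⟩
    (2 * κ) ^ length segs * ∏ segs (λ seg → ∏ seg siteSize) ∎
    where
    open ≤-Reasoning
    ρss = choices (map choices segs)
    ∏-mono∈ : ∀ xs {f g : List (List (Cell A)) → ℕ} → (∀ x → x ∈ xs → f x ≤ g x) → ∏ xs f ≤ ∏ xs g
    ∏-mono∈ [] h = ≤-refl
    ∏-mono∈ (x ∷ xs) h = *-mono-≤ (h x (here refl)) (∏-mono∈ xs (λ y y∈ → h y (there y∈)))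
    pw : ∀ segs → Pointwise _≈_ (map sites segs) (map (concatMap outcomes ∘ choices) segs)
    pw [] = []
    pw (seg ∷ segs) = (λ G → trans (refine opts seg G) (sym (∑-concatMap outcomes (choices seg) G))) ∷ pw segs
    len-ρs : ∀ {ρs} → ρs ∈ ρss → length ρs ≡ length segs
    len-ρs ρs∈ = trans (PW.Pointwise-length (∈-choices⁻ (map choices segs) ρs∈)) (length-map choices segs)
    each : ∀ ρs → ρs ∈ ρss → R ^ length segs * ∑ (choices (map outcomes ρs)) F ≤ ∏ ρs bound
    each ρs ρs∈ with ∑ (choices (map outcomes ρs)) F in eq
    ... | zero = ≤-trans (≤-reflexive (*-zeroʳ (R ^ length segs))) z≤n
    ... | suc k with ∑-pos (choices (map outcomes ρs)) F (subst (0 <_) (sym eq) (s≤s z≤n))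
    ...   | ω₀ , ω₀∈ , pos with constrain ρs ρs∈ ω₀ ω₀∈ pos
    ...     | Vs , short , con = ≤-trans (≤-reflexive (cong₂ (λ a b → R ^ a * b) (sym (len-ρs ρs∈)) (sym eq)))
                                         (pattern-bound ρs Vs F F≤1 short con)
    per-segment : ∀ seg → seg ∈ segs → ∑ (choices seg) bound ≤ 2 * κ * ∏ seg siteSize
    per-segment seg seg∈ = begin
      ∑ (choices seg) bound
        ≡⟨ ∑-*ˡ (choices seg) κ _ ⟩
      κ * ∑ (choices seg) (λ ρ → ∏ ρ size + R * (⟦ #sw ρ <ᵇ t ⟧ * ∏ ρ size))
        ≡⟨ cong (κ *_) (trans (∑-+ (choices seg) (λ ρ → ∏ ρ size) (λ ρ → R * (⟦ #sw ρ <ᵇ t ⟧ * ∏ ρ size)))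
             (cong₂ _+_ (trans (cong (λ l → ∑ (choices l) (λ ρ → ∏ ρ size)) (sym (map-id seg))) (∑-len seg))
                        (trans (∑-*ˡ (choices seg) R (λ ρ → ⟦ #sw ρ <ᵇ t ⟧ * ∏ ρ size))
                          (cong (λ l → R * ∑ (choices l) (λ ρ → ⟦ #sw ρ <ᵇ t ⟧ * ∏ ρ size)) (sym (map-id seg)))))) ⟩
      κ * (∏ seg siteSize + R * ∑ (choices (map id seg)) (λ ρ → ⟦ #sw ρ <ᵇ t ⟧ * ∏ ρ size))
        ≤⟨ *-monoʳ-≤ κ (+-monoʳ-≤ (∏ seg siteSize) (tail-bound seg R t (λ cs cs∈ → bounded cs (sizes seg seg∈ cs cs∈)) (small seg seg∈))) ⟩
      κ * (∏ seg siteSize + ∏ seg siteSize)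
        ≡⟨ e κ (∏ seg siteSize) ⟩
      2 * κ * ∏ seg siteSize ∎
      where
      e : ∀ k a → k * (a + a) ≡ 2 * k * a
      e = solve-∀
      size>0 : ∀ (c : Cell A) → 1 ≤ size c
      size>0 (sw p q) = s≤s z≤n
      size>0 (fx o) = s≤s z≤n
      bounded : ∀ cs → 2 * siteSize cs ≤ 1 + N → Bounded cs
      bounded cs q l = ≤-trans (≤ᵇ-true {1} l) (∑-mono cs (λ c → ≤-trans (≤-reflexive (sym (*-identityʳ ⟦ isSw c ⟧))) (*-monoʳ-≤ ⟦ isSw c ⟧ (size>0 c)))) , q

-- Choices between pairs of hubs

choices-map : ∀ (h : A → B) Os F → ∑ (choices (map (map h) Os)) F ≡ ∑ (choices Os) (F ∘ map h)
choices-map h [] F = refl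
choices-map h (O ∷ Os) F = trans (∑-choices (map h O) (map (map h) Os) F) (trans (∑-map h O _)
  (trans (∑-cong O (λ y → choices-map h Os (λ f → F (h y ∷ f)))) (sym (∑-choices O Os _))))

-- A site lists the options O, tagged by the role they play in a switch.
Tagged : List A → List (Cell A) → Set
Tagged O cs = O ≈ map proj₂ (concatMap opts cs)

untag : List (List (Bool × A)) → List A
untag ω = concat (map (map proj₂) ω)

tagged-sites : ∀ {Os : List (List A)} {seg} → Pointwise Tagged Os seg → choices Os ≈ map (map proj₂) (sites seg)
tagged-sites {Os = Os} {seg} p F = begin
  ∑ (choices Os) F                                               ≡⟨ choices-cong (pw p) F ⟩
  ∑ (choices (map (map proj₂) (map (concatMap opts) seg))) F     ≡⟨ choices-map proj₂ (map (concatMap opts) seg) F ⟩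
  ∑ (sites seg) (F ∘ map proj₂)                                  ≡⟨ sym (∑-map (map proj₂) (sites seg) F) ⟩
  ∑ (map (map proj₂) (sites seg)) F                              ∎
  where
  open ≡-Reasoning
  pw : ∀ {Os seg} → Pointwise Tagged Os seg → Pointwise _≈_ Os (map (map proj₂) (map (concatMap opts) seg))
  pw [] = []
  pw (e ∷ es) = e ∷ pw es

tagged-∑ : ∀ {oss : List (List (List A))} {segs} → Pointwise (Pointwise Tagged) oss segs → ∀ F →
  ∑ (choices (concat oss)) F ≡ ∑ (choices (map sites segs)) (F ∘ untag)
tagged-∑ {oss = oss} {segs} p F = begin
  ∑ (choices (concat oss)) F                                    ≡⟨ choices-concat oss F ⟩
  ∑ (choices (map choices oss)) (F ∘ concat)                    ≡⟨ choices-cong (pw p) (F ∘ concat) ⟩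
  ∑ (choices (map (map (map proj₂)) (map sites segs))) (F ∘ concat) ≡⟨ choices-map (map proj₂) (map sites segs) (F ∘ concat) ⟩
  ∑ (choices (map sites segs)) (F ∘ untag)                      ∎
  where
  open ≡-Reasoning
  pw : ∀ {oss segs} → Pointwise (Pointwise Tagged) oss segs → Pointwise _≈_ (map choices oss) (map (map (map proj₂)) (map sites segs))
  pw [] = []
  pw (e ∷ es) = tagged-sites e ∷ pw es

length-opts : ∀ (cs : List (Cell A)) → length (concatMap opts cs) ≡ siteSize cs
length-opts [] = refl
length-opts (c ∷ cs) = trans (length-++ (opts c)) (cong (length (opts c) +_) (length-opts cs))

tagged-length : ∀ (O : List A) cs → Tagged O cs → length O ≡ siteSize cs
tagged-length O cs e = trans (≈-length O (map proj₂ (concatMap opts cs)) e) (trans (length-map proj₂ (concatMap opts cs)) (length-opts cs))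

tagged-∏ : ∀ {oss : List (List (List A))} {segs} → Pointwise (Pointwise Tagged) oss segs →
  ∏ segs (λ seg → ∏ seg siteSize) ≡ ∏ (concat oss) length
tagged-∏ [] = refl
tagged-∏ {oss = os ∷ oss} (p ∷ ps) = trans (cong₂ _*_ (inner p) (tagged-∏ ps)) (sym (∏-++ os (concat oss) length))
  where
  inner : ∀ {os seg} → Pointwise Tagged os seg → ∏ seg siteSize ≡ ∏ os length
  inner [] = refl
  inner {O ∷ _} {cs ∷ _} (e ∷ es) = cong₂ _*_ (sym (tagged-length O cs e)) (inner es)

proj₂-opts-fx : ∀ (xs : List A) → map proj₂ (concatMap opts (map fx xs)) ≡ xs
proj₂-opts-fx [] = refl
proj₂-opts-fx (x ∷ xs) = cong (x ∷_) (proj₂-opts-fx xs)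

switchSite : A → A → List A → List (Cell A)
switchSite p q rest = sw p q ∷ map fx rest

switchSite-tagged : ∀ {O : List A} {p q rest} → O ↭ p ∷ q ∷ rest → Tagged O (switchSite p q rest)
switchSite-tagged {p = p} {q} {rest} σ G = trans (∑-↭ G σ) (cong (λ l → G p + (G q + ∑ l G)) (sym (proj₂-opts-fx rest)))

two-members : ∀ {O : List A} {p q} → p ∈ O → q ∈ O → p ≢ q → Σ (List A) λ rest → O ↭ p ∷ q ∷ rest
two-members {p = p} p∈ q∈ p≢q with ∈⇒↭ p∈
... | ys , σ with ∈-resp-↭ σ q∈
...   | here e = contradiction (sym e) p≢q
...   | there q∈ys with ∈⇒↭ q∈ys
...     | rest , τ = rest , _↭_.trans σ (_↭_.prep p τ)

swSites-switch : ∀ (seg : List (List (Cell A))) → All (λ cs → hasSw cs ≡ true) seg → swSites seg ≡ length seg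
swSites-switch [] [] = refl
swSites-switch (cs ∷ seg) (e ∷ es) = cong₂ _+_ (⟦⟧-true e) (swSites-switch seg es)

load : List (Fin n) → Fin n → ℕ
load f u = ∑ f (λ y → ⟦ y == u ⟧)

load-++ : ∀ (f g : List (Fin n)) u → load (f ++ g) u ≡ load f u + load g u
load-++ f g u = ∑-++ f g _

load-concat : ∀ (fs : List (List (Fin n))) u → load (concat fs) u ≡ ∑ fs (λ f → load f u)
load-concat [] u = refl
load-concat (f ∷ fs) u = trans (load-++ f (concat fs) u) (cong (load f u +_) (load-concat fs u))

-- F detects only choices whose final degree sequence is a rearrangement of a
-- fixed one, expressed by the sums of all functions of the degrees.
Detects : (c : Fin n → ℕ) (Stat : (ℕ → ℕ) → ℕ) (F : List (Fin n) → ℕ) → Set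
Detects c Stat F = ∀ f → 0 < F f → ∀ φ → ∑V (λ u → φ (c u + load f u)) ≡ Stat φ

module Hubs {n : ℕ} where

  open import Data.List.Membership.DecPropositional (F._≟_ {n}) using (_∈?_)

  record Hub : Set where
    field
      a b : Fin n
      a≢b : a ≢ b
      os  : List (List (Fin n))
      a∈  : All (a ∈_) os
      b∈  : All (b ∈_) os
  open Hub public

  hubSite : (h : Hub) → ∀ {O} → a h ∈ O → b h ∈ O → List (Cell (Fin n))
  hubSite h p q = switchSite (a h) (b h) (proj₁ (two-members p q (a≢b h)))

  hubSites : (h : Hub) → ∀ {os} → All (a h ∈_) os → All (b h ∈_) os → List (List (Cell (Fin n)))
  hubSites h [] [] = []
  hubSites h (p ∷ ps) (q ∷ qs) = hubSite h p q ∷ hubSites h ps qs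

  segment : Hub → List (List (Cell (Fin n)))
  segment h = hubSites h (a∈ h) (b∈ h)

  hubSites-tagged : ∀ h {os} (ps : All (a h ∈_) os) (qs : All (b h ∈_) os) → Pointwise Tagged os (hubSites h ps qs)
  hubSites-tagged h [] [] = []
  hubSites-tagged h (p ∷ ps) (q ∷ qs) = switchSite-tagged (proj₂ (two-members p q (a≢b h))) ∷ hubSites-tagged h ps qs

  hubSites-hasSw : ∀ h {os} (ps : All (a h ∈_) os) (qs : All (b h ∈_) os) → All (λ cs → hasSw cs ≡ true) (hubSites h ps qs)
  hubSites-hasSw h [] [] = []
  hubSites-hasSw h (p ∷ ps) (q ∷ qs) = refl ∷ hubSites-hasSw h ps qs

  hubVertices : List Hub → List (Fin n)
  hubVertices [] = []
  hubVertices (h ∷ hs) = a h ∷ b h ∷ hubVertices hs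

  length-hubVertices : ∀ hs → length (hubVertices hs) ≡ 2 * length hs
  length-hubVertices [] = refl
  length-hubVertices (h ∷ hs) = trans (cong (2 +_) (length-hubVertices hs)) (e (length hs))
    where
    e : ∀ k → 2 + 2 * k ≡ 2 * (1 + k)
    e = solve-∀

  fxs : List (Cell A) → List A
  fxs [] = []
  fxs (sw _ _ ∷ ρ) = fxs ρ
  fxs (fx o ∷ ρ) = o ∷ fxs ρ

  IsHubCell : Hub → Cell (Fin n) → Set
  IsHubCell h c = c ≡ sw (a h) (b h) ⊎ (Σ (Fin n) λ o → c ≡ fx o)

  pattern-cells : ∀ h {os} (ps : All (a h ∈_) os) (qs : All (b h ∈_) os) {ρ} →
    Pointwise _∈_ ρ (hubSites h ps qs) → All (IsHubCell h) ρ
  pattern-cells h [] [] [] = []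
  pattern-cells h (p ∷ ps) (q ∷ qs) (here e ∷ r) = inj₁ e ∷ pattern-cells h ps qs r
  pattern-cells h (p ∷ ps) (q ∷ qs) (there c∈ ∷ r) with ∈-map⁻ fx c∈
  ... | o , _ , e = inj₂ (o , e) ∷ pattern-cells h ps qs r

  Excess : Hub → List (Cell (Fin n)) → List (Bool × Fin n) → Set
  Excess h ρ o = Σ ℕ λ m → ∀ u → load (map proj₂ o) u ≡ load (fxs ρ) u + (⟦ a h == u ⟧ * #p o + ⟦ b h == u ⟧ * m)

  excess : ∀ h {ρ} → All (IsHubCell h) ρ → ∀ {o} → Pointwise _∈_ o (map opts ρ) → Excess h ρ o
  excess h [] [] = 0 , λ u → sym (cong₂ _+_ (*-zeroʳ ⟦ a h == u ⟧) (*-zeroʳ ⟦ b h == u ⟧))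
  excess h {_ ∷ ρ} (inj₂ (o , refl) ∷ cells) (here refl ∷ p) with excess h cells p
  ... | m , eq = m , λ u → trans (cong (⟦ o == u ⟧ +_) (eq u)) (sym (+-assoc ⟦ o == u ⟧ (load (fxs ρ) u) _))
  excess h {_ ∷ ρ} (inj₁ refl ∷ cells) {_ ∷ o} (here refl ∷ p) with excess h cells p
  ... | m , eq = m , λ u → trans (cong (⟦ a h == u ⟧ +_) (eq u)) (e ⟦ a h == u ⟧ ⟦ b h == u ⟧ (load (fxs ρ) u) (#p o) m)
    where
    e : ∀ x y l p m → x + (l + (x * p + y * m)) ≡ l + (x * (1 + p) + y * m)
    e = solve-∀
  excess h {_ ∷ ρ} (inj₁ refl ∷ cells) {_ ∷ o} (there (here refl) ∷ p) with excess h cells p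
  ... | m , eq = suc m , λ u → trans (cong (⟦ b h == u ⟧ +_) (eq u)) (e ⟦ a h == u ⟧ ⟦ b h == u ⟧ (load (fxs ρ) u) (#p o) m)
    where
    e : ∀ x y l p m → y + (l + (x * p + y * m)) ≡ l + (x * p + y * (1 + m))
    e = solve-∀

  excess-off : ∀ h ρ o {u} → Excess h ρ o → a h ≢ u → b h ≢ u → load (map proj₂ o) u ≡ load (fxs ρ) u
  excess-off h ρ o {u} (m , eq) a≢u b≢u = trans (eq u)
    (trans (cong₂ (λ x y → load (fxs ρ) u + (⟦ x ⟧ * #p o + ⟦ y ⟧ * m)) (==-neq a≢u) (==-neq b≢u)) (+-identityʳ _))

  -- The final load is the fixed load plus an excess supported on the hubs.
  data Run : List Hub → List (List (Cell (Fin n))) → List (List (Bool × Fin n)) → Set where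
    []  : Run [] [] []
    _∷_ : ∀ {h ρ o hs ρs ω} → Excess h ρ o → Run hs ρs ω → Run (h ∷ hs) (ρ ∷ ρs) (o ∷ ω)

  run : ∀ hs {ρs} → Pointwise _∈_ ρs (map choices (map segment hs)) → ∀ {ω} → Pointwise _∈_ ω (map outcomes ρs) → Run hs ρs ω
  run [] [] [] = []
  run (h ∷ hs) {ρ ∷ ρs} (p ∷ ps) (q ∷ qs) =
    excess h (pattern-cells h (a∈ h) (b∈ h) (∈-choices⁻ (segment h) p)) (∈-choices⁻ (map opts ρ) q) ∷ run hs ps qs

  fixedLoad : List (List (Cell (Fin n))) → Fin n → ℕ
  fixedLoad ρs u = ∑ ρs (λ ρ → load (fxs ρ) u)

  load-untag : ∀ (ω : List (List (Bool × Fin n))) u → load (untag ω) u ≡ ∑ ω (λ o → load (map proj₂ o) u)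
  load-untag ω u = trans (load-concat (map (map proj₂) ω) u) (∑-map (map proj₂) ω (λ f → load f u))

  off-hubs : ∀ {hs ρs ω} → Run hs ρs ω → ∀ {u} → u ∉ hubVertices hs → load (untag ω) u ≡ fixedLoad ρs u
  off-hubs {ω = ω} r {u} u∉ = trans (load-untag ω u) (go r u∉)
    where
    go : ∀ {hs ρs ω} → Run hs ρs ω → u ∉ hubVertices hs → ∑ ω (λ o → load (map proj₂ o) u) ≡ fixedLoad ρs u
    go [] _ = refl
    go {h ∷ _} {ρ ∷ _} {o ∷ _} (ex ∷ r) u∉ = cong₂ _+_
      (excess-off h ρ o ex (λ q → u∉ (here (sym q))) (λ q → u∉ (there (here (sym q)))))
      (go r (λ q → u∉ (there (there q))))

  -- Hub vertices are distinct, so no other segment has an excess at `a h`. Fixed cells of other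
  -- segments may still load it, which is why `fixedLoad` runs over all of them.
  go-at-hub : ∀ {hs ρs ω} → Run hs ρs ω → Unique (hubVertices hs) →
    Pointwise (λ o h → load (untag ω) (a h) ≡ fixedLoad ρs (a h) + #p o) ω hs
  go-at-hub [] _ = []
  go-at-hub {h ∷ hs} {ρ ∷ ρs} {o ∷ ω} ((m , eq) ∷ r) ((a≢b′ ∷ a∉) ∷ b∉ ∷ u) =
    trans (load-++ (map proj₂ o) (untag ω) (a h)) (trans (cong₂ _+_ (eq (a h)) (off-hubs r (λ q → All.lookup a∉ q refl)))
      (trans (cong₂ (λ x y → load (fxs ρ) (a h) + (⟦ x ⟧ * #p o + ⟦ y ⟧ * m) + fixedLoad ρs (a h)) (==-refl (a h)) (==-neq (a≢b′ ∘ sym)))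
        (e (load (fxs ρ) (a h)) (#p o) (fixedLoad ρs (a h)))))
    ∷ shift-head a∉ b∉ (go-at-hub r u)
    where
    e : ∀ l p k → l + (1 * p + 0) + k ≡ l + k + p
    e = solve-∀
    shift-head : ∀ {hs′ ω′} → All (a h ≢_) (hubVertices hs′) → All (b h ≢_) (hubVertices hs′) →
      Pointwise (λ o h → load (untag ω) (a h) ≡ fixedLoad ρs (a h) + #p o) ω′ hs′ →
      Pointwise (λ o′ h → load (untag (o ∷ ω)) (a h) ≡ fixedLoad (ρ ∷ ρs) (a h) + #p o′) ω′ hs′
    shift-head _ _ [] = []
    shift-head {h′ ∷ _} {o′ ∷ _} (x ∷ _ ∷ xs) (y ∷ _ ∷ ys) (p ∷ ps) =
      trans (load-++ (map proj₂ o) (untag ω) (a h′))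
        (trans (cong₂ _+_ (excess-off h ρ o (m , eq) x y) p)
          (sym (+-assoc (load (fxs ρ) (a h′)) _ _)))
      ∷ shift-head xs ys ps

  module _ (hs : List Hub) (unique : Unique (hubVertices hs)) (R N t : ℕ) (R²≤t : R * R ≤ t)
           (sizes : ∀ h → h ∈ hs → All (λ O → 2 * length O ≤ 1 + N) (os h))
           (small : ∀ h → h ∈ hs → R * 2 ^ t * N ^ length (os h) ≤ (1 + N) ^ length (os h))
           (c : Fin n → ℕ) (Stat : (ℕ → ℕ) → ℕ) (F : List (Fin n) → ℕ) (F≤1 : ∀ f → F f ≤ 1) (det : Detects c Stat F) where

    -- Outside the hubs all degrees are fixed, so a detected outcome determines the multiset of the
    -- hub degrees: each hub then has one of the hub degrees of `ω₀`. With K pairs this leaves 2K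
    -- candidates, and `switch-bound` turns them into a factor 4K per pair.
    hub-bound : R ^ length hs * ∑ (choices (concat (map os hs))) F ≤
      (4 * length hs) ^ length hs * ∏ (concat (map os hs)) length
    hub-bound = begin
      R ^ length hs * ∑ (choices (concat (map os hs))) F
        ≡⟨ cong₂ (λ k s → R ^ k * s) (sym (length-map segment hs)) (tagged-∑ tags F) ⟩
      R ^ length (map segment hs) * ∑ (choices (map sites (map segment hs))) (F ∘ untag)
        ≤⟨ Switch.switch-bound (2 * length hs) R N t R²≤t (map segment hs) (F ∘ untag) (λ ω → F≤1 (untag ω)) sizes′ small′ constrain ⟩
      (2 * (2 * length hs)) ^ length (map segment hs) * ∏ (map segment hs) (λ seg → ∏ seg siteSize)
        ≡⟨ cong₂ _*_ (cong₂ _^_ (sym (*-assoc 2 2 (length hs))) (length-map segment hs)) (tagged-∏ tags) ⟩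
      (4 * length hs) ^ length hs * ∏ (concat (map os hs)) length ∎
      where
      open ≤-Reasoning
      tags : Pointwise (Pointwise Tagged) (map os hs) (map segment hs)
      tags = go hs
        where
        go : ∀ hs → Pointwise (Pointwise Tagged) (map os hs) (map segment hs)
        go [] = []
        go (h ∷ hs) = hubSites-tagged h (a∈ h) (b∈ h) ∷ go hs
      sizes′ : ∀ seg → seg ∈ map segment hs → ∀ cs → cs ∈ seg → 2 * siteSize cs ≤ 1 + N
      sizes′ seg seg∈ cs cs∈ with ∈-map⁻ segment seg∈
      ... | h , h∈ , refl = go (hubSites-tagged h (a∈ h) (b∈ h)) (sizes h h∈) cs∈
        where
        go : ∀ {os seg} → Pointwise Tagged os seg → All (λ O → 2 * length O ≤ 1 + N) os → cs ∈ seg → 2 * siteSize cs ≤ 1 + N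
        go {O ∷ _} (e ∷ _) (q ∷ _) (here refl) = ≤-trans (≤-reflexive (cong (2 *_) (sym (tagged-length O cs e)))) q
        go (_ ∷ es) (_ ∷ qs) (there c∈) = go es qs c∈
      small′ : ∀ seg → seg ∈ map segment hs → R * 2 ^ t * N ^ swSites seg ≤ (1 + N) ^ swSites seg
      small′ seg seg∈ with ∈-map⁻ segment seg∈
      ... | h , h∈ , refl = subst (λ k → R * 2 ^ t * N ^ k ≤ (1 + N) ^ k)
        (trans (PW.Pointwise-length (hubSites-tagged h (a∈ h) (b∈ h))) (sym (swSites-switch (segment h) (hubSites-hasSw h (a∈ h) (b∈ h)))))
        (small h h∈)
      constrain : ∀ ρs → ρs ∈ choices (map choices (map segment hs)) → ∀ ω₀ → ω₀ ∈ choices (map outcomes ρs) → 0 < F (untag ω₀) →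
        Σ (List (List ℕ)) λ Vs → All (λ v → length v ≤ 2 * length hs) Vs ×
          (∀ ω → ω ∈ choices (map outcomes ρs) → 0 < F (untag ω) → Pointwise (λ o v → #p o ∈ v) ω Vs)
      constrain ρs ρs∈ ω₀ ω₀∈ pos₀ = map vals hs
        , AllP.map⁺ (All.tabulate (λ {h} _ → ≤-reflexive (trans (length-map _ (hubVertices hs)) (length-hubVertices hs))))
        , λ ω ω∈ pos → convert (at-hubs ω ω∈ pos)
        where
        pρ = ∈-choices⁻ (map choices (map segment hs)) ρs∈
        dg : List (List (Bool × Fin n)) → Fin n → ℕ
        dg ω u = c u + load (untag ω) u
        vals : Hub → List ℕ
        vals h = map (λ u → dg ω₀ u ∸ (c (a h) + fixedLoad ρs (a h))) (hubVertices hs)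
        r₀ = run hs pρ (∈-choices⁻ (map outcomes ρs) ω₀∈)
        same-value : ∀ ω → ω ∈ choices (map outcomes ρs) → 0 < F (untag ω) → ∀ {v} → v ∈ hubVertices hs →
          Σ (Fin n) λ u → u ∈ hubVertices hs × dg ω₀ u ≡ dg ω v
        same-value ω ω∈ pos {v} v∈ with ∑-pos (allFin n) (λ u → ⟦ does (u ∈? hubVertices hs) ⟧ * ⟦ dg ω₀ u ≡ᵇ k ⟧) hub₀>0
          where
          k = dg ω v
          H : Fin n → Bool
          H u = does (u ∈? hubVertices hs)
          r = run hs pρ (∈-choices⁻ (map outcomes ρs) ω∈)
          split : ∀ ω → ∑V (λ u → ⟦ dg ω u ≡ᵇ k ⟧) ≡
            ∑V (λ u → ⟦ H u ⟧ * ⟦ dg ω u ≡ᵇ k ⟧) + ∑V (λ u → ⟦ not (H u) ⟧ * ⟦ dg ω u ≡ᵇ k ⟧)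
          split ω = trans (∑-cong (allFin n) (λ u → trans (sym (*-identityˡ _)) (trans (cong (_* ⟦ dg ω u ≡ᵇ k ⟧) (sym (⟦⟧-not (H u))))
                      (*-distribʳ-+ ⟦ dg ω u ≡ᵇ k ⟧ ⟦ H u ⟧ _))))
                    (∑-+ (allFin n) (λ u → ⟦ H u ⟧ * ⟦ dg ω u ≡ᵇ k ⟧) (λ u → ⟦ not (H u) ⟧ * ⟦ dg ω u ≡ᵇ k ⟧))
          outside : ∑V (λ u → ⟦ not (H u) ⟧ * ⟦ dg ω u ≡ᵇ k ⟧) ≡ ∑V (λ u → ⟦ not (H u) ⟧ * ⟦ dg ω₀ u ≡ᵇ k ⟧)
          outside = ∑-cong (allFin n) local
            where
            local : ∀ u → ⟦ not (H u) ⟧ * ⟦ dg ω u ≡ᵇ k ⟧ ≡ ⟦ not (H u) ⟧ * ⟦ dg ω₀ u ≡ᵇ k ⟧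
            local u with u ∈? hubVertices hs
            ... | yes _ = refl
            ... | no u∉ = cong (λ l → 1 * ⟦ c u + l ≡ᵇ k ⟧) (trans (off-hubs r u∉) (sym (off-hubs r₀ u∉)))
          -- Tested with the indicator of `k`, both outcomes have equally many vertices of degree
          -- `k`; removing the equal contributions outside the hubs leaves the hubs.
          hub-equal : ∑V (λ u → ⟦ H u ⟧ * ⟦ dg ω u ≡ᵇ k ⟧) ≡ ∑V (λ u → ⟦ H u ⟧ * ⟦ dg ω₀ u ≡ᵇ k ⟧)
          hub-equal = +-cancelʳ-≡ _ _ _ (trans (sym (split ω)) (trans (trans (det (untag ω) pos (λ x → ⟦ x ≡ᵇ k ⟧))
            (sym (det (untag ω₀) pos₀ (λ x → ⟦ x ≡ᵇ k ⟧)))) (trans (split ω₀) (cong (∑V (λ u → ⟦ H u ⟧ * ⟦ dg ω₀ u ≡ᵇ k ⟧) +_) (sym outside)))))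
          hub₀>0 : 0 < ∑V (λ u → ⟦ H u ⟧ * ⟦ dg ω₀ u ≡ᵇ k ⟧)
          hub₀>0 = ≤-trans (≤-trans (≤-reflexive (sym (cong₂ _*_ (⟦⟧-true (dec-true (v ∈? hubVertices hs) v∈)) (⟦⟧-true (≡ᵇ-intro {k} refl)))))
            (∑-term (λ u → ⟦ H u ⟧ * ⟦ dg ω u ≡ᵇ k ⟧) (∈-allFin v))) (≤-reflexive hub-equal)
        ... | u , _ , q with u ∈? hubVertices hs
        ...   | yes u∈ = u , u∈ , ≡ᵇ-true (⟦⟧-pos (subst (0 <_) (*-identityˡ _) q))
        at-hubs : ∀ ω → ω ∈ choices (map outcomes ρs) → 0 < F (untag ω) → Pointwise (λ o h → #p o ∈ vals h) ω hs
        at-hubs ω ω∈ pos = go (go-at-hub (run hs pρ (∈-choices⁻ (map outcomes ρs) ω∈)) unique) id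
          where
          one : ∀ h o → a h ∈ hubVertices hs → load (untag ω) (a h) ≡ fixedLoad ρs (a h) + #p o → #p o ∈ vals h
          one h o ah∈ eq with same-value ω ω∈ pos ah∈
          ... | u , u∈ , q = subst (_∈ vals h) (trans (cong (_∸ (c (a h) + fixedLoad ρs (a h))) (trans q (trans (cong (c (a h) +_) eq) (sym (+-assoc (c (a h)) _ _)))))
                               (m+n∸m≡n (c (a h) + fixedLoad ρs (a h)) (#p o))) (∈-map⁺ _ u∈)
          go : ∀ {hs′ ω′} → Pointwise (λ o h → load (untag ω) (a h) ≡ fixedLoad ρs (a h) + #p o) ω′ hs′ →
            (∀ {v} → v ∈ hubVertices hs′ → v ∈ hubVertices hs) → Pointwise (λ o h → #p o ∈ vals h) ω′ hs′
          go [] _ = []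
          go {h ∷ hs′} {o ∷ _} (p ∷ ps) sub = one h o (sub (here refl)) p ∷ go ps (λ q → sub (there (there q)))
        convert : ∀ {hs′ ω} → Pointwise (λ o h → #p o ∈ vals h) ω hs′ → Pointwise (λ o v → #p o ∈ v) ω (map vals hs′)
        convert [] = []
        convert (p ∷ ps) = p ∷ convert ps

-- Choices on disjoint spiders

∑V-bump : ∀ (φ : ℕ → ℕ) (c : Fin n → ℕ) y →
  ∑V (λ u → φ (c u + ⟦ y == u ⟧)) + φ (c y) ≡ ∑V (λ u → φ (c u)) + φ (suc (c y))
∑V-bump {n} φ c y = begin
  ∑ V (λ u → φ (c u + ⟦ y == u ⟧)) + φ (c y)
    ≡⟨ cong (∑ V (λ u → φ (c u + ⟦ y == u ⟧)) +_) (sym (∑V-single y (λ u → φ (c u)))) ⟩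
  ∑ V (λ u → φ (c u + ⟦ y == u ⟧)) + ∑ V (λ u → ⟦ y == u ⟧ * φ (c u))
    ≡⟨ sym (∑-+ V (λ u → φ (c u + ⟦ y == u ⟧)) (λ u → ⟦ y == u ⟧ * φ (c u))) ⟩
  ∑ V (λ u → φ (c u + ⟦ y == u ⟧) + ⟦ y == u ⟧ * φ (c u))
    ≡⟨ ∑-cong V local ⟩
  ∑ V (λ u → φ (c u) + ⟦ y == u ⟧ * φ (suc (c u)))
    ≡⟨ ∑-+ V (λ u → φ (c u)) (λ u → ⟦ y == u ⟧ * φ (suc (c u))) ⟩
  ∑ V (λ u → φ (c u)) + ∑ V (λ u → ⟦ y == u ⟧ * φ (suc (c u)))
    ≡⟨ cong (∑ V (λ u → φ (c u)) +_) (∑V-single y (λ u → φ (suc (c u)))) ⟩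
  ∑ V (λ u → φ (c u)) + φ (suc (c y)) ∎
  where
  open ≡-Reasoning
  V = allFin n
  local : ∀ u → φ (c u + ⟦ y == u ⟧) + ⟦ y == u ⟧ * φ (c u) ≡ φ (c u) + ⟦ y == u ⟧ * φ (suc (c u))
  local u with y == u
  ... | true rewrite +-comm (c u) 1 = e (φ (suc (c u))) (φ (c u))
    where
    e : ∀ x y → x + 1 * y ≡ y + 1 * x
    e = solve-∀
  ... | false rewrite +-identityʳ (c u) = refl

module Residues (Q : ℕ) {{Q≢0 : NonZero Q}} where

  -- φ τ x is the number of v < x with v ≡ τ modulo Q, so raising a degree from
  -- x to x + 1 changes the invariant ∑ φ τ (degree) exactly if x ≡ τ.
  φ : ℕ → ℕ → ℕ
  φ τ zero = 0
  φ τ (suc x) = φ τ x + ⟦ x % Q ≡ᵇ τ ⟧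

  ∑φ-bump : ∀ τ (c : Fin n → ℕ) y → ∑V (λ u → φ τ (c u + ⟦ y == u ⟧)) ≡ ∑V (λ u → φ τ (c u)) + ⟦ c y % Q ≡ᵇ τ ⟧
  ∑φ-bump τ c y = +-cancelʳ-≡ (φ τ (c y)) _ _ (trans (∑V-bump (φ τ) c y) (e (∑V (λ u → φ τ (c u))) (φ τ (c y)) ⟦ c y % Q ≡ᵇ τ ⟧))
    where
    e : ∀ a b c → a + (b + c) ≡ a + c + b
    e = solve-∀

  -- As `f` has no repetitions, every vertex in it is raised once and from its original degree, so
  -- the increments can be read off from `c`.
  ∑φ-load : ∀ τ (c : Fin n → ℕ) f → Unique f →
    ∑V (λ u → φ τ (c u + load f u)) ≡ ∑V (λ u → φ τ (c u)) + ∑ f (λ y → ⟦ c y % Q ≡ᵇ τ ⟧)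
  ∑φ-load {n} τ c [] _ = trans (∑-cong (allFin n) (λ u → cong (φ τ) (+-identityʳ (c u)))) (sym (+-identityʳ _))
  ∑φ-load {n} τ c (y ∷ f) (y∉ ∷ uf) = begin
    ∑V (λ u → φ τ (c u + (⟦ y == u ⟧ + load f u)))
      ≡⟨ ∑-cong (allFin n) (λ u → cong (φ τ) (sym (+-assoc (c u) ⟦ y == u ⟧ (load f u)))) ⟩
    ∑V (λ u → φ τ (c′ u + load f u))
      ≡⟨ ∑φ-load τ c′ f uf ⟩
    ∑V (λ u → φ τ (c′ u)) + ∑ f (λ z → ⟦ c′ z % Q ≡ᵇ τ ⟧)
      ≡⟨ cong₂ _+_ (∑φ-bump τ c y) (∑-cong∈ f (λ z z∈ → cong (λ k → ⟦ k % Q ≡ᵇ τ ⟧)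
           (trans (cong (λ b → c z + ⟦ b ⟧) (==-neq (All.lookup y∉ z∈))) (+-identityʳ (c z))))) ⟩
    ∑V (λ u → φ τ (c u)) + ⟦ c y % Q ≡ᵇ τ ⟧ + ∑ f (λ z → ⟦ c z % Q ≡ᵇ τ ⟧)
      ≡⟨ +-assoc (∑V (λ u → φ τ (c u))) _ _ ⟩
    ∑V (λ u → φ τ (c u)) + (⟦ c y % Q ≡ᵇ τ ⟧ + ∑ f (λ z → ⟦ c z % Q ≡ᵇ τ ⟧)) ∎
    where
    open ≡-Reasoning
    c′ : Fin n → ℕ
    c′ u = c u + ⟦ y == u ⟧

  -- Shows that `Q` legs are enough to steer the degree of a body into any residue class.
  reach-residue : ∀ α τ → τ < Q → Σ ℕ λ k → k ≤ Q × (α + k) % Q ≡ τ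
  reach-residue α τ τ<Q with α % Q ≤? τ
  ... | yes p = τ ∸ r , ≤-trans (m∸n≤m τ r) (<⇒≤ τ<Q) , trans (cong (_% Q) eq) (trans ([m+kn]%n≡m%n τ (α / Q) Q) (m<n⇒m%n≡m τ<Q))
    where
    open ≡-Reasoning
    r = α % Q
    e : ∀ r a k → r + a + k ≡ r + k + a
    e = solve-∀
    eq : α + (τ ∸ r) ≡ τ + α / Q * Q
    eq = trans (cong (_+ (τ ∸ r)) (m≡m%n+[m/n]*n α Q)) (trans (e r (α / Q * Q) (τ ∸ r)) (cong (_+ α / Q * Q) (m+[n∸m]≡n p)))
  ... | no p = τ + (Q ∸ r) , bound , trans (cong (_% Q) eq) (trans ([m+kn]%n≡m%n τ (1 + α / Q) Q) (m<n⇒m%n≡m τ<Q))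
    where
    r = α % Q
    r≤Q : r ≤ Q
    r≤Q = <⇒≤ (m%n<n α Q)
    e : ∀ r a t k → r + a + (t + k) ≡ t + (r + k + a)
    e = solve-∀
    eq : α + (τ + (Q ∸ r)) ≡ τ + (1 + α / Q) * Q
    eq = trans (cong (_+ (τ + (Q ∸ r))) (m≡m%n+[m/n]*n α Q)) (trans (e r (α / Q * Q) τ (Q ∸ r)) (cong (λ k → τ + (k + α / Q * Q)) (m+[n∸m]≡n r≤Q)))
    bound : τ + (Q ∸ r) ≤ Q
    bound = ≤-trans (+-monoˡ-≤ (Q ∸ r) (<⇒≤ (≰⇒> p))) (≤-reflexive (m+[n∸m]≡n r≤Q))

++-disjoint : ∀ {xs ys : List A} → Unique (xs ++ ys) → ∀ {u} → u ∈ xs → u ∉ ys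
++-disjoint {xs = x ∷ xs} (x∉ ∷ q) (here refl) u∈ = All.lookup (AllP.++⁻ʳ xs x∉) u∈ refl
++-disjoint {xs = x ∷ xs} (x∉ ∷ q) (there p) u∈ = ++-disjoint q p u∈

++-uniqueˡ : ∀ (xs : List A) {ys} → Unique (xs ++ ys) → Unique xs
++-uniqueˡ [] _ = []
++-uniqueˡ (x ∷ xs) (x∉ ∷ u) = AllP.++⁻ˡ xs x∉ ∷ ++-uniqueˡ xs u

++-uniqueʳ : ∀ (xs : List A) {ys} → Unique (xs ++ ys) → Unique ys
++-uniqueʳ [] u = u
++-uniqueʳ (x ∷ xs) (_ ∷ u) = ++-uniqueʳ xs u

module Spiders {n : ℕ} where

  open import Data.List.Membership.DecPropositional (F._≟_ {n}) using (_∈?_)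

  Config : Set
  Config = List (Fin n)

  record Leg : Set where
    field
      foot : Fin n
      opt  : List (Fin n)
  open Leg public

  -- The first site is kept apart because it carries the final decision between `body` and `foot₁`;
  -- the legs adjust the degree of `body` before that.
  record Spider : Set where
    field
      body foot₁ : Fin n
      opt₁  : List (Fin n)
      legs  : List Leg
      body∈₁ : body ∈ opt₁
      foot∈₁ : foot₁ ∈ opt₁
      legs∈ : All (λ l → body ∈ opt l × foot l ∈ opt l) legs
  open Spider public

  verts : Spider → List (Fin n)
  verts sp = body sp ∷ foot₁ sp ∷ map foot (legs sp)

  spOpts : Spider → List (List (Fin n))
  spOpts sp = opt₁ sp ∷ map opt (legs sp)

  configs : Spider → List Config
  configs sp = choices (spOpts sp)

  -- An on-configuration loads only the vertices of its own spider. Hence, once all other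
  -- configurations are revealed, spiders with disjoint vertices do not disturb each other.
  isOn : Spider → Config → Bool
  isOn sp x = does (All.all? (_∈? verts sp) x)

  data Item : Set where
    live : Spider → Item
    dead : Config → Item

  isLive : Item → Bool
  isLive (live _) = true
  isLive (dead _) = false

  options : Item → List Config
  options (live sp) = filterᵇ (isOn sp) (configs sp)
  options (dead x) = [ x ]

  items : Spider → List Item
  items sp = live sp ∷ map dead (filterᵇ (not ∘ isOn sp) (configs sp))

  filter-split : ∀ (p : A → Bool) xs G → ∑ (filterᵇ p xs) G + ∑ (filterᵇ (not ∘ p) xs) G ≡ ∑ xs G
  filter-split p xs G = trans (cong₂ _+_ (∑-filter p xs G) (∑-filter (not ∘ p) xs G))
    (trans (sym (∑-+ xs (λ x → ⟦ p x ⟧ * G x) (λ x → ⟦ not (p x) ⟧ * G x)))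
      (∑-cong xs (λ x → trans (sym (*-distribʳ-+ (G x) ⟦ p x ⟧ _)) (trans (cong (_* G x) (⟦⟧-not (p x))) (*-identityˡ _)))))

  items-partition : ∀ sp → configs sp ≈ concatMap options (items sp)
  items-partition sp G = sym (trans (∑-++ (options (live sp)) (concatMap options (map dead offs)) G)
    (trans (cong (λ l → ∑ (options (live sp)) G + ∑ l G) (singles offs)) (filter-split (isOn sp) (configs sp) G)))
    where
    offs = filterᵇ (not ∘ isOn sp) (configs sp)
    singles : ∀ xs → concatMap options (map dead xs) ≡ xs
    singles [] = refl
    singles (x ∷ xs) = cong (x ∷_) (singles xs)

  itemVerts : Item → List (Fin n)
  itemVerts (live sp) = verts sp
  itemVerts (dead _) = []

  deadOf : Item → Config
  deadOf (live _) = []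
  deadOf (dead x) = x

  tailConfig : Fin n → ℕ → List Leg → Config
  tailConfig a k [] = []
  tailConfig a zero (l ∷ ls) = foot l ∷ tailConfig a zero ls
  tailConfig a (suc k) (l ∷ ls) = a ∷ tailConfig a k ls

  tailConfig-∈ : ∀ a k {ls} → All (λ l → a ∈ opt l × foot l ∈ opt l) ls → Pointwise _∈_ (tailConfig a k ls) (map opt ls)
  tailConfig-∈ a k [] = []
  tailConfig-∈ a zero ((_ , q) ∷ ps) = q ∷ tailConfig-∈ a zero ps
  tailConfig-∈ a (suc k) ((q , _) ∷ ps) = q ∷ tailConfig-∈ a k ps

  tailConfig-verts : ∀ a k ls → All (_∈ a ∷ map foot ls) (tailConfig a k ls)
  tailConfig-verts a k [] = []
  tailConfig-verts a zero (l ∷ ls) = there (here refl) ∷ All.map (λ { (here e) → here e ; (there q) → there (there q) }) (tailConfig-verts a zero ls)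
  tailConfig-verts a (suc k) (l ∷ ls) = here refl ∷ All.map (λ { (here e) → here e ; (there q) → there (there q) }) (tailConfig-verts a k ls)

  tailConfig-load : ∀ a k ls → k ≤ length ls → All (a ≢_) (map foot ls) → load (tailConfig a k ls) a ≡ k
  tailConfig-load a zero [] _ _ = refl
  tailConfig-load a zero (l ∷ ls) _ (p ∷ ps) = cong₂ (λ b k → ⟦ b ⟧ + k) (==-neq (p ∘ sym)) (tailConfig-load a zero ls z≤n ps)
  tailConfig-load a (suc k) (l ∷ ls) (s≤s q) (p ∷ ps) = cong₂ (λ b k → ⟦ b ⟧ + k) (==-refl a) (tailConfig-load a k ls q ps)

  load-avoid : ∀ {u} (f : Config) → All (_≢ u) f → load f u ≡ 0
  load-avoid [] [] = refl
  load-avoid (y ∷ f) (p ∷ ps) = cong₂ (λ b k → ⟦ b ⟧ + k) (==-neq p) (load-avoid f ps)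

  module Stage2 (Q : ℕ) {{Q≢0 : NonZero Q}} (taus : List ℕ) (base : Fin n → ℕ) where

    open Residues Q

    -- In `ok-sw` the tail `tl` has brought `body` to residue `τ`, so choosing it raises the
    -- statistic for `τ`; the residue of `foot₁` avoids `taus`, so choosing `foot₁` raises none of
    -- the statistics considered.
    data CellOk (τ : ℕ) : Item → Cell Config → Set where
      ok-dead : ∀ x → CellOk τ (dead x) (fx x)
      ok-fix  : ∀ sp o → All (_∈ verts sp) o → CellOk τ (live sp) (fx o)
      ok-sw   : ∀ sp tl → All (_∈ verts sp) tl → load tl (foot₁ sp) ≡ 0 →
                (base (body sp) + load tl (body sp)) % Q ≡ τ → base (foot₁ sp) % Q ∉ taus →
                CellOk τ (live sp) (sw (body sp ∷ tl) (foot₁ sp ∷ tl))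

    record Entry : Set where
      constructor entry
      field
        τ  : ℕ
        it : Item
        c  : Cell Config
        o  : Bool × Config
        ok : CellOk τ it c
        o∈ : o ∈ opts c
    open Entry public

    -- The part of the load shared by both outcomes of a switch; the coordinate in which they differ
    -- is left to `head`.
    common : Cell Config → Config
    common (fx o) = o
    common (sw [] _) = []
    common (sw (_ ∷ tl) _) = tl

    head : Entry → Config
    head (entry _ _ _ _ (ok-dead x) _) = []
    head (entry _ _ _ _ (ok-fix sp o x) _) = []
    head (entry _ _ _ _ (ok-sw sp _ _ _ _ _) (here _)) = [ body sp ]
    head (entry _ _ _ _ (ok-sw sp _ _ _ _ _) (there _)) = [ foot₁ sp ]

    load-split : ∀ e u → load (proj₂ (o e)) u ≡ load (common (c e)) u + load (head e) u
    load-split (entry _ _ _ _ (ok-dead x) (here refl)) u = sym (+-identityʳ _)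
    load-split (entry _ _ _ _ (ok-fix sp o x) (here refl)) u = sym (+-identityʳ _)
    load-split (entry _ _ _ _ (ok-sw sp tl _ _ _ _) (here refl)) u = trans (+-comm _ (load tl u)) (cong (load tl u +_) (sym (+-identityʳ _)))
    load-split (entry _ _ _ _ (ok-sw sp tl _ _ _ _) (there (here refl))) u = trans (+-comm _ (load tl u)) (cong (load tl u +_) (sym (+-identityʳ _)))

    head-verts : ∀ e → All (_∈ itemVerts (it e)) (head e)
    head-verts (entry _ _ _ _ (ok-dead x) _) = []
    head-verts (entry _ _ _ _ (ok-fix sp o x) _) = []
    head-verts (entry _ _ _ _ (ok-sw sp _ _ _ _ _) (here _)) = here refl ∷ []
    head-verts (entry _ _ _ _ (ok-sw sp _ _ _ _ _) (there _)) = there (here refl) ∷ []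

    head-unique : ∀ e → Unique (head e)
    head-unique (entry _ _ _ _ (ok-dead x) _) = []
    head-unique (entry _ _ _ _ (ok-fix sp o x) _) = []
    head-unique (entry _ _ _ _ (ok-sw sp _ _ _ _ _) (here _)) = [] ∷ []
    head-unique (entry _ _ _ _ (ok-sw sp _ _ _ _ _) (there _)) = [] ∷ []

    avoid : ∀ {u vs} (f : Config) → All (_∈ vs) f → u ∉ vs → load f u ≡ 0
    avoid f p u∉ = load-avoid f (All.map (λ y∈ → λ { refl → u∉ y∈ }) p)

    off-verts : ∀ e {u} → u ∉ itemVerts (it e) → load (common (c e)) u ≡ load (deadOf (it e)) u
    off-verts (entry _ _ _ _ (ok-dead x) _) u∉ = refl
    off-verts (entry _ _ _ _ (ok-fix sp o p) _) u∉ = avoid o p u∉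
    off-verts (entry _ _ _ _ (ok-sw sp tl p _ _ _) _) u∉ = avoid tl p u∉

    no-dead : ∀ e {y} → y ∈ itemVerts (it e) → deadOf (it e) ≡ []
    no-dead (entry _ (live _) _ _ _ _) _ = refl

    -- A body has residue `τ e` after its legs are counted and a foot has a residue outside `taus`;
    -- so for `τ′` in `taus` the head counts only if it is a body with this label.
    head-residue : ∀ e τ′ → τ′ ∈ taus →
      ∑ (head e) (λ y → ⟦ (base y + load (common (c e)) y) % Q ≡ᵇ τ′ ⟧) ≡ ⟦ proj₁ (o e) ⟧ * ⟦ τ e ≡ᵇ τ′ ⟧
    head-residue (entry _ _ _ _ (ok-dead x) (here refl)) τ′ _ = refl
    head-residue (entry _ _ _ _ (ok-fix sp o x) (here refl)) τ′ _ = refl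
    head-residue (entry _ _ _ _ (ok-sw sp tl _ _ e _) (here refl)) τ′ _ rewrite e = refl
    head-residue (entry _ _ _ _ (ok-sw sp tl _ z _ q) (there (here refl))) τ′ τ′∈ rewrite z | +-identityʳ (base (foot₁ sp)) =
      trans (+-identityʳ _) (cong ⟦_⟧ (≡ᵇ-false (λ e → q (subst (_∈ taus) (sym e) τ′∈))))

    commonLoad deadLoad : List Entry → Fin n → ℕ
    commonLoad es u = ∑ es (λ e → load (common (c e)) u)
    deadLoad es u = ∑ es (λ e → load (deadOf (it e)) u)

    vertsOf : List Entry → List (Fin n)
    vertsOf es = concatMap (itemVerts ∘ it) es

    common-off : ∀ es {u} → u ∉ vertsOf es → commonLoad es u ≡ deadLoad es u
    common-off [] _ = refl
    common-off (e ∷ es) u∉ = cong₂ _+_ (off-verts e (λ p → u∉ (∈-++⁺ˡ p))) (common-off es (λ p → u∉ (∈-++⁺ʳ (itemVerts (it e)) p)))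

    ∈-vertsOf : ∀ {e es u} → e ∈ es → u ∈ itemVerts (it e) → u ∈ vertsOf es
    ∈-vertsOf e∈ u∈ = ∈-concatMap⁺ (itemVerts ∘ it) (lose e∈ u∈)

    common-at : ∀ es → Unique (vertsOf es) → ∀ {e u} → e ∈ es → u ∈ itemVerts (it e) →
      commonLoad es u ≡ deadLoad es u + load (common (c e)) u
    common-at (e ∷ es) uq {e = _} {u} (here refl) u∈ rewrite no-dead e u∈ =
      trans (cong (load (common (c e)) u +_) (common-off es (++-disjoint uq u∈))) (+-comm (load (common (c e)) u) _)
    common-at (e′ ∷ es) uq {e} {u} (there e∈) u∈ =
      trans (cong₂ _+_ (off-verts e′ (λ p → ++-disjoint uq p (∈-vertsOf e∈ u∈))) (common-at es (++-uniqueʳ (itemVerts (it e′)) uq) e∈ u∈))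
            (sym (+-assoc (load (deadOf (it e′)) u) _ _))

    heads-verts : ∀ es → All (_∈ vertsOf es) (concatMap head es)
    heads-verts [] = []
    heads-verts (e ∷ es) = AllP.++⁺ (All.map ∈-++⁺ˡ (head-verts e)) (All.map (∈-++⁺ʳ (itemVerts (it e))) (heads-verts es))

    heads-unique : ∀ es → Unique (vertsOf es) → Unique (concatMap head es)
    heads-unique [] _ = []
    heads-unique (e ∷ es) uq = Uniq.++⁺ (head-unique e) (heads-unique es (++-uniqueʳ (itemVerts (it e)) uq))
      (λ (p , q) → ++-disjoint uq (All.lookup (head-verts e) p) (All.lookup (heads-verts es) q))

    -- The heads are distinct vertices, so `∑φ-load` adds them on top of the common load. By
    -- disjointness the degree of a head before this step is `base` plus the common load of its own
    -- entry.
    phi-formula : ∀ (c₀ : Fin n → ℕ) es → Unique (vertsOf es) → (∀ u → base u ≡ c₀ u + deadLoad es u) → ∀ {τ′} → τ′ ∈ taus →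
      ∑V (λ u → φ τ′ (c₀ u + load (concat (map (proj₂ ∘ o) es)) u)) ≡
      ∑V (λ u → φ τ′ (c₀ u + load (concat (map (common ∘ c) es)) u)) + ∑ es (λ e → ⟦ proj₁ (o e) ⟧ * ⟦ τ e ≡ᵇ τ′ ⟧)
    phi-formula c₀ es uq bs {τ′} τ′∈ = begin
      ∑V (λ u → φ τ′ (c₀ u + load (concat (map (proj₂ ∘ o) es)) u))
        ≡⟨ ∑-cong (allFin n) (λ u → cong (φ τ′) (trans (cong (c₀ u +_) (total u)) (sym (+-assoc (c₀ u) _ _)))) ⟩
      ∑V (λ u → φ τ′ (c₁ u + load (concatMap head es) u))
        ≡⟨ ∑φ-load τ′ c₁ (concatMap head es) (heads-unique es uq) ⟩
      ∑V (λ u → φ τ′ (c₁ u)) + ∑ (concatMap head es) (λ y → ⟦ c₁ y % Q ≡ᵇ τ′ ⟧)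
        ≡⟨ cong (∑V (λ u → φ τ′ (c₁ u)) +_) (trans (∑-concatMap head es _) (∑-cong∈ es per-entry)) ⟩
      ∑V (λ u → φ τ′ (c₁ u)) + ∑ es (λ e → ⟦ proj₁ (o e) ⟧ * ⟦ τ e ≡ᵇ τ′ ⟧) ∎
      where
      open ≡-Reasoning
      c₁ : Fin n → ℕ
      c₁ u = c₀ u + load (concat (map (common ∘ c) es)) u
      commonLoad≡ : ∀ u → load (concat (map (common ∘ c) es)) u ≡ commonLoad es u
      commonLoad≡ u = trans (load-concat (map (common ∘ c) es) u) (∑-map (common ∘ c) es (λ f → load f u))
      total : ∀ u → load (concat (map (proj₂ ∘ o) es)) u ≡ load (concat (map (common ∘ c) es)) u + load (concatMap head es) u
      total u = trans (trans (load-concat (map (proj₂ ∘ o) es) u) (∑-map (proj₂ ∘ o) es (λ f → load f u)))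
        (trans (∑-cong es (λ e → load-split e u)) (trans (∑-+ es (λ e → load (common (c e)) u) (λ e → load (head e) u))
          (cong₂ _+_ (sym (commonLoad≡ u)) (sym (∑-concatMap head es (λ y → ⟦ y == u ⟧))))))
      per-entry : ∀ e → e ∈ es → ∑ (head e) (λ y → ⟦ c₁ y % Q ≡ᵇ τ′ ⟧) ≡ ⟦ proj₁ (o e) ⟧ * ⟦ τ e ≡ᵇ τ′ ⟧
      per-entry e e∈ = trans (∑-cong∈ (head e) (λ y y∈ → cong (λ k → ⟦ k % Q ≡ᵇ τ′ ⟧) (at y (All.lookup (head-verts e) y∈))))
                             (head-residue e τ′ τ′∈)
        where
        at : ∀ y → y ∈ itemVerts (it e) → c₁ y ≡ base y + load (common (c e)) y
        at y y∈ = trans (cong (c₀ y +_) (trans (commonLoad≡ y) (common-at es uq e∈ y∈)))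
          (trans (sym (+-assoc (c₀ y) _ _)) (cong (_+ load (common (c e)) y) (sym (bs y))))

-- Segments of spiders labelled by residues

peel : ∀ (p : A → Bool) t xs → t ≤ ∑ xs (λ x → ⟦ p x ⟧) →
  Σ (List A) λ ys → Σ (List A) λ zs → xs ≡ ys ++ zs × ∑ ys (λ x → ⟦ p x ⟧) ≡ t
peel p zero xs _ = [] , xs , refl , refl
peel p (suc t) (x ∷ xs) h with p x in eq
... | true with peel p t xs (≤-pred h)
...   | ys , zs , e , q = x ∷ ys , zs , cong (x ∷_) e , trans (cong (λ b → ⟦ b ⟧ + ∑ ys (λ x → ⟦ p x ⟧)) eq) (cong suc q)
peel p (suc t) (x ∷ xs) h | false with peel p (suc t) xs h
...   | ys , zs , e , q = x ∷ ys , zs , cong (x ∷_) e , trans (cong (λ b → ⟦ b ⟧ + ∑ ys (λ x → ⟦ p x ⟧)) eq) q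

-- All surplus goes into the last segment, where only a lower bound on the number of marked entries
-- is wanted.
split-by : ∀ (p : A → Bool) t (τ : ℕ) τs xs → suc (length τs) * t ≤ ∑ xs (λ x → ⟦ p x ⟧) →
  Σ (List (ℕ × List A)) λ zs → map proj₁ zs ≡ τ ∷ τs × concat (map proj₂ zs) ≡ xs ×
    All (λ z → t ≤ ∑ (proj₂ z) (λ x → ⟦ p x ⟧)) zs
split-by p t τ [] xs h = [ (τ , xs) ] , refl , ++-identityʳ xs , (≤-trans (m≤m+n t 0) h) ∷ []
split-by p t τ (τ′ ∷ τs) xs h with peel p t xs (≤-trans (m≤m+n t _) h)
... | ys , zs , refl , q with split-by p t τ′ τs zs
      (+-cancelˡ-≤ t _ _ (≤-trans h (≤-reflexive (trans (∑-++ ys zs _) (cong (_+ ∑ zs (λ x → ⟦ p x ⟧)) q)))))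
...   | ws , e₁ , e₂ , al = (τ , ys) ∷ ws , cong (τ ∷_) e₁ , cong (ys ++_) e₂ , ≤-reflexive (sym q) ∷ al

wsum : List ℕ → List (List (Bool × A)) → ℕ → ℕ
wsum (τ ∷ τs) (o ∷ ω) τ′ = #p o * ⟦ τ ≡ᵇ τ′ ⟧ + wsum τs ω τ′
wsum _ _ τ′ = 0

wsum-avoid : ∀ {A : Set} τs (ω : List (List (Bool × A))) {τ′} → All (τ′ ≢_) τs → wsum τs ω τ′ ≡ 0
wsum-avoid [] ω _ = refl
wsum-avoid (τ ∷ τs) [] _ = refl
wsum-avoid (τ ∷ τs) (o ∷ ω) (p ∷ ps) = cong₂ _+_ (trans (cong (λ b → #p o * ⟦ b ⟧) (≡ᵇ-false (p ∘ sym))) (*-zeroʳ (#p o))) (wsum-avoid τs ω ps)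

-- Since labels are distinct, `wsum` at a label is the count of the one segment that carries it.
-- Each candidate list therefore has a single entry.
wsum-determines : ∀ {A : Set} τs (ω ω₀ : List (List (Bool × A))) → Unique τs → length ω ≡ length τs → length ω₀ ≡ length τs →
  (∀ {τ′} → τ′ ∈ τs → wsum τs ω τ′ ≡ wsum τs ω₀ τ′) → Pointwise (λ o v → #p o ∈ v) ω (map (λ o → [ #p o ]) ω₀)
wsum-determines [] [] [] _ _ _ _ = []
wsum-determines (τ ∷ τs) (o ∷ ω) (o₀ ∷ ω₀) (τ∉ ∷ u) l l₀ eq =
  here (trans (sym (at o ω)) (trans (eq (here refl)) (at o₀ ω₀)))
  ∷ wsum-determines τs ω ω₀ u (suc-injective l) (suc-injective l₀) (λ {τ′} τ′∈ →
      trans (sym (cong (_+ wsum τs ω τ′) (off o τ′∈))) (trans (eq (there τ′∈)) (cong (_+ wsum τs ω₀ τ′) (off o₀ τ′∈))))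
  where
  at : ∀ o ω → wsum (τ ∷ τs) (o ∷ ω) τ ≡ #p o
  at o ω = trans (cong₂ _+_ (trans (cong (λ b → #p o * ⟦ b ⟧) (≡ᵇ-intro {τ} refl)) (*-identityʳ (#p o))) (wsum-avoid τs ω τ∉)) (+-identityʳ _)
  off : ∀ o {τ′} → τ′ ∈ τs → #p o * ⟦ τ ≡ᵇ τ′ ⟧ ≡ 0
  off o τ′∈ = trans (cong (λ b → #p o * ⟦ b ⟧) (≡ᵇ-false (All.lookup τ∉ τ′∈))) (*-zeroʳ (#p o))

unique-part : ∀ {A B : Set} (f : A → List B) xs → Unique (concatMap f xs) → ∀ {x} → x ∈ xs → Unique (f x)
unique-part f (x ∷ xs) u (here refl) = ++-uniqueˡ (f x) u
unique-part f (x ∷ xs) u (there x∈) = unique-part f xs (++-uniqueʳ (f x) u) x∈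

idle-tagged : ∀ (O : List A) → Tagged O (map fx O)
idle-tagged O G = cong (λ l → ∑ l G) (sym (proj₂-opts-fx O))

module SpiderBound {n : ℕ} (K : ℕ) (K>0 : 1 ≤ K) (R N t t₂ : ℕ) (R²≤t : R * R ≤ t)
  (small₂ : R * 2 ^ t * N ^ t₂ ≤ (1 + N) ^ t₂) where

  open Spiders {n}
  open import Data.List.Membership.DecPropositional (F._≟_ {n}) using (_∈?_)

  -- Twice `K`, so that when the feet have their residues in one half, the other half still offers
  -- `K` labels.
  Q : ℕ
  Q = 2 * K

  instance
    Q-nonZero : NonZero Q
    Q-nonZero = >-nonZero (≤-trans K>0 (m≤m+n K _))

  module _ (its : List Item) (uq : Unique (concatMap itemVerts its))
           (enough-legs : ∀ sp → live sp ∈ its → Q ≤ length (legs sp))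
           (sizes : ∀ it → it ∈ its → 2 * length (options it) ≤ 1 + N)
           (many : 2 * (K * t₂) ≤ ∑ its (λ it → ⟦ isLive it ⟧))
           (c₀ : Fin n → ℕ) (Stat : (ℕ → ℕ) → ℕ) (F : List (Fin n) → ℕ) (F≤1 : ∀ f → F f ≤ 1) (det : Detects c₀ Stat F) where

    -- Degrees after the dead spiders are revealed and before the live ones choose.
    base : Fin n → ℕ
    base u = c₀ u + ∑ its (λ it → load (deadOf it) u)

    lowFoot : Spider → Bool
    lowFoot sp = base (foot₁ sp) % Q <ᵇ K

    matches : Bool → Item → Bool
    matches h (live sp) = does (lowFoot sp 𝔹.≟ h)
    matches h (dead _) = false

    -- At least half of the live spiders have the residue of `foot₁` in the same half of the
    -- residues. These are allowed to switch, and the labels are taken from the opposite half.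
    majority : Σ Bool λ h → K * t₂ ≤ ∑ its (λ it → ⟦ matches h it ⟧)
    majority with K * t₂ ≤? ∑ its (λ it → ⟦ matches true it ⟧)
    ... | yes p = true , p
    ... | no p = false , +-cancelˡ-≤ (K * t₂) _ _ (begin
      K * t₂ + K * t₂                                   ≡⟨ cong (K * t₂ +_) (sym (+-identityʳ _)) ⟩
      2 * (K * t₂)                                      ≤⟨ many ⟩
      ∑ its (λ it → ⟦ isLive it ⟧)                      ≡⟨ ∑-cong its halves ⟩
      ∑ its (λ it → ⟦ matches true it ⟧ + ⟦ matches false it ⟧) ≡⟨ ∑-+ its _ _ ⟩
      ∑ its (λ it → ⟦ matches true it ⟧) + ∑ its (λ it → ⟦ matches false it ⟧) ≤⟨ +-monoˡ-≤ _ (<⇒≤ (≰⇒> p)) ⟩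
      K * t₂ + ∑ its (λ it → ⟦ matches false it ⟧)      ∎)
      where
      open ≤-Reasoning
      halves : ∀ it → ⟦ isLive it ⟧ ≡ ⟦ matches true it ⟧ + ⟦ matches false it ⟧
      halves (dead _) = refl
      halves (live sp) with lowFoot sp
      ... | true = refl
      ... | false = refl

    h : Bool
    h = proj₁ majority

    tausOf : Bool → List ℕ
    tausOf true = map (K +_) (upTo K)
    tausOf false = upTo K

    taus : List ℕ
    taus = tausOf h

    taus-length : ∀ h → length (tausOf h) ≡ K
    taus-length true = trans (length-map (K +_) (upTo K)) (length-upTo K)
    taus-length false = length-upTo K

    taus-unique : ∀ h → Unique (tausOf h)
    taus-unique true = Uniq.map⁺ (+-cancelˡ-≡ K _ _) (Uniq.upTo⁺ K)
    taus-unique false = Uniq.upTo⁺ K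

    taus-< : ∀ h {τ} → τ ∈ tausOf h → τ < Q
    taus-< true τ∈ with ∈-map⁻ (K +_) τ∈
    ... | i , i∈ , refl = <-≤-trans (+-monoʳ-< K (∈-upTo⁻ i∈)) (≤-reflexive (cong (K +_) (sym (+-identityʳ K))))
    taus-< false τ∈ = ≤-trans (∈-upTo⁻ τ∈) (m≤m+n K _)

    foot-avoids : ∀ h sp → matches h (live sp) ≡ true → base (foot₁ sp) % Q ∉ tausOf h
    foot-avoids true sp m τ∈ with ∈-map⁻ (K +_) τ∈
    ... | i , _ , e = <⇒≱ (<ᵇ⇒< _ K (Equivalence.from T-≡ (does-true {d = lowFoot sp 𝔹.≟ true} m)))
                          (≤-trans (m≤m+n K i) (≤-reflexive (sym e)))
    foot-avoids false sp m τ∈ =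
      true≢false (trans (sym (Equivalence.to T-≡ (<⇒<ᵇ (∈-upTo⁻ τ∈)))) (does-true {d = lowFoot sp 𝔹.≟ false} m))

    open Stage2 Q taus base
    open Residues Q

    record SiteData (τ : ℕ) (it : Item) : Set where
      field
        cells  : List (Cell Config)
        tagged : Tagged (options it) cells
        sw-ok  : matches h it ≡ true → hasSw cells ≡ true
        cell-ok : ∀ {c} → c ∈ cells → CellOk τ it c
    open SiteData

    on-verts : ∀ sp {x} → x ∈ options (live sp) → All (_∈ verts sp) x
    on-verts sp x∈ = does-true {d = All.all? (_∈? verts sp) _} (proj₂ (∈-filterᵇ⁻ {p = isOn sp} {xs = configs sp} x∈))

    idleSite : ∀ τ it → matches h it ≡ false → SiteData τ it
    idleSite τ it m .cells = map fx (options it)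
    idleSite τ it m .tagged = idle-tagged (options it)
    idleSite τ it m .sw-ok e = contradiction (trans (sym e) m) true≢false
    idleSite τ (dead x) m .cell-ok (here refl) = ok-dead x
    idleSite τ (live sp) m .cell-ok c∈ with ∈-map⁻ fx c∈
    ... | o , o∈ , refl = ok-fix sp o (on-verts sp o∈)

    -- Only two on-configurations with equal legs are paired and all others become fixed cells: one
    -- switch among boundedly many cells is frequent enough for the tail bound.
    switchingSite : ∀ {τ} → τ ∈ taus → ∀ sp → live sp ∈ its → matches h (live sp) ≡ true → SiteData τ (live sp)
    switchingSite {τ} τ∈ sp sp∈ m with reach-residue (base (body sp)) τ (taus-< h τ∈) | unique-part itemVerts its uq sp∈
    ... | k , k≤Q , res | (body≢foot ∷ body∉) ∷ foot∉ ∷ _ = record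
      { cells = switchSite p q rest
      ; tagged = switchSite-tagged σ
      ; sw-ok = λ _ → refl
      ; cell-ok = λ { (here refl) → ok-sw sp tl (All.map to-verts in-verts) no-foot
                                      (trans (cong (λ k → (base (body sp) + k) % Q) body-load) res) (foot-avoids h sp m)
                    ; (there c∈) → fixed c∈ } }
      where
      tl = tailConfig (body sp) k (legs sp)
      p = body sp ∷ tl
      q = foot₁ sp ∷ tl
      in-verts = tailConfig-verts (body sp) k (legs sp)
      to-verts : ∀ {y} → y ∈ body sp ∷ map foot (legs sp) → y ∈ verts sp
      to-verts (here e) = here e
      to-verts (there y∈) = there (there y∈)
      on : ∀ y → y ∈ verts sp → y ∈ opt₁ sp → y ∷ tl ∈ options (live sp)
      on y y∈ y∈O = ∈-filterᵇ⁺ {p = isOn sp} (∈-choices⁺ (y∈O ∷ tailConfig-∈ (body sp) k (legs∈ sp)))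
        (dec-true (All.all? (_∈? verts sp) (y ∷ tl)) (y∈ ∷ All.map to-verts in-verts))
      found = two-members (on (body sp) (here refl) (body∈₁ sp)) (on (foot₁ sp) (there (here refl)) (foot∈₁ sp))
                (λ e → body≢foot (proj₁ (LP.∷-injective e)))
      rest = proj₁ found
      σ = proj₂ found
      body-load : load tl (body sp) ≡ k
      body-load = tailConfig-load (body sp) k (legs sp) (≤-trans k≤Q (enough-legs sp sp∈)) body∉
      no-foot : load tl (foot₁ sp) ≡ 0
      no-foot = avoid tl in-verts (λ { (here e) → body≢foot (sym e) ; (there f∈) → All.lookup foot∉ f∈ refl })
      fixed : ∀ {c} → c ∈ map fx rest → CellOk τ (live sp) c
      fixed c∈ with ∈-map⁻ fx c∈
      ... | o , o∈ , refl = ok-fix sp o (on-verts sp (∈-resp-↭ (↭-sym σ) (there (there o∈))))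

    site : ∀ {τ} → τ ∈ taus → ∀ it → it ∈ its → SiteData τ it
    site τ∈ it it∈ with matches h it in m
    ... | false = idleSite _ it m
    site τ∈ (live sp) it∈ | true = switchingSite τ∈ sp it∈ m

    record SegmentData (z : ℕ × List Item) : Set where
      field
        seg  : List (List (Cell Config))
        tags : Pointwise Tagged (map options (proj₂ z)) seg
        sws  : ∑ (proj₂ z) (λ it → ⟦ matches h it ⟧) ≤ swSites seg
        oks  : ∀ {ρ} → Pointwise _∈_ ρ seg → Pointwise (CellOk (proj₁ z)) (proj₂ z) ρ
    open SegmentData

    segmentData : ∀ {τ} → τ ∈ taus → ∀ its′ → (∀ {it} → it ∈ its′ → it ∈ its) → SegmentData (τ , its′)
    segmentData τ∈ [] sub = record { seg = [] ; tags = [] ; sws = z≤n ; oks = λ { [] → [] } }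
    segmentData τ∈ (it ∷ its′) sub = record
      { seg = cells S ∷ seg Tl
      ; tags = tagged S ∷ tags Tl
      ; sws = +-mono-≤ (⟦⟧-≤ (λ e → ≤-reflexive (sym (⟦⟧-true (sw-ok S e))))) (sws Tl)
      ; oks = λ { (c∈ ∷ ps) → cell-ok S c∈ ∷ oks Tl ps } }
      where
      S = site τ∈ it (sub (here refl))
      Tl = segmentData τ∈ its′ (λ p → sub (there p))

    segsOf : ∀ {zs} → All SegmentData zs → List (List (List (Cell Config)))
    segsOf [] = []
    segsOf (d ∷ ds) = seg d ∷ segsOf ds

    segs-tagged : ∀ {zs} (ds : All SegmentData zs) → Pointwise (Pointwise Tagged) (map (map options) (map proj₂ zs)) (segsOf ds)
    segs-tagged [] = []
    segs-tagged (d ∷ ds) = tags d ∷ segs-tagged ds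

    segs-length : ∀ {zs} (ds : All SegmentData zs) → length (segsOf ds) ≡ length zs
    segs-length [] = refl
    segs-length (d ∷ ds) = cong suc (segs-length ds)

    record Entries (zs : List (ℕ × List Item)) (ρs : List (List (Cell Config))) (ω : List (List (Bool × Config))) : Set where
      field
        es : List Entry
        es-it : map it es ≡ concat (map proj₂ zs)
        es-c : map c es ≡ concat ρs
        es-o : map (proj₂ ∘ o) es ≡ untag ω
        es-τ : ∀ τ′ → ∑ es (λ e → ⟦ proj₁ (o e) ⟧ * ⟦ τ e ≡ᵇ τ′ ⟧) ≡ wsum (map proj₁ zs) ω τ′
    open Entries

    record Row (τ₀ : ℕ) (its′ : List Item) (ρ : List (Cell Config)) (om : List (Bool × Config)) : Set where
      field
        rs : List Entry
        rs-it : map it rs ≡ its′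
        rs-c : map c rs ≡ ρ
        rs-o : map (proj₂ ∘ o) rs ≡ map proj₂ om
        rs-τ : ∀ τ′ → ∑ rs (λ e → ⟦ proj₁ (o e) ⟧ * ⟦ τ e ≡ᵇ τ′ ⟧) ≡ #p om * ⟦ τ₀ ≡ᵇ τ′ ⟧
    open Row

    row : ∀ {τ₀ its′ ρ} → Pointwise (CellOk τ₀) its′ ρ → ∀ {om} → Pointwise _∈_ om (map opts ρ) → Row τ₀ its′ ρ om
    row [] [] = record { rs = [] ; rs-it = refl ; rs-c = refl ; rs-o = refl ; rs-τ = λ _ → refl }
    row {τ₀} (_∷_ {x = i} {y = cell} k ks) {x ∷ om} (x∈ ∷ ps) = record
      { rs = entry τ₀ i cell x k x∈ ∷ rs r
      ; rs-it = cong (i ∷_) (rs-it r)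
      ; rs-c = cong (cell ∷_) (rs-c r)
      ; rs-o = cong (proj₂ x ∷_) (rs-o r)
      ; rs-τ = λ τ′ → trans (cong (⟦ proj₁ x ⟧ * ⟦ τ₀ ≡ᵇ τ′ ⟧ +_) (rs-τ r τ′)) (sym (*-distribʳ-+ ⟦ τ₀ ≡ᵇ τ′ ⟧ ⟦ proj₁ x ⟧ (#p om))) }
      where r = row ks ps

    entries : ∀ {zs} (ds : All SegmentData zs) {ρs} → Pointwise _∈_ ρs (map choices (segsOf ds)) →
      ∀ {ω} → Pointwise _∈_ ω (map outcomes ρs) → Entries zs ρs ω
    entries [] [] [] = record { es = [] ; es-it = refl ; es-c = refl ; es-o = refl ; es-τ = λ _ → refl }
    entries (d ∷ ds) {ρ ∷ ρs} (p ∷ ps) {om ∷ ω} (q ∷ qs) = record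
      { es = rs r ++ es E
      ; es-it = trans (map-++ it (rs r) (es E)) (cong₂ _++_ (rs-it r) (es-it E))
      ; es-c = trans (map-++ c (rs r) (es E)) (cong₂ _++_ (rs-c r) (es-c E))
      ; es-o = trans (map-++ (proj₂ ∘ o) (rs r) (es E)) (cong₂ _++_ (rs-o r) (es-o E))
      ; es-τ = λ τ′ → trans (∑-++ (rs r) (es E) _) (cong₂ _+_ (rs-τ r τ′) (es-τ E τ′)) }
      where
      r = row (oks d (∈-choices⁻ (seg d) p)) (∈-choices⁻ (map opts ρ) q)
      E = entries ds ps qs

    concatMap-∘ : ∀ {A B C : Set} (f : B → List C) (g : A → B) xs → concatMap (f ∘ g) xs ≡ concatMap f (map g xs)
    concatMap-∘ f g [] = refl
    concatMap-∘ f g (x ∷ xs) = cong (f (g x) ++_) (concatMap-∘ f g xs)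

    -- The K statistics separate the segments and leave one candidate for each count, so
    -- `switch-bound` applies with κ = 1.
    stage₂ : R ^ K * ∑ (choices (map options its)) (F ∘ concat) ≤ 2 ^ K * ∏ its (length ∘ options)
    stage₂ with taus in taus-eq
    ... | [] = contradiction (trans (sym (taus-length h)) (cong length taus-eq)) (λ e → n≮0 (subst (1 ≤_) e K>0))
    ... | τ₁ ∷ τs with split-by (matches h) t₂ τ₁ τs its
             (≤-trans (≤-reflexive (cong (_* t₂) (trans (sym (cong length taus-eq)) (taus-length h)))) (proj₂ majority))
    ...   | zs , zs-τ , zs-its , zs-many = begin
      R ^ K * ∑ (choices (map options its)) (F ∘ concat)
        ≡⟨ cong₂ (λ k s → R ^ k * s) (sym segsK) (trans (cong (λ l → ∑ (choices l) (F ∘ concat)) oss≡) (tagged-∑ (segs-tagged ds) (F ∘ concat))) ⟩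
      R ^ length (segsOf ds) * ∑ (choices (map sites (segsOf ds))) (F ∘ concat ∘ untag)
        ≤⟨ Switch.switch-bound 1 R N t R²≤t (segsOf ds) (F ∘ concat ∘ untag) (λ ω → F≤1 _) sizes′ small′ constrain ⟩
      2 ^ length (segsOf ds) * ∏ (segsOf ds) (λ seg → ∏ seg siteSize)
        ≡⟨ cong₂ (λ k s → 2 ^ k * s) segsK (trans (tagged-∏ (segs-tagged ds)) (trans (cong (λ l → ∏ l length) (sym oss≡)) (∏-map options its length))) ⟩
      2 ^ K * ∏ its (length ∘ options) ∎
      where
      open ≤-Reasoning
      zs-taus : map proj₁ zs ≡ taus
      zs-taus = trans zs-τ (sym taus-eq)
      ds : All SegmentData zs
      ds = All.tabulate (λ {z} z∈ → segmentData (subst (proj₁ z ∈_) zs-taus (∈-map⁺ proj₁ z∈)) (proj₂ z)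
             (λ i∈ → subst (_ ∈_) zs-its (∈-concat⁺′ i∈ (∈-map⁺ proj₂ z∈))))
      segsK : length (segsOf ds) ≡ K
      segsK = trans (segs-length ds) (trans (sym (length-map proj₁ zs)) (trans (cong length zs-taus) (taus-length h)))
      oss≡ : map options its ≡ concat (map (map options) (map proj₂ zs))
      oss≡ = trans (cong (map options) (sym zs-its)) (sym (concat-map (map proj₂ zs)))
      sizes′ : ∀ sg → sg ∈ segsOf ds → ∀ cs → cs ∈ sg → 2 * siteSize cs ≤ 1 + N
      sizes′ sg sg∈ cs cs∈ = go (segs-tagged ds) (λ O∈ → in-sizes (subst (_ ∈_) (sym oss≡) O∈)) sg∈
        where
        in-sizes : ∀ {O} → O ∈ map options its → 2 * length O ≤ 1 + N
        in-sizes O∈ with ∈-map⁻ options O∈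
        ... | i , i∈ , refl = sizes i i∈
        inner : ∀ {os sg} → Pointwise Tagged os sg → (∀ {O} → O ∈ os → 2 * length O ≤ 1 + N) → cs ∈ sg → 2 * siteSize cs ≤ 1 + N
        inner {O ∷ _} (e ∷ _) f (here refl) = ≤-trans (≤-reflexive (cong (2 *_) (sym (tagged-length O cs e)))) (f (here refl))
        inner (_ ∷ es) f (there c∈) = inner es (λ p → f (there p)) c∈
        go : ∀ {oss sgs} → Pointwise (Pointwise Tagged) oss sgs → (∀ {O} → O ∈ concat oss → 2 * length O ≤ 1 + N) → sg ∈ sgs → 2 * siteSize cs ≤ 1 + N
        go (p ∷ _) f (here refl) = inner p (λ q → f (∈-++⁺ˡ q)) cs∈
        go {os ∷ _} (_ ∷ ps) f (there s∈) = go ps (λ q → f (∈-++⁺ʳ os q)) s∈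
      small′ : ∀ sg → sg ∈ segsOf ds → R * 2 ^ t * N ^ swSites sg ≤ (1 + N) ^ swSites sg
      small′ sg sg∈ = power-gap-mono (R * 2 ^ t) N (go ds zs-many sg∈) small₂
        where
        go : ∀ {zs} (ds : All SegmentData zs) → All (λ z → t₂ ≤ ∑ (proj₂ z) (λ x → ⟦ matches h x ⟧)) zs → sg ∈ segsOf ds → t₂ ≤ swSites sg
        go (d ∷ _) (q ∷ _) (here refl) = ≤-trans q (sws d)
        go (_ ∷ ds) (_ ∷ qs) (there s∈) = go ds qs s∈
      constrain : ∀ ρs → ρs ∈ choices (map choices (segsOf ds)) → ∀ ω₀ → ω₀ ∈ choices (map outcomes ρs) → 0 < F (concat (untag ω₀)) →
        Σ (List (List ℕ)) λ Vs → All (λ v → length v ≤ 1) Vs ×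
          (∀ ω → ω ∈ choices (map outcomes ρs) → 0 < F (concat (untag ω)) → Pointwise (λ o v → #p o ∈ v) ω Vs)
      constrain ρs ρs∈ ω₀ ω₀∈ pos₀ = map (λ o → [ #p o ]) ω₀ , AllP.map⁺ (All.tabulate (λ _ → ≤-refl))
        , λ ω ω∈ pos → wsum-determines (map proj₁ zs) ω ω₀ (subst Unique (sym zs-taus) (taus-unique h)) (len ω∈) (len ω₀∈)
            (λ {τ′} τ′∈ → let τ′∈′ = subst (τ′ ∈_) zs-taus τ′∈ in
              +-cancelˡ-≡ (∑V (λ u → φ τ′ (c₀ u + load (concat (map common (concat ρs))) u))) _ _
                (trans (sym (value ω ω∈ τ′∈′)) (trans (det _ pos (φ τ′)) (trans (sym (det _ pos₀ (φ τ′))) (value ω₀ ω₀∈ τ′∈′)))))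
        where
        pρ = ∈-choices⁻ (map choices (segsOf ds)) ρs∈
        len : ∀ {ω} → ω ∈ choices (map outcomes ρs) → length ω ≡ length (map proj₁ zs)
        len ω∈ = trans (trans (PW.Pointwise-length (∈-choices⁻ (map outcomes ρs) ω∈)) (length-map outcomes ρs))
          (trans (trans (PW.Pointwise-length pρ) (length-map choices (segsOf ds))) (trans (segs-length ds) (sym (length-map proj₁ zs))))
        value : ∀ ω → ω ∈ choices (map outcomes ρs) → ∀ {τ′} → τ′ ∈ taus →
          ∑V (λ u → φ τ′ (c₀ u + load (concat (untag ω)) u)) ≡
          ∑V (λ u → φ τ′ (c₀ u + load (concat (map common (concat ρs))) u)) + wsum (map proj₁ zs) ω τ′
        value ω ω∈ {τ′} τ′∈ = trans (cong (λ l → ∑V (λ u → φ τ′ (c₀ u + load (concat l) u))) (sym (es-o E)))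
          (trans (phi-formula c₀ (es E) uq′ bases τ′∈)
            (cong₂ (λ l s → ∑V (λ u → φ τ′ (c₀ u + load (concat l) u)) + s)
              (trans (map-∘ (es E)) (cong (map common) (es-c E))) (es-τ E τ′)))
          where
          E = entries ds pρ (∈-choices⁻ (map outcomes ρs) ω∈)
          its≡ : map it (es E) ≡ its
          its≡ = trans (es-it E) zs-its
          uq′ : Unique (vertsOf (es E))
          uq′ = subst Unique (sym (trans (concatMap-∘ itemVerts it (es E)) (cong (concatMap itemVerts) its≡))) uq
          bases : ∀ u → base u ≡ c₀ u + deadLoad (es E) u
          bases u = cong (c₀ u +_) (trans (cong (λ l → ∑ l (λ i → load (deadOf i) u)) (sym its≡)) (∑-map it (es E) (λ i → load (deadOf i) u)))

  module _ (sps : List Spider) (uq : Unique (concatMap verts sps))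
           (enough-legs : ∀ sp → sp ∈ sps → Q ≤ length (legs sp))
           (sizes : ∀ sp → sp ∈ sps → 2 * length (configs sp) ≤ 1 + N) (1≤N : 1 ≤ N)
           (small₁ : R ^ K * 2 ^ (2 * (K * t₂)) * N ^ length sps ≤ (1 + N) ^ length sps)
           (c₀ : Fin n → ℕ) (Stat : (ℕ → ℕ) → ℕ) (F : List (Fin n) → ℕ) (F≤1 : ∀ f → F f ≤ 1) (det : Detects c₀ Stat F) where

    open Tail {S = Spider} items options isLive (λ _ → true) N

    -- Two stages of revelation. The first shows which spiders are off; fewer than `2 * (K * t₂)`
    -- live ones remain with probability at most 1/R^K. Otherwise `stage₂` works with the live
    -- spiders that are left.
    spider-bound : R ^ K * ∑ (choices (concat (map spOpts sps))) F ≤ (1 + 2 ^ K) * ∏ (concat (map spOpts sps)) length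
    spider-bound = begin
      R ^ K * ∑ (choices (concat (map spOpts sps))) F
        ≡⟨ cong (R ^ K *_) (trans (choices-concat (map spOpts sps) F) (trans (choices-cong (pw sps) (F ∘ concat)) (trans (cong (λ l → ∑ (choices l) (F ∘ concat)) (map-∘ sps)) (refine options (map items sps) (F ∘ concat))))) ⟩
      R ^ K * ∑ (choices (map items sps)) (λ ρ → ∑ (choices (map options ρ)) (F ∘ concat))
        ≤⟨ conditional-bound sps (R ^ K) (2 ^ K) (2 * (K * t₂)) bounded small₁′ _ trivial live-enough ⟩
      (1 + 2 ^ K) * ∏ sps Ω
        ≡⟨ cong ((1 + 2 ^ K) *_) (total sps) ⟩
      (1 + 2 ^ K) * ∏ (concat (map spOpts sps)) length ∎
      where
      open ≤-Reasoning
      pw : ∀ sps → Pointwise _≈_ (map choices (map spOpts sps)) (map (concatMap options ∘ items) sps)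
      pw [] = []
      pw (sp ∷ sps) = items-partition sp ∷ pw sps
      Ω≡ : ∀ sp → Ω sp ≡ length (configs sp)
      Ω≡ sp = trans (go (items sp)) (sym (≈-length (configs sp) (concatMap options (items sp)) (items-partition sp)))
        where
        go : ∀ is → ∑ is len ≡ length (concatMap options is)
        go [] = refl
        go (i ∷ is) = trans (cong (length (options i) +_) (go is)) (sym (length-++ (options i)))
      total : ∀ sps → ∏ sps Ω ≡ ∏ (concat (map spOpts sps)) length
      total [] = refl
      total (sp ∷ sps) = trans (cong₂ _*_ (trans (Ω≡ sp) (length-choices (spOpts sp))) (total sps)) (sym (∏-++ (spOpts sp) _ length))
      all-on : ∀ sp → 1 ≤ length (options (live sp))
      all-on sp = ≤-trans (∑-term (λ _ → 1) mem) (≤-reflexive (∑-one (options (live sp))))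
        where
        tl = tailConfig (body sp) 0 (legs sp)
        to-verts : ∀ {y} → y ∈ body sp ∷ map foot (legs sp) → y ∈ verts sp
        to-verts (here e) = here e
        to-verts (there y∈) = there (there y∈)
        mem : body sp ∷ tl ∈ options (live sp)
        mem = ∈-filterᵇ⁺ {p = isOn sp} (∈-choices⁺ (body∈₁ sp ∷ tailConfig-∈ (body sp) 0 (legs∈ sp)))
          (dec-true (All.all? (_∈? verts sp) (body sp ∷ tl)) (here refl ∷ All.map to-verts (tailConfig-verts (body sp) 0 (legs sp))))
      bounded : ∀ sp → sp ∈ sps → Bounded sp
      bounded sp sp∈ _ = ≤-trans (all-on sp) (≤-trans (≤-reflexive (sym (+-identityʳ (length (options (live sp)))))) (m≤m+n _ _))
        , ≤-trans (≤-reflexive (cong (2 *_) (Ω≡ sp))) (sizes sp sp∈)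
      live-all : ∀ sps → liveCount sps ≡ length sps
      live-all sps = ∑-one sps
      small₁′ : R ^ K * 2 ^ (2 * (K * t₂)) * N ^ liveCount sps ≤ (1 + N) ^ liveCount sps
      small₁′ = subst (λ k → R ^ K * 2 ^ (2 * (K * t₂)) * N ^ k ≤ (1 + N) ^ k) (sym (live-all sps)) small₁
      trivial : ∀ ρ → ρ ∈ choices (map items sps) → ∑ (choices (map options ρ)) (F ∘ concat) ≤ ∏ ρ len
      trivial ρ _ = ≤-trans (∑-mono (choices (map options ρ)) (λ f → F≤1 (concat f)))
        (≤-reflexive (trans (∑-one (choices (map options ρ))) (trans (length-choices (map options ρ)) (∏-map options ρ length))))
      data ItemOf (sp : Spider) : Item → Set where
        alive : ItemOf sp (live sp)
        dying : ∀ x → ItemOf sp (dead x)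
      itemOf : ∀ sp {i} → i ∈ items sp → ItemOf sp i
      itemOf sp (here refl) = alive
      itemOf sp (there i∈) with ∈-map⁻ dead i∈
      ... | x , _ , refl = dying x
      itemsOf : ∀ sps {ρ} → Pointwise _∈_ ρ (map items sps) → Pointwise ItemOf sps ρ
      itemsOf [] [] = []
      itemsOf (sp ∷ sps) (p ∷ ps) = itemOf sp p ∷ itemsOf sps ps
      live-enough : ∀ ρ → ρ ∈ choices (map items sps) → 2 * (K * t₂) ≤ onCount ρ →
        R ^ K * ∑ (choices (map options ρ)) (F ∘ concat) ≤ 2 ^ K * ∏ ρ len
      live-enough ρ ρ∈ many = stage₂ ρ (unique-verts sps uq pis) (λ sp sp∈ → enough-legs sp (live-∈ pis sp∈))
        (λ i i∈ → item-size i (λ sp e → live-∈ pis (subst (_∈ ρ) e i∈))) many c₀ Stat F F≤1 det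
        where
        pis = itemsOf sps (∈-choices⁻ (map items sps) ρ∈)
        live-∈ : ∀ {sps ρ} → Pointwise ItemOf sps ρ → ∀ {sp} → live sp ∈ ρ → sp ∈ sps
        live-∈ (alive ∷ ps) (here refl) = here refl
        live-∈ (_ ∷ ps) (there p) = there (live-∈ ps p)
        item-size : ∀ i → (∀ sp → i ≡ live sp → sp ∈ sps) → 2 * length (options i) ≤ 1 + N
        item-size (dead x) _ = s≤s 1≤N
        item-size (live sp) f = ≤-trans (*-monoʳ-≤ 2 (≤-trans (≤-reflexive (length-filter-∑ (isOn sp) (configs sp)))
          (≤-trans (∑-mono (configs sp) (λ x → ⟦⟧≤1 (isOn sp x))) (≤-reflexive (∑-one (configs sp)))))) (sizes sp (f sp refl))
        verts-sub : ∀ {sps ρ} → Pointwise ItemOf sps ρ → ∀ {v} → v ∈ concatMap itemVerts ρ → v ∈ concatMap verts sps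
        verts-sub {sp ∷ _} (alive ∷ ps) v∈ with ∈-++⁻ (verts sp) v∈
        ... | inj₁ q = ∈-++⁺ˡ q
        ... | inj₂ q = ∈-++⁺ʳ (verts sp) (verts-sub ps q)
        verts-sub {sp ∷ _} (dying x ∷ ps) v∈ = ∈-++⁺ʳ (verts sp) (verts-sub ps v∈)
        unique-verts : ∀ sps → Unique (concatMap verts sps) → ∀ {ρ} → Pointwise ItemOf sps ρ → Unique (concatMap itemVerts ρ)
        unique-verts [] _ [] = []
        unique-verts (sp ∷ sps) u (dying x ∷ ps) = unique-verts sps (++-uniqueʳ (verts sp) u) ps
        unique-verts (sp ∷ sps) u {_ ∷ ρ′} (alive ∷ ps) = merge (verts sp) u
          where
          merge : ∀ ys → Unique (ys ++ concatMap verts sps) → Unique (ys ++ concatMap itemVerts ρ′)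
          merge [] u = unique-verts sps u ps
          merge (y ∷ ys) (y∉ ∷ u) = AllP.++⁺ (AllP.++⁻ˡ ys y∉) (All.tabulate (λ v∈ → All.lookup (AllP.++⁻ʳ ys y∉) (verts-sub ps v∈))) ∷ merge ys u

-- Many disjoint spiders or few hubs

n≤2^n : ∀ R → R ≤ 2 ^ R
n≤2^n zero = z≤n
n≤2^n (suc R) = ≤-trans (+-mono-≤ (m^n>0 2 R) (n≤2^n R)) (≤-reflexive (cong (2 ^ R +_) (sym (+-identityʳ _))))

take-unique : ∀ (p : Fin n → Bool) r → r ≤ ∑V (λ w → ⟦ p w ⟧) →
  Σ (List (Fin n)) λ ws → length ws ≡ r × Unique ws × All (λ w → p w ≡ true) ws
take-unique {n} p r h = take r ws , len , Uniq.take⁺ r (unique-filterᵇ p (Uniq.allFin⁺ n)) , AllP.take⁺ r (All.tabulate (λ w∈ → proj₂ (∈-filterᵇ⁻ {p = p} {xs = allFin n} w∈)))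
  where
  ws = filterᵇ p (allFin n)
  len : length (take r ws) ≡ r
  len = trans (length-take r ws) (m≤n⇒m⊓n≡m (≤-trans h (≤-reflexive (sym (length-filter-∑ p (allFin n))))))

module _ {n : ℕ} where

  open import Data.List.Membership.DecPropositional (F._≟_ {n}) using (_∈?_)

  infix 4 _∈ᵇ_
  abstract
    _∈ᵇ_ : Fin n → List (Fin n) → Bool
    y ∈ᵇ xs = does (y ∈? xs)

    ∈ᵇ-true : ∀ {y xs} → (y ∈ᵇ xs) ≡ true → y ∈ xs
    ∈ᵇ-true {y} {xs} = does-true {d = y ∈? xs}

    ∈ᵇ-false : ∀ {y xs} → not (y ∈ᵇ xs) ≡ true → y ∉ xs
    ∈ᵇ-false {y} {xs} e with y ∈? xs
    ... | no p = p

    ∈ᵇ-intro : ∀ {y xs} → y ∈ xs → (y ∈ᵇ xs) ≡ true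
    ∈ᵇ-intro {y} {xs} = dec-true (y ∈? xs)

    ∉ᵇ-intro : ∀ {y xs} → y ∉ xs → not (y ∈ᵇ xs) ≡ true
    ∉ᵇ-intro {y} {xs} q = cong not (dec-false (y ∈? xs) q)

  ∑-∈ᵇ : ∀ (p : Fin n → Bool) xs → ∑V (λ y → ⟦ p y ∧ (y ∈ᵇ xs) ⟧) ≤ length xs
  ∑-∈ᵇ p xs = ≤-trans (∑-inj {ys = xs} id {g = λ _ → 1} (Uniq.allFin⁺ n)
    (λ y _ q → ∈ᵇ-true (proj₂ (∧-true {p y} (⟦⟧-pos q))) , ⟦⟧≤1 (p y ∧ (y ∈ᵇ xs))) (λ _ _ _ _ _ _ e → e)) (≤-reflexive (∑-one xs))

  ⟦⟧-split : ∀ p b → ⟦ p ⟧ ≡ ⟦ p ∧ b ⟧ + ⟦ p ∧ not b ⟧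
  ⟦⟧-split true true = refl
  ⟦⟧-split true false = refl
  ⟦⟧-split false b = refl

  ∑-split : ∀ (p b : Fin n → Bool) → ∑V (λ y → ⟦ p y ⟧) ≡ ∑V (λ y → ⟦ p y ∧ b y ⟧) + ∑V (λ y → ⟦ p y ∧ not (b y) ⟧)
  ∑-split p b = trans (∑-cong (allFin n) (λ y → ⟦⟧-split (p y) (b y))) (∑-+ (allFin n) (λ y → ⟦ p y ∧ b y ⟧) (λ y → ⟦ p y ∧ not (b y) ⟧))

  ∑-avoid : ∀ (p : Fin n → Bool) xs → ∑V (λ y → ⟦ p y ⟧) ≤ length xs + ∑V (λ y → ⟦ p y ∧ not (y ∈ᵇ xs) ⟧)
  ∑-avoid p xs = ≤-trans (≤-reflexive (∑-split p (_∈ᵇ xs))) (+-monoˡ-≤ _ (∑-∈ᵇ p xs))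

  pick-avoiding : ∀ (p : Fin n → Bool) xs → length xs < ∑V (λ y → ⟦ p y ⟧) → Σ (Fin n) λ y → p y ≡ true × y ∉ xs
  pick-avoiding p xs h with ∑V-pos (λ y → p y ∧ not (y ∈ᵇ xs)) (+-cancelˡ-< (length xs) _ _
    (≤-<-trans (≤-reflexive (+-identityʳ _)) (<-≤-trans h (∑-avoid p xs))))
  ... | y , e = y , proj₁ (∧-true {p y} e) , ∈ᵇ-false (proj₂ (∧-true {p y} e))

-- The hypothesis `n-small` says that leaves and options form so many pairs that, even after losing
-- half of the leaves and half of the options, some vertex is an option of more than 2K leaves.
module Dichotomy {n : ℕ} (inL : Fin n → Bool) (op : Fin n → Fin n → Bool) (ℓ : ℕ) (ℓ≤ : ℓ ≤ ∑V (λ w → ⟦ inL w ⟧))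
  (K h R : ℕ) (K>0 : 1 ≤ K) (h-large : 2 * K + 3 ≤ h)
  (op-lower : ∀ w → inL w ≡ true → 2 * h ≤ ∑V (λ y → ⟦ op w y ⟧))
  (op-upper : ∀ w → inL w ≡ true → ∑V (λ y → ⟦ op w y ⟧) ≤ 4 * h)
  (n-small : 2 * (n * (2 * K)) < ℓ * h) where

  O : Fin n → List (Fin n)
  O w = filterᵇ (op w) (allFin n)

  O-length : ∀ w → inL w ≡ true → length (O w) ≤ 4 * h
  O-length w e = ≤-trans (≤-reflexive (length-filter-∑ (op w) (allFin n))) (op-upper w e)

  ∈-O : ∀ {w y} → op w y ≡ true → y ∈ O w
  ∈-O {w} e = ∈-filterᵇ⁺ {p = op w} (∈-allFin _) e

  Q : ℕ
  Q = 2 * K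

  h>0 : 1 ≤ h
  h>0 = ≤-trans (s≤s z≤n) (≤-trans (m≤n+m 3 (2 * K)) h-large)

  4h-nonZero : NonZero (4 * h)
  4h-nonZero = >-nonZero (*-mono-≤ {1} {4} (s≤s z≤n) h>0)

  t : ℕ
  t = R * R

  abstract
    -- A spider has at most `s` configurations, and `1 + N = 2 * s` is the size parameter of the
    -- tail bound. By `power-gap` and `R ≤ 2 ^ R`, `t₂` sites gain the factor R · 2^t and `m`
    -- spiders gain R^K · 2^(2 K t₂). Finally `u` bounds the number of vertices in `m` spiders.
    s N t₂ m u : ℕ
    s = (4 * h) ^ suc Q
    N = 2 * s ∸ 1
    t₂ = (1 + N) * (t + R)
    m = (1 + N) * (2 * (K * t₂) + K * R)
    u = m * (2 + Q)

    s-def : s ≡ (4 * h) ^ suc Q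
    s-def = refl

    t₂-def : t₂ ≡ (1 + N) * (t + R)
    t₂-def = refl

    m-def : m ≡ (1 + N) * (2 * (K * t₂) + K * R)
    m-def = refl

    u-def : u ≡ m * (2 + Q)
    u-def = refl

    s>0 : 1 ≤ s
    s>0 = m^n>0 (4 * h) {{4h-nonZero}} (suc Q)

    1+N : 1 + N ≡ 2 * s
    1+N = m+[n∸m]≡n (*-mono-≤ {1} {2} (s≤s z≤n) s>0)

    4h≤s : 4 * h ≤ s
    4h≤s = ≤-trans (≤-reflexive (sym (*-identityʳ (4 * h)))) (*-monoʳ-≤ (4 * h) (m^n>0 (4 * h) {{4h-nonZero}} Q))

    small-t₂ : R * 2 ^ t * N ^ t₂ ≤ (1 + N) ^ t₂
    small-t₂ = ≤-trans (*-monoˡ-≤ (N ^ t₂) (≤-trans (*-monoˡ-≤ (2 ^ t) (n≤2^n R))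
      (≤-reflexive (trans (*-comm (2 ^ R) (2 ^ t)) (sym (^-distribˡ-+-* 2 t R)))))) (power-gap N (t + R))

    small-m : R ^ K * 2 ^ (2 * (K * t₂)) * N ^ m ≤ (1 + N) ^ m
    small-m = ≤-trans (*-monoˡ-≤ (N ^ m) (≤-trans (*-monoˡ-≤ (2 ^ (2 * (K * t₂))) (≤-trans (^-monoˡ-≤ K (n≤2^n R)) (≤-reflexive (trans (^-*-assoc 2 R K) (cong (2 ^_) (*-comm R K))))))
      (≤-reflexive (trans (*-comm (2 ^ (K * R)) _) (sym (^-distribˡ-+-* 2 (2 * (K * t₂)) (K * R))))))) (power-gap N (2 * (K * t₂) + K * R))

  -- Common target of both cases. The constant is that of the hubs, which exceeds the `1 + 2 ^ K` of
  -- the spiders.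
  Good : List (Fin n) → Set
  Good ws = Unique ws × All (λ w → inL w ≡ true) ws ×
    (∀ c Stat F → (∀ f → F f ≤ 1) → Detects c Stat F →
       R ^ K * ∑ (choices (map O ws)) F ≤ (4 * K) ^ K * ∏ (map O ws) length)

  open Spiders {n}

  record Sel : Set where
    field
      bodyS : Fin n
      w₁ f₁ : Fin n
      pairs : List (Fin n × Fin n)
      len   : length pairs ≡ Q
      w₁-ok : inL w₁ ≡ true × op w₁ bodyS ≡ true × op w₁ f₁ ≡ true
      ps-ok : All (λ p → inL (proj₁ p) ≡ true × op (proj₁ p) bodyS ≡ true × op (proj₁ p) (proj₂ p) ≡ true) pairs
  open Sel

  spider : Sel → Spider
  spider x = record
    { body = bodyS x ; foot₁ = f₁ x ; opt₁ = O (w₁ x)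
    ; legs = map (λ p → record { foot = proj₂ p ; opt = O (proj₁ p) }) (pairs x)
    ; body∈₁ = ∈-O (proj₁ (proj₂ (w₁-ok x))) ; foot∈₁ = ∈-O (proj₂ (proj₂ (w₁-ok x)))
    ; legs∈ = AllP.map⁺ (All.map (λ (_ , a , b) → ∈-O a , ∈-O b) (ps-ok x)) }

  wsOf : Sel → List (Fin n)
  wsOf x = w₁ x ∷ map proj₁ (pairs x)

  vsOf : Sel → List (Fin n)
  vsOf x = bodyS x ∷ f₁ x ∷ map proj₂ (pairs x)

  vsOf≡verts : ∀ x → vsOf x ≡ verts (spider x)
  vsOf≡verts x = cong (λ l → bodyS x ∷ f₁ x ∷ l) (map-∘ (pairs x))

  spOpts≡ : ∀ x → spOpts (spider x) ≡ map O (wsOf x)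
  spOpts≡ x = cong (O (w₁ x) ∷_) (trans (sym (map-∘ (pairs x))) (map-∘ (pairs x)))

  Selection : List Sel → Set
  Selection xs = Unique (concatMap wsOf xs) × Unique (concatMap vsOf xs)

  ws-inL : ∀ x → All (λ w → inL w ≡ true) (wsOf x)
  ws-inL x = proj₁ (w₁-ok x) ∷ AllP.map⁺ (All.map proj₁ (ps-ok x))

  spiders-good : ∀ xs → length xs ≡ m → Selection xs → Good (concatMap wsOf xs)
  spiders-good xs len-xs (uw , uv) = uw , all-L xs , λ c Stat F F≤1 det → begin
    R ^ K * ∑ (choices (map O (concatMap wsOf xs))) F
      ≡⟨ cong (λ l → R ^ K * ∑ (choices l) F) (opts≡ xs) ⟩
    R ^ K * ∑ (choices (concat (map spOpts sps))) F
      ≤⟨ SpiderBound.spider-bound K K>0 R N t t₂ ≤-refl small-t₂ sps uq legs-enough sizes 1≤N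
           (subst (λ k → R ^ K * 2 ^ (2 * (K * t₂)) * N ^ k ≤ (1 + N) ^ k) (sym (trans (length-map spider xs) len-xs)) small-m) c Stat F F≤1 det ⟩
    (1 + 2 ^ K) * ∏ (concat (map spOpts sps)) length
      ≤⟨ *-monoˡ-≤ _ constant ⟩
    (4 * K) ^ K * ∏ (concat (map spOpts sps)) length
      ≡⟨ cong (λ l → (4 * K) ^ K * ∏ l length) (sym (opts≡ xs)) ⟩
    (4 * K) ^ K * ∏ (map O (concatMap wsOf xs)) length ∎
    where
    open ≤-Reasoning
    sps = map spider xs
    all-L : ∀ xs → All (λ w → inL w ≡ true) (concatMap wsOf xs)
    all-L [] = []
    all-L (x ∷ xs) = AllP.++⁺ (ws-inL x) (all-L xs)
    opts≡ : ∀ xs → map O (concatMap wsOf xs) ≡ concat (map spOpts (map spider xs))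
    opts≡ [] = refl
    opts≡ (x ∷ xs) = trans (map-++ O (wsOf x) _) (cong₂ _++_ (sym (spOpts≡ x)) (opts≡ xs))
    verts≡ : ∀ xs → concatMap vsOf xs ≡ concatMap verts (map spider xs)
    verts≡ [] = refl
    verts≡ (x ∷ xs) = cong₂ _++_ (vsOf≡verts x) (verts≡ xs)
    uq : Unique (concatMap verts sps)
    uq = subst Unique (verts≡ xs) uv
    legs-enough : ∀ sp → sp ∈ sps → Q ≤ length (legs sp)
    legs-enough sp sp∈ with ∈-map⁻ spider sp∈
    ... | x , _ , refl = ≤-reflexive (sym (trans (length-map _ (pairs x)) (len x)))
    ∏-bound : ∀ ws → All (λ w → inL w ≡ true) ws → ∏ (map O ws) length ≤ (4 * h) ^ length ws
    ∏-bound [] [] = ≤-refl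
    ∏-bound (w ∷ ws) (e ∷ es) = *-mono-≤ (O-length w e) (∏-bound ws es)
    sizes : ∀ sp → sp ∈ sps → 2 * length (configs sp) ≤ 1 + N
    sizes sp sp∈ with ∈-map⁻ spider sp∈
    ... | x , _ , refl = begin
      2 * length (configs (spider x))   ≡⟨ cong (2 *_) (trans (length-choices (spOpts (spider x))) (cong (λ l → ∏ l length) (spOpts≡ x))) ⟩
      2 * ∏ (map O (wsOf x)) length     ≤⟨ *-monoʳ-≤ 2 (∏-bound (wsOf x) (ws-inL x)) ⟩
      2 * (4 * h) ^ length (wsOf x)     ≡⟨ cong (λ k → 2 * (4 * h) ^ suc k) (trans (length-map proj₁ (pairs x)) (len x)) ⟩
      2 * (4 * h) ^ suc Q               ≡⟨ trans (cong (2 *_) (sym s-def)) (sym 1+N) ⟩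
      1 + N                             ∎
    1≤N : 1 ≤ N
    1≤N = ≤-pred (≤-trans (*-monoʳ-≤ 2 s>0) (≤-reflexive (sym 1+N)))
    constant : 1 + 2 ^ K ≤ (4 * K) ^ K
    constant = ≤-trans (go K K>0) (^-monoˡ-≤ K (≤-trans (≤-reflexive (sym (*-identityʳ 4))) (*-monoʳ-≤ 4 K>0)))
      where
      go : ∀ k → 1 ≤ k → 1 + 2 ^ k ≤ 4 ^ k
      go (suc zero) _ = s≤s (s≤s (s≤s z≤n))
      go (suc (suc k)) _ = ≤-trans (≤-trans (m≤m+n (1 + 2 * 2 ^ suc k) (3 + 2 * 2 ^ suc k)) (≤-reflexive (e (2 ^ suc k)))) (*-monoʳ-≤ 4 (go (suc k) (s≤s z≤n)))
        where
        e : ∀ a → 1 + 2 * a + (3 + 2 * a) ≡ 4 * (1 + a)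
        e = solve-∀

  fresh : List (Fin n) → Fin n → Bool
  fresh W w = inL w ∧ not (w ∈ᵇ W)

  optsIn : List (Fin n) → Fin n → ℕ
  optsIn U w = ∑V (λ y → ⟦ op w y ∧ (y ∈ᵇ U) ⟧)

  hubby : List (Fin n) → Fin n → Bool
  hubby U w = h ≤ᵇ optsIn U w

  ManyHubby : List (Fin n) → List (Fin n) → Set
  ManyHubby W U = ℓ ≤ 4 * ∑V (λ w → ⟦ fresh W w ∧ hubby U w ⟧)

  -- Greedy choice: a foot avoids the body and the feet chosen earlier, at most Q + 1 vertices in
  -- all, while `h` options outside `U` are available.
  feet : ∀ U a ws fb → length fb + length ws ≤ 1 + Q → All (λ w → inL w ≡ true × op w a ≡ true × h ≤ ∑V (λ y → ⟦ op w y ∧ not (y ∈ᵇ U) ⟧)) ws →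
    Σ (List (Fin n × Fin n)) λ ps → map proj₁ ps ≡ ws × Unique (map proj₂ ps) × All (λ y → y ∉ U × y ≢ a × y ∉ fb) (map proj₂ ps) ×
      All (λ p → inL (proj₁ p) ≡ true × op (proj₁ p) a ≡ true × op (proj₁ p) (proj₂ p) ≡ true) ps
  feet U a [] fb _ [] = [] , refl , [] , [] , []
  feet U a (w ∷ ws) fb bound ((wL , wa , wh) ∷ rest)
    with pick-avoiding (λ y → op w y ∧ not (y ∈ᵇ U)) (a ∷ fb)
           (≤-trans (s≤s (s≤s (≤-trans (m≤m+n (length fb) (suc (length ws))) bound))) (≤-trans (≤-trans (≤-reflexive (e Q)) h-large′) wh))
    where
    e : ∀ q → 2 + (1 + q) ≡ 3 + q
    e = solve-∀
    h-large′ : 3 + Q ≤ h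
    h-large′ = ≤-trans (≤-reflexive (+-comm 3 Q)) h-large
  ... | y , yok , y∉ with feet U a ws (y ∷ fb) (≤-trans (≤-reflexive (sym (+-suc (length fb) (length ws)))) bound) rest
  ...   | ps , e , uq , al , ok = (w , y) ∷ ps , cong (w ∷_) e
    , All.map (λ (_ , _ , q) → λ { refl → q (here refl) }) al ∷ uq
    , (∈ᵇ-false (proj₂ (∧-true {op w y} yok)) , (λ e → y∉ (here e)) , (λ q → y∉ (there q)))
      ∷ All.map (λ (p , q , r) → p , q , (λ z → r (there z))) al
    , (wL , wa , proj₁ (∧-true {op w y} yok)) ∷ ok

  step : ∀ W U → 4 * length W ≤ ℓ → ManyHubby W U ⊎
    (Σ Sel λ x → Unique (wsOf x) × Unique (vsOf x) × All (_∉ W) (wsOf x) × All (_∉ U) (vsOf x))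
  step W U W-small with ℓ ≤? 4 * ∑V (λ w → ⟦ fresh W w ∧ hubby U w ⟧)
  ... | yes p = inj₁ p
  ... | no p = inj₂ (build centre)
    where
    open ≤-Reasoning
    V = allFin n
    good : Fin n → Bool
    good w = fresh W w ∧ not (hubby U w)
    out : Fin n → Fin n → Bool
    out w y = op w y ∧ not (y ∈ᵇ U)
    G = ∑V (λ w → ⟦ good w ⟧)
    H = ∑V (λ w → ⟦ fresh W w ∧ hubby U w ⟧)
    G-large : ℓ ≤ 2 * G
    G-large = *-cancelˡ-≤ 2 (+-cancelˡ-≤ (ℓ + ℓ) _ _ (begin
      ℓ + ℓ + 2 * ℓ                        ≡⟨ e₁ ℓ ⟩
      4 * ℓ                                ≤⟨ *-monoʳ-≤ 4 (≤-trans ℓ≤ (∑-avoid inL W)) ⟩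
      4 * (length W + ∑V (λ w → ⟦ fresh W w ⟧)) ≡⟨ cong (λ k → 4 * (length W + k)) (∑-split (fresh W) (hubby U)) ⟩
      4 * (length W + (H + G))             ≡⟨ e₂ (length W) H G ⟩
      4 * length W + 4 * H + 2 * (2 * G)   ≤⟨ +-monoˡ-≤ (2 * (2 * G)) (+-mono-≤ W-small (<⇒≤ (≰⇒> p))) ⟩
      ℓ + ℓ + 2 * (2 * G)                  ∎))
      where
      e₁ : ∀ l → l + l + 2 * l ≡ 4 * l
      e₁ = solve-∀
      e₂ : ∀ w h g → 4 * (w + (h + g)) ≡ 4 * w + 4 * h + 2 * (2 * g)
      e₂ = solve-∀
    out-large : ∀ w → good w ≡ true → h ≤ ∑V (λ y → ⟦ out w y ⟧)
    out-large w gw = +-cancelˡ-≤ h _ _ (begin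
      h + h                                         ≡⟨ cong (h +_) (sym (+-identityʳ h)) ⟩
      2 * h                                         ≤⟨ op-lower w (proj₁ (∧-true {inL w} (proj₁ (∧-true {fresh W w} gw)))) ⟩
      ∑V (λ y → ⟦ op w y ⟧)                         ≡⟨ ∑-split (op w) (_∈ᵇ U) ⟩
      optsIn U w + ∑V (λ y → ⟦ out w y ⟧)           ≤⟨ +-monoˡ-≤ _ (<⇒≤ few) ⟩
      h + ∑V (λ y → ⟦ out w y ⟧)                    ∎)
      where
      few : optsIn U w < h
      few with hubby U w in eq | proj₂ (∧-true {fresh W w} gw)
      ... | false | _ = ≤ᵇ-false eq
    centre : Σ (Fin n) λ a → Q < ∑V (λ w → ⟦ good w ∧ out w a ⟧)
    centre = ∑V-pigeonhole (λ a → ∑V (λ w → ⟦ good w ∧ out w a ⟧)) Q (*-cancelˡ-< 2 _ _ (begin-strict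
      2 * (n * Q)                                        <⟨ n-small ⟩
      ℓ * h                                              ≤⟨ *-monoˡ-≤ h G-large ⟩
      2 * G * h                                          ≡⟨ trans (*-assoc 2 G h) (cong (2 *_) (sym (∑-*ʳ V h (λ w → ⟦ good w ⟧)))) ⟩
      2 * ∑ V (λ w → ⟦ good w ⟧ * h)                     ≤⟨ *-monoʳ-≤ 2 (∑-mono V per-w) ⟩
      2 * ∑ V (λ w → ∑ V (λ a → ⟦ good w ∧ out w a ⟧))   ≡⟨ cong (2 *_) (∑-swap V V (λ w a → ⟦ good w ∧ out w a ⟧)) ⟩
      2 * ∑ V (λ a → ∑ V (λ w → ⟦ good w ∧ out w a ⟧))   ∎))
      where
      per-w : ∀ w → ⟦ good w ⟧ * h ≤ ∑ V (λ a → ⟦ good w ∧ out w a ⟧)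
      per-w w = begin
        ⟦ good w ⟧ * h                                ≤⟨ weak (≡true-or-false (good w)) ⟩
        ⟦ good w ⟧ * ∑ V (λ a → ⟦ out w a ⟧)          ≡⟨ sym (∑-*ˡ V ⟦ good w ⟧ (λ a → ⟦ out w a ⟧)) ⟩
        ∑ V (λ a → ⟦ good w ⟧ * ⟦ out w a ⟧)          ≡⟨ ∑-cong V (λ a → sym (⟦⟧-∧ (good w) (out w a))) ⟩
        ∑ V (λ a → ⟦ good w ∧ out w a ⟧)              ∎
        where
        weak : good w ≡ true ⊎ good w ≡ false → ⟦ good w ⟧ * h ≤ ⟦ good w ⟧ * ∑ V (λ a → ⟦ out w a ⟧)
        weak (inj₁ e) = *-monoʳ-≤ ⟦ good w ⟧ (out-large w e)
        weak (inj₂ e) = ≤-trans (≤-reflexive (cong (λ b → ⟦ b ⟧ * h) e)) z≤n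
    build : (Σ (Fin n) λ a → Q < ∑V (λ w → ⟦ good w ∧ out w a ⟧)) →
      Σ Sel λ x → Unique (wsOf x) × Unique (vsOf x) × All (_∉ W) (wsOf x) × All (_∉ U) (vsOf x)
    build (a , many) with take-unique (λ w → good w ∧ out w a) (suc Q) many
    ... | ws , len-ws , uws , ok with feet U a ws [] (≤-reflexive len-ws) (All.map props ok)
      where
      props : ∀ {w} → good w ∧ out w a ≡ true → inL w ≡ true × op w a ≡ true × h ≤ ∑V (λ y → ⟦ op w y ∧ not (y ∈ᵇ U) ⟧)
      props {w} e = proj₁ (∧-true {inL w} (proj₁ (∧-true {fresh W w} (proj₁ (∧-true {good w} e)))))
                  , proj₁ (∧-true {op w a} (proj₂ (∧-true {good w} e)))
                  , out-large w (proj₁ (∧-true {good w} e))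
    ...   | [] , refl , _ = contradiction len-ws (λ ())
    ...   | (w , f) ∷ ps , refl , uf , al , (p ∷ pok) =
      record { bodyS = a ; w₁ = w ; f₁ = f ; pairs = ps ; len = trans (sym (length-map proj₁ ps)) (suc-injective len-ws) ; w₁-ok = p ; ps-ok = pok }
      , uws , (All.map (λ (_ , q , _) → λ e → q (sym e)) al ∷ uf) , All.map w∉ ok , (a∉ (All.head ok) ∷ All.map proj₁ al)
      where
      w∉ : ∀ {w} → good w ∧ out w a ≡ true → w ∉ W
      w∉ {w} e = ∈ᵇ-false (proj₂ (∧-true {inL w} (proj₁ (∧-true {fresh W w} (proj₁ (∧-true {good w} e))))))
      a∉ : ∀ {w} → good w ∧ out w a ≡ true → a ∉ U
      a∉ {w} e = ∈ᵇ-false (proj₂ (∧-true {op w a} (proj₂ (∧-true {good w} e))))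

  Blocked : Set
  Blocked = Σ (List (Fin n)) λ W → Σ (List (Fin n)) λ U → length U ≤ u × ManyHubby W U

  length-wsOf : ∀ xs → length (concatMap wsOf xs) ≤ length xs * (2 + Q)
  length-wsOf [] = z≤n
  length-wsOf (x ∷ xs) = ≤-trans (≤-reflexive (length-++ (wsOf x)))
    (+-mono-≤ (≤-trans (≤-reflexive (cong suc (trans (length-map proj₁ (pairs x)) (len x)))) (n≤1+n _)) (length-wsOf xs))

  length-vsOf : ∀ xs → length (concatMap vsOf xs) ≤ length xs * (2 + Q)
  length-vsOf [] = z≤n
  length-vsOf (x ∷ xs) = ≤-trans (≤-reflexive (length-++ (vsOf x)))
    (+-mono-≤ (≤-reflexive (cong (2 +_) (trans (length-map proj₂ (pairs x)) (len x)))) (length-vsOf xs))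

  collect : 4 * u ≤ ℓ → ∀ j → j ≤ m → Blocked ⊎ (Σ (List Sel) λ xs → length xs ≡ j × Selection xs)
  collect small zero _ = inj₂ ([] , refl , [] , [])
  collect small (suc j) j<m with collect small j (<⇒≤ j<m)
  ... | inj₁ b = inj₁ b
  ... | inj₂ (xs , refl , uw , uv) with step (concatMap wsOf xs) (concatMap vsOf xs)
          (≤-trans (*-monoʳ-≤ 4 (≤-trans (length-wsOf xs) (≤-trans (*-monoˡ-≤ (2 + Q) (<⇒≤ j<m)) (≤-reflexive (sym u-def))))) small)
  ...   | inj₁ p = inj₁ (concatMap wsOf xs , concatMap vsOf xs , ≤-trans (length-vsOf xs) (≤-trans (*-monoˡ-≤ (2 + Q) (<⇒≤ j<m)) (≤-reflexive (sym u-def))) , p)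
  ...   | inj₂ (x , uwx , uvx , w∉ , v∉) = inj₂ (x ∷ xs , refl
        , Uniq.++⁺ uwx uw (λ (p , q) → All.lookup w∉ p q) , Uniq.++⁺ uvx uv (λ (p , q) → All.lookup v∉ p q))

  -- Hubs found among the vertices of a maximal family of spiders

  open Hubs {n}

  record Pair : Set where
    field
      left right : Fin n
      left≢right : left ≢ right
      common : List (Fin n)
      |common| : length common ≡ t₂
      c-ok   : All (λ w → inL w ≡ true × op w left ≡ true × op w right ≡ true) common
  open Pair

  pairHub : Pair → Hub
  pairHub x = record
    { a = left x ; b = right x ; a≢b = left≢right x ; os = map O (common x)
    ; a∈ = AllP.map⁺ (All.map (λ (_ , p , _) → ∈-O p) (c-ok x)) ; b∈ = AllP.map⁺ (All.map (λ (_ , _ , p) → ∈-O p) (c-ok x)) }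

  hubs-good : ∀ xs → length xs ≡ K → Unique (concatMap common xs) → Unique (hubVertices (map pairHub xs)) → Good (concatMap common xs)
  hubs-good xs len-xs uw uv = uw , all-L xs , λ c Stat F F≤1 det → begin
    R ^ K * ∑ (choices (map O (concatMap common xs))) F
      ≡⟨ cong₂ (λ k l → R ^ k * ∑ (choices l) F) (sym lenK) (opts≡ xs) ⟩
    R ^ length hs * ∑ (choices (concat (map os hs))) F
      ≤⟨ hub-bound hs uv R N t ≤-refl sizes small c Stat F F≤1 det ⟩
    (4 * length hs) ^ length hs * ∏ (concat (map os hs)) length
      ≡⟨ cong₂ (λ k l → (4 * k) ^ k * ∏ l length) lenK (sym (opts≡ xs)) ⟩
    (4 * K) ^ K * ∏ (map O (concatMap common xs)) length ∎
    where
    open ≤-Reasoning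
    hs = map pairHub xs
    lenK : length hs ≡ K
    lenK = trans (length-map pairHub xs) len-xs
    all-L : ∀ xs → All (λ w → inL w ≡ true) (concatMap common xs)
    all-L [] = []
    all-L (x ∷ xs) = AllP.++⁺ (All.map proj₁ (c-ok x)) (all-L xs)
    opts≡ : ∀ xs → map O (concatMap common xs) ≡ concat (map os (map pairHub xs))
    opts≡ [] = refl
    opts≡ (x ∷ xs) = trans (map-++ O (common x) _) (cong (map O (common x) ++_) (opts≡ xs))
    sizes : ∀ hb → hb ∈ hs → All (λ O → 2 * length O ≤ 1 + N) (os hb)
    sizes hb hb∈ with ∈-map⁻ pairHub hb∈
    ... | x , _ , refl = AllP.map⁺ (All.map (λ {w} (p , _) → ≤-trans (*-monoʳ-≤ 2 (≤-trans (O-length w p) 4h≤s)) (≤-reflexive (sym 1+N))) (c-ok x))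
    small : ∀ hb → hb ∈ hs → R * 2 ^ t * N ^ length (os hb) ≤ (1 + N) ^ length (os hb)
    small hb hb∈ with ∈-map⁻ pairHub hb∈
    ... | x , _ , refl = subst (λ k → R * 2 ^ t * N ^ k ≤ (1 + N) ^ k) (sym (trans (length-map O (common x)) (|common| x))) small-t₂

  module _ (W U : List (Fin n)) (U≤u : length U ≤ u) (many : ManyHubby W U) (ℓ-large : 4 * (K * t₂ + u * u * t₂) < ℓ) where

    cand : List (Fin n) → Fin n → Bool
    cand W′ w = (fresh W w ∧ hubby U w) ∧ not (w ∈ᵇ W′)

    pairOk : List (Fin n) → Fin n → Fin n × Fin n → Bool
    pairOk H w (y , z) = (op w y ∧ not (y ∈ᵇ H)) ∧ (op w z ∧ not (z ∈ᵇ (y ∷ H)))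

    pairOf : ∀ H w → length H + 2 ≤ h → hubby U w ≡ true → Σ (Fin n × Fin n) λ p → p ∈ cartesianProduct U U × pairOk H w p ≡ true
    pairOf H w bound hub
      with pick-avoiding (λ y → op w y ∧ (y ∈ᵇ U)) H (≤-trans (≤-trans (≤-reflexive (+-comm 1 (length H))) (≤-trans (+-monoʳ-≤ (length H) (s≤s z≤n)) bound)) (≤ᵇ-true hub))
    ... | y , yok , y∉ with pick-avoiding (λ z → op w z ∧ (z ∈ᵇ U)) (y ∷ H) (≤-trans (≤-trans (≤-reflexive (+-comm 2 (length H))) bound) (≤ᵇ-true hub))
    ...   | z , zok , z∉ = (y , z) , ∈-cartesianProduct⁺ {xs = U} {ys = U} (∈ᵇ-true (proj₂ (∧-true {op w y} yok))) (∈ᵇ-true (proj₂ (∧-true {op w z} zok)))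
      , ∧-intro (∧-intro (proj₁ (∧-true {op w y} yok)) (∉ᵇ-intro y∉)) (∧-intro (proj₁ (∧-true {op w z} zok)) (∉ᵇ-intro z∉))

    NewPair : List (Fin n) → List (Fin n) → Set
    NewPair W′ H = Σ Pair λ x → Unique (common x) × All (_∉ W′) (common x) × left x ∉ H × right x ∉ H

    extract : ∀ W′ H y z → t₂ < ∑V (λ w → ⟦ cand W′ w ∧ pairOk H w (y , z) ⟧) → NewPair W′ H
    extract W′ H y z cnt = record { left = y ; right = z ; left≢right = λ y≡z → z∉ (here (sym y≡z)) ; common = ws ; |common| = proj₁ (proj₂ taken) ; c-ok = All.map props ok }
      , proj₁ (proj₂ (proj₂ taken))
      , All.map (λ {w} e → ∈ᵇ-false (proj₂ (∧-true {fresh W w ∧ hubby U w} (proj₁ (∧-true {cand W′ w} e))))) ok , y∉ , (λ q → z∉ (there q))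
      where
      p : Fin n → Bool
      p w = cand W′ w ∧ pairOk H w (y , z)
      taken = take-unique p t₂ (<⇒≤ cnt)
      ws = proj₁ taken
      ok = proj₂ (proj₂ (proj₂ taken))
      some = ∑V-pos p (≤-trans (s≤s z≤n) cnt)
      w₀ = proj₁ some
      ok₀ = proj₂ (∧-true {cand W′ w₀} (proj₂ some))
      props : ∀ {w} → p w ≡ true → inL w ≡ true × op w y ≡ true × op w z ≡ true
      props {w} e = proj₁ (∧-true {inL w} (proj₁ (∧-true {fresh W w} (proj₁ (∧-true {fresh W w ∧ hubby U w} (proj₁ (∧-true {cand W′ w} e)))))))
        , proj₁ (∧-true {op w y} (proj₁ (∧-true {op w y ∧ not (y ∈ᵇ H)} (proj₂ (∧-true {cand W′ w} e)))))
        , proj₁ (∧-true {op w z} (proj₂ (∧-true {op w y ∧ not (y ∈ᵇ H)} (proj₂ (∧-true {cand W′ w} e)))))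
      y∉ : y ∉ H
      y∉ = ∈ᵇ-false (proj₂ (∧-true {op w₀ y} (proj₁ (∧-true {op w₀ y ∧ not (y ∈ᵇ H)} ok₀))))
      z∉ : z ∉ y ∷ H
      z∉ = ∈ᵇ-false (proj₂ (∧-true {op w₀ z} (proj₂ (∧-true {op w₀ y ∧ not (y ∈ᵇ H)} ok₀))))

    -- Every hubby leaf has two options in `U` that are not yet hubs. There are at most u² pairs in
    -- `U`, so one pair serves more than `t₂` leaves outside `W′`.
    newPair : ∀ W′ H → length H + 2 ≤ h → length W′ ≤ K * t₂ → NewPair W′ H
    newPair W′ H H-small W′-small = extract W′ H (proj₁ (proj₁ found)) (proj₂ (proj₁ found)) (proj₂ (proj₂ found))
      where
      open ≤-Reasoning
      V = allFin n
      UU = cartesianProduct U U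
      length-UU : length UU ≤ u * u
      length-UU = ≤-trans (≤-reflexive (trans (sym (∑-one UU)) (trans (∑-cartesianProduct U U (λ _ → 1))
        (trans (∑-cong U (λ _ → ∑-one U)) (∑-const U (length U)))))) (*-mono-≤ U≤u U≤u)
      Cnd = ∑V (λ w → ⟦ cand W′ w ⟧)
      Cnd-large : u * u * t₂ < Cnd
      Cnd-large = *-cancelˡ-< 4 _ _ (+-cancelˡ-< (4 * (K * t₂)) _ _ (begin-strict
        4 * (K * t₂) + 4 * (u * u * t₂)       ≡⟨ sym (*-distribˡ-+ 4 (K * t₂) (u * u * t₂)) ⟩
        4 * (K * t₂ + u * u * t₂)             <⟨ ℓ-large ⟩
        ℓ                                     ≤⟨ many ⟩
        4 * ∑V (λ w → ⟦ fresh W w ∧ hubby U w ⟧) ≤⟨ *-monoʳ-≤ 4 (∑-avoid (λ w → fresh W w ∧ hubby U w) W′) ⟩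
        4 * (length W′ + Cnd)                   ≤⟨ *-monoʳ-≤ 4 (+-monoˡ-≤ Cnd W′-small) ⟩
        4 * (K * t₂ + Cnd)                      ≡⟨ *-distribˡ-+ 4 (K * t₂) Cnd ⟩
        4 * (K * t₂) + 4 * Cnd                  ∎))
      per-w : ∀ w → ⟦ cand W′ w ⟧ ≤ ∑ UU (λ p → ⟦ cand W′ w ∧ pairOk H w p ⟧)
      per-w w = ⟦⟧-≤ (λ e → let (p , p∈ , ok) = pairOf H w H-small (proj₂ (∧-true {fresh W w} (proj₁ (∧-true {fresh W w ∧ hubby U w} e)))) in
        ≤-trans (≤-reflexive (sym (⟦⟧-true (∧-intro e ok)))) (∑-term (λ p → ⟦ cand W′ w ∧ pairOk H w p ⟧) p∈))
      enough : length UU * t₂ < ∑ UU (λ p → ∑V (λ w → ⟦ cand W′ w ∧ pairOk H w p ⟧))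
      enough = begin-strict
        length UU * t₂      ≤⟨ *-monoˡ-≤ t₂ length-UU ⟩
        u * u * t₂          <⟨ Cnd-large ⟩
        Cnd                   ≤⟨ ∑-mono V per-w ⟩
        ∑ V (λ w → ∑ UU (λ p → ⟦ cand W′ w ∧ pairOk H w p ⟧)) ≡⟨ ∑-swap V UU (λ w p → ⟦ cand W′ w ∧ pairOk H w p ⟧) ⟩
        ∑ UU (λ p → ∑V (λ w → ⟦ cand W′ w ∧ pairOk H w p ⟧)) ∎
      found = ∑-pigeonhole UU (λ p → ∑V (λ w → ⟦ cand W′ w ∧ pairOk H w p ⟧)) t₂ enough

    Pairs : ℕ → Set
    Pairs j = Σ (List Pair) λ xs → length xs ≡ j × Unique (concatMap common xs) × Unique (hubVertices (map pairHub xs))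

    length-common : ∀ xs → length (concatMap common xs) ≡ length xs * t₂
    length-common [] = refl
    length-common (x ∷ xs) = trans (length-++ (common x)) (cong₂ _+_ (|common| x) (length-common xs))

    addPair : ∀ xs → Unique (concatMap common xs) → Unique (hubVertices (map pairHub xs)) →
      NewPair (concatMap common xs) (hubVertices (map pairHub xs)) → Pairs (suc (length xs))
    addPair xs uw uv (x , uwx , w∉ , l∉ , r∉) = x ∷ xs , refl , Uniq.++⁺ uwx uw (λ (p , q) → All.lookup w∉ p q)
      , (left≢right x ∷ AllP.¬Any⇒All¬ (hubVertices (map pairHub xs)) l∉) ∷ AllP.¬Any⇒All¬ (hubVertices (map pairHub xs)) r∉ ∷ uv

    extendPairs : ∀ {j} → j < K → Pairs j → Pairs (suc j)
    extendPairs j<K (xs , refl , uw , uv) = addPair xs uw uv (newPair (concatMap common xs) (hubVertices (map pairHub xs)) small-H small-W)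
      where
      small-H : length (hubVertices (map pairHub xs)) + 2 ≤ h
      small-H = ≤-trans (+-monoˡ-≤ 2 (≤-trans (≤-reflexive (trans (length-hubVertices (map pairHub xs)) (cong (2 *_) (length-map pairHub xs)))) (*-monoʳ-≤ 2 (<⇒≤ j<K)))) (≤-trans (+-monoʳ-≤ (2 * K) (n≤1+n 2)) h-large)
      small-W : length (concatMap common xs) ≤ K * t₂
      small-W = ≤-trans (≤-reflexive (length-common xs)) (*-monoˡ-≤ t₂ (<⇒≤ j<K))

    collectPairs : ∀ j → j ≤ K → Pairs j
    collectPairs zero _ = [] , refl , [] , []
    collectPairs (suc j) j<K = extendPairs j<K (collectPairs j (<⇒≤ j<K))

  dichotomy : 4 * u ≤ ℓ → 4 * (K * t₂ + u * u * t₂) < ℓ → Σ (List (Fin n)) Good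
  dichotomy small large with collect small m ≤-refl
  ... | inj₂ (xs , len-xs , sel) = concatMap wsOf xs , spiders-good xs len-xs sel
  ... | inj₁ (W , U , U≤u , many) with collectPairs W U U≤u many large K ≤-refl
  ...   | xs , len-xs , uw , uv = concatMap common xs , hubs-good xs len-xs uw uv

-- Resampling the neighbours of leaves

-- Law of total probability over the values of `key` that occur.
group-bound : ∀ {X Key : Set} (_≟_ : (k k′ : Key) → Dec (k ≡ k′)) (key : X → Key) (xs : List X) (a b : ℕ) (p : X → ℕ) →
  (∀ k → a * ∑ xs (λ s → ⟦ does (key s ≟ k) ⟧ * p s) ≤ b * ∑ xs (λ s → ⟦ does (key s ≟ k) ⟧)) →
  a * ∑ xs p ≤ b * length xs
group-bound {X} {Key} _≟_ key xs a b p h = begin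
  a * ∑ xs p
    ≡⟨ cong (a *_) (by-key p) ⟩
  a * ∑ ks (λ k → ∑ xs (λ s → ⟦ does (key s ≟ k) ⟧ * p s))
    ≡⟨ sym (∑-*ˡ ks a _) ⟩
  ∑ ks (λ k → a * ∑ xs (λ s → ⟦ does (key s ≟ k) ⟧ * p s))
    ≤⟨ ∑-mono ks h ⟩
  ∑ ks (λ k → b * ∑ xs (λ s → ⟦ does (key s ≟ k) ⟧))
    ≡⟨ ∑-*ˡ ks b _ ⟩
  b * ∑ ks (λ k → ∑ xs (λ s → ⟦ does (key s ≟ k) ⟧))
    ≡⟨ cong (b *_) (trans (∑-cong ks (λ k → ∑-cong xs (λ s → sym (*-identityʳ _)))) (sym (by-key (λ _ → 1)))) ⟩
  b * ∑ xs (λ _ → 1)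
    ≡⟨ cong (b *_) (∑-one xs) ⟩
  b * length xs ∎
  where
  open ≤-Reasoning
  ks : List Key
  ks = deduplicate _≟_ (map key xs)
  by-key : ∀ q → ∑ xs q ≡ ∑ ks (λ k → ∑ xs (λ s → ⟦ does (key s ≟ k) ⟧ * q s))
  by-key q = trans (∑-cong∈ xs one) (∑-swap xs ks (λ s k → ⟦ does (key s ≟ k) ⟧ * q s))
    where
    one : ∀ s → s ∈ xs → q s ≡ ∑ ks (λ k → ⟦ does (key s ≟ k) ⟧ * q s)
    one s s∈ = sym (trans (∑-single (λ k → ⟦ does (key s ≟ k) ⟧ * q s) (deduplicate-! _≟_ (map key xs)) (∈-deduplicate⁺ _≟_ (∈-map⁺ key s∈))
      (λ k _ k≢ → cong (λ b → ⟦ b ⟧ * q s) (dec-false (key s ≟ k) (k≢ ∘ sym))))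
      (trans (cong (λ b → ⟦ b ⟧ * q s) (dec-true (key s ≟ key s) refl)) (*-identityˡ (q s))))

-- The function `g` colours a set so that colour classes have between `D` and `2 * D` elements.
-- Neighbourhoods can be arbitrarily large, whereas the tail bounds need option lists of a size
-- controlled by d.
Grouping : ℕ → (Fin n → Bool) → Set
Grouping {n} D q = Σ (Fin n → ℕ) λ g → ∀ y → q y ≡ true →
  D ≤ ∑V (λ z → ⟦ q z ∧ (g z ≡ᵇ g y) ⟧) × ∑V (λ z → ⟦ q z ∧ (g z ≡ᵇ g y) ⟧) ≤ 2 * D

-- Classes of exactly `D` elements are split off while more than `2 * D` remain, so the rest never
-- drops below `D`.
grouping : ∀ D (fuel : ℕ) (q : Fin n → Bool) → 1 ≤ D → D ≤ ∑V (λ y → ⟦ q y ⟧) → ∑V (λ y → ⟦ q y ⟧) ≤ fuel → Grouping D q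
grouping {n} D fuel q D>0 large bounded with ∑V (λ y → ⟦ q y ⟧) ≤? 2 * D
... | yes small = (λ _ → 0) , λ y _ → ≤-trans large (≤-reflexive (sym all)) , ≤-trans (≤-reflexive all) small
  where
  all : ∑V (λ z → ⟦ q z ∧ true ⟧) ≡ ∑V (λ z → ⟦ q z ⟧)
  all = ∑-cong (allFin n) (λ z → cong ⟦_⟧ (trans (∧-comm (q z) true) refl))
grouping {n} D zero q D>0 large bounded | no _ = ⊥-elim (n≮0 (≤-trans D>0 (≤-trans large bounded)))
grouping {n} D (suc fuel) q D>0 large bounded | no big = combine (take-unique q D large)
  where
  combine : (Σ (List (Fin n)) λ ys → length ys ≡ D × Unique ys × All (λ y → q y ≡ true) ys) → Grouping D q
  combine (ys , len , uys , qys) = g , ok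
    where
    open ≤-Reasoning
    q′ : Fin n → Bool
    q′ y = q y ∧ not (y ∈ᵇ ys)
    chosen : ∑V (λ y → ⟦ q y ∧ (y ∈ᵇ ys) ⟧) ≡ D
    chosen = ≤-antisym (≤-trans (∑-∈ᵇ q ys) (≤-reflexive len)) (≤-trans (≤-reflexive (trans (sym len) (sym (∑-one ys))))
      (∑-inj id uys (λ y y∈ _ → ∈-allFin y , ≤-reflexive (sym (⟦⟧-true (∧-intro (All.lookup qys y∈) (∈ᵇ-intro y∈))))) (λ _ _ _ _ _ _ e → e)))
    total : ∑V (λ y → ⟦ q y ⟧) ≡ D + ∑V (λ y → ⟦ q′ y ⟧)
    total = trans (∑-split q (_∈ᵇ ys)) (cong (_+ ∑V (λ y → ⟦ q′ y ⟧)) chosen)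
    large′ : D ≤ ∑V (λ y → ⟦ q′ y ⟧)
    large′ = +-cancelˡ-≤ D _ _ (≤-trans (≤-reflexive (cong (D +_) (sym (+-identityʳ D)))) (≤-trans (<⇒≤ (≰⇒> big)) (≤-reflexive total)))
    bounded′ : ∑V (λ y → ⟦ q′ y ⟧) ≤ fuel
    bounded′ = ≤-pred (≤-trans (+-monoˡ-≤ (∑V (λ y → ⟦ q′ y ⟧)) D>0) (≤-trans (≤-reflexive (sym total)) bounded))
    rec = grouping D fuel q′ D>0 large′ bounded′
    g : Fin n → ℕ
    g y = if y ∈ᵇ ys then 0 else suc (proj₁ rec y)
    same-in : ∀ y z → (y ∈ᵇ ys) ≡ true → ⟦ q z ∧ (g z ≡ᵇ g y) ⟧ ≡ ⟦ q z ∧ (z ∈ᵇ ys) ⟧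
    same-in y z e rewrite e with z ∈ᵇ ys
    ... | true = refl
    ... | false = refl
    same-out : ∀ y z → (y ∈ᵇ ys) ≡ false → ⟦ q z ∧ (g z ≡ᵇ g y) ⟧ ≡ ⟦ q′ z ∧ (proj₁ rec z ≡ᵇ proj₁ rec y) ⟧
    same-out y z e rewrite e with z ∈ᵇ ys | q z
    ... | true | true = refl
    ... | true | false = refl
    ... | false | true = refl
    ... | false | false = refl
    ok : ∀ y → q y ≡ true → D ≤ ∑V (λ z → ⟦ q z ∧ (g z ≡ᵇ g y) ⟧) × ∑V (λ z → ⟦ q z ∧ (g z ≡ᵇ g y) ⟧) ≤ 2 * D
    ok y qy = cases (≡true-or-false (y ∈ᵇ ys))
      where
      cases : (y ∈ᵇ ys) ≡ true ⊎ (y ∈ᵇ ys) ≡ false → D ≤ ∑V (λ z → ⟦ q z ∧ (g z ≡ᵇ g y) ⟧) × ∑V (λ z → ⟦ q z ∧ (g z ≡ᵇ g y) ⟧) ≤ 2 * D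
      cases (inj₁ e) = ≤-reflexive (sym count) , ≤-trans (≤-reflexive count) (m≤m+n D _)
        where
        count : ∑V (λ z → ⟦ q z ∧ (g z ≡ᵇ g y) ⟧) ≡ D
        count = trans (∑-cong (allFin n) (λ z → same-in y z e)) chosen
      cases (inj₂ e) = ≤-trans (proj₁ r) (≤-reflexive (sym count)) , ≤-trans (≤-reflexive count) (proj₂ r)
        where
        r = proj₂ rec y (∧-intro qy (cong not e))
        count : ∑V (λ z → ⟦ q z ∧ (g z ≡ᵇ g y) ⟧) ≡ ∑V (λ z → ⟦ q′ z ∧ (proj₁ rec z ≡ᵇ proj₁ rec y) ⟧)
        count = ∑-cong (allFin n) (λ z → same-out y z e)

-- Classes of trees closed under moving leaves within their groups

module Resampling {n : ℕ} (G : Graph n) (xs : List (EdgeSubset G)) (uxs : Unique xs)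
  (tree : ∀ {s} → s ∈ xs → Tree (Matrices.mat G s))
  (complete : ∀ s → Tree (Matrices.mat G s) → s ∈ xs)
  (inA inB : Fin n → Bool) (disjoint : ∀ w → inA w ≡ true → inB w ≡ false)
  (grp : Fin n → Fin n → ℕ) where

  open SpanningTrees G xs uxs tree complete

  abstract
    nbr : X → Fin n → Fin n
    nbr s w with any? (λ y → mat s w y 𝔹.≟ true)
    ... | yes (y , _) = y
    ... | no _ = w

    nbr-ok : ∀ s w {y} → mat s w y ≡ true → mat s w (nbr s w) ≡ true
    nbr-ok s w {y} e with any? (λ y → mat s w y 𝔹.≟ true)
    ... | yes (_ , q) = q
    ... | no none = contradiction (y , e) none

  attachedB : X → Fin n → ℕ
  attachedB s w = ∑V (λ y → ⟦ mat s w y ⟧ * ⟦ inB y ⟧)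

  inL : X → Fin n → Bool
  inL s w = inA w ∧ ((deg (mat s) w ≡ᵇ 1) ∧ (1 ≤ᵇ attachedB s w))

  module InL {s w} (e : inL s w ≡ true) where
    A-w : inA w ≡ true
    A-w = proj₁ (∧-true {inA w} e)
    e₂ = proj₂ (∧-true {inA w} e)
    leaf-w : deg (mat s) w ≡ 1
    leaf-w = ≡ᵇ-true (proj₁ (∧-true {deg (mat s) w ≡ᵇ 1} e₂))
    pos : Σ (Fin n) λ y → mat s w y ≡ true × inB y ≡ true
    pos with ∑-pos (allFin n) (λ y → ⟦ mat s w y ⟧ * ⟦ inB y ⟧) (≤ᵇ-true {1} (proj₂ (∧-true {deg (mat s) w ≡ᵇ 1} e₂)))
    ... | y , _ , q = y , ∧-true (⟦⟧-pos (subst (0 <_) (sym (⟦⟧-∧ (mat s w y) (inB y))) q))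
    nbr-edge : mat s w (nbr s w) ≡ true
    nbr-edge = nbr-ok s w (proj₁ (proj₂ pos))
    nbr-unique : ∀ {y} → mat s w y ≡ true → y ≡ nbr s w
    nbr-unique r = leaf-unique (mat s) leaf-w nbr-edge r
    nbr-B : inB (nbr s w) ≡ true
    nbr-B = subst (λ y → inB y ≡ true) (nbr-unique (proj₁ (proj₂ pos))) (proj₂ (proj₂ pos))

  inL-intro : ∀ {s w y} → inA w ≡ true → deg (mat s) w ≡ 1 → mat s w y ≡ true → inB y ≡ true → inL s w ≡ true
  inL-intro {s} {w} {y} a d r b = ∧-intro a (∧-intro (≡ᵇ-intro d) (≤ᵇ-intro (≤-trans
    (≤-reflexive (sym (cong₂ _*_ (⟦⟧-true r) (⟦⟧-true b)))) (∑-term (λ y → ⟦ mat s w y ⟧ * ⟦ inB y ⟧) (∈-allFin y)))))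

  A≢B : ∀ {w y} → inA w ≡ true → inB y ≡ true → w ≢ y
  A≢B a b refl = true≢false (trans (sym b) (disjoint _ a))

  re : X → Fin n → Fin n → X
  re s w y = enc (exch (mat s) w (nbr s w) y)

  module Re {s} (s∈ : s ∈ xs) {w} (w∈L : inL s w ≡ true) {y} (wy : Adj G w y) (y∈B : inB y ≡ true) where
    open InL {s} {w} w∈L
    w≢y : w ≢ y
    w≢y = A≢B A-w y∈B
    v = nbr s w
    cutᵥ : Cut (mat s) v w
    cutᵥ = leaf-cut (tree s∈) leaf-w nbr-edge
    open Move s∈ {x = w} {v} {y} (trans (mat-sym s v w) nbr-edge) cutᵥ (cong not (==-neq (w≢y ∘ sym))) wy

    re∈ : re s w y ∈ xs
    re∈ = s′∈

    re-degree : ∀ u → deg (mat (re s w y)) u + ⟦ v == u ⟧ ≡ deg (mat s) u + ⟦ y == u ⟧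
    re-degree u = trans (cong (λ b → deg (mat s′) u + ⟦ b ⟧) (==-sym v u)) (trans (degree′ u) (cong (λ b → deg (mat s) u + ⟦ b ⟧) (==-sym u y)))

    leaf-after : deg (mat (re s w y)) w ≡ 1
    leaf-after = trans (sym (+-identityʳ _)) (trans (cong (λ b → deg (mat s′) w + ⟦ b ⟧) (sym (==-neq (λ e → A≢B A-w nbr-B (sym e)))))
      (trans (re-degree w) (trans (cong (λ b → deg (mat s) w + ⟦ b ⟧) (==-neq (w≢y ∘ sym))) (trans (+-identityʳ _) leaf-w))))

    inL-after : inL (re s w y) w ≡ true
    inL-after = inL-intro {re s w y} A-w leaf-after new-edge y∈B

    nbr-after : nbr (re s w y) w ≡ y
    nbr-after = sym (InL.nbr-unique {re s w y} {w} inL-after new-edge)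

    re-back : re (re s w y) w (nbr s w) ≡ s
    re-back = trans (cong (λ z → enc (exch (mat (re s w y)) w z (nbr s w))) nbr-after) back

    -- Both exchanged edges join `w` to B, so they touch no other row of A. This is what the
    -- bipartition is for.
    row-same : ∀ {w′} → inA w′ ≡ true → w′ ≢ w → ∀ j → mat (re s w y) w′ j ≡ mat s w′ j
    row-same {w′} a ne j = trans (mat-s′ w′ j) (trans (cong₂ (λ p q → (mat s w′ j ∧ not p) ∨ q) (no-edge-at nbr-B) (no-edge-at y∈B))
      (trans (∨-identityʳ _) (trans (∧-comm (mat s w′ j) true) refl)))
      where
      no-edge-at : ∀ {z} → inB z ≡ true → edge w z w′ j ≡ false
      no-edge-at {z} z∈B with edge w z w′ j in eq
      ... | false = refl
      ... | true with edge⁻ {a = w} {z} {w′} {j} eq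
      ...   | inj₁ (e , _) = contradiction e ne
      ...   | inj₂ (e , _) = contradiction e (A≢B a z∈B)

    inL-same : ∀ w′ → w′ ≢ w → inL (re s w y) w′ ≡ inL s w′
    inL-same w′ ne with inA w′ in a
    ... | false = refl
    ... | true = cong₂ (λ d k → (d ≡ᵇ 1) ∧ (1 ≤ᵇ k)) (∑-cong (allFin n) (λ j → cong ⟦_⟧ (row-same a ne j)))
                   (∑-cong (allFin n) (λ j → cong (λ b → ⟦ b ⟧ * ⟦ inB j ⟧) (row-same a ne j)))

    nbr-same : ∀ w′ → w′ ≢ w → inL s w′ ≡ true → nbr (re s w y) w′ ≡ nbr s w′
    nbr-same w′ ne e = sym (InL.nbr-unique {re s w y} {w′} (trans (inL-same w′ ne) e)
      (trans (row-same (InL.A-w {s} {w′} e) ne (nbr s w′)) (InL.nbr-edge {s} {w′} e)))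

  -- Records whether `w` is a free leaf and, if so, the group of its neighbour; the shift by one
  -- keeps 0 for the other vertices. Exactly this information survives resampling.
  keyAt : X → Fin n → ℕ
  keyAt s w = if inL s w then suc (grp w (nbr s w)) else 0

  key : X → Vec ℕ n
  key s = V.tabulate (keyAt s)

  _≟ᵏ_ : (k k′ : Vec ℕ n) → Dec (k ≡ k′)
  _≟ᵏ_ = VP.≡-dec _≟_

  module Class (k : Vec ℕ n) where

    inLk : Fin n → Bool
    inLk w = not (V.lookup k w ≡ᵇ 0)

    op : Fin n → Fin n → Bool
    op w y = (adj G w y ∧ inB y) ∧ (suc (grp w y) ≡ᵇ V.lookup k w)

    O : Fin n → List (Fin n)
    O w = filterᵇ (op w) (allFin n)

    cls : X → ℕ
    cls s = ⟦ does (key s ≟ᵏ k) ⟧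

    cls-pos : ∀ {s a} → 0 < cls s * a → key s ≡ k × 0 < a
    cls-pos {s} p with key s ≟ᵏ k
    ... | yes e = e , subst (0 <_) (*-identityˡ _) p

    at : ∀ {s} → key s ≡ k → ∀ w → V.lookup k w ≡ keyAt s w
    at {s} e w = trans (cong (λ k → V.lookup k w) (sym e)) (VP.lookup∘tabulate (keyAt s) w)

    inLk≡inL : ∀ {s} → key s ≡ k → ∀ w → inLk w ≡ inL s w
    inLk≡inL {s} e w rewrite at {s} e w with inL s w
    ... | true = refl
    ... | false = refl

    key-grp : ∀ {s} → key s ≡ k → ∀ w → inL s w ≡ true → V.lookup k w ≡ suc (grp w (nbr s w))
    key-grp {s} e w l = trans (at {s} e w) (cong (λ b → if b then suc (grp w (nbr s w)) else 0) l)

    op-nbr : ∀ {s} → key s ≡ k → ∀ w → inL s w ≡ true → op w (nbr s w) ≡ true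
    op-nbr {s} e w l = ∧-intro (∧-intro (mat⊆adj s w (nbr s w) (InL.nbr-edge {s} {w} l)) (InL.nbr-B {s} {w} l)) (≡ᵇ-intro (sym (key-grp {s} e w l)))

    module Step {s} (s∈ : s ∈ xs) (e : key s ≡ k) {w} (l : inLk w ≡ true) {y} (o : op w y ≡ true) where
      w∈L : inL s w ≡ true
      w∈L = trans (sym (inLk≡inL {s} e w)) l
      open Re s∈ {w} w∈L {y} (proj₁ (∧-true {adj G w y} (proj₁ (∧-true {adj G w y ∧ inB y} o)))) (proj₂ (∧-true {adj G w y} (proj₁ (∧-true {adj G w y ∧ inB y} o)))) public
      key-after : key (re s w y) ≡ k
      key-after = trans (VP.tabulate-cong same) e
        where
        same : ∀ w′ → keyAt (re s w y) w′ ≡ keyAt s w′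
        same w′ with w′ F.≟ w
        ... | yes refl = trans (cong (λ b → if b then suc (grp w (nbr (re s w y) w)) else 0) inL-after)
                (trans (cong (λ z → suc (grp w z)) nbr-after) (trans (≡ᵇ-true (proj₂ (∧-true {adj G w y ∧ inB y} o))) (at {s} e w)))
        ... | no ne = cases (≡true-or-false (inL s w′))
          where
          cases : inL s w′ ≡ true ⊎ inL s w′ ≡ false → keyAt (re s w y) w′ ≡ keyAt s w′
          cases (inj₁ q) = cong₂ (λ b z → if b then suc (grp w′ z) else 0) (inL-same w′ ne) (nbr-same w′ ne q)
          cases (inj₂ q) = trans (cong (λ b → if b then suc (grp w′ (nbr (re s w y) w′)) else 0) (trans (inL-same w′ ne) q))
                                 (sym (cong (λ b → if b then suc (grp w′ (nbr s w′)) else 0) q))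

    ∈O⁻ : ∀ {w y} → y ∈ O w → op w y ≡ true
    ∈O⁻ {w} y∈ = proj₂ (∈-filterᵇ⁻ {p = op w} {xs = allFin n} y∈)

    ∈O⁺ : ∀ {w y} → op w y ≡ true → y ∈ O w
    ∈O⁺ {w} o = ∈-filterᵇ⁺ {p = op w} (∈-allFin _) o

    -- (s , y) ↦ (s with w moved to y , old neighbour of w) is an involution.
    resample : ∀ w → inLk w ≡ true → ∀ (g : X → ℕ) →
      length (O w) * ∑ xs (λ s → cls s * g s) ≤ ∑ xs (λ s → cls s * ∑ (O w) (λ y → g (re s w y)))
    resample w l g = begin
      length (O w) * ∑ xs (λ s → cls s * g s)
        ≡⟨ trans (sym (∑-*ˡ xs (length (O w)) _)) (∑-cong xs (λ s → sym (∑-const (O w) (cls s * g s)))) ⟩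
      ∑ xs (λ s → ∑ (O w) (λ y → cls s * g s))
        ≡⟨ sym (∑-cartesianProduct xs (O w) (λ (s , y) → cls s * g s)) ⟩
      ∑ XY (λ (s , y) → cls s * g s)
        ≤⟨ ∑-inj φ (Uniq.cartesianProduct⁺ uxs (unique-filterᵇ (op w) (Uniq.allFin⁺ n))) into injective ⟩
      ∑ XY (λ (s , y) → cls s * g (re s w y))
        ≡⟨ ∑-cartesianProduct xs (O w) (λ (s , y) → cls s * g (re s w y)) ⟩
      ∑ xs (λ s → ∑ (O w) (λ y → cls s * g (re s w y)))
        ≡⟨ ∑-cong xs (λ s → ∑-*ˡ (O w) (cls s) _) ⟩
      ∑ xs (λ s → cls s * ∑ (O w) (λ y → g (re s w y))) ∎
      where
      open ≤-Reasoning
      XY = cartesianProduct xs (O w)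
      φ : X × Fin n → X × Fin n
      φ (s , y) = re s w y , nbr s w
      parts : ∀ {s y} → (s , y) ∈ XY → s ∈ xs × op w y ≡ true
      parts p = let (a , b) = ∈-cartesianProduct⁻ xs (O w) p in a , ∈O⁻ b
      into : ∀ x → x ∈ XY → 0 < cls (proj₁ x) * g (proj₁ x) →
        φ x ∈ XY × cls (proj₁ x) * g (proj₁ x) ≤ cls (proj₁ (φ x)) * g (re (proj₁ (φ x)) w (proj₂ (φ x)))
      into (s , y) x∈ q = ∈-cartesianProduct⁺ re∈ (∈O⁺ (op-nbr {s} e w w∈L))
        , ≤-trans (*-monoˡ-≤ (g s) (⟦⟧≤1 (does (key s ≟ᵏ k)))) (≤-reflexive (cong₂ _*_ (sym (⟦⟧-true (dec-true (key (re s w y) ≟ᵏ k) key-after))) (cong g (sym re-back))))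
        where
        e = proj₁ (cls-pos {s} q)
        open Step (proj₁ (parts x∈)) e {w} l {y} (proj₂ (parts x∈))
      injective : ∀ x x′ → x ∈ XY → x′ ∈ XY → 0 < cls (proj₁ x) * g (proj₁ x) → 0 < cls (proj₁ x′) * g (proj₁ x′) → φ x ≡ φ x′ → x ≡ x′
      injective (s , y) (s′ , y′) x∈ x′∈ q q′ eq = cong₂ _,_
        (trans (sym S.re-back) (trans (cong₂ (λ a b → re a w b) (cong proj₁ eq) (cong proj₂ eq)) S′.re-back))
        (trans (sym S.nbr-after) (trans (cong (λ a → nbr a w) (cong proj₁ eq)) S′.nbr-after))
        where
        module S = Step (proj₁ (parts x∈)) (proj₁ (cls-pos {s} q)) {w} l {y} (proj₂ (parts x∈))
        module S′ = Step (proj₁ (parts x′∈)) (proj₁ (cls-pos {s′} q′)) {w} l {y′} (proj₂ (parts x′∈))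

    re* : X → List (Fin n) → List (Fin n) → X
    re* s (w ∷ ws) (y ∷ f) = re* (re s w y) ws f
    re* s _ _ = s

    resample* : ∀ ws → All (λ w → inLk w ≡ true) ws → ∀ (g : X → ℕ) →
      ∏ (map O ws) length * ∑ xs (λ s → cls s * g s) ≤ ∑ xs (λ s → cls s * ∑ (choices (map O ws)) (λ f → g (re* s ws f)))
    resample* [] _ g = ≤-reflexive (trans (*-identityˡ _) (∑-cong xs (λ s → cong (cls s *_) (sym (+-identityʳ (g s))))))
    resample* (w ∷ ws) (l ∷ ls) g = begin
      length (O w) * ∏ (map O ws) length * ∑ xs (λ s → cls s * g s)
        ≡⟨ *-assoc (length (O w)) _ _ ⟩
      length (O w) * (∏ (map O ws) length * ∑ xs (λ s → cls s * g s))
        ≤⟨ *-monoʳ-≤ (length (O w)) (resample* ws ls g) ⟩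
      length (O w) * ∑ xs (λ s → cls s * ∑ (choices (map O ws)) (λ f → g (re* s ws f)))
        ≤⟨ resample w l (λ s → ∑ (choices (map O ws)) (λ f → g (re* s ws f))) ⟩
      ∑ xs (λ s → cls s * ∑ (O w) (λ y → ∑ (choices (map O ws)) (λ f → g (re* (re s w y) ws f))))
        ≡⟨ ∑-cong xs (λ s → cong (cls s *_) (sym (∑-choices (O w) (map O ws) (λ f → g (re* s (w ∷ ws) f))))) ⟩
      ∑ xs (λ s → cls s * ∑ (choices (map O (w ∷ ws))) (λ f → g (re* s (w ∷ ws) f))) ∎
      where open ≤-Reasoning

    oldLoad : X → List (Fin n) → Fin n → ℕ
    oldLoad s ws u = ∑ ws (λ w → ⟦ nbr s w == u ⟧)

    re*-ok : ∀ ws → Unique ws → All (λ w → inLk w ≡ true) ws → ∀ {s} → s ∈ xs → key s ≡ k → ∀ {f} → Pointwise _∈_ f (map O ws) →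
      re* s ws f ∈ xs × (∀ u → deg (mat (re* s ws f)) u + oldLoad s ws u ≡ deg (mat s) u + load f u)
    re*-ok [] _ _ s∈ e [] = s∈ , λ u → refl
    re*-ok (w ∷ ws) (w∉ ∷ uws) (l ∷ ls) {s} s∈ e {y ∷ f} (y∈ ∷ p) = proj₁ IH , λ u → begin
      D u + (⟦ nbr s w == u ⟧ + oldLoad s ws u)
        ≡⟨ cong (λ k → D u + (⟦ nbr s w == u ⟧ + k)) (∑-cong∈ ws (λ w′ w′∈ → cong (λ z → ⟦ z == u ⟧)
             (sym (nbr-same w′ (λ q → All.lookup w∉ w′∈ (sym q)) (trans (sym (inLk≡inL {s} e w′)) (All.lookup ls w′∈)))))) ⟩
      D u + (⟦ nbr s w == u ⟧ + oldLoad (re s w y) ws u)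
        ≡⟨ e₁ (D u) ⟦ nbr s w == u ⟧ (oldLoad (re s w y) ws u) ⟩
      (D u + oldLoad (re s w y) ws u) + ⟦ nbr s w == u ⟧
        ≡⟨ cong (_+ ⟦ nbr s w == u ⟧) (proj₂ IH u) ⟩
      (deg (mat (re s w y)) u + load f u) + ⟦ nbr s w == u ⟧
        ≡⟨ e₂ (deg (mat (re s w y)) u) (load f u) ⟦ nbr s w == u ⟧ ⟩
      (deg (mat (re s w y)) u + ⟦ nbr s w == u ⟧) + load f u
        ≡⟨ cong (_+ load f u) (re-degree u) ⟩
      (deg (mat s) u + ⟦ y == u ⟧) + load f u
        ≡⟨ +-assoc (deg (mat s) u) ⟦ y == u ⟧ (load f u) ⟩
      deg (mat s) u + (⟦ y == u ⟧ + load f u) ∎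
      where
      open ≡-Reasoning
      open Step s∈ e {w} l {y} (∈O⁻ y∈)
      IH = re*-ok ws uws ls re∈ key-after p
      D : Fin n → ℕ
      D u = deg (mat (re* (re s w y) ws f)) u
      e₁ : ∀ a b c → a + (b + c) ≡ (a + c) + b
      e₁ = solve-∀
      e₂ : ∀ a b c → (a + b) + c ≡ (a + c) + b
      e₂ = solve-∀

    oldLoad≤deg : ∀ ws → Unique ws → All (λ w → inLk w ≡ true) ws → ∀ {s} → key s ≡ k → ∀ u → oldLoad s ws u ≤ deg (mat s) u
    oldLoad≤deg ws uws ls {s} e u = ∑-inj id uws
      (λ w w∈ q → ∈-allFin w , ≤-trans (⟦⟧≤1 (nbr s w == u)) (≤-reflexive (sym (⟦⟧-true (trans (mat-sym s u w)
        (subst (λ z → mat s w z ≡ true) (==-eq (⟦⟧-pos q)) (InL.nbr-edge {s} {w} (trans (sym (inLk≡inL {s} e w)) (All.lookup ls w∈)))))))))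
      (λ _ _ _ _ _ _ q → q)

    -- By `resample*` the sum over a class is bounded by averages over all resamplings of its trees,
    -- so it suffices to treat one tree `s` at a time. Its resampled degrees are the degrees with
    -- the old attachments of `ws` subtracted, plus the load of the choices.
    class-bound : ∀ ws → Unique ws → All (λ w → inLk w ≡ true) ws → (∀ w → inLk w ≡ true → 1 ≤ length (O w)) → ∀ α β →
      (∀ c Stat F → (∀ f → F f ≤ 1) → Detects c Stat F → α * ∑ (choices (map O ws)) F ≤ β * ∏ (map O ws) length) →
      ∀ (p : X → ℕ) Stat → (∀ s → p s ≤ 1) → (∀ s → 0 < p s → ∀ φ → ∑V (λ u → φ (deg (mat s) u)) ≡ Stat φ) →
      α * ∑ xs (λ s → cls s * p s) ≤ β * ∑ xs cls
    class-bound ws uws ls nonempty α β good p Stat p≤1 det = *-cancelˡ-≤ Π {{>-nonZero Π>0}} (begin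
      Π * (α * ∑ xs (λ s → cls s * p s))
        ≡⟨ rot Π α _ ⟩
      α * (Π * ∑ xs (λ s → cls s * p s))
        ≤⟨ *-monoʳ-≤ α (resample* ws ls p) ⟩
      α * ∑ xs (λ s → cls s * ∑ (choices (map O ws)) (λ f → p (re* s ws f)))
        ≡⟨ trans (sym (∑-*ˡ xs α _)) (∑-cong xs (λ s → rot α (cls s) _)) ⟩
      ∑ xs (λ s → cls s * (α * ∑ (choices (map O ws)) (λ f → p (re* s ws f))))
        ≤⟨ ∑-mono∈ xs each ⟩
      ∑ xs (λ s → cls s * (β * Π))
        ≡⟨ ∑-*ʳ xs (β * Π) cls ⟩
      ∑ xs cls * (β * Π)
        ≡⟨ e (∑ xs cls) β Π ⟩
      Π * (β * ∑ xs cls) ∎)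
      where
      open ≤-Reasoning
      open import Data.List.Membership.DecPropositional (LP.≡-dec (F._≟_ {n})) using () renaming (_∈?_ to _∈ᶜ?_)
      Π = ∏ (map O ws) length
      rot : ∀ a b c → a * (b * c) ≡ b * (a * c)
      rot = solve-∀
      e : ∀ a b c → a * (b * c) ≡ c * (b * a)
      e = solve-∀
      Π>0 : 1 ≤ Π
      Π>0 = ≤-trans (∏-pos ws (length ∘ O) (λ w w∈ → nonempty w (All.lookup ls w∈))) (≤-reflexive (sym (∏-map O ws length)))
      module _ (s : X) (s∈ : s ∈ xs) (ks : key s ≡ k) where
        F : List (Fin n) → ℕ
        F f = ⟦ does (f ∈ᶜ? choices (map O ws)) ⟧ * p (re* s ws f)
        c : Fin n → ℕ
        c u = deg (mat s) u ∸ oldLoad s ws u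
        F-det : Detects c Stat F
        F-det f pos φ with f ∈ᶜ? choices (map O ws)
        ... | yes f∈ = trans (∑-cong (allFin n) (λ u → cong φ (sym (degrees u)))) (det (re* s ws f) (subst (0 <_) (*-identityˡ _) pos) φ)
          where
          ok = re*-ok ws uws ls s∈ ks (∈-choices⁻ (map O ws) f∈)
          degrees : ∀ u → deg (mat (re* s ws f)) u ≡ c u + load f u
          degrees u = +-cancelʳ-≡ (oldLoad s ws u) _ _ (trans (proj₂ ok u) (trans
            (cong (_+ load f u) (sym (m∸n+n≡m (oldLoad≤deg ws uws ls {s} ks u)))) (e′ (c u) (oldLoad s ws u) (load f u))))
            where
            e′ : ∀ a b c → a + b + c ≡ a + c + b
            e′ = solve-∀
        F-sum : α * ∑ (choices (map O ws)) (λ f → p (re* s ws f)) ≤ β * Π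
        F-sum = ≤-trans (≤-reflexive (cong (α *_) (∑-cong∈ (choices (map O ws)) (λ f f∈ →
            sym (trans (cong (λ b → ⟦ b ⟧ * p (re* s ws f)) (dec-true (f ∈ᶜ? choices (map O ws)) f∈)) (*-identityˡ _))))))
          (good c Stat F (λ f → *-mono-≤ (⟦⟧≤1 (does (f ∈ᶜ? choices (map O ws)))) (p≤1 _)) F-det)
      each : ∀ s → s ∈ xs → cls s * (α * ∑ (choices (map O ws)) (λ f → p (re* s ws f))) ≤ cls s * (β * Π)
      each s s∈ with key s ≟ᵏ k
      ... | yes ks = *-monoʳ-≤ 1 (F-sum s s∈ ks)
      ... | no _ = z≤n

-- Assembling the bound

∑V-reindex-≤ : ∀ {n m} (f : Fin n → Fin m) → (∀ i j → f i ≡ f j → i ≡ j) → (g : Fin m → ℕ) → ∑V (λ i → g (f i)) ≤ ∑V g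
∑V-reindex-≤ {n} f inj g = ∑-inj f (Uniq.allFin⁺ n) (λ i _ _ → ∈-allFin (f i) , ≤-refl) (λ i j _ _ _ _ → inj i j)

∑V-reindex : ∀ {n m} (f : Fin n ↔ Fin m) (g : Fin m → ℕ) → ∑V (λ i → g (Inverse.to f i)) ≡ ∑V g
∑V-reindex {n} {m} f g = ≤-antisym
  (∑V-reindex-≤ to (λ i j e → trans (sym (strictlyInverseʳ i)) (trans (cong from e) (strictlyInverseʳ j))) g)
  (≤-trans (≤-reflexive (∑-cong (allFin m) (λ j → cong g (sym (strictlyInverseˡ j)))))
    (∑V-reindex-≤ from (λ i j e → trans (sym (strictlyInverseˡ i)) (trans (cong to e) (strictlyInverseˡ j))) (λ i → g (to i))))
  where open Inverse f

-- An isomorphism permutes the vertices and keeps degrees; the sums over all `φ` are the shape in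
-- which `Detects` takes a degree sequence.
isomorphic-degrees : ∀ {n m} (G : Graph n) (s : EdgeSubset G) (T : Graph m) → Isomorphic (SubAdj G s) (Adj T) →
  ∀ (φ : ℕ → ℕ) → ∑V (λ u → φ (deg (Matrices.mat G s) u)) ≡ ∑V (λ v → φ (deg (adj T) v))
isomorphic-degrees {n} G s T (f , iso) φ = trans (∑-cong (allFin n) (λ u → cong φ (degree-same u))) (∑V-reindex f (λ v → φ (deg (adj T) v)))
  where
  open Matrices G
  degree-same : ∀ u → deg (mat s) u ≡ deg (adj T) (Inverse.to f u)
  degree-same u = trans (∑-cong (allFin n) (λ j → cong ⟦_⟧ (⇔-≡ (λ e → Equivalence.to (iso u j) (mat⁻ {s} e)) (λ e → mat⁺ {s} (Equivalence.from (iso u j) e)))))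
    (∑V-reindex f (λ v → ⟦ adj T (Inverse.to f u) v ⟧))

n∣n! : ∀ k → 1 ≤ k → k ∣ k !
n∣n! (suc k) _ = divides (k !) (*-comm (suc k) (k !))

2n≤2^n : ∀ x → 2 * x ≤ 2 ^ x
2n≤2^n zero = z≤n
2n≤2^n (suc zero) = ≤-refl
2n≤2^n (suc (suc x)) = begin
  2 * suc (suc x)      ≡⟨ e x ⟩
  2 * suc x + 2        ≤⟨ +-mono-≤ (2n≤2^n (suc x)) (≤-trans (*-monoʳ-≤ 2 (m^n>0 2 x)) (≤-reflexive (sym (+-identityʳ _)))) ⟩
  2 ^ suc x + (2 ^ suc x + 0) ∎
  where
  open ≤-Reasoning
  e : ∀ x → 2 * (2 + x) ≡ 2 * (1 + x) + 2
  e = solve-∀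

-- The parameter `R` is the polynomial scale. Each quantity depending on d alone is required to be
-- at most `R`, so that absorbing it costs one power of `R`.
module Counting {n : ℕ} (G : Graph n) (d : ℕ) (min-degree : MinDegreeAtLeast G d)
  (xs : List (EdgeSubset G)) (uxs : Unique xs)
  (tree : ∀ {s} → s ∈ xs → Tree (Matrices.mat G s)) (complete : ∀ s → Tree (Matrices.mat G s) → s ∈ xs)
  (κ K R : ℕ) (16·896≤κ : 16 * 896 ≤ κ) (K>0 : 1 ≤ K) (K-small : κ * (2 * (16 * κ * K)) ≤ d)
  (n-large : R ^ 21 ≤ n)
  (R-s : 2 * (4 * (16 * κ * K)) ^ suc (2 * K) ≤ R) (R-K : 4 * K ≤ R) (R-κ : 2 * κ ≤ R) (R-896 : 896 ≤ R)
  (p : EdgeSubset G → ℕ) (p≤1 : ∀ s → p s ≤ 1) (Stat : (ℕ → ℕ) → ℕ)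
  (p-det : ∀ s → 0 < p s → ∀ φ → ∑V (λ u → φ (deg (Matrices.mat G s) u)) ≡ Stat φ) where

  open SpanningTrees G xs uxs tree complete

  hh : ℕ
  hh = 16 * κ * K

  κ>0 : 1 ≤ κ
  κ>0 = ≤-trans (s≤s z≤n) 16·896≤κ

  R>0 : 1 ≤ R
  R>0 = ≤-trans (s≤s z≤n) R-896

  instance
    R-nonZero : NonZero R
    R-nonZero = >-nonZero R>0

  R≤R^ : ∀ k → R ≤ R ^ suc k
  R≤R^ k = ≤-trans (≤-reflexive (sym (*-identityʳ R))) (*-monoʳ-≤ R (m^n>0 R k))

  896≤n : 896 ≤ n
  896≤n = ≤-trans R-896 (≤-trans (R≤R^ 20) n-large)

  n>0 : 1 ≤ n
  n>0 = ≤-trans (s≤s z≤n) 896≤n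

  u₀ u₁ : Fin n
  u₀ = F.fromℕ< n>0
  u₁ = F.fromℕ< {1} (≤-trans (s≤s (s≤s z≤n)) 896≤n)

  u₀≢u₁ : u₀ ≢ u₁
  u₀≢u₁ e = contradiction (trans (sym (FP.toℕ-fromℕ< n>0)) (trans (cong toℕ e) (FP.toℕ-fromℕ< _))) (λ ())

  hh>0 : 1 ≤ hh
  hh>0 = *-mono-≤ {1} {16 * κ} (*-mono-≤ {1} {16} (s≤s z≤n) κ>0) K>0

  16≤d : 16 ≤ d
  16≤d = ≤-trans (≤-trans (≤-trans (≤ᵇ⇒≤ 16 (16 * 896) tt) 16·896≤κ) (≤-trans (≤-reflexive (sym (*-identityʳ κ))) (*-monoʳ-≤ κ (*-mono-≤ {1} {2} (s≤s z≤n) hh>0)))) K-small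

  gdeg≡ : ∀ x → degree G x ≡ gdeg x
  gdeg≡ x = length-filter-∑ (adj G x) (allFin n)

  d≤gdeg : ∀ x → d ≤ gdeg x
  d≤gdeg x = ≤-trans (min-degree x) (≤-reflexive (gdeg≡ x))

  -- Degrees are positive and at most `n`, so the factorial is a common multiple and all weights
  -- W/deg are integers.
  W : ℕ
  W = n !

  W>0 : 1 ≤ W
  W>0 = 1≤n! n

  gdeg∣W : ∀ x → gdeg x ∣ W
  gdeg∣W x = ∣-trans (n∣n! (gdeg x) (≤-trans (≤-trans (s≤s z≤n) 16≤d) (d≤gdeg x)))
    (m≤n⇒m!∣n! (≤-trans (∑V-one-bound _ 1 (λ z → ⟦⟧≤1 (adj G x z))) (≤-reflexive (*-identityʳ n))))

  c : Fin n → ℕ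
  c x = quotient (gdeg∣W x)

  c-deg : ∀ x → c x * gdeg x ≡ W
  c-deg x = sym (_∣_.equality (gdeg∣W x))

  open Weights W W>0 c c-deg using (goodLeaves; leaf; gl; good)
  module P = Partition G xs uxs tree complete W W>0 c c-deg κ 896 (s≤s z≤n) 16·896≤κ

  -- The largest level that `few-leaves` admits. Rounding down costs at most a factor 2, so trees
  -- with `J` good leaves have at least n/896 leaves; hence the 896 passed to `Partition`.
  J : ℕ
  J = n / 448

  448J≤n : 448 * J ≤ n
  448J≤n = ≤-trans (≤-reflexive (*-comm 448 J)) (m/n*n≤m n 448)

  J>0 : 1 ≤ J
  J>0 = ≰⇒> (λ J≤0 → <⇒≱ (≤-trans (m%n<n n 448) (≤ᵇ⇒≤ 448 896 tt)) (≤-trans 896≤n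
    (≤-reflexive (trans (m≡m%n+[m/n]*n n 448) (trans (cong (λ k → n % 448 + k * 448) (n≤0⇒n≡0 J≤0)) (+-identityʳ _))))))

  n≤896J : n ≤ 896 * J
  n≤896J = begin
    n                    ≡⟨ m≡m%n+[m/n]*n n 448 ⟩
    n % 448 + J * 448    ≤⟨ +-monoˡ-≤ (J * 448) (≤-trans (<⇒≤ (m%n<n n 448)) (≤-trans (≤-reflexive (sym (*-identityˡ 448))) (*-monoˡ-≤ 448 J>0))) ⟩
    J * 448 + J * 448    ≡⟨ e J ⟩
    896 * J              ∎
    where
    open ≤-Reasoning
    e : ∀ j → j * 448 + j * 448 ≡ 896 * j
    e = solve-∀

  fewLeaves : ℕ
  fewLeaves = ∑ xs (λ s → ⟦ goodLeaves s <ᵇ J ⟧)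

  few : 2 ^ J * fewLeaves ≤ J * length xs
  few = FewLeaves.few-leaves G xs uxs tree complete W W>0 c c-deg d 16≤d d≤gdeg u₀ u₁ u₀≢u₁ J 448J≤n

  R^20≤J : R ^ 20 ≤ J
  R^20≤J = *-cancelˡ-≤ R (≤-trans n-large (≤-trans n≤896J (*-monoˡ-≤ J R-896)))

  R²+R²≤J : R * R + R * R ≤ J
  R²+R²≤J = begin
    R * R + R * R       ≡⟨ e (R * R) ⟩
    2 * (R * R)         ≤⟨ *-monoˡ-≤ (R * R) (≤-trans (≤ᵇ⇒≤ 2 896 tt) R-896) ⟩
    R * (R * R)         ≡⟨ cong (λ k → R * (R * k)) (sym (*-identityʳ R)) ⟩
    R ^ 3               ≤⟨ ^-monoʳ-≤ R (≤ᵇ⇒≤ 3 20 tt) ⟩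
    R ^ 20              ≤⟨ R^20≤J ⟩
    J                   ∎
    where
    open ≤-Reasoning
    e : ∀ a → a + a ≡ 2 * a
    e = solve-∀

  -- As `J` is at least 2R², one part R² of the exponent covers R^K because K ≤ R, and the remaining
  -- `x`, at least half of `J`, covers `J`.
  R^K·J≤2^J : R ^ K * J ≤ 2 ^ J
  R^K·J≤2^J = begin
    R ^ K * J                    ≤⟨ *-mono-≤ (≤-trans (^-monoˡ-≤ K (n≤2^n R)) (≤-reflexive (^-*-assoc 2 R K))) J≤ ⟩
    2 ^ (R * K) * 2 ^ x          ≡⟨ sym (^-distribˡ-+-* 2 (R * K) x) ⟩
    2 ^ (R * K + x)              ≤⟨ ^-monoʳ-≤ 2 (≤-trans (+-monoˡ-≤ x (*-monoʳ-≤ R (≤-trans (m≤n*m K 4) R-K))) (≤-reflexive (m+[n∸m]≡n R²≤J))) ⟩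
    2 ^ J                        ∎
    where
    open ≤-Reasoning
    x = J ∸ R * R
    R²≤J : R * R ≤ J
    R²≤J = ≤-trans (m≤m+n _ _) R²+R²≤J
    R²≤x : R * R ≤ x
    R²≤x = +-cancelˡ-≤ (R * R) _ _ (≤-trans R²+R²≤J (≤-reflexive (sym (m+[n∸m]≡n R²≤J))))
    J≤ : J ≤ 2 ^ x
    J≤ = ≤-trans (≤-trans (≤-reflexive (sym (m+[n∸m]≡n R²≤J))) (≤-trans (+-monoˡ-≤ x R²≤x) (≤-reflexive (cong (x +_) (sym (+-identityʳ x)))))) (2n≤2^n x)

  few′ : R ^ K * fewLeaves ≤ length xs
  few′ = *-cancelˡ-≤ (2 ^ J) {{m^n≢0 2 J}} (begin
    2 ^ J * (R ^ K * fewLeaves)     ≡⟨ rot (2 ^ J) (R ^ K) fewLeaves ⟩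
    R ^ K * (2 ^ J * fewLeaves)     ≤⟨ *-monoʳ-≤ (R ^ K) few ⟩
    R ^ K * (J * length xs)         ≡⟨ sym (*-assoc (R ^ K) J (length xs)) ⟩
    R ^ K * J * length xs           ≤⟨ *-monoˡ-≤ (length xs) R^K·J≤2^J ⟩
    2 ^ J * length xs               ∎)
    where
    open ≤-Reasoning
    rot : ∀ a b c → a * (b * c) ≡ b * (a * c)
    rot = solve-∀

  p₁ : X → ℕ
  p₁ s = p s * ⟦ not (goodLeaves s <ᵇ J) ⟧

  p₁-many : ∀ s → s ∈ xs → 0 < p₁ s → n ≤ 896 * P.leaves s
  p₁-many s _ q = ≤-trans n≤896J (*-monoʳ-≤ 896 (≤-trans J≤ (∑-mono (allFin n) (λ v → ⟦⟧-≤ (λ e → ≤-reflexive (sym (⟦⟧-true (proj₂ (∧-true {good v} e)))))))))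
    where
    J≤ : J ≤ goodLeaves s
    J≤ = ≮⇒≥ (λ l → n≮0 (subst (0 <_) (trans (cong (λ b → p s * ⟦ not b ⟧) (Equivalence.to T-≡ (<⇒<ᵇ l))) (*-zeroʳ (p s))) q))

  abstract
    found : Σ (Vec Bool n) λ bits → ∑ xs p₁ ≤ 2 * κ * ∑ xs (λ s → p₁ s * ⟦ n ≤ᵇ 2 * κ * P.sizeL bits s ⟧)
    found = P.partition n>0 p₁ p₁-many

  bits : Vec Bool n
  bits = proj₁ found

  inA inB : Fin n → Bool
  inA = P.inA bits
  inB = P.inB bits

  inA-notB : ∀ w → inA w ≡ true → inB w ≡ false
  inA-notB w e with inB w | proj₁ (∧-true {not (inB w)} e)
  ... | false | _ = refl

  q : Fin n → Fin n → Bool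
  q w y = adj G w y ∧ inB y

  q-large : ∀ w → inA w ≡ true → 2 * hh ≤ ∑V (λ y → ⟦ q w y ⟧)
  q-large w e = *-cancelˡ-≤ κ {{>-nonZero κ>0}} (begin
    κ * (2 * hh)               ≤⟨ K-small ⟩
    d                          ≤⟨ d≤gdeg w ⟩
    gdeg w                     ≤⟨ ≤ᵇ-true (proj₂ (∧-true {not (inB w)} e)) ⟩
    κ * P.nB bits w            ≡⟨ cong (κ *_) (∑-cong (allFin n) (λ b → sym (⟦⟧-∧ (adj G w b) (inB b)))) ⟩
    κ * ∑V (λ y → ⟦ q w y ⟧)   ∎)
    where open ≤-Reasoning

  GroupsOf : Fin n → Set
  GroupsOf w = Σ (Fin n → ℕ) λ g → inA w ≡ true → ∀ y → q w y ≡ true →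
    2 * hh ≤ ∑V (λ z → ⟦ q w z ∧ (g z ≡ᵇ g y) ⟧) × ∑V (λ z → ⟦ q w z ∧ (g z ≡ᵇ g y) ⟧) ≤ 2 * (2 * hh)

  abstract
    groups : ∀ w → inA w ≡ true → Grouping (2 * hh) (q w)
    groups w e = grouping (2 * hh) (∑V (λ y → ⟦ q w y ⟧)) (q w) (*-mono-≤ {1} {2} (s≤s z≤n) hh>0) (q-large w e) ≤-refl

  fromGrouping : ∀ w → Grouping (2 * hh) (q w) → GroupsOf w
  fromGrouping w (g , ok) = g , λ _ → ok

  abstract
    groupsOf : ∀ w → GroupsOf w
    groupsOf w = [ (λ e → fromGrouping w (groups w e)) , (λ e → (λ _ → 0) , λ e′ → ⊥-elim (true≢false (trans (sym e′) e))) ]′ (≡true-or-false (inA w))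

  grp : Fin n → Fin n → ℕ
  grp w = proj₁ (groupsOf w)

  grp-ok : ∀ w → inA w ≡ true → ∀ y → q w y ≡ true →
    2 * hh ≤ ∑V (λ z → ⟦ q w z ∧ (grp w z ≡ᵇ grp w y) ⟧) × ∑V (λ z → ⟦ q w z ∧ (grp w z ≡ᵇ grp w y) ⟧) ≤ 2 * (2 * hh)
  grp-ok w = proj₂ (groupsOf w)

  open Resampling G xs uxs tree complete inA inB inA-notB grp

  big : X → Bool
  big s = n ≤ᵇ 2 * κ * P.sizeL bits s

  p₂ : X → ℕ
  p₂ s = p₁ s * ⟦ big s ⟧

  p₂≤p : ∀ s → p₂ s ≤ p s
  p₂≤p s = ≤-trans (*-monoʳ-≤ (p₁ s) (⟦⟧≤1 (big s))) (≤-trans (≤-reflexive (*-identityʳ (p₁ s)))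
    (≤-trans (*-monoʳ-≤ (p s) (⟦⟧≤1 (not (goodLeaves s <ᵇ J)))) (≤-reflexive (*-identityʳ (p s)))))

  module _ (k : Vec ℕ n) where
    open Class k

    -- The key alone determines the set of free leaves, so a single tree `s` of the class with many
    -- of them makes the whole class accessible to the dichotomy.
    module _ {s : X} (ks : key s ≡ k) (bs : big s ≡ true) where

      ℓ : ℕ
      ℓ = ∑V (λ w → ⟦ inLk w ⟧)

      n≤2κℓ : n ≤ 2 * κ * ℓ
      n≤2κℓ = ≤-trans (≤ᵇ-true bs) (*-monoʳ-≤ (2 * κ) (≤-reflexive (∑-cong (allFin n) (λ w → cong ⟦_⟧ (sym (inLk≡inL {s} ks w))))))

      ℓ>0 : 1 ≤ ℓ
      ℓ>0 = ≰⇒> (λ z → <⇒≱ n>0 (≤-trans n≤2κℓ (≤-reflexive (trans (cong (2 * κ *_) (n≤0⇒n≡0 z)) (*-zeroʳ (2 * κ))))))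

      R^20≤ℓ : R ^ 20 ≤ ℓ
      R^20≤ℓ = *-cancelˡ-≤ R (≤-trans n-large (≤-trans n≤2κℓ (*-monoˡ-≤ ℓ R-κ)))

      class-count : ∀ w → inLk w ≡ true → Σ (Fin n) λ y → q w y ≡ true × inA w ≡ true ×
        ∑V (λ z → ⟦ op w z ⟧) ≡ ∑V (λ z → ⟦ q w z ∧ (grp w z ≡ᵇ grp w y) ⟧)
      class-count w l = nbr s w , proj₁ (∧-true {q w (nbr s w)} (op-nbr {s} ks w w∈L)) , proj₁ (∧-true {inA w} w∈L)
        , ∑-cong (allFin n) (λ z → cong (λ j → ⟦ q w z ∧ (suc (grp w z) ≡ᵇ j) ⟧) (key-grp {s} ks w w∈L))
        where
        w∈L : inL s w ≡ true
        w∈L = trans (sym (inLk≡inL {s} ks w)) l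

      op-lower : ∀ w → inLk w ≡ true → 2 * hh ≤ ∑V (λ y → ⟦ op w y ⟧)
      op-lower w l with class-count w l
      ... | y , qy , a , e = ≤-trans (proj₁ (grp-ok w a y qy)) (≤-reflexive (sym e))

      op-upper : ∀ w → inLk w ≡ true → ∑V (λ y → ⟦ op w y ⟧) ≤ 4 * hh
      op-upper w l with class-count w l
      ... | y , qy , a , e = ≤-trans (≤-reflexive e) (≤-trans (proj₂ (grp-ok w a y qy)) (≤-reflexive (sym (*-assoc 2 2 hh))))

      -- The factor 16 in `hh` is made for this inequality: with n ≤ 2κℓ the left side is at most
      -- 8κKℓ.
      n-small : 2 * (n * (2 * K)) < ℓ * hh
      n-small = begin-strict
        2 * (n * (2 * K))                 ≤⟨ *-monoʳ-≤ 2 (*-monoˡ-≤ (2 * K) n≤2κℓ) ⟩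
        2 * (2 * κ * ℓ * (2 * K))         ≡⟨ e₁ κ ℓ K ⟩
        8 * (ℓ * (κ * K))                 <⟨ *-monoˡ-< (ℓ * (κ * K)) {{>-nonZero (*-mono-≤ ℓ>0 (*-mono-≤ κ>0 K>0))}} (≤ᵇ⇒≤ 9 16 tt) ⟩
        16 * (ℓ * (κ * K))                ≡⟨ e₂ κ ℓ K ⟩
        ℓ * hh                            ∎
        where
        open ≤-Reasoning
        e₁ : ∀ κ l k → 2 * (2 * κ * l * (2 * k)) ≡ 8 * (l * (κ * k))
        e₁ = solve-∀
        e₂ : ∀ κ l k → 16 * (l * (κ * k)) ≡ l * (16 * κ * k)
        e₂ = solve-∀

      h-large : 2 * K + 3 ≤ hh
      h-large = begin
        2 * K + 3                ≤⟨ +-monoʳ-≤ (2 * K) (*-monoʳ-≤ 3 K>0) ⟩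
        2 * K + 3 * K            ≤⟨ m≤m+n _ (11 * K) ⟩
        2 * K + 3 * K + 11 * K   ≡⟨ e K ⟩
        16 * 1 * K               ≤⟨ *-monoˡ-≤ K (*-monoʳ-≤ 16 κ>0) ⟩
        hh                       ∎
        where
        open ≤-Reasoning
        e : ∀ k → 2 * k + 3 * k + 11 * k ≡ 16 * 1 * k
        e = solve-∀

      module D = Dichotomy inLk op ℓ ≤-refl K hh R K>0 h-large op-lower op-upper n-small

      2≤R : 2 ≤ R
      2≤R = ≤-trans (≤ᵇ⇒≤ 2 896 tt) R-896

      1+N≤R : 1 + D.N ≤ R
      1+N≤R = ≤-trans (≤-reflexive (trans D.1+N (cong (2 *_) D.s-def))) R-s

      t₂≤ : D.t₂ ≤ R ^ 4
      t₂≤ = begin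
        D.t₂                        ≡⟨ D.t₂-def ⟩
        (1 + D.N) * (R * R + R)     ≤⟨ *-mono-≤ 1+N≤R (+-monoʳ-≤ (R * R) (m≤m*n R R)) ⟩
        R * (R * R + R * R)         ≡⟨ e R ⟩
        R * (R * (2 * R))           ≤⟨ *-monoʳ-≤ R (*-monoʳ-≤ R (*-monoˡ-≤ R 2≤R)) ⟩
        R * (R * (R * R))           ≡⟨ cong (λ k → R * (R * (R * k))) (sym (*-identityʳ R)) ⟩
        R ^ 4                       ∎
        where
        open ≤-Reasoning
        e : ∀ r → r * (r * r + r * r) ≡ r * (r * (2 * r))
        e = solve-∀

      m≤ : D.m ≤ R ^ 6
      m≤ = begin
        D.m                                   ≡⟨ D.m-def ⟩
        (1 + D.N) * (2 * (K * D.t₂) + K * R)  ≤⟨ *-mono-≤ 1+N≤R (+-mono-≤ (*-monoʳ-≤ 2 (*-monoʳ-≤ K t₂≤)) (*-monoʳ-≤ K (R≤R^ 3))) ⟩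
        R * (2 * (K * R ^ 4) + K * R ^ 4)     ≤⟨ *-monoʳ-≤ R (≤-trans (m≤m+n _ (K * R ^ 4)) (≤-reflexive (e K (R ^ 4)))) ⟩
        R * (4 * K * R ^ 4)                   ≤⟨ *-monoʳ-≤ R (*-monoˡ-≤ (R ^ 4) R-K) ⟩
        R ^ 6                                 ∎
        where
        open ≤-Reasoning
        e : ∀ k r → 2 * (k * r) + k * r + k * r ≡ 4 * k * r
        e = solve-∀

      u≤ : D.u ≤ R ^ 7
      u≤ = begin
        D.u                  ≡⟨ D.u-def ⟩
        D.m * (2 + 2 * K)    ≤⟨ *-mono-≤ m≤ (≤-trans (≤-trans (+-monoˡ-≤ (2 * K) (*-monoʳ-≤ 2 K>0)) (≤-reflexive (e K))) R-K) ⟩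
        R ^ 6 * R            ≡⟨ *-comm (R ^ 6) R ⟩
        R ^ 7                ∎
        where
        open ≤-Reasoning
        e : ∀ k → 2 * k + 2 * k ≡ 4 * k
        e = solve-∀

      small : 4 * D.u ≤ ℓ
      small = begin
        4 * D.u     ≤⟨ *-mono-≤ (≤-trans (≤ᵇ⇒≤ 4 896 tt) R-896) u≤ ⟩
        R ^ 8       ≤⟨ ^-monoʳ-≤ R (≤ᵇ⇒≤ 8 20 tt) ⟩
        R ^ 20      ≤⟨ R^20≤ℓ ⟩
        ℓ           ∎
        where open ≤-Reasoning

      -- The dominant term has exponent 7 + 7 + 4 = 18. One more power absorbs the constant and one
      -- gives strictness; with the power lost in n ≤ 2κℓ this makes 21.
      large : 4 * (K * D.t₂ + D.u * D.u * D.t₂) < ℓ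
      large = begin-strict
        4 * (K * D.t₂ + D.u * D.u * D.t₂)        ≤⟨ *-monoʳ-≤ 4 (+-mono-≤ (*-mono-≤ (≤-trans (m≤n*m K 4) R-K) t₂≤) (*-mono-≤ (*-mono-≤ u≤ u≤) t₂≤)) ⟩
        4 * (R ^ 5 + R ^ 7 * R ^ 7 * R ^ 4)      ≡⟨ cong (λ k → 4 * (R ^ 5 + k)) (trans (cong (_* R ^ 4) (sym (^-distribˡ-+-* R 7 7))) (sym (^-distribˡ-+-* R 14 4))) ⟩
        4 * (R ^ 5 + R ^ 18)                     ≤⟨ *-monoʳ-≤ 4 (+-monoˡ-≤ (R ^ 18) (^-monoʳ-≤ R (≤ᵇ⇒≤ 5 18 tt))) ⟩
        4 * (R ^ 18 + R ^ 18)                    ≡⟨ e (R ^ 18) ⟩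
        8 * R ^ 18                               ≤⟨ *-monoˡ-≤ (R ^ 18) (≤-trans (≤ᵇ⇒≤ 8 896 tt) R-896) ⟩
        R ^ 19                                   <⟨ ^-monoʳ-< R 2≤R (≤ᵇ⇒≤ 20 20 tt) ⟩
        R ^ 20                                   ≤⟨ R^20≤ℓ ⟩
        ℓ                                        ∎
        where
        open ≤-Reasoning
        e : ∀ a → 4 * (a + a) ≡ 8 * a
        e = solve-∀

      one-class : R ^ K * ∑ xs (λ s → cls s * p₂ s) ≤ (4 * K) ^ K * ∑ xs cls
      one-class = from-good (D.dichotomy small large)
        where
        from-good : Σ (List (Fin n)) D.Good → R ^ K * ∑ xs (λ s → cls s * p₂ s) ≤ (4 * K) ^ K * ∑ xs cls
        from-good (ws , uws , ls , good) = class-bound ws uws ls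
          (λ w l → ≤-trans (≤-trans (*-mono-≤ {1} {2} (s≤s z≤n) hh>0) (op-lower w l)) (≤-reflexive (sym (length-filter-∑ (op w) (allFin n)))))
          (R ^ K) ((4 * K) ^ K) good p₂ Stat (λ s → ≤-trans (p₂≤p s) (p≤1 s)) (λ s pos → p-det s (≤-trans pos (p₂≤p s)))

    -- A class of weight zero is trivial; in any other class a tree with positive `p₂` certifies
    -- that the set of free leaves is large.
    every-class : R ^ K * ∑ xs (λ s → cls s * p₂ s) ≤ (4 * K) ^ K * ∑ xs cls
    every-class = cases (∑ xs (λ s → cls s * p₂ s) ≟ 0)
      where
      cases : Dec (∑ xs (λ s → cls s * p₂ s) ≡ 0) → R ^ K * ∑ xs (λ s → cls s * p₂ s) ≤ (4 * K) ^ K * ∑ xs cls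
      cases (yes z) = ≤-trans (≤-reflexive (trans (cong (R ^ K *_) z) (*-zeroʳ (R ^ K)))) z≤n
      cases (no nz) = one-class {s} (proj₁ kp) (big-of (proj₂ kp))
        where
        wit = ∑-pos xs (λ s → cls s * p₂ s) (n≢0⇒n>0 nz)
        s = proj₁ wit
        kp = cls-pos {s} (proj₂ (proj₂ wit))
        big-of : 0 < p₂ s → big s ≡ true
        big-of pos with big s
        ... | true = refl
        ... | false = ⊥-elim (n≮0 (subst (0 <_) (*-zeroʳ (p₁ s)) pos))

  p₂-bound : R ^ K * ∑ xs p₂ ≤ (4 * K) ^ K * length xs
  p₂-bound = group-bound _≟ᵏ_ key xs (R ^ K) ((4 * K) ^ K) p₂ every-class

  count-bound : R ^ K * ∑ xs p ≤ (2 * κ * (4 * K) ^ K + 1) * length xs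
  count-bound = begin
    R ^ K * ∑ xs p
      ≤⟨ *-monoʳ-≤ (R ^ K) (≤-trans (∑-mono xs split) (≤-reflexive (∑-+ xs p₁ (λ s → ⟦ goodLeaves s <ᵇ J ⟧)))) ⟩
    R ^ K * (∑ xs p₁ + fewLeaves)
      ≤⟨ *-monoʳ-≤ (R ^ K) (+-monoˡ-≤ fewLeaves (proj₂ found)) ⟩
    R ^ K * (2 * κ * ∑ xs p₂ + fewLeaves)
      ≡⟨ e₁ (R ^ K) (2 * κ) (∑ xs p₂) fewLeaves ⟩
    2 * κ * (R ^ K * ∑ xs p₂) + R ^ K * fewLeaves
      ≤⟨ +-mono-≤ (*-monoʳ-≤ (2 * κ) p₂-bound) few′ ⟩
    2 * κ * ((4 * K) ^ K * length xs) + length xs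
      ≡⟨ e₂ (2 * κ) ((4 * K) ^ K) (length xs) ⟩
    (2 * κ * (4 * K) ^ K + 1) * length xs ∎
    where
    open ≤-Reasoning
    e₁ : ∀ r k a b → r * (k * a + b) ≡ k * (r * a) + r * b
    e₁ = solve-∀
    e₂ : ∀ k b l → k * (b * l) + l ≡ (k * b + 1) * l
    e₂ = solve-∀
    split : ∀ s → p s ≤ p₁ s + ⟦ goodLeaves s <ᵇ J ⟧
    split s with goodLeaves s <ᵇ J
    ... | true = ≤-trans (p≤1 s) (m≤n+m 1 _)
    ... | false = ≤-trans (≤-reflexive (sym (*-identityʳ (p s)))) (m≤m+n _ 0)

-- From the scale R to a power of n

root : ∀ e → 1 ≤ e → ∀ n → Σ ℕ λ R → R ^ e ≤ n × n < suc R ^ e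
root e e>0 zero = 0 , ≤-reflexive (zero^ e e>0) , m^n>0 1 e
  where
  zero^ : ∀ e → 1 ≤ e → 0 ^ e ≡ 0
  zero^ (suc e) _ = refl
root e e>0 (suc n) with root e e>0 n
... | R , lo , hi with suc n <? suc R ^ e
...   | yes p = R , m≤n⇒m≤1+n lo , p
...   | no p = suc R , ≮⇒≥ p , ≤-<-trans hi (^-monoˡ-< e {{>-nonZero e>0}} ≤-refl)

root-maximal : ∀ e R S n → n < suc R ^ e → S ^ e ≤ n → S ≤ R
root-maximal e R S n hi lo = ≮⇒≥ (λ R<S → <⇒≱ hi (≤-trans (^-monoˡ-≤ e R<S) lo))

-- Squaring gives R^(2K) against B². One factor `R` cancels B², and since K ≥ 1 at least K of the
-- remaining 2K - 1 factors are left; this removes the constant at the cost of half the exponent.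
square-bound : ∀ R K M N B → 1 ≤ R → 1 ≤ K → R ^ K * M ≤ B * N → B * B ≤ R → R ^ K * (M * M) ≤ N * N
square-bound R (suc K) M N B R>0 _ h B²≤R = *-cancelˡ-≤ R {{>-nonZero R>0}} (begin
  R * (R ^ suc K * (M * M))                        ≡⟨ cong (λ k → R * (R ^ suc K * k)) (sym (*-identityˡ (M * M))) ⟩
  R * (R ^ suc K * (1 * (M * M)))                  ≤⟨ *-monoʳ-≤ R (*-monoʳ-≤ (R ^ suc K) (*-monoˡ-≤ (M * M) (m^n>0 R {{>-nonZero R>0}} K))) ⟩
  R * (R ^ suc K * (R ^ K * (M * M)))              ≡⟨ e₁ R (R ^ K) M ⟩
  (R ^ suc K * M) * (R ^ suc K * M)                ≤⟨ *-mono-≤ h h ⟩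
  (B * N) * (B * N)                                ≡⟨ e₂ B N ⟩
  B * B * (N * N)                                  ≤⟨ *-monoˡ-≤ (N * N) B²≤R ⟩
  R * (N * N)                                      ∎)
  where
  open ≤-Reasoning
  e₁ : ∀ r s m → r * (r * s * (s * (m * m))) ≡ (r * s * m) * (r * s * m)
  e₁ = solve-∀
  e₂ : ∀ b n → (b * n) * (b * n) ≡ b * b * (n * n)
  e₂ = solve-∀

-- Rounding in the integer root is compensated by R + 1 ≤ R², which doubles the exponent e · C.
power-bound : ∀ R K n d e C → 2 ≤ R → n < suc R ^ e → d ≤ C * K → n ^ d ≤ (R ^ K) ^ (e * C + e * C)
power-bound R K n d e C 2≤R n< d≤ = begin
  n ^ d                              ≤⟨ ^-monoˡ-≤ d (≤-trans (<⇒≤ n<) (^-monoˡ-≤ e sucR≤)) ⟩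
  ((R * R) ^ e) ^ d                  ≡⟨ ^-*-assoc (R * R) e d ⟩
  (R * R) ^ (e * d)                  ≤⟨ ^-monoʳ-≤ (R * R) {{>-nonZero (*-mono-≤ R>0 R>0)}} (*-monoʳ-≤ e d≤) ⟩
  (R * R) ^ (e * (C * K))            ≡⟨ cong ((R * R) ^_) (trans (sym (*-assoc e C K)) (*-comm (e * C) K)) ⟩
  (R * R) ^ (K * (e * C))            ≡⟨ sym (^-*-assoc (R * R) K (e * C)) ⟩
  ((R * R) ^ K) ^ (e * C)            ≡⟨ trans (cong (_^ (e * C)) (*-^ R R K)) (*-^ (R ^ K) (R ^ K) (e * C)) ⟩
  (R ^ K) ^ (e * C) * (R ^ K) ^ (e * C) ≡⟨ sym (^-distribˡ-+-* (R ^ K) (e * C) (e * C)) ⟩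
  (R ^ K) ^ (e * C + e * C)          ∎
  where
  open ≤-Reasoning
  R>0 : 1 ≤ R
  R>0 = ≤-trans (s≤s z≤n) 2≤R
  sucR≤ : suc R ≤ R * R
  sucR≤ = ≤-trans (+-monoˡ-≤ R R>0) (≤-trans (≤-reflexive (cong (R +_) (sym (+-identityʳ R)))) (*-monoˡ-≤ R 2≤R))

final-bound : ∀ R K M N B n d e C → 2 ≤ R → 1 ≤ K → R ^ K * M ≤ B * N → B * B ≤ R → n < suc R ^ e → d ≤ C * K →
  M ^ (2 * (e * C + e * C)) * n ^ (1 * d) ≤ N ^ (2 * (e * C + e * C))
final-bound R K M N B n d e C 2≤R K>0 h B²≤R n< d≤ = begin
  M ^ (2 * E) * n ^ (1 * d)       ≡⟨ cong₂ _*_ (square M) (cong (n ^_) (*-identityˡ d)) ⟩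
  (M * M) ^ E * n ^ d             ≤⟨ *-monoʳ-≤ ((M * M) ^ E) (power-bound R K n d e C 2≤R n< d≤) ⟩
  (M * M) ^ E * (R ^ K) ^ E       ≡⟨ trans (*-comm ((M * M) ^ E) _) (sym (*-^ (R ^ K) (M * M) E)) ⟩
  (R ^ K * (M * M)) ^ E           ≤⟨ ^-monoˡ-≤ E (square-bound R K M N B (≤-trans (s≤s z≤n) 2≤R) K>0 h B²≤R) ⟩
  (N * N) ^ E                     ≡⟨ sym (square N) ⟩
  N ^ (2 * E)                     ∎
  where
  open ≤-Reasoning
  E = e * C + e * C
  square : ∀ a → a ^ (2 * E) ≡ (a * a) ^ E
  square a = trans (sym (^-*-assoc a 2 E)) (cong (λ k → (a * k) ^ E) (*-identityʳ a))

-- Opaque, because unfolding a power with such an exponent is infeasible.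
opaque
  κ₀ : ℕ
  κ₀ = 16384

  κ₀-large : 16 * 896 ≤ κ₀
  κ₀-large = ≤ᵇ⇒≤ (16 * 896) 16384 tt

κ₀>0 : 1 ≤ κ₀
κ₀>0 = ≤-trans (s≤s z≤n) κ₀-large

opaque
  -- With K = d / C₁ this is exactly what makes κ₀ times the required `2 * hh` neighbours in B fit
  -- into the minimum degree d.
  C₁ : ℕ
  C₁ = κ₀ * (2 * (16 * κ₀))

  C₁-def : C₁ ≡ κ₀ * (2 * (16 * κ₀))
  C₁-def = refl

  C₁>0 : 1 ≤ C₁
  C₁>0 = *-mono-≤ κ₀>0 (*-mono-≤ {1} {2} (s≤s z≤n) (*-mono-≤ {1} {16} (s≤s z≤n) κ₀>0))

opaque
  -- The reciprocal of γ. The leading 2 comes from `square-bound`, 21 from the root, `2 * C₁` from d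
  -- ≤ 2 C₁ K, and the doubled summand from rounding the root.
  exponent : ℕ
  exponent = 2 * (21 * (2 * C₁) + 21 * (2 * C₁))

  exponent>0 : 1 ≤ exponent
  exponent>0 = *-mono-≤ {1} {2} (s≤s z≤n) (≤-trans (*-mono-≤ {1} {21} (s≤s z≤n) (*-mono-≤ {1} {2} (s≤s z≤n) C₁>0)) (m≤m+n (21 * (2 * C₁)) (21 * (2 * C₁))))

  exponent-bound : ∀ R K M N B n d → 2 ≤ R → 1 ≤ K → R ^ K * M ≤ B * N → B * B ≤ R → n < suc R ^ 21 → d ≤ 2 * C₁ * K →
    M ^ exponent * n ^ (1 * d) ≤ N ^ exponent
  exponent-bound R K M N B n d = final-bound R K M N B n d 21 (2 * C₁)

opaque
  B₀ : ℕ → ℕ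
  B₀ K = 2 * κ₀ * (4 * K) ^ K + 1

  B₀-def : ∀ K → B₀ K ≡ 2 * κ₀ * (4 * K) ^ K + 1
  B₀-def K = refl

opaque
  -- The sum of all lower bounds imposed on `R`, standing in for their maximum. It depends on d only
  -- through `K`, so its 21st power can serve as n₀.
  R₀ : ℕ → ℕ
  R₀ K = 2 * (4 * (16 * κ₀ * K)) ^ suc (2 * K) + (4 * K + (2 * κ₀ + (896 + B₀ K * B₀ K)))

  R₀-bounds : ∀ K R → R₀ K ≤ R →
    2 * (4 * (16 * κ₀ * K)) ^ suc (2 * K) ≤ R × 4 * K ≤ R × 2 * κ₀ ≤ R × 896 ≤ R × B₀ K * B₀ K ≤ R
  R₀-bounds K R h = ≤-trans (m≤m+n _ _) h , ≤-trans (m≤m+n _ _) h₁ , ≤-trans (m≤m+n _ _) h₂ , ≤-trans (m≤m+n 896 (B₀ K * B₀ K)) h₃ , ≤-trans (m≤n+m _ 896) h₃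
    where
    h₁ : 4 * K + (2 * κ₀ + (896 + B₀ K * B₀ K)) ≤ R
    h₁ = ≤-trans (m≤n+m (4 * K + (2 * κ₀ + (896 + B₀ K * B₀ K))) (2 * (4 * (16 * κ₀ * K)) ^ suc (2 * K))) h
    h₂ : 2 * κ₀ + (896 + B₀ K * B₀ K) ≤ R
    h₂ = ≤-trans (m≤n+m (2 * κ₀ + (896 + B₀ K * B₀ K)) (4 * K)) h₁
    h₃ : 896 + B₀ K * B₀ K ≤ R
    h₃ = ≤-trans (m≤n+m (896 + B₀ K * B₀ K) (2 * κ₀)) h₂

instance
  C₁-nonZero : NonZero C₁
  C₁-nonZero = >-nonZero C₁>0

module _ (d : ℕ) (C₁≤d : C₁ ≤ d) where

  K₀ : ℕ
  K₀ = d / C₁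

  K₀>0 : 1 ≤ K₀
  K₀>0 = ≰⇒> (λ z → <⇒≱ (m%n<n d C₁) (≤-trans C₁≤d (≤-reflexive (trans (m≡m%n+[m/n]*n d C₁)
    (trans (cong (λ k → d % C₁ + k * C₁) (n≤0⇒n≡0 z)) (+-identityʳ _))))))

  K₀-small : κ₀ * (2 * (16 * κ₀ * K₀)) ≤ d
  K₀-small = ≤-trans (≤-reflexive (trans (e κ₀ K₀) (cong (K₀ *_) (sym C₁-def)))) (m/n*n≤m d C₁)
    where
    e : ∀ κ k → κ * (2 * (16 * κ * k)) ≡ k * (κ * (2 * (16 * κ)))
    e = solve-∀

  d≤ : d ≤ 2 * C₁ * K₀
  d≤ = begin
    d                     ≡⟨ m≡m%n+[m/n]*n d C₁ ⟩
    d % C₁ + K₀ * C₁      ≤⟨ +-monoˡ-≤ (K₀ * C₁) (≤-trans (<⇒≤ (m%n<n d C₁)) (≤-trans (≤-reflexive (sym (*-identityˡ C₁))) (*-monoˡ-≤ C₁ K₀>0))) ⟩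
    K₀ * C₁ + K₀ * C₁     ≡⟨ e K₀ C₁ ⟩
    2 * C₁ * K₀           ∎
    where
    open ≤-Reasoning
    e : ∀ k c → k * c + k * c ≡ 2 * c * k
    e = solve-∀

  module _ {n : ℕ} (G : Graph n) (min-degree : MinDegreeAtLeast G d) {m : ℕ} (T : Graph m) (N M : ℕ)
           (spanning : HasCount G (IsSpanningTree G) N)
           (isomorphic : HasCount G (λ s → IsSpanningTree G s × Isomorphic (SubAdj G s) (Adj T)) M) where

    open Matrices G
    open import Data.List.Membership.DecPropositional (VP.≡-dec {A = Bool} {n = numEdges G} 𝔹._≟_) using (_∈?_)

    xs ys : List X
    xs = proj₁ spanning
    ys = proj₁ isomorphic

    ys⇒isomorphic : ∀ {s} → s ∈ ys → IsSpanningTree G s × Isomorphic (SubAdj G s) (Adj T)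
    ys⇒isomorphic {s} = Equivalence.from (proj₂ (proj₂ (proj₂ isomorphic)) s)

    xs⇒spanning : ∀ {s} → s ∈ xs → IsSpanningTree G s
    xs⇒spanning {s} = Equivalence.from (proj₂ (proj₂ (proj₂ spanning)) s)

    spanning⇒xs : ∀ {s} → IsSpanningTree G s → s ∈ xs
    spanning⇒xs {s} = Equivalence.to (proj₂ (proj₂ (proj₂ spanning)) s)

    abstract
      isT : X → ℕ
      isT s = ⟦ does (s ∈? ys) ⟧

      isT≤1 : ∀ s → isT s ≤ 1
      isT≤1 s = ⟦⟧≤1 (does (s ∈? ys))

      isT-degrees : ∀ s → 0 < isT s → ∀ (φ : ℕ → ℕ) → ∑V (λ u → φ (deg (mat s) u)) ≡ ∑V (λ v → φ (deg (adj T) v))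
      isT-degrees s pos = isomorphic-degrees G s T (proj₂ (ys⇒isomorphic (does-true {d = s ∈? ys} (⟦⟧-pos pos))))

      M≤∑isT : M ≤ ∑ xs isT
      M≤∑isT = ≤-trans (≤-reflexive (trans (sym (proj₁ (proj₂ (proj₂ isomorphic)))) (sym (∑-one ys))))
        (∑-inj id (proj₁ (proj₂ isomorphic)) (λ s s∈ _ → spanning⇒xs (proj₁ (ys⇒isomorphic s∈))
          , ≤-reflexive (sym (⟦⟧-true (dec-true (s ∈? ys) s∈)))) (λ _ _ _ _ _ _ e → e))

    counted : ∀ R → R ^ 21 ≤ n → R₀ K₀ ≤ R → R ^ K₀ * M ≤ B₀ K₀ * N
    counted R lo large = ≤-trans (*-monoʳ-≤ (R ^ K₀) M≤∑isT) (≤-trans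
      (Counting.count-bound G d min-degree xs (proj₁ (proj₂ spanning)) (λ s∈ → spanning⇒Tree (xs⇒spanning s∈))
        (λ s t → spanning⇒xs (Tree⇒spanning t)) κ₀ K₀ R κ₀-large K₀>0 K₀-small lo
        (proj₁ bounds) (proj₁ (proj₂ bounds)) (proj₁ (proj₂ (proj₂ bounds))) (proj₁ (proj₂ (proj₂ (proj₂ bounds))))
        isT isT≤1 (λ (φ : ℕ → ℕ) → ∑V (λ v → φ (deg (adj T) v))) isT-degrees)
      (≤-reflexive (cong₂ _*_ (sym (B₀-def K₀)) (proj₁ (proj₂ (proj₂ spanning))))))
      where bounds = R₀-bounds K₀ R large

    -- Maximality of the integer root is used twice: it lifts `R` above `R₀`, and it lets the gain
    -- in `R` be read as a gain in `n`.
    theorem-bound : R₀ K₀ ^ 21 ≤ n → M ^ exponent * n ^ (1 * d) ≤ N ^ exponent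
    theorem-bound n₀≤n = with-root (root 21 (s≤s z≤n) n)
      where
      with-root : (Σ ℕ λ R → R ^ 21 ≤ n × n < suc R ^ 21) → M ^ exponent * n ^ (1 * d) ≤ N ^ exponent
      with-root (R , lo , hi) = exponent-bound R K₀ M N (B₀ K₀) n d (≤-trans (≤ᵇ⇒≤ 2 896 tt) (proj₁ (proj₂ (proj₂ (proj₂ bounds)))))
        K₀>0 (counted R lo large) (proj₂ (proj₂ (proj₂ (proj₂ bounds)))) hi d≤
        where
        large : R₀ K₀ ≤ R
        large = root-maximal 21 R (R₀ K₀) n hi n₀≤n
        bounds = R₀-bounds K₀ R large

theorem1p4 : Σ ℕ λ p → Σ ℕ λ q → 1 ≤ p × 1 ≤ q × Σ ℕ λ d₀ →
    (d : ℕ) → d₀ ≤ d → Σ ℕ λ n₀ →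
    (n : ℕ) → n₀ ≤ n → (G : Graph n) → Connected (Adj G) → MinDegreeAtLeast G d →
    (m : ℕ) (T : Graph m) → IsTree (Adj T) →
    (N M : ℕ) → HasCount G (IsSpanningTree G) N →
    HasCount G (λ s → IsSpanningTree G s × Isomorphic (SubAdj G s) (Adj T)) M →
    M ^ q * n ^ (p * d) ≤ N ^ q
theorem1p4 = 1 , exponent , ≤-refl , exponent>0 , C₁ , λ d C₁≤d →
  R₀ (K₀ d C₁≤d) ^ 21 , λ n n₀≤n G _ min-degree m T _ N M spanning isomorphic →
    theorem-bound d C₁≤d G min-degree T N M spanning isomorphic n₀≤n
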